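{- Let $\mathbf{w}$ be a weight in $\mathbb{R}^n$, let $\boldsymbol\theta\in\mathbb{R}^n$, and let $\mathcal{M}$ be a nondegenerate curve in $\mathbb{R}^n$. Then almost every point on $\mathcal{M}$ is not in $\mathbf{Bad}_{\boldsymbol\theta}(\mathbf{w})$.
   Context: A weight in $\mathbb{R}^n$ is a vector $\mathbf{w}=(w_1,\dots,w_n)$ with $w_i\ge 0$ and $\sum_i w_i=1$. $|x|_{\mathbb{Z}}$ is the distance from $x\in\mathbb{R}$ to the nearest integer. For $\boldsymbol\theta=(\theta_i)\in\mathbb{R}^n$, $$\mathbf{Bad}_{\boldsymbol\theta}(\mathbf{w}):=\Big\{\mathbf{x}\in\mathbb{R}^n:\ \liminf_{q\in\mathbb{Z}\setminus\{0\},\,|q|\to\infty}\ \max_{1\le i\le n}|qx_i-\theta_i|_{\mathbb{Z}}^{1/w_i}\,|q|>0\Big\},$$ with the convention $|x|_{\mathbb{Z}}^{1/w_i}:=0$ if $w_i=0$. Let $U\subset\mathbb{R}^d$ be open. A map $\mathbf{f}:U\to\mathbb{R}^n$ is $l$-nondegenerate at $\mathbf{x}\in U$ if $\mathbf{f}$ is $C^l$ on a neighbourhood of $\mathbf{x}$ in $U$ and there are $n$ linearly independent vectors among the partial derivatives of $\mathbf{f}$ at $\mathbf{x}$ of orders between $1$ and $l$. $\mathbf{f}$ is nondegenerate if there is $l$ such that $\mathbf{f}$ is $l$-nondegenerate at Lebesgue almost every $\mathbf{x}\in U$. A nondegenerate curve $\mathcal{M}$ is one parametrized by a nondegenerate map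 $\mathbf{f}:U\to\mathbb{R}^n$ with $U\subset\mathbb{R}$ an open interval ($d=1$); "almost every point on $\mathcal{M}$" means $\mathbf{f}(x)$ for Lebesgue almost every $x\in U$. -}

module Defs where

open import Level using (0ℓ; suc)
open import Algebra.Bundles using (CommutativeRing; Semiring)
open import Axiom.ExcludedMiddle using (ExcludedMiddle)
open import Data.Fin.Base using (Fin; toℕ)
open import Data.Integer.Base as ℤ using (ℤ; +_; -[1+_]; 0ℤ)
open import Data.Nat.Base as ℕ using (ℕ)
open import Data.Product.Base using (Σ; ∃; _×_; _,_; proj₁)
open import Data.Sum.Base using (_⊎_)
open import Data.Vec.Functional using (Vector; foldr)
open import Function.Base using (flip; _∘_)
open import Function.Bundles using (Func)
open import Relation.Binary.Bundles using (TotalOrder)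
open import Relation.Binary.Core using (Rel)
open import Relation.Binary.PropositionalEquality.Core using (_≡_; _≢_)
open import Relation.Binary.Structures using (IsTotalOrder)
open import Relation.Nullary.Construct.Add.Extrema using (_±; [_])
open import Relation.Nullary.Decidable.Core using (yes; no)
open import Relation.Nullary.Negation.Core using (¬_)
open import Relation.Unary using (Pred; _∈_)
import Algebra.Construct.NaturalChoice.Max as Max
import Algebra.Definitions.RawSemiring as RawSemiringDefs
import Data.Vec.Functional.Relation.Binary.Equality.Setoid as VectorEquality
import Relation.Binary.Construct.Add.Extrema.NonStrict as AddExtremaNonStrict
import Relation.Binary.Construct.Add.Extrema.Strict as AddExtremaStrict
import Relation.Binary.Construct.NonStrictToStrict as NonStrictToStrict
import Relation.Binary.Construct.On as On

module _ {A : Set} (_≤_ : Rel A 0ℓ) where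

  IsUpperBound : Pred A 0ℓ → Pred A 0ℓ
  IsUpperBound P b = ∀ x → x ∈ P → x ≤ b

  IsSupremum : Pred A 0ℓ → Pred A 0ℓ
  IsSupremum P s = s ∈ IsUpperBound P × (∀ b → b ∈ IsUpperBound P → s ≤ b)

IsInfimum : {A : Set} → Rel A 0ℓ → Pred A 0ℓ → Pred A 0ℓ
IsInfimum _≤_ = IsSupremum (flip _≤_)

-- The axioms of the real numbers, over a setoid: with excluded middle they
-- determine ℝ up to unique isomorphism (and Cauchy sequences of rationals
-- satisfy them).
record CompleteOrderedField : Set (suc 0ℓ) where
  field
    commutativeRing : CommutativeRing 0ℓ 0ℓ

  open CommutativeRing commutativeRing public renaming (Carrier to ℝ)

  infix 4 _≤_
  infix 9 _⁻¹[_]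

  field
    _≤_          : Rel ℝ 0ℓ
    isTotalOrder : IsTotalOrder _≈_ _≤_
    0≉1          : ¬ (0# ≈ 1#)
    _⁻¹[_]       : ∀ x → ¬ (x ≈ 0#) → ℝ
    ⁻¹-inverse   : ∀ x (x≉0 : ¬ (x ≈ 0#)) → x * x ⁻¹[ x≉0 ] ≈ 1#
    +-monoˡ-≤    : ∀ z {x y} → x ≤ y → x + z ≤ y + z
    *-nonNeg     : ∀ {x y} → 0# ≤ x → 0# ≤ y → 0# ≤ x * y
    supremum     : ∀ (P : Pred ℝ 0ℓ) → ∃ P → ∃ (IsUpperBound _≤_ P) →
                   ∃ (IsSupremum _≤_ P)

  totalOrder : TotalOrder 0ℓ 0ℓ 0ℓ
  totalOrder = record { isTotalOrder = isTotalOrder }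

  open NonStrictToStrict _≈_ _≤_ public using (_<_)
  open Max totalOrder public using (_⊔_)
  open RawSemiringDefs (Semiring.rawSemiring semiring) public using (_^_; sum)
    renaming (_×_ to _×ℕ_)
  open VectorEquality setoid public using (_≋_; ≋-setoid)

module Analysis (em : ExcludedMiddle 0ℓ) (reals : CompleteOrderedField) where

  open CompleteOrderedField reals public

  ℝ± : Set
  ℝ± = ℝ ±

  open AddExtremaNonStrict _≤_ public using (_≤±_)
  open AddExtremaStrict _<_ public using (_<±_)

  fromℕ : ℕ → ℝ
  fromℕ n = n ×ℕ 1#

  fromℤ : ℤ → ℝ
  fromℤ (+ n)    = fromℕ n
  fromℤ -[1+ n ] = - fromℕ (ℕ.suc n)

  ∣_∣ : ℝ → ℝ
  ∣ x ∣ = x ⊔ (- x)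

  -- Junk value 0 for sets that are empty or unbounded above.
  sup : Pred ℝ 0ℓ → ℝ
  sup P with em {∃ P × ∃ (IsUpperBound _≤_ P)}
  ... | yes (nonempty , bounded) = proj₁ (supremum P nonempty bounded)
  ... | no  _                    = 0#

  inf : Pred ℝ 0ℓ → ℝ
  inf P = - sup (λ x → - x ∈ P)

  ∣_∣ℤ : ℝ → ℝ
  ∣ x ∣ℤ = inf (λ r → ∃ λ m → r ≈ ∣ x - fromℤ m ∣)

  -- t to the power s, for 0 ≤ t and 0 < s: the supremum of the rational powers
  -- t ^ (a / b) with a / b ≤ s if 1 ≤ t, and with s ≤ a / b if t ≤ 1 (where
  -- t ^ r decreases in r).
  rpow : ℝ → ℝ → ℝ
  rpow t s = sup λ y → 0# ≤ y × ∃ λ a → ∃ λ k → let b = ℕ.suc k in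
    y ^ b ≈ t ^ a ×
    ((1# ≤ t × fromℕ a ≤ s * fromℕ b) ⊎ (t ≤ 1# × s * fromℕ b ≤ fromℕ a))

  -- t ^ (1 / w), with the convention that it is 0 when w = 0.
  root : ℝ → ℝ → ℝ
  root w t with em {w ≈ 0#}
  ... | yes _   = 0#
  ... | no  w≉0 = rpow t (w ⁻¹[ w≉0 ])

  -- The starting value 0 is harmless: used for nonempty families of
  -- nonnegative numbers only.
  max : ∀ {n} → Vector ℝ n → ℝ
  max = foldr _⊔_ 0#

  IsWeight : ∀ {n} → Pred (Vector ℝ n) 0ℓ
  IsWeight w = (∀ i → 0# ≤ w i) × sum w ≈ 1#

  -- L is the lower limit of a q as |q| → ∞, computed in the extended reals as
  -- the supremum over N of the infimum over |q| ≥ N, q ≠ 0.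
  IsLiminf : (ℤ → ℝ) → Pred ℝ± 0ℓ
  IsLiminf a = IsSupremum _≤±_ λ m → ∃ λ N → IsInfimum _≤±_ (tail N) m
    where
    tail : ℕ → Pred ℝ± 0ℓ
    tail N y = ∃ λ q → q ≢ 0ℤ × N ℕ.≤ ℤ.∣ q ∣ × y ≡ [ a q ]

  Bad : ∀ {n} → Vector ℝ n → Vector ℝ n → Pred (Vector ℝ n) 0ℓ
  Bad θ w x = ∃ λ L → IsLiminf approx L × [ 0# ] <± L
    where
    approx : ℤ → ℝ
    approx q = max (λ i → root (w i) ∣ fromℤ q * x i - θ i ∣ℤ) * fromℕ ℤ.∣ q ∣

  Null : Pred (Pred ℝ 0ℓ) 0ℓ
  Null E = ∀ ε → 0# < ε → ∃ λ (a : ℕ → ℝ) → ∃ λ (b : ℕ → ℝ) →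
    (∀ k → a k ≤ b k) ×
    (∀ x → x ∈ E → ∃ λ k → a k < x × x < b k) ×
    (∀ N → sum {N} (λ k → b (toℕ k) - a (toℕ k)) ≤ ε)

  OpenInterval : ℝ± → ℝ± → Pred ℝ 0ℓ
  OpenInterval a b x = a <± [ x ] × [ x ] <± b

  AlmostEvery : (U : Pred ℝ 0ℓ) → Pred (Pred (Σ ℝ U) 0ℓ) 0ℓ
  AlmostEvery U P = Null (λ x → ∃ λ (x∈U : x ∈ U) → ¬ P (x , x∈U))

  Map : Pred ℝ 0ℓ → ℕ → Set
  Map U n = Func (On.setoid {B = Σ ℝ U} setoid proj₁) (≋-setoid n)

  HasDerivativeAt : (ℝ → ℝ) → ℝ → ℝ → Set
  HasDerivativeAt g x c = ∀ ε → 0# < ε → ∃ λ δ → 0# < δ ×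
    (∀ h (h≉0 : ¬ (h ≈ 0#)) → ∣ h ∣ < δ →
      ∣ (g (x + h) - g x) * h ⁻¹[ h≉0 ] - c ∣ < ε)

  ContinuousAt : (ℝ → ℝ) → ℝ → Set
  ContinuousAt g x = ∀ ε → 0# < ε → ∃ λ δ → 0# < δ ×
    (∀ y → ∣ y - x ∣ < δ → ∣ g y - g x ∣ < ε)

  LinearlyIndependent : ∀ {m n} → Pred (Vector (Vector ℝ n) m) 0ℓ
  LinearlyIndependent {m} v = ∀ (c : Vector ℝ m) →
    (∀ j → sum (λ i → c i * v i j) ≈ 0#) → ∀ i → c i ≈ 0#

  module _ {U : Pred ℝ 0ℓ} {n : ℕ} (f : Map U n) where

    open Func f using (to)

    -- g 0, …, g l are f and its derivatives up to order l on the
    -- δ-neighbourhood of x, which lies in U, and g l is continuous there; the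
    -- values of g elsewhere are irrelevant.
    record IsJet (l : ℕ) (x δ : ℝ) (g : ℕ → ℝ → Vector ℝ n) : Set where
      field
        extends    : ∀ y → ∣ y - x ∣ < δ →
                     ∃ λ (y∈U : y ∈ U) → g 0 y ≋ to (y , y∈U)
        derivative : ∀ y → ∣ y - x ∣ < δ → ∀ j → j ℕ.< l → ∀ i →
                     HasDerivativeAt (λ z → g j z i) y (g (ℕ.suc j) y i)
        continuous : ∀ y → ∣ y - x ∣ < δ → ∀ i →
                     ContinuousAt (λ z → g l z i) y

    -- In one variable there is one partial derivative of each order, so the
    -- n vectors are chosen by their orders, suc (toℕ (order i)) ∈ {1, …, l}.
    NondegenerateAt : ℕ → Pred (Σ ℝ U) 0ℓ
    NondegenerateAt l (x , _) = ∃ λ δ → 0# < δ × ∃ λ g → IsJet l x δ g ×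
      ∃ λ (order : Fin n → Fin l) →
        LinearlyIndependent (λ i → g (ℕ.suc (toℕ (order i))) x)

    Nondegenerate : Set
    Nondegenerate = ∃ λ l → AlmostEvery U (NondegenerateAt l)

{-# OPTIONS --safe #-}
module Submission where

open import Defs
open import Level using (0ℓ)
open import Algebra.Bundles using (CommutativeRing; RawRing)
open import Algebra.Solver.Ring.AlmostCommutativeRing using (fromCommutativeRing; _-Raw-AlmostCommutative⟶_)
open import Axiom.ExcludedMiddle using (ExcludedMiddle)
open import Data.Bool.Base using (Bool; true; false)
open import Data.Empty using (⊥; ⊥-elim)
open import Data.Fin.Base using (Fin; zero; suc; toℕ; fromℕ<; punchIn; punchOut)
open import Data.Integer.Base as ℤ using (ℤ; +_; -[1+_]; +[1+_])
open import Data.List.Base using (List; []; _∷_)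
open import Data.List.Relation.Unary.All as All using (All; []; _∷_)
open import Data.Maybe.Base using (Maybe; just; nothing)
open import Data.Nat.Base as ℕ using (ℕ; zero; suc; s≤s; z≤n)
open import Data.Product.Base using (Σ; ∃; _×_; _,_; proj₁; proj₂)
open import Data.Sum.Base using (_⊎_; inj₁; inj₂)
open import Data.Vec.Base as Vec using (Vec; []; _∷_)
open import Data.Vec.Functional using (Vector)
open import Data.Vec.N-ary using (N-ary; curryⁿ; Eq; Eqʰ)
open import Function.Base using (_∘_)
open import Function.Bundles using (Func)
open import Relation.Binary.PropositionalEquality.Core as ≡ using (_≡_; _≢_)
open import Relation.Nullary.Construct.Add.Extrema using ([_]; ⊥±; ⊤±)
open import Relation.Nullary.Decidable.Core using (yes; no)
open import Relation.Nullary.Negation.Core using (¬_)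
open import Relation.Unary using (Pred; _∉_)
open import Relation.Binary.Structures using (module IsTotalOrder)
import Algebra.Construct.NaturalChoice.Max as NaturalMax
import Algebra.Properties.Ring as RingProperties
import Algebra.Solver.Ring as RingSolver
import Data.Fin.Properties as Fin
import Data.Integer.Properties as ℤ
import Data.Nat.Properties as ℕ
import Relation.Binary.Reasoning.Setoid as SetoidReasoning
import Relation.Binary.Reflection as Reflection
import Relation.Binary.Construct.Add.Extrema.NonStrict as AddExtremaNonStrict
import Relation.Binary.Construct.Add.Extrema.Strict as AddExtremaStrict

-- Discard the coordinates of weight zero and put one of largest weight first. Its critical points form
-- a null set; elsewhere it suffices to show that on a small cell the set E of points without good
-- inhomogeneous approximations of large denominator is null. Cut any cell into subcells on which the
-- direction (1, s) of the curve is almost constant. By the nondivergence argument of Kleinbock and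
-- Margulis, at most points of such a subcell a lattice adapted to the weight, the scale and (1, s) has no
-- short vector, so that its dual lattice has bounded covering radius. This yields a rational point P / q,
-- shifted by θ, which is close to the curve in every direction but (1, s); moving along the curve by a
-- bounded multiple of the scale cancels the error in that direction, and an interval around the point
-- reached is disjoint from E. Hence E misses a fixed proportion of every cell and is null.

-- Leaving `Bad` requires errors that beat the weighted scales by an arbitrarily large factor,
-- whereas a bounded covering radius yields them only up to a fixed factor `R`. Shrinking all scales
-- would push the determinant of the lattice below 1. So the scale of the first coordinate alone is
-- enlarged, by 2^`τ`, which pays for the gain in the others; the first error is then too large, and
-- this is what moving along the curve has to repair. Such a move also shifts the other coordinates,
-- by the slopes `s` times the first shift, so errors are measured after a tilt by `s`, which the
-- move hardly changes. Undoing the tilt adds `s` times the first error to the others. This is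
-- tolerable because the largest weight gives the first coordinate the strictest tolerance. The
-- direction has to be frozen on a cell, since nondivergence needs covolumes that are combinations
-- of 1 and the coordinate functions with constant coefficients. How finely a cell must be cut for
-- this is unknown, but the proportion gained in a piece does not depend on its size, so the gain is
-- uniform over all cells.

module IntegerSolver (R : CommutativeRing 0ℓ 0ℓ) where
  open CommutativeRing R
  open import Algebra.Properties.Ring ring using (-0#≈0#; -‿+-comm; -‿distribˡ-*; -‿distribʳ-*; -‿involutive)
  open import Relation.Binary.Reasoning.Setoid setoid

  -- Unlike n × 1#, this sends 1 to 1# definitionally.
  natural : ℕ → Carrier
  natural 0 = 0#
  natural 1 = 1#
  natural (ℕ.suc n@(ℕ.suc _)) = 1# + natural n

  integer : ℤ → Carrier
  integer (+ n)    = natural n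
  integer -[1+ n ] = - natural (ℕ.suc n)

  natural-suc : ∀ n → natural (ℕ.suc n) ≈ 1# + natural n
  natural-suc 0         = sym (+-identityʳ 1#)
  natural-suc (ℕ.suc n) = refl

  natural-+ : ∀ m n → natural (m ℕ.+ n) ≈ natural m + natural n
  natural-+ 0 n = sym (+-identityˡ _)
  natural-+ (ℕ.suc m) n = begin
    natural (ℕ.suc (m ℕ.+ n))    ≈⟨ natural-suc (m ℕ.+ n) ⟩
    1# + natural (m ℕ.+ n)       ≈⟨ +-congˡ (natural-+ m n) ⟩
    1# + (natural m + natural n) ≈⟨ +-assoc 1# _ _ ⟨
    1# + natural m + natural n   ≈⟨ +-congʳ (natural-suc m) ⟨
    natural (ℕ.suc m) + natural n ∎

  natural-* : ∀ m n → natural (m ℕ.* n) ≈ natural m * natural n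
  natural-* 0 n = sym (zeroˡ _)
  natural-* (ℕ.suc m) n = begin
    natural (n ℕ.+ m ℕ.* n)                   ≈⟨ natural-+ n (m ℕ.* n) ⟩
    natural n + natural (m ℕ.* n)             ≈⟨ +-cong (*-identityˡ _) (sym (natural-* m n)) ⟨
    1# * natural n + natural m * natural n    ≈⟨ distribʳ _ 1# _ ⟨
    (1# + natural m) * natural n              ≈⟨ *-congʳ (natural-suc m) ⟨
    natural (ℕ.suc m) * natural n             ∎

  integer-⊖ : ∀ m n → integer (m ℤ.⊖ n) ≈ natural m - natural n
  integer-⊖ 0 0 = sym (-‿inverseʳ 0#)
  integer-⊖ 0 (ℕ.suc n) = sym (+-identityˡ _)
  integer-⊖ (ℕ.suc m) 0 = sym (trans (+-congˡ -0#≈0#) (+-identityʳ _))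
  integer-⊖ (ℕ.suc m) (ℕ.suc n) = begin
    integer (ℕ.suc m ℤ.⊖ ℕ.suc n)             ≈⟨ reflexive (≡.cong integer (ℤ.[1+m]⊖[1+n]≡m⊖n m n)) ⟩
    integer (m ℤ.⊖ n)                         ≈⟨ integer-⊖ m n ⟩
    natural m - natural n                     ≈⟨ +-congʳ (+-identityʳ _) ⟨
    natural m + 0# - natural n                ≈⟨ +-congʳ (+-congˡ (-‿inverseʳ 1#)) ⟨
    natural m + (1# - 1#) - natural n         ≈⟨ +-congʳ (+-assoc _ 1# _) ⟨
    natural m + 1# - 1# - natural n           ≈⟨ +-assoc _ _ _ ⟩
    natural m + 1# + (- 1# - natural n)       ≈⟨ +-cong (+-comm _ 1#) (-‿+-comm 1# _) ⟩
    1# + natural m - (1# + natural n)         ≈⟨ +-cong (natural-suc m) (-‿cong (natural-suc n)) ⟨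
    natural (ℕ.suc m) - natural (ℕ.suc n)     ∎

  integer-neg : ∀ i → integer (ℤ.- i) ≈ - integer i
  integer-neg (+ 0)       = sym -0#≈0#
  integer-neg (+ ℕ.suc n) = refl
  integer-neg -[1+ n ]    = sym (-‿involutive _)

  integer-+ : ∀ i j → integer (i ℤ.+ j) ≈ integer i + integer j
  integer-+ (+ m)    (+ n)    = natural-+ m n
  integer-+ (+ m)    -[1+ n ] = integer-⊖ m (ℕ.suc n)
  integer-+ -[1+ m ] (+ n)    = trans (integer-⊖ n (ℕ.suc m)) (+-comm _ _)
  integer-+ -[1+ m ] -[1+ n ] = begin
    - natural (ℕ.suc (ℕ.suc (m ℕ.+ n)))          ≡⟨ ≡.cong (λ k → - natural (ℕ.suc k)) (ℕ.+-suc m n) ⟨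
    - natural (ℕ.suc m ℕ.+ ℕ.suc n)              ≈⟨ -‿cong (natural-+ (ℕ.suc m) (ℕ.suc n)) ⟩
    - (natural (ℕ.suc m) + natural (ℕ.suc n))    ≈⟨ -‿+-comm _ _ ⟨
    - natural (ℕ.suc m) - natural (ℕ.suc n)      ∎

  integer-* : ∀ i j → integer (i ℤ.* j) ≈ integer i * integer j
  integer-* (+ m)       (+ n)       = trans (reflexive (≡.cong integer (ℤ.+◃n≡+n (m ℕ.* n)))) (natural-* m n)
  integer-* (+ m)       -[1+ n ]    = begin
    integer (+ m ℤ.* -[1+ n ])          ≡⟨ ≡.cong integer (ℤ.neg-distribʳ-* (+ m) (+[1+ n ])) ⟨
    integer (ℤ.- (+ m ℤ.* +[1+ n ]))    ≈⟨ integer-neg (+ m ℤ.* +[1+ n ]) ⟩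
    - integer (+ m ℤ.* +[1+ n ])        ≈⟨ -‿cong (integer-* (+ m) +[1+ n ]) ⟩
    - (natural m * natural (ℕ.suc n))   ≈⟨ -‿distribʳ-* _ _ ⟩
    natural m * - natural (ℕ.suc n)     ∎
  integer-* -[1+ m ]    j           = begin
    integer (-[1+ m ] ℤ.* j)            ≡⟨ ≡.cong integer (ℤ.neg-distribˡ-* (+[1+ m ]) j) ⟨
    integer (ℤ.- (+[1+ m ] ℤ.* j))      ≈⟨ integer-neg (+[1+ m ] ℤ.* j) ⟩
    - integer (+[1+ m ] ℤ.* j)          ≈⟨ -‿cong (pos j) ⟩
    - (natural (ℕ.suc m) * integer j)   ≈⟨ -‿distribˡ-* _ _ ⟩
    - natural (ℕ.suc m) * integer j     ∎
    where
    pos : ∀ j → integer (+[1+ m ] ℤ.* j) ≈ natural (ℕ.suc m) * integer j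
    pos (+ n)    = trans (reflexive (≡.cong integer (ℤ.+◃n≡+n (ℕ.suc m ℕ.* n)))) (natural-* (ℕ.suc m) n)
    pos -[1+ n ] = trans (-‿cong (natural-* (ℕ.suc m) (ℕ.suc n))) (-‿distribʳ-* _ _)

  private
    coefficients : RawRing 0ℓ 0ℓ
    coefficients = record
      { Carrier = ℤ ; _≈_ = _≡_ ; _+_ = ℤ._+_ ; _*_ = ℤ._*_ ; -_ = ℤ.-_ ; 0# = + 0 ; 1# = + 1 }

    morphism : coefficients -Raw-AlmostCommutative⟶ fromCommutativeRing R
    morphism = record
      { ⟦_⟧ = integer ; +-homo = integer-+ ; *-homo = integer-* ; -‿homo = integer-neg
      ; 0-homo = refl ; 1-homo = refl }

    integer-≟ : ∀ i j → Maybe (integer i ≈ integer j)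
    integer-≟ i j with i ℤ.≟ j
    ... | yes ≡.refl = just refl
    ... | no  _      = nothing

  private
    module S = RingSolver coefficients (fromCommutativeRing R) morphism integer-≟
    module Reflected = Reflection setoid S.var S.⟦_⟧ S.⟦_⟧↓ S.correct

  open S public using (Polynomial; con; _:=_; _:+_; _:*_; _:-_; :-_)

  :0 :1 : ∀ {n} → Polynomial n
  :0 = con (+ 0)
  :1 = con (+ 1)

  -- Abstract, so that normalisation never unfolds a solver proof.
  abstract
    solve : ∀ n (f : N-ary n (Polynomial n) (Polynomial n × Polynomial n)) →
            Eqʰ n _≈_ (curryⁿ (S.⟦ proj₁ (Reflected.close n f) ⟧↓)) (curryⁿ (S.⟦ proj₂ (Reflected.close n f) ⟧↓)) →
            Eq n _≈_ (curryⁿ (S.⟦ proj₁ (Reflected.close n f) ⟧)) (curryⁿ (S.⟦ proj₂ (Reflected.close n f) ⟧))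
    solve = S.solve

-- Arithmetic of ordered fields and absolute values

module OrderedField (em : ExcludedMiddle 0ℓ) (reals : CompleteOrderedField) where

  open Analysis em reals hiding (zero; ∣_∣)
  open IntegerSolver commutativeRing
  open SetoidReasoning setoid
  open IsTotalOrder isTotalOrder public using () renaming (trans to ≤-trans; antisym to ≤-antisym; total to ≤-total; reflexive to ≤-reflexive)
  open NaturalMax totalOrder using (x≤x⊔y; x≤y⊔x; ⊔-lub)

  opaque
    lem : (P : Set) → P ⊎ ¬ P
    lem P with em {P}
    ... | yes p = inj₁ p
    ... | no ¬p = inj₂ ¬p

  opaque
    by-contradiction : {P : Set} → ¬ ¬ P → P
    by-contradiction {P} ¬¬p with em {P}
    ... | yes p = p
    ... | no ¬p = ⊥-elim (¬¬p ¬p)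

  opaque
    ≤-refl : ∀ {x} → x ≤ x
    ≤-refl = ≤-reflexive refl

  opaque
    ≤≈ : ∀ {x y z} → x ≤ y → y ≈ z → x ≤ z
    ≤≈ p e = ≤-trans p (≤-reflexive e)

  opaque
    ≈≤ : ∀ {x y z} → x ≈ y → y ≤ z → x ≤ z
    ≈≤ e p = ≤-trans (≤-reflexive e) p

  -- Every linear inequality below is an instance of by≤: a ≤ b follows from a
  -- combination x ≤ y of the hypotheses with b - a ≈ y - x, a ring identity.
  opaque
    by≤ : ∀ {a b x y} → x ≤ y → a + y ≈ b + x → a ≤ b
    by≤ {a} {b} {x} {y} p e = ≈≤ lhs (≤≈ (+-monoˡ-≤ (b - y) p) (solve 2 (λ a b → a :+ (b :- a) := b) refl _ _))
      where
      lhs : a ≈ x + (b - y)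
      lhs = begin
        a               ≈⟨ (solve 2 (λ a b → a := a :+ b :- b) refl _ _) ⟩
        a + y - y       ≈⟨ +-congʳ e ⟩
        b + x - y       ≈⟨ (solve 3 (λ a b c → a :+ b :- c := b :+ (a :- c)) refl _ _ _) ⟩
        x + (b - y)     ∎

  opaque
    by≈ : ∀ {a b x y} → x ≈ y → a + y ≈ b + x → a ≈ b
    by≈ p e = ≤-antisym (by≤ (≤-reflexive p) e) (by≤ (≤-reflexive (sym p)) (sym e))

  opaque
    by< : ∀ {a b x y} → x < y → a + y ≈ b + x → a < b
    by< {a} {b} {x} {y} (p , x≉y) e = by≤ p e , λ a≈b → x≉y (by≈ a≈b (begin
      x + b  ≈⟨ +-comm x b ⟩
      b + x  ≈⟨ sym e ⟩
      a + y  ≈⟨ +-comm a y ⟩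
      y + a  ∎))

  infixl 6 _⊞_ _<⊞_ _⊞<_

  opaque
    _⊞_ : ∀ {a b c d} → a ≤ b → c ≤ d → a + c ≤ b + d
    _⊞_ {a} {b} {c} {d} p q = ≤-trans (+-monoˡ-≤ c p) (≈≤ (+-comm b c) (≤≈ (+-monoˡ-≤ b q) (+-comm d b)))

  opaque
    <⇒≤ : ∀ {x y} → x < y → x ≤ y
    <⇒≤ = proj₁

  opaque
    ≰⇒> : ∀ {x y} → ¬ (x ≤ y) → y < x
    ≰⇒> {x} {y} ¬p with ≤-total x y
    ... | inj₁ p = ⊥-elim (¬p p)
    ... | inj₂ p = p , λ e → ¬p (≤-reflexive (sym e))

  opaque
    <⇒≱ : ∀ {x y} → x < y → ¬ (y ≤ x)
    <⇒≱ (p , ne) q = ne (≤-antisym p q)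

  opaque
    ≤⊎> : ∀ x y → x ≤ y ⊎ y < x
    ≤⊎> x y with lem (x ≤ y)
    ... | inj₁ p = inj₁ p
    ... | inj₂ p = inj₂ (≰⇒> p)

  opaque
    ≮⇒≥ : ∀ {x y} → ¬ (x < y) → y ≤ x
    ≮⇒≥ {x} {y} ¬p with ≤⊎> y x
    ... | inj₁ q = q
    ... | inj₂ q = ⊥-elim (¬p q)

  opaque
    <-irrefl : ∀ {x} → ¬ (x < x)
    <-irrefl (_ , ne) = ne refl

  opaque
    <-≤-trans : ∀ {x y z} → x < y → y ≤ z → x < z
    <-≤-trans p q = ≤-trans (<⇒≤ p) q , λ e → <⇒≱ p (≤≈ q (sym e))

  opaque
    ≤-<-trans : ∀ {x y z} → x ≤ y → y < z → x < z
    ≤-<-trans p q = ≤-trans p (<⇒≤ q) , λ e → <⇒≱ q (≈≤ (sym e) p)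

  opaque
    <-trans : ∀ {x y z} → x < y → y < z → x < z
    <-trans p q = <-≤-trans p (<⇒≤ q)

  opaque
    _<⊞_ : ∀ {a b c d} → a < b → c ≤ d → a + c < b + d
    _<⊞_ {a} {b} {c} {d} p q = <-≤-trans (by< p (solve 3 (λ a b c → a :+ b :+ c := c :+ b :+ a) refl _ _ _)) (≤-refl ⊞ q)

  opaque
    _⊞<_ : ∀ {a b c d} → a ≤ b → c < d → a + c < b + d
    _⊞<_ {a} {b} {c} {d} p q = ≤-<-trans (p ⊞ ≤-refl) (by< q (solve 3 (λ a b c → a :+ b :+ c := a :+ c :+ b) refl _ _ _))

  opaque
    sub≥0 : ∀ {x y} → x ≤ y → 0# ≤ y - x
    sub≥0 p = by≤ p (solve 2 (λ a b → :0 :+ a := a :- b :+ b) refl _ _)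

  opaque
    sub>0 : ∀ {x y} → x < y → 0# < y - x
    sub>0 p = by< p (solve 2 (λ a b → :0 :+ a := a :- b :+ b) refl _ _)

  opaque
    *-monoʳ : ∀ {a b} c → 0# ≤ c → a ≤ b → a * c ≤ b * c
    *-monoʳ c 0≤c p = by≤ (*-nonNeg (sub≥0 p) 0≤c) (solve 3 (λ a b c → a :* b :+ (c :- a) :* b := c :* b :+ :0) refl _ _ _)

  opaque
    *-monoˡ : ∀ {a b} c → 0# ≤ c → a ≤ b → c * a ≤ c * b
    *-monoˡ c 0≤c p = by≤ (*-nonNeg (sub≥0 p) 0≤c) (solve 3 (λ a b c → a :* b :+ (c :- b) :* a := a :* c :+ :0) refl _ _ _)

  opaque
    *-mono : ∀ {a b c d} → 0# ≤ a → a ≤ b → 0# ≤ c → c ≤ d → a * c ≤ b * d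
    *-mono 0≤a p 0≤c q = ≤-trans (*-monoˡ _ 0≤a q) (*-monoʳ _ (≤-trans 0≤c q) p)

  opaque
    sq≥0 : ∀ x → 0# ≤ x * x
    sq≥0 x with ≤-total 0# x
    ... | inj₁ p = *-nonNeg p p
    ... | inj₂ p = ≤≈ (*-nonNeg q q) (solve 1 (λ a → (:- a) :* (:- a) := a :* a) refl _)
      where
      q : 0# ≤ - x
      q = by≤ p (solve 1 (λ a → :0 :+ :0 := :- a :+ a) refl _)

  opaque
    0≤1 : 0# ≤ 1#
    0≤1 = ≤≈ (sq≥0 1#) (*-identityˡ 1#)

  opaque
    0<1 : 0# < 1#
    0<1 = 0≤1 , 0≉1

  2# : ℝ
  2# = 1# + 1#

  4# : ℝ
  4# = 2# + 2#

  opaque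
    pos+nn : ∀ {a b} → 0# < a → 0# ≤ b → 0# < a + b
    pos+nn p q = by< (p <⊞ q) (solve 2 (λ a b → :0 :+ (a :+ b) := a :+ b :+ (:0 :+ :0)) refl _ _)

  opaque
    nn+ : ∀ {a b} → 0# ≤ a → 0# ≤ b → 0# ≤ a + b
    nn+ p q = by≤ (p ⊞ q) (solve 2 (λ a b → :0 :+ (a :+ b) := a :+ b :+ (:0 :+ :0)) refl _ _)

  opaque
    pos+ : ∀ {a b} → 0# < a → 0# < b → 0# < a + b
    pos+ p q = pos+nn p (<⇒≤ q)

  opaque
    0<2 : 0# < 2#
    0<2 = pos+ 0<1 0<1

  opaque
    0<4 : 0# < 4#
    0<4 = pos+ 0<2 0<2

  opaque
    pos⇒≉0 : ∀ {a} → 0# < a → ¬ (a ≈ 0#)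
    pos⇒≉0 (_ , ne) e = ne (sym e)

  opaque
    inv : ∀ {a} → 0# < a → ℝ
    inv {a} p = a ⁻¹[ pos⇒≉0 p ]
    inv-eq : ∀ {a} (p : 0# < a) → a * inv p ≈ 1#
    inv-eq p = ⁻¹-inverse _ _

  opaque
    inv≥0 : ∀ {a} (p : 0# < a) → 0# ≤ inv p
    inv≥0 {a} p with ≤⊎> 0# (inv p)
    ... | inj₁ q = q
    ... | inj₂ q = ⊥-elim (<⇒≱ 0<1 (by≤ (*-nonNeg (<⇒≤ p) (sub≥0 (<⇒≤ q)))
        (trans (+-cong (sym (inv-eq p)) refl) (solve 2 (λ a b → a :* b :+ a :* (:0 :- b) := :0 :+ :0) refl _ _))))

  opaque
    inv>0 : ∀ {a} (p : 0# < a) → 0# < inv p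
    inv>0 {a} p = inv≥0 p , λ e → 0≉1 (begin
      0#          ≈⟨ (solve 1 (λ a → :0 := a :* :0) refl _) ⟩
      a * 0#      ≈⟨ *-congˡ e ⟩
      a * inv p   ≈⟨ inv-eq p ⟩
      1#          ∎)

  opaque
    pos* : ∀ {a b} → 0# < a → 0# < b → 0# < a * b
    pos* {a} {b} p q = *-nonNeg (<⇒≤ p) (<⇒≤ q) , λ e → <⇒≱ q (≤-reflexive (begin
      b                 ≈⟨ (solve 1 (λ a → a := :1 :* a) refl _) ⟩
      1# * b            ≈⟨ *-congʳ (sym (inv-eq p)) ⟩
      a * inv p * b     ≈⟨ (solve 3 (λ a b c → a :* b :* c := a :* c :* b) refl _ _ _) ⟩
      a * b * inv p     ≈⟨ *-congʳ (sym e) ⟩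
      0# * inv p        ≈⟨ (solve 1 (λ a → :0 :* a := :0) refl _) ⟩
      0#                ∎))

  opaque
    *-monoʳ-< : ∀ {a b c} → 0# < c → a < b → a * c < b * c
    *-monoʳ-< 0<c p = by< (pos* (sub>0 p) 0<c) (solve 3 (λ a b c → a :* b :+ (c :- a) :* b := c :* b :+ :0) refl _ _ _)

  opaque
    *-cancelʳ-≤ : ∀ {a b} c → 0# < c → a * c ≤ b * c → a ≤ b
    *-cancelʳ-≤ {a} {b} c 0<c p with ≤⊎> a b
    ... | inj₁ q = q
    ... | inj₂ q = ⊥-elim (<⇒≱ (*-monoʳ-< 0<c q) p)

  opaque
    *-cancelʳ-< : ∀ {a b} c → 0# ≤ c → a * c < b * c → a < b
    *-cancelʳ-< {a} {b} c 0≤c p with ≤⊎> b a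
    ... | inj₁ q = ⊥-elim (<⇒≱ p (*-monoʳ c 0≤c q))
    ... | inj₂ q = q

  opaque
    no-zero-divisors : ∀ {a b} → a * b ≈ 0# → ¬ (a ≈ 0#) → b ≈ 0#
    no-zero-divisors {a} {b} e a≉0 = begin
      b                          ≈⟨ (solve 1 (λ a → a := :1 :* a) refl _) ⟩
      1# * b                     ≈⟨ *-congʳ (sym (⁻¹-inverse a a≉0)) ⟩
      a * a ⁻¹[ a≉0 ] * b        ≈⟨ (solve 3 (λ a b c → a :* b :* c := b :* (a :* c)) refl _ _ _) ⟩
      a ⁻¹[ a≉0 ] * (a * b)      ≈⟨ *-congˡ e ⟩
      a ⁻¹[ a≉0 ] * 0#           ≈⟨ zeroʳ _ ⟩
      0#                         ∎

  opaque
    ½ : ℝ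
    ½ = inv 0<2
    0<½ : 0# < ½
    0<½ = inv>0 0<2
    ½-eq : ∀ x → ½ * x + ½ * x ≈ x
    ½-eq x = begin
      ½ * x + ½ * x     ≈⟨ (solve 2 (λ a b → a :* b :+ a :* b := (:1 :+ :1) :* a :* b) refl _ _) ⟩
      2# * ½ * x        ≈⟨ *-congʳ (inv-eq 0<2) ⟩
      1# * x            ≈⟨ *-identityˡ x ⟩
      x                 ∎

  opaque
    ½+½ : ½ + ½ ≈ 1#
    ½+½ = trans (sym (+-cong (*-identityʳ ½) (*-identityʳ ½))) (½-eq 1#)

  opaque
    ½<1 : ½ < 1#
    ½<1 = by< 0<½ (trans ½+½ (sym (+-identityʳ 1#)))

  opaque
    ½≤1 : ½ ≤ 1#
    ½≤1 = <⇒≤ ½<1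

  opaque
    ½-pos : ∀ {x} → 0# < x → 0# < ½ * x
    ½-pos = pos* 0<½

  opaque
    ½-< : ∀ {x} → 0# < x → ½ * x < x
    ½-< {x} p = by< (½-pos p) (trans (½-eq x) (sym (+-identityʳ x)))

  opaque
    min₂ : ∀ {a b} → 0# < a → 0# < b → ∃ λ c → 0# < c × c ≤ a × c ≤ b
    min₂ {a} {b} p q with ≤-total a b
    ... | inj₁ r = a , p , ≤-refl , r
    ... | inj₂ r = b , q , r , ≤-refl

  -- Opaque, since unifying unfolded absolute values is slow.
  opaque
    ∣_∣ : ℝ → ℝ
    ∣ x ∣ = Analysis.∣_∣ em reals x
    ∣∣-def : ∀ x → ∣ x ∣ ≡ Analysis.∣_∣ em reals x
    ∣∣-def x = ≡.refl
    x≤∣x∣ : ∀ x → x ≤ ∣ x ∣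
    x≤∣x∣ x = x≤x⊔y x (- x)
    -x≤∣x∣ : ∀ x → - x ≤ ∣ x ∣
    -x≤∣x∣ x = x≤y⊔x x (- x)
    ∣∣≤ : ∀ {x a} → x ≤ a → - x ≤ a → ∣ x ∣ ≤ a
    ∣∣≤ = ⊔-lub

  opaque
    ⊔≤ : ∀ {x y a} → x ≤ a → y ≤ a → x ⊔ y ≤ a
    ⊔≤ = ⊔-lub

  opaque
    ∣∣≥0 : ∀ x → 0# ≤ ∣ x ∣
    ∣∣≥0 x with ≤-total 0# x
    ... | inj₁ p = ≤-trans p (x≤∣x∣ x)
    ... | inj₂ p = ≤-trans (by≤ p (solve 1 (λ a → :0 :+ :0 := :- a :+ a) refl _)) (-x≤∣x∣ x)

  opaque
    ∣∣-cong : ∀ {x y} → x ≈ y → ∣ x ∣ ≈ ∣ y ∣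
    ∣∣-cong {x} {y} e = ≤-antisym
      (∣∣≤ (≈≤ e (x≤∣x∣ y)) (≈≤ (-‿cong e) (-x≤∣x∣ y)))
      (∣∣≤ (≈≤ (sym e) (x≤∣x∣ x)) (≈≤ (-‿cong (sym e)) (-x≤∣x∣ x)))

  opaque
    ∣∣-pos : ∀ {x} → 0# ≤ x → ∣ x ∣ ≈ x
    ∣∣-pos {x} p = ≤-antisym (∣∣≤ ≤-refl (by≤ (p ⊞ p) (solve 1 (λ a → :- a :+ (a :+ a) := a :+ (:0 :+ :0)) refl _))) (x≤∣x∣ x)

  opaque
    ∣∣-neg : ∀ x → ∣ - x ∣ ≈ ∣ x ∣
    ∣∣-neg x = ≤-antisym (∣∣≤ (-x≤∣x∣ x) (≈≤ (solve 1 (λ a → :- (:- a) := a) refl _) (x≤∣x∣ x)))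
      (∣∣≤ (≈≤ (solve 1 (λ a → a := :- (:- a)) refl _) (-x≤∣x∣ (- x))) (x≤∣x∣ (- x)))

  opaque
    ∣∣-sub : ∀ x y → ∣ x - y ∣ ≈ ∣ y - x ∣
    ∣∣-sub x y = trans (∣∣-cong (solve 2 (λ a b → a :- b := :- (b :- a)) refl _ _)) (∣∣-neg (y - x))

  opaque
    ∣∣-+ : ∀ x y → ∣ x + y ∣ ≤ ∣ x ∣ + ∣ y ∣
    ∣∣-+ x y = ∣∣≤ (x≤∣x∣ x ⊞ x≤∣x∣ y) (≈≤ (solve 2 (λ a b → :- (a :+ b) := :- a :- b) refl _ _) (-x≤∣x∣ x ⊞ -x≤∣x∣ y))

  opaque
    ∣∣-cases : ∀ x → (∣ x ∣ ≈ x) ⊎ (∣ x ∣ ≈ - x)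
    ∣∣-cases x with ≤-total 0# x
    ... | inj₁ p = inj₁ (∣∣-pos p)
    ... | inj₂ p = inj₂ (trans (sym (∣∣-neg x)) (∣∣-pos (by≤ p (solve 1 (λ a → :0 :+ :0 := :- a :+ a) refl _))))

  opaque
    ∣∣-* : ∀ x y → ∣ x * y ∣ ≈ ∣ x ∣ * ∣ y ∣
    ∣∣-* x y with ∣∣-cases x | ∣∣-cases y
    ... | inj₁ p | inj₁ q = trans (∣∣-pos (≤≈ (*-nonNeg (∣∣≥0 x) (∣∣≥0 y)) (*-cong p q))) (sym (*-cong p q))
    ... | inj₂ p | inj₂ q = trans (∣∣-pos (≤≈ (≤≈ (*-nonNeg (∣∣≥0 x) (∣∣≥0 y)) (*-cong p q)) (solve 2 (λ a b → (:- a) :* (:- b) := a :* b) refl _ _))) (trans (solve 2 (λ a b → a :* b := (:- a) :* (:- b)) refl _ _) (sym (*-cong p q)))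
    ... | inj₁ p | inj₂ q = trans (sym (∣∣-neg (x * y))) (trans (∣∣-pos (≤≈ (≤≈ (*-nonNeg (∣∣≥0 x) (∣∣≥0 y)) (*-cong p q)) (solve 2 (λ a b → a :* (:- b) := :- (a :* b)) refl _ _))) (trans (solve 2 (λ a b → :- (a :* b) := a :* (:- b)) refl _ _) (sym (*-cong p q))))
    ... | inj₂ p | inj₁ q = trans (sym (∣∣-neg (x * y))) (trans (∣∣-pos (≤≈ (≤≈ (*-nonNeg (∣∣≥0 x) (∣∣≥0 y)) (*-cong p q)) (solve 2 (λ a b → (:- a) :* b := :- (a :* b)) refl _ _))) (trans (solve 2 (λ a b → :- (a :* b) := (:- a) :* b) refl _ _) (sym (*-cong p q))))

  opaque
    ∣0∣ : ∣ 0# ∣ ≈ 0#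
    ∣0∣ = ∣∣-pos ≤-refl

  opaque
    ∣∣≤0⇒≈0 : ∀ {x} → ∣ x ∣ ≤ 0# → x ≈ 0#
    ∣∣≤0⇒≈0 {x} p = ≤-antisym (≤-trans (x≤∣x∣ x) p) (by≤ (≤-trans (-x≤∣x∣ x) p) (solve 1 (λ a → :0 :+ :0 := a :- a) refl _))

  opaque
    ≉0⇒∣∣>0 : ∀ {x} → ¬ (x ≈ 0#) → 0# < ∣ x ∣
    ≉0⇒∣∣>0 {x} x≉0 = ≰⇒> λ p → x≉0 (∣∣≤0⇒≈0 p)

  opaque
    ∣∣²≈ : ∀ x → ∣ x ∣ * ∣ x ∣ ≈ x * x
    ∣∣²≈ x = trans (sym (∣∣-* x x)) (∣∣-pos (sq≥0 x))

  -- Squares are compared instead of taking square roots.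
  opaque
    sq≤⇒∣∣≤ : ∀ {x y} → 0# ≤ y → x * x ≤ y * y → ∣ x ∣ ≤ y
    sq≤⇒∣∣≤ {x} {y} 0≤y p with ≤⊎> ∣ x ∣ y
    ... | inj₁ q = q
    ... | inj₂ q = ⊥-elim (<⇒≱ (≤-<-trans (*-monoˡ y 0≤y (<⇒≤ q)) (*-monoʳ-< (≤-<-trans 0≤y q) q)) (≈≤ (∣∣²≈ x) p))

  opaque
    arbitrarily-small : ∀ {x} → (∀ ε → 0# < ε → x ≤ ε) → x ≤ 0#
    arbitrarily-small {x} h with ≤⊎> x 0#
    ... | inj₁ p = p
    ... | inj₂ p = ⊥-elim (<⇒≱ (½-< p) (h (½ * x) (½-pos p)))

-- Dyadic scales, integers, real powers and finite sums

module Numbers (em : ExcludedMiddle 0ℓ) (reals : CompleteOrderedField) where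

  open Analysis em reals hiding (zero; ∣_∣)
  open OrderedField em reals
  open IntegerSolver commutativeRing
  open SetoidReasoning setoid

  opaque
    fromℕ≥0 : ∀ n → 0# ≤ fromℕ n
    fromℕ≥0 zero    = ≤-refl
    fromℕ≥0 (suc n) = nn+ 0≤1 (fromℕ≥0 n)

  opaque
    fromℕ-+ : ∀ m n → fromℕ (m ℕ.+ n) ≈ fromℕ m + fromℕ n
    fromℕ-+ zero    n = (solve 1 (λ a → a := :0 :+ a) refl _)
    fromℕ-+ (suc m) n = trans (+-congˡ (fromℕ-+ m n)) (solve 2 (λ a b → :1 :+ (a :+ b) := :1 :+ a :+ b) refl _ _)

  opaque
    fromℕ-* : ∀ m n → fromℕ (m ℕ.* n) ≈ fromℕ m * fromℕ n
    fromℕ-* zero    n = (solve 1 (λ a → :0 := :0 :* a) refl _)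
    fromℕ-* (suc m) n = trans (fromℕ-+ n (m ℕ.* n)) (trans (+-congˡ (fromℕ-* m n)) (solve 2 (λ a b → a :+ b :* a := (:1 :+ b) :* a) refl _ _))

  opaque
    fromℕ-mono : ∀ {m n} → m ℕ.≤ n → fromℕ m ≤ fromℕ n
    fromℕ-mono {n = n} z≤n = fromℕ≥0 n
    fromℕ-mono (s≤s p) = ≤-refl ⊞ fromℕ-mono p

  opaque
    fromℕ-mono-< : ∀ {m n} → m ℕ.< n → fromℕ m < fromℕ n
    fromℕ-mono-< p = <-≤-trans (by< 0<1 (solve 1 (λ a → a :+ :1 := :1 :+ a :+ :0) refl _)) (fromℕ-mono p)

  opaque
    fromℕ-reflects-≤ : ∀ {m n} → fromℕ m ≤ fromℕ n → m ℕ.≤ n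
    fromℕ-reflects-≤ {m} {n} p with m ℕ.≤? n
    ... | yes q = q
    ... | no ¬q = ⊥-elim (<⇒≱ (fromℕ-mono-< (ℕ.≰⇒> ¬q)) p)

  opaque
    archimedean : ∀ x → ∃ λ n → x < fromℕ n
    archimedean x = by-contradiction λ none →
      no-supremum (supremum N (0# , 0 , refl) (x , λ { y (n , e) → ≈≤ e (≮⇒≥ λ q → none (n , q)) }))
      where
      N : Pred ℝ 0ℓ
      N y = ∃ λ n → y ≈ fromℕ n
      no-supremum : ¬ ∃ (IsSupremum _≤_ N)
      no-supremum (s , ub , least) = <⇒≱ 0<1 (by≤ smaller (solve 1 (λ a → :1 :+ (a :- :1) := :0 :+ a) refl _))
        where
        next : ∀ n → 1# + fromℕ n ≤ s
        next n = ub (1# + fromℕ n) (suc n , refl)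
        smaller : s ≤ s - 1#
        smaller = least (s - 1#) λ { y (n , e) → by≤ (≈≤ (+-congˡ e) (next n)) (solve 2 (λ a b → a :+ b := b :- :1 :+ (:1 :+ a)) refl _ _) }

  -- Every scale below is a power of two: cells are bisected, and the exponents of the lattices are
  -- rounded to naturals. Real powers then have to be estimated only in `root≤`.
  p2 : ℕ → ℝ
  p2 zero    = 1#
  p2 (suc n) = p2 n + p2 n

  h2 : ℕ → ℝ
  h2 zero    = 1#
  h2 (suc n) = ½ * h2 n

  opaque
    p2>0 : ∀ n → 0# < p2 n
    p2>0 zero    = 0<1
    p2>0 (suc n) = pos+ (p2>0 n) (p2>0 n)

  opaque
    h2>0 : ∀ n → 0# < h2 n
    h2>0 zero    = 0<1
    h2>0 (suc n) = ½-pos (h2>0 n)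

  opaque
    p2-h2 : ∀ n → p2 n * h2 n ≈ 1#
    p2-h2 zero    = (solve 0 (:1 :* :1 := :1) refl)
    p2-h2 (suc n) = begin
      (p2 n + p2 n) * (½ * h2 n)            ≈⟨ (solve 3 (λ a b c → (a :+ a) :* (b :* c) := a :* (b :* c :+ b :* c)) refl _ _ _) ⟩
      p2 n * (½ * h2 n + ½ * h2 n)          ≈⟨ *-congˡ (½-eq (h2 n)) ⟩
      p2 n * h2 n                           ≈⟨ p2-h2 n ⟩
      1#                                    ∎

  opaque
    h2-+ : ∀ m n → h2 (m ℕ.+ n) ≈ h2 m * h2 n
    h2-+ zero    n = (solve 1 (λ a → a := :1 :* a) refl _)
    h2-+ (suc m) n = trans (*-congˡ (h2-+ m n)) (solve 3 (λ a b c → a :* (b :* c) := a :* b :* c) refl _ _ _)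

  opaque
    p2≥1 : ∀ n → 1# ≤ p2 n
    p2≥1 zero    = ≤-refl
    p2≥1 (suc n) = ≤-trans (p2≥1 n) (by≤ (<⇒≤ (p2>0 n)) (solve 1 (λ a → a :+ a := a :+ a :+ :0) refl _))

  opaque
    p2-mono : ∀ {m n} → m ℕ.≤ n → p2 m ≤ p2 n
    p2-mono {n = n} z≤n = p2≥1 n
    p2-mono (s≤s p) = p2-mono p ⊞ p2-mono p

  opaque
    h2-anti : ∀ {m n} → m ℕ.≤ n → h2 n ≤ h2 m
    h2-anti {n = zero} z≤n = ≤-refl
    h2-anti {n = suc n} z≤n = ≤-trans (<⇒≤ (½-< (h2>0 n))) (h2-anti {zero} {n} z≤n)
    h2-anti (s≤s p) = *-monoˡ ½ (<⇒≤ 0<½) (h2-anti p)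

  opaque
    h2≤1 : ∀ n → h2 n ≤ 1#
    h2≤1 n = h2-anti {0} {n} z≤n

  opaque
    fromℕ≤p2 : ∀ n → 1# + fromℕ n ≤ p2 n
    fromℕ≤p2 zero    = ≤-reflexive (solve 0 (:1 :+ :0 := :1) refl)
    fromℕ≤p2 (suc n) = by≤ (fromℕ≤p2 n ⊞ p2≥1 n) (solve 2 (λ a b → :1 :+ (:1 :+ a) :+ (b :+ b) := b :+ b :+ (:1 :+ a :+ :1)) refl _ _)

  opaque
    ∃p2≥ : ∀ x → ∃ λ n → x ≤ p2 n
    ∃p2≥ x with archimedean x
    ... | n , q = n , ≤-trans (<⇒≤ q) (by≤ (fromℕ≤p2 n ⊞ 0≤1) (solve 2 (λ a b → a :+ (b :+ :1) := b :+ (:1 :+ a :+ :0)) refl _ _))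

  opaque
    ∃h2< : ∀ ε → 0# < ε → ∃ λ n → h2 n < ε
    ∃h2< ε 0<ε = from (∃p2≥ (inv 0<ε + 1#))
      where
      from : (∃ λ n → inv 0<ε + 1# ≤ p2 n) → ∃ λ n → h2 n < ε
      from (n , q) = n , *-cancelʳ-< (p2 n * inv 0<ε) (<⇒≤ (pos* (p2>0 n) (inv>0 0<ε)))
        (≤-<-trans (≤-reflexive small) (<-≤-trans below (≤≈ q big)))
        where
        below : inv 0<ε < inv 0<ε + 1#
        below = by< 0<1 (solve 1 (λ a → a :+ :1 := a :+ :1 :+ :0) refl _)
        small : h2 n * (p2 n * inv 0<ε) ≈ inv 0<ε
        small = begin
          h2 n * (p2 n * inv 0<ε)  ≈⟨ (solve 3 (λ a b c → a :* (b :* c) := b :* a :* c) refl _ _ _) ⟩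
          p2 n * h2 n * inv 0<ε    ≈⟨ *-congʳ (p2-h2 n) ⟩
          1# * inv 0<ε             ≈⟨ *-identityˡ _ ⟩
          inv 0<ε                  ∎
        big : p2 n ≈ ε * (p2 n * inv 0<ε)
        big = begin
          p2 n                     ≈⟨ (solve 1 (λ a → a := a :* :1) refl _) ⟩
          p2 n * 1#                ≈⟨ *-congˡ (sym (inv-eq 0<ε)) ⟩
          p2 n * (ε * inv 0<ε)     ≈⟨ (solve 3 (λ a b c → a :* (b :* c) := b :* (a :* c)) refl _ _ _) ⟩
          ε * (p2 n * inv 0<ε)     ∎

  opaque
    least : (P : ℕ → Set) → ∃ P → ∃ λ n → P n × (∀ m → P m → n ℕ.≤ m)
    least P (n , p) = go n n p (ℕ.≤-refl)
      where
      go : ∀ fuel n → P n → n ℕ.≤ fuel → ∃ λ n → P n × (∀ m → P m → n ℕ.≤ m)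
      go fuel n p n≤f with lem (∃ λ m → P m × m ℕ.< n)
      go fuel n p n≤f | inj₂ none = n , p , λ m q → ℕ.≮⇒≥ λ m<n → none (m , q , m<n)
      go zero n p n≤f | inj₁ (m , q , m<n) with () ← ℕ.<-≤-trans m<n n≤f
      go (suc fuel) n p n≤f | inj₁ (m , q , m<n) = go fuel m q (ℕ.≤-pred (ℕ.<-≤-trans m<n n≤f))

  opaque
    ceiling : ∀ x → 0# ≤ x → ∃ λ n → x ≤ fromℕ n × fromℕ n ≤ x + 1# × (∀ m → x ≤ fromℕ m → n ℕ.≤ m)
    ceiling x 0≤x with least (λ n → x ≤ fromℕ n) (proj₁ (archimedean x) , <⇒≤ (proj₂ (archimedean x)))
    ... | zero , p , min = 0 , p , nn+ 0≤x 0≤1 , min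
    ... | suc n , p , min = suc n , p , by≤ (<⇒≤ (≰⇒> λ q → ℕ.1+n≰n (min n q))) (solve 2 (λ a b → :1 :+ a :+ b := b :+ :1 :+ a) refl _ _) , min

  opaque
    fromℕ≈natural : ∀ n → fromℕ n ≈ natural n
    fromℕ≈natural zero    = refl
    fromℕ≈natural (suc n) = trans (+-congˡ (fromℕ≈natural n)) (sym (natural-suc n))

  opaque
    fromℤ≈integer : ∀ i → fromℤ i ≈ integer i
    fromℤ≈integer (+ n)    = fromℕ≈natural n
    fromℤ≈integer -[1+ n ] = -‿cong (fromℕ≈natural (suc n))

  IsInt : Pred ℝ 0ℓ
  IsInt x = ∃ λ i → x ≈ integer i

  opaque
    int-cong : ∀ {x y} → x ≈ y → IsInt x → IsInt y
    int-cong e (i , p) = i , trans (sym e) p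

  opaque
    int-+ : ∀ {x y} → IsInt x → IsInt y → IsInt (x + y)
    int-+ (i , p) (j , q) = i ℤ.+ j , trans (+-cong p q) (sym (integer-+ i j))

  opaque
    int-* : ∀ {x y} → IsInt x → IsInt y → IsInt (x * y)
    int-* (i , p) (j , q) = i ℤ.* j , trans (*-cong p q) (sym (integer-* i j))

  opaque
    int-neg : ∀ {x} → IsInt x → IsInt (- x)
    int-neg (i , p) = ℤ.- i , trans (-‿cong p) (sym (integer-neg i))

  opaque
    int-0 : IsInt 0#
    int-0 = + 0 , refl

  opaque
    int-1 : IsInt 1#
    int-1 = + 1 , refl

  opaque
    int-- : ∀ {x y} → IsInt x → IsInt y → IsInt (x - y)
    int-- p q = int-+ p (int-neg q)

  opaque
    int-fromℕ : ∀ n → IsInt (fromℕ n)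
    int-fromℕ n = + n , fromℕ≈natural n

  opaque
    int-∣∣ : ∀ {x} → IsInt x → ∃ λ n → ∣ x ∣ ≈ fromℕ n
    int-∣∣ (+ n , p) = n , trans (∣∣-cong (trans p (sym (fromℕ≈natural n)))) (∣∣-pos (fromℕ≥0 n))
    int-∣∣ (-[1+ n ] , p) = suc n , trans (∣∣-cong (trans p (-‿cong (sym (fromℕ≈natural (suc n))))))
      (trans (∣∣-neg _) (∣∣-pos (fromℕ≥0 (suc n))))

  opaque
    int≥1 : ∀ {x} → IsInt x → ¬ (x ≈ 0#) → 1# ≤ ∣ x ∣
    int≥1 p x≉0 with int-∣∣ p
    ... | zero , e = ⊥-elim (x≉0 (∣∣≤0⇒≈0 (≤-reflexive e)))
    ... | suc n , e = ≤≈ (by≤ (fromℕ≥0 n) (solve 1 (λ a → :1 :+ a := :1 :+ a :+ :0) refl _)) (sym e)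

  opaque
    floor : ∀ x → ∃ λ m → IsInt m × m ≤ x × x < m + 1#
    floor x with archimedean (- x)
    ... | N , q with least (λ n → x + fromℕ N < fromℕ n) (archimedean (x + fromℕ N))
    ... | zero , p , _ = ⊥-elim (<⇒≱ p (by≤ (<⇒≤ q) (solve 2 (λ a b → :0 :+ a := b :+ a :- b) refl _ _)))
    ... | suc n , p , min = fromℕ n - fromℕ N , int-- (int-fromℕ n) (int-fromℕ N) ,
        by≤ (≮⇒≥ λ r → ℕ.1+n≰n (min n r)) (solve 3 (λ a b c → a :- b :+ (c :+ b) := c :+ a) refl _ _ _) , by< p (solve 3 (λ a b c → a :+ (:1 :+ b) := b :- c :+ :1 :+ (a :+ c)) refl _ _ _)

  opaque
    nearest : ∀ x → ∃ λ m → IsInt m × ∣ x - m ∣ ≤ ½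
    nearest x with floor (x + ½)
    ... | m , int , p , q = m , int , ∣∣≤ (by≤ (≤≈ (<⇒≤ q) (+-congˡ (sym ½+½))) (solve 3 (λ a b c → a :- b :+ (b :+ (c :+ c)) := c :+ (a :+ c)) refl _ _ _)) (by≤ p (solve 3 (λ a b c → :- (a :- b) :+ (a :+ c) := c :+ b) refl _ _ _))

  opaque
    sup-isSupremum : (P : Pred ℝ 0ℓ) → ∃ P → ∃ (IsUpperBound _≤_ P) → IsSupremum _≤_ P (sup P)
    sup-isSupremum P ne bd with em {∃ P × ∃ (IsUpperBound _≤_ P)}
    ... | yes (nonempty , bounded) = proj₂ (supremum P nonempty bounded)
    ... | no ¬p = ⊥-elim (¬p (ne , bd))

  opaque
    sup≤ : (P : Pred ℝ 0ℓ) {c : ℝ} → 0# ≤ c → (∀ y → P y → y ≤ c) → sup P ≤ c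
    sup≤ P {c} 0≤c h with em {∃ P × ∃ (IsUpperBound _≤_ P)}
    ... | yes (nonempty , bounded) = proj₂ (proj₂ (supremum P nonempty bounded)) c h
    ... | no _ = 0≤c

  private
    module Dist (x : ℝ) where
      S : Pred ℝ 0ℓ
      S y = ∃ λ m → - y ≈ Analysis.∣_∣ em reals (x - fromℤ m)
      nonneg : ∀ {y} m → - y ≈ Analysis.∣_∣ em reals (x - fromℤ m) → 0# ≤ - y
      nonneg m e = ≤≈ (∣∣≥0 (x - fromℤ m)) (trans (reflexive (∣∣-def _)) (sym e))
      dist-sup : IsSupremum _≤_ S (sup S)
      dist-sup = sup-isSupremum S (- ∣ x - fromℤ (+ 0) ∣ , + 0 , trans (solve 1 (λ a → :- (:- a) := a) refl _) (reflexive (∣∣-def _)))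
        (0# , λ { y (m , e) → by≤ (nonneg m e) (solve 1 (λ a → a :- a := :0 :+ :0) refl _) })

  opaque
    ∣∣ℤ≤ : ∀ x m → ∣ x ∣ℤ ≤ ∣ x - fromℤ m ∣
    ∣∣ℤ≤ x m = bound
      where
      open Dist x
      bound : - sup S ≤ ∣ x - fromℤ m ∣
      bound = by≤ (proj₁ dist-sup (- ∣ x - fromℤ m ∣) (m , trans (solve 1 (λ a → :- (:- a) := a) refl _) (reflexive (∣∣-def _)))) (solve 2 (λ a b → :- a :+ a := b :- b) refl _ _)

  opaque
    ∣∣ℤ≥0 : ∀ x → 0# ≤ ∣ x ∣ℤ
    ∣∣ℤ≥0 x = bound
      where
      open Dist x
      bound : 0# ≤ - sup S
      bound = by≤ (proj₂ dist-sup 0# λ { y (m , e) → by≤ (nonneg m e) (solve 1 (λ a → a :- a := :0 :+ :0) refl _) }) (solve 1 (λ a → :0 :+ :0 := :- a :+ a) refl _)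

  opaque
    ^-nn : ∀ {x} n → 0# ≤ x → 0# ≤ x ^ n
    ^-nn zero    p = 0≤1
    ^-nn (suc n) p = *-nonNeg p (^-nn n p)

  opaque
    ^-mono : ∀ {x y} n → 0# ≤ x → x ≤ y → x ^ n ≤ y ^ n
    ^-mono zero    p q = ≤-refl
    ^-mono (suc n) p q = *-mono p q (^-nn n p) (^-mono n p q)

  opaque
    ^-mono-< : ∀ {x y} n → 0# ≤ x → x < y → x ^ suc n < y ^ suc n
    ^-mono-< zero p q = by< q (solve 2 (λ a b → a :* :1 :+ b := b :* :1 :+ a) refl _ _)
    ^-mono-< {x} {y} (suc n) p q = ≤-<-trans (*-monoˡ x p (<⇒≤ r)) (*-monoʳ-< (≤-<-trans (^-nn (suc n) p) r) q)
      where
      r : x ^ suc n < y ^ suc n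
      r = ^-mono-< n p q

  opaque
    h2-^ : ∀ j a → h2 j ^ a ≈ h2 (j ℕ.* a)
    h2-^ j zero    = reflexive (≡.cong h2 (≡.sym (ℕ.*-zeroʳ j)))
    h2-^ j (suc a) = trans (*-congˡ (h2-^ j a)) (trans (sym (h2-+ j (j ℕ.* a))) (reflexive (≡.cong h2 (≡.sym (ℕ.*-suc j a)))))

  opaque
    root-zero : ∀ {w} t → w ≈ 0# → root w t ≈ 0#
    root-zero {w} t e with em {w ≈ 0#}
    ... | yes _ = refl
    ... | no ¬e = ⊥-elim (¬e e)

  opaque
    -- The exponent `suc j` makes t at most ½, which rules out the branch 1 ≤ t of `rpow`. In the
    -- other branch y^b = t^a with b ≤ w a, hence K b ≤ K w a ≤ (j + 1) a and y^b ≤ 2^-(j + 1)a ≤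
    -- 2^-Kb; comparing b-th powers gives the bound on y.
    root≤ : ∀ {w t} K j → 0# < w → 0# ≤ t → t ≤ h2 (suc j) → fromℕ K * w ≤ fromℕ (suc j) → root w t ≤ h2 K
    root≤ {w} {t} K j 0<w 0≤t t≤ Kw≤j with em {w ≈ 0#}
    ... | yes _ = <⇒≤ (h2>0 K)
    ... | no w≉0 = sup≤ _ (<⇒≤ (h2>0 K)) λ { y (0≤y , a , k , e , c) → bound y 0≤y a k e c }
      where
      s : ℝ
      s = w ⁻¹[ w≉0 ]
      bound : ∀ y → 0# ≤ y → ∀ a k → y ^ suc k ≈ t ^ a →
        ((1# ≤ t × fromℕ a ≤ s * fromℕ (suc k)) ⊎ (t ≤ 1# × s * fromℕ (suc k) ≤ fromℕ a)) → y ≤ h2 K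
      bound y 0≤y a k e (inj₁ (1≤t , _)) = ⊥-elim (<⇒≱ ½<1
        (≤-trans 1≤t (≤-trans t≤ (≤≈ (*-monoˡ ½ (<⇒≤ 0<½) (h2≤1 j)) (*-identityʳ ½)))))
      bound y 0≤y a k e (inj₂ (_ , sb≤a)) = ≮⇒≥ λ h<y → <⇒≱ (^-mono-< k (<⇒≤ (h2>0 K)) h<y)
        (≈≤ e (≤-trans (^-mono a 0≤t t≤) (≈≤ (h2-^ (suc j) a) (≤≈ (h2-anti Kb≤ja) (sym (h2-^ K (suc k)))))))
        where
        b≤wa : fromℕ (suc k) ≤ w * fromℕ a
        b≤wa = ≈≤ (begin
          fromℕ (suc k)              ≈⟨ *-identityˡ _ ⟨
          1# * fromℕ (suc k)         ≈⟨ *-congʳ (⁻¹-inverse w w≉0) ⟨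
          w * s * fromℕ (suc k)      ≈⟨ *-assoc _ _ _ ⟩
          w * (s * fromℕ (suc k))    ∎) (*-monoˡ w (<⇒≤ 0<w) sb≤a)
        Kb≤ja : K ℕ.* suc k ℕ.≤ suc j ℕ.* a
        Kb≤ja = fromℕ-reflects-≤ (≈≤ (fromℕ-* K (suc k)) (≤-trans (*-monoˡ _ (fromℕ≥0 K) b≤wa)
          (≈≤ (solve 3 (λ a b c → a :* (b :* c) := a :* b :* c) refl _ _ _) (≤≈ (*-monoʳ _ (fromℕ≥0 a) Kw≤j) (sym (fromℕ-* (suc j) a))))))

  opaque
    sum-cong : ∀ {n} {f g : Vector ℝ n} → (∀ i → f i ≈ g i) → sum f ≈ sum g
    sum-cong {zero}  h = refl
    sum-cong {suc n} h = +-cong (h zero) (sum-cong (h ∘ suc))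

  opaque
    sum-+ : ∀ {n} (f g : Vector ℝ n) → sum (λ i → f i + g i) ≈ sum f + sum g
    sum-+ {zero}  f g = (solve 0 (:0 := :0 :+ :0) refl)
    sum-+ {suc n} f g = trans (+-congˡ (sum-+ (f ∘ suc) (g ∘ suc))) (solve 4 (λ a b c d → a :+ b :+ (c :+ d) := a :+ c :+ (b :+ d)) refl _ _ _ _)

  opaque
    sum-* : ∀ {n} c (f : Vector ℝ n) → sum (λ i → c * f i) ≈ c * sum f
    sum-* {zero}  c f = (solve 1 (λ a → :0 := a :* :0) refl _)
    sum-* {suc n} c f = trans (+-congˡ (sum-* c (f ∘ suc))) (solve 3 (λ a b c → a :* b :+ a :* c := a :* (b :+ c)) refl _ _ _)

  opaque
    sum-0 : ∀ {n} {f : Vector ℝ n} → (∀ i → f i ≈ 0#) → sum f ≈ 0#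
    sum-0 {zero}  h = refl
    sum-0 {suc n} h = trans (+-cong (h zero) (sum-0 (h ∘ suc))) (solve 0 (:0 :+ :0 := :0) refl)

  opaque
    sum-mono : ∀ {n} {f g : Vector ℝ n} → (∀ i → f i ≤ g i) → sum f ≤ sum g
    sum-mono {zero}  h = ≤-refl
    sum-mono {suc n} h = h zero ⊞ sum-mono (h ∘ suc)

  opaque
    sum≥0 : ∀ {n} {f : Vector ℝ n} → (∀ i → 0# ≤ f i) → 0# ≤ sum f
    sum≥0 {zero}  h = ≤-refl
    sum≥0 {suc n} h = nn+ (h zero) (sum≥0 (h ∘ suc))

  opaque
    ∣sum∣≤ : ∀ {n} {f : Vector ℝ n} {c} → (∀ i → ∣ f i ∣ ≤ c) → ∣ sum f ∣ ≤ fromℕ n * c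
    ∣sum∣≤ {zero}  h = ≤-reflexive (trans ∣0∣ (solve 1 (λ a → :0 := :0 :* a) refl _))
    ∣sum∣≤ {suc n} {f} h = ≤-trans (∣∣-+ _ _) (≤≈ (h zero ⊞ ∣sum∣≤ (h ∘ suc)) (solve 2 (λ a b → a :+ b :* a := (:1 :+ b) :* a) refl _ _))

  opaque
    sum-swap : ∀ {m n} (f : Fin m → Fin n → ℝ) → sum (λ i → sum (f i)) ≈ sum (λ j → sum (λ i → f i j))
    sum-swap {zero}  f = sym (sum-0 {f = λ j → sum (λ i → f i j)} (λ _ → refl))
    sum-swap {suc m} f = trans (+-congˡ (sum-swap (f ∘ suc))) (sym (sum-+ (f zero) _))

  opaque
    term≤sum : ∀ {n} {f : Vector ℝ n} → (∀ i → 0# ≤ f i) → ∀ i → f i ≤ sum f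
    term≤sum h zero    = by≤ (sum≥0 (h ∘ suc)) (solve 2 (λ a b → a :+ b := a :+ b :+ :0) refl _ _)
    term≤sum h (suc i) = ≤-trans (term≤sum (h ∘ suc) i) (by≤ (h zero) (solve 2 (λ a b → a :+ b := b :+ a :+ :0) refl _ _))

  opaque
    argmax : ∀ {n} (f : Vector ℝ (suc n)) → ∃ λ i → ∀ j → f j ≤ f i
    argmax {zero}  f = zero , λ { zero → ≤-refl }
    argmax {suc n} f with argmax (f ∘ suc)
    ... | i , h with ≤-total (f zero) (f (suc i))
    ... | inj₁ p = suc i , λ { zero → p ; (suc j) → h j }
    ... | inj₂ p = zero , λ { zero → ≤-refl ; (suc j) → ≤-trans (h j) p }

  opaque
    common-bound : ∀ {n} (P : Fin n → ℝ → Set) → (∀ i → ∃ λ M → ∀ M′ → M ≤ M′ → P i M′) → ∃ λ M → ∀ i → P i M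
    common-bound {n} P h = M , λ i → proj₂ (h i) M (≤-trans (x≤∣x∣ _) (term≤sum (λ j → ∣∣≥0 (proj₁ (h j))) i))
      where
      M : ℝ
      M = sum (λ i → ∣ proj₁ (h i) ∣)

  opaque
    common-radius : ∀ {n} (P : Fin n → ℝ → Set) → (∀ i → ∃ λ δ → 0# < δ × (∀ δ′ → δ′ ≤ δ → P i δ′)) →
      ∃ λ δ → 0# < δ × (∀ i → P i δ)
    common-radius {zero} P h = 1# , 0<1 , λ ()
    common-radius {suc n} P h with h zero | common-radius (λ i δ → ∀ δ′ → δ′ ≤ δ → P (suc i) δ′)
        (λ i → proj₁ (h (suc i)) , proj₁ (proj₂ (h (suc i))) , λ δ p δ′ q → proj₂ (proj₂ (h (suc i))) δ′ (≤-trans q p))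
    ... | δ₀ , 0<δ₀ , h₀ | δ₁ , 0<δ₁ , h₁ with min₂ 0<δ₀ 0<δ₁
    ... | δ , 0<δ , p , q = δ , 0<δ , λ { zero → h₀ δ p ; (suc i) → h₁ i δ q }

-- Compactness of cells and the mean value theorem

module Calculus (em : ExcludedMiddle 0ℓ) (reals : CompleteOrderedField) where

  open Analysis em reals hiding (zero; ∣_∣; ContinuousAt)
  open OrderedField em reals
  open Numbers em reals
  open IntegerSolver commutativeRing
  open SetoidReasoning setoid

  In : ℝ → ℝ → Pred ℝ 0ℓ
  In u ℓ x = u ≤ x × x ≤ u + ℓ

  data Tree (P : ℝ → ℝ → Set) : ℝ → ℝ → Set where
    leaf : ∀ {u ℓ} → P u ℓ → Tree P u ℓ
    node : ∀ {u ℓ} → Tree P u (½ * ℓ) → Tree P (u + ½ * ℓ) (½ * ℓ) → Tree P u ℓ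

  opaque
    ∃h2*< : ∀ {L δ} → 0# ≤ L → 0# < δ → ∃ λ n → h2 n * L < δ
    ∃h2*< {L} {δ} 0≤L 0<δ = from (∃h2< (δ * inv 0<L+1) (pos* 0<δ (inv>0 0<L+1)))
      where
      0<L+1 : 0# < L + 1#
      0<L+1 = by< (0<1 <⊞ 0≤L) (solve 1 (λ a → :0 :+ (:1 :+ a) := a :+ :1 :+ (:0 :+ :0)) refl _)
      from : (∃ λ n → h2 n < δ * inv 0<L+1) → ∃ λ n → h2 n * L < δ
      from (n , p) = n , ≤-<-trans (by≤ (<⇒≤ (h2>0 n)) (solve 2 (λ a b → a :* b :+ a := a :* (b :+ :1) :+ :0) refl _ _)) (<-≤-trans (*-monoʳ-< 0<L+1 p) (≤-reflexive (begin
        δ * inv 0<L+1 * (L + 1#)     ≈⟨ (solve 3 (λ a b c → a :* b :* (c :+ :1) := a :* ((c :+ :1) :* b)) refl _ _ _) ⟩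
        δ * ((L + 1#) * inv 0<L+1)   ≈⟨ *-congˡ (inv-eq 0<L+1) ⟩
        δ * 1#                       ≈⟨ *-identityʳ δ ⟩
        δ                            ∎)))

  opaque
    left≤ : ∀ u {ℓ} → 0# ≤ ℓ → u + ½ * ℓ ≤ u + ℓ
    left≤ u {ℓ} p = by≤ (*-nonNeg (<⇒≤ 0<½) p ⊞ ≤-reflexive (½-eq ℓ)) (solve 3 (λ a b c → a :+ b :* c :+ (b :* c :+ c) := a :+ c :+ (:0 :+ (b :* c :+ b :* c))) refl _ _ _)

  opaque
    right≈ : ∀ u ℓ → u + ½ * ℓ + ½ * ℓ ≈ u + ℓ
    right≈ u ℓ = trans (+-assoc _ _ _) (+-congˡ (½-eq ℓ))

  opaque
    half≥0 : ∀ {ℓ} → 0# ≤ ℓ → 0# ≤ ½ * ℓ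
    half≥0 = *-nonNeg (<⇒≤ 0<½)

  opaque
    In-split : ∀ {u ℓ x} → In u ℓ x → In u (½ * ℓ) x ⊎ In (u + ½ * ℓ) (½ * ℓ) x
    In-split {u} {ℓ} {x} (p , q) with ≤-total x (u + ½ * ℓ)
    ... | inj₁ r = inj₁ (p , r)
    ... | inj₂ r = inj₂ (r , ≤≈ q (sym (right≈ u ℓ)))

  opaque
    In-left : ∀ {u ℓ x} → 0# ≤ ℓ → In u (½ * ℓ) x → In u ℓ x
    In-left {u} 0≤ℓ (p , q) = p , ≤-trans q (left≤ u 0≤ℓ)

  opaque
    In-right : ∀ {u ℓ x} → 0# ≤ ℓ → In (u + ½ * ℓ) (½ * ℓ) x → In u ℓ x
    In-right {u} {ℓ} 0≤ℓ (p , q) = ≤-trans (by≤ (half≥0 0≤ℓ) (solve 3 (λ a b c → a :+ b :* c := a :+ b :* c :+ :0) refl _ _ _)) p , ≤≈ q (right≈ u ℓ)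

  opaque
    ∣-∣-In : ∀ {u ℓ x y} → In u ℓ x → In u ℓ y → ∣ x - y ∣ ≤ ℓ
    ∣-∣-In (p , q) (r , s) = ∣∣≤ (by≤ (q ⊞ r) (solve 4 (λ a b c d → a :- b :+ (c :+ d :+ b) := d :+ (a :+ c)) refl _ _ _ _)) (by≤ (p ⊞ s) (solve 4 (λ a b c d → :- (a :- b) :+ (a :+ (c :+ d)) := d :+ (c :+ b)) refl _ _ _ _))

  module Bisection (Q : ℝ → ℝ → Set) (split : ∀ {v m} → Q v m → Q v (½ * m) ⊎ Q (v + ½ * m) (½ * m)) where

    record State : Set where
      constructor state
      field
        left width : ℝ
        property   : Q left width
        width≥0    : 0# ≤ width
    open State public

    opaque
      halve : (s : State) → ∃ λ t → left s ≤ left t × left t + width t ≤ left s + width s × width t ≈ ½ * width s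
      halve (state v m q 0≤m) with split q
      ... | inj₁ r = state v (½ * m) r (half≥0 0≤m) , ≤-refl , left≤ v 0≤m , refl
      ... | inj₂ r = state (v + ½ * m) (½ * m) r (half≥0 0≤m) , by≤ (half≥0 0≤m) (solve 3 (λ a b c → a :+ b :* c := a :+ b :* c :+ :0) refl _ _ _) , ≤-reflexive (right≈ v m) , refl

    module _ (s₀ : State) where

      cell : ℕ → State
      cell zero    = s₀
      cell (suc n) = proj₁ (halve (cell n))

      opaque
        left-mono : ∀ d n → left (cell n) ≤ left (cell (d ℕ.+ n))
        left-mono zero    n = ≤-refl
        left-mono (suc d) n = ≤-trans (left-mono d n) (proj₁ (proj₂ (halve (cell (d ℕ.+ n)))))
        right-mono : ∀ d n → left (cell (d ℕ.+ n)) + width (cell (d ℕ.+ n)) ≤ left (cell n) + width (cell n)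
        right-mono zero    n = ≤-refl
        right-mono (suc d) n = ≤-trans (proj₁ (proj₂ (proj₂ (halve (cell (d ℕ.+ n)))))) (right-mono d n)
        width-cell : ∀ n → width (cell n) ≈ h2 n * width s₀
        width-cell zero    = (solve 1 (λ a → a := :1 :* a) refl _)
        width-cell (suc n) = trans (proj₂ (proj₂ (proj₂ (halve (cell n))))) (trans (*-congˡ (width-cell n)) (solve 3 (λ a b c → a :* (b :* c) := a :* b :* c) refl _ _ _))
        left≤right : ∀ n k → left (cell n) ≤ left (cell k) + width (cell k)
        left≤right n k with ℕ.≤-total n k
        ... | inj₁ p = ≤-trans (≡.subst (λ i → left (cell n) ≤ left (cell i)) (ℕ.m∸n+n≡m p) (left-mono (k ℕ.∸ n) n))
            (by≤ (width≥0 (cell k)) (solve 2 (λ a b → a :+ b := a :+ b :+ :0) refl _ _))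
        ... | inj₂ p = ≤-trans (by≤ (width≥0 (cell n)) (solve 2 (λ a b → a :+ b := a :+ b :+ :0) refl _ _))
            (≡.subst (λ i → left (cell i) + width (cell i) ≤ left (cell k) + width (cell k)) (ℕ.m∸n+n≡m p) (right-mono (n ℕ.∸ k) k))
        limit : ∃ λ x → ∀ n → In (left (cell n)) (width (cell n)) x
        limit = from (supremum Lefts (left s₀ , 0 , refl) (left s₀ + width s₀ , λ { y (n , e) → ≈≤ e (left≤right n 0) }))
          where
          Lefts : Pred ℝ 0ℓ
          Lefts y = ∃ λ n → y ≈ left (cell n)
          from : ∃ (IsSupremum _≤_ Lefts) → ∃ λ x → ∀ n → In (left (cell n)) (width (cell n)) x
          from (x , ub , lub) = x , λ n → ub (left (cell n)) (n , refl) , lub (left (cell n) + width (cell n)) λ { y (k , e) → ≈≤ e (left≤right k n) }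
        bisect : ∃ λ x → In (left s₀) (width s₀) x × (∀ δ → 0# < δ → ∃ λ t →
          width t < δ × left s₀ ≤ left t × left t + width t ≤ left s₀ + width s₀ × In (left t) (width t) x)
        bisect = from limit
          where
          from : (∃ λ x → ∀ n → In (left (cell n)) (width (cell n)) x) → ∃ λ x → In (left s₀) (width s₀) x × (∀ δ → 0# < δ → ∃ λ t →
            width t < δ × left s₀ ≤ left t × left t + width t ≤ left s₀ + width s₀ × In (left t) (width t) x)
          from (x , x∈) = x , x∈ 0 , λ δ 0<δ → small δ (∃h2*< (width≥0 s₀) 0<δ)
            where
            small : ∀ δ → (∃ λ n → h2 n * width s₀ < δ) → ∃ λ t →
              width t < δ × left s₀ ≤ left t × left t + width t ≤ left s₀ + width s₀ × In (left t) (width t) x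
            small δ (n , p) = cell n , ≤-<-trans (≤-reflexive (width-cell n)) p ,
              ≡.subst (λ i → left s₀ ≤ left (cell i)) (ℕ.+-identityʳ n) (left-mono n 0) ,
              ≡.subst (λ i → left (cell i) + width (cell i) ≤ left s₀ + width s₀) (ℕ.+-identityʳ n) (right-mono n 0) , x∈ n

  opaque
    -- Heine-Borel in the form of Cousin: if a cell had no subdivision into cells with `P`, neither
    -- would one of its halves, and the nested halves shrink to a point whose neighbourhood makes
    -- the small ones leaves.
    compact : (P : ℝ → ℝ → Set) {u ℓ : ℝ} → 0# ≤ ℓ →
      (∀ x → In u ℓ x → ∃ λ δ → 0# < δ × (∀ v m → 0# ≤ m → m < δ → u ≤ v → v + m ≤ u + ℓ → In v m x → P v m)) →
      Tree P u ℓ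
    compact P {u} {ℓ} 0≤ℓ local = by-contradiction λ none → absurd none (bisect (state u ℓ none 0≤ℓ))
      where
      split : ∀ {v m} → ¬ Tree P v m → ¬ Tree P v (½ * m) ⊎ ¬ Tree P (v + ½ * m) (½ * m)
      split {v} {m} ¬t with lem (Tree P v (½ * m))
      ... | inj₂ ¬l = inj₁ ¬l
      ... | inj₁ l  = inj₂ λ r → ¬t (node l r)
      open Bisection (λ v m → ¬ Tree P v m) split
      absurd : (none : ¬ Tree P u ℓ) → (∃ λ x → In u ℓ x × (∀ δ → 0# < δ → ∃ λ t →
          width t < δ × u ≤ left t × left t + width t ≤ u + ℓ × In (left t) (width t) x)) → ⊥
      absurd none (x , x∈ , near) = use (local x x∈)
        where
        use : (∃ λ δ → 0# < δ × (∀ v m → 0# ≤ m → m < δ → u ≤ v → v + m ≤ u + ℓ → In v m x → P v m)) → ⊥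
        use (δ , 0<δ , h) with near δ 0<δ
        ... | t , w , p , q , x∈t = property t (leaf (h (left t) (width t) (width≥0 t) w p q x∈t))

  ContinuousAt : (ℝ → ℝ) → ℝ → Set
  ContinuousAt F x = ∀ ε → 0# < ε → ∃ λ δ → 0# < δ × (∀ y → ∣ y - x ∣ < δ → ∣ F y - F x ∣ < ε)

  -- A derivative free of division, whose estimate includes points y equal to x. There it yields F y
  -- ≈ F x, which matters because F is a bare function and need not respect `_≈_`.
  record Der (F : ℝ → ℝ) (x D : ℝ) : Set where
    constructor mkDer
    field
      at : ∀ ε → 0# < ε → ∃ λ δ → 0# < δ × (∀ y → ∣ y - x ∣ < δ → ∣ F y - F x - D * (y - x) ∣ ≤ ε * ∣ y - x ∣)

  opaque
    der-continuous : ∀ {F x D} → Der F x D → ContinuousAt F x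
    der-continuous {F} {x} {D} (mkDer d) ε 0<ε = from (d 1# 0<1)
      where
      K : ℝ
      K = 1# + ∣ D ∣
      0<K : 0# < K
      0<K = pos+nn 0<1 (∣∣≥0 D)
      from : (∃ λ δ → 0# < δ × (∀ y → ∣ y - x ∣ < δ → ∣ F y - F x - D * (y - x) ∣ ≤ 1# * ∣ y - x ∣)) →
        ∃ λ δ → 0# < δ × (∀ y → ∣ y - x ∣ < δ → ∣ F y - F x ∣ < ε)
      from (δ₀ , 0<δ₀ , h) = from′ (min₂ 0<δ₀ (pos* 0<ε (inv>0 0<K)))
        where
        from′ : (∃ λ δ → 0# < δ × δ ≤ δ₀ × δ ≤ ε * inv 0<K) → ∃ λ δ → 0# < δ × (∀ y → ∣ y - x ∣ < δ → ∣ F y - F x ∣ < ε)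
        from′ (δ , 0<δ , δ≤δ₀ , δ≤) = δ , 0<δ , λ y p → ≤-<-trans
          (≈≤ (∣∣-cong (solve 5 (λ a b c d e → a :- b := a :- b :- c :* (d :- e) :+ c :* (d :- e)) refl _ _ _ _ _)) (≤-trans (∣∣-+ (F y - F x - D * (y - x)) (D * (y - x)))
            (≤≈ (h y (<-≤-trans p δ≤δ₀) ⊞ ≤-reflexive (∣∣-* D (y - x))) (solve 2 (λ a b → :1 :* a :+ b :* a := a :* (:1 :+ b)) refl _ _))))
          (<-≤-trans (*-monoʳ-< 0<K (<-≤-trans p δ≤)) (≤-reflexive (begin
            ε * inv 0<K * K     ≈⟨ (solve 3 (λ a b c → a :* b :* (:1 :+ c) := a :* ((:1 :+ c) :* b)) refl _ _ _) ⟩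
            ε * (K * inv 0<K)   ≈⟨ *-congˡ (inv-eq 0<K) ⟩
            ε * 1#              ≈⟨ *-identityʳ ε ⟩
            ε                   ∎)))

  opaque
    der-+ : ∀ {F G x D E} → Der F x D → Der G x E → Der (λ y → F y + G y) x (D + E)
    der-+ {F} {G} {x} {D} {E} (mkDer d) (mkDer e) = mkDer λ ε 0<ε → from ε 0<ε (d (½ * ε) (½-pos 0<ε)) (e (½ * ε) (½-pos 0<ε))
      where
      from : ∀ ε → 0# < ε → (∃ λ δ → 0# < δ × (∀ y → ∣ y - x ∣ < δ → ∣ F y - F x - D * (y - x) ∣ ≤ ½ * ε * ∣ y - x ∣)) →
        (∃ λ δ → 0# < δ × (∀ y → ∣ y - x ∣ < δ → ∣ G y - G x - E * (y - x) ∣ ≤ ½ * ε * ∣ y - x ∣)) →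
        (∃ λ δ → 0# < δ × (∀ y → ∣ y - x ∣ < δ → ∣ F y + G y - (F x + G x) - (D + E) * (y - x) ∣ ≤ ε * ∣ y - x ∣))
      from ε 0<ε (δ₁ , 0<δ₁ , h₁) (δ₂ , 0<δ₂ , h₂) with min₂ 0<δ₁ 0<δ₂
      ... | δ , 0<δ , p₁ , p₂ = δ , 0<δ , λ y p → ≈≤ (∣∣-cong (solve 8 (λ a b c d e f g h → a :+ b :- (c :+ d) :- (e :+ f) :* (g :- h) := a :- c :- e :* (g :- h) :+ (b :- d :- f :* (g :- h))) refl _ _ _ _ _ _ _ _)) (≤-trans (∣∣-+ _ _)
        (≤≈ (h₁ y (<-≤-trans p p₁) ⊞ h₂ y (<-≤-trans p p₂)) (trans (solve 3 (λ a b c → a :* b :* c :+ a :* b :* c := (a :* b :+ a :* b) :* c) refl _ _ _) (*-congʳ (½-eq ε)))))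

  opaque
    der-const : ∀ c x → Der (λ _ → c) x 0#
    der-const c x = mkDer λ ε 0<ε → 1# , 0<1 , λ y _ → ≈≤ (trans (∣∣-cong (solve 3 (λ a b c → a :- a :- :0 :* (b :- c) := :0) refl _ _ _)) ∣0∣) (*-nonNeg (<⇒≤ 0<ε) (∣∣≥0 (y - x)))

  opaque
    der-id : ∀ x → Der (λ y → y) x 1#
    der-id x = mkDer λ ε 0<ε → 1# , 0<1 , λ y _ → ≈≤ (trans (∣∣-cong (solve 2 (λ a b → a :- b :- :1 :* (a :- b) := :0) refl _ _)) ∣0∣) (*-nonNeg (<⇒≤ 0<ε) (∣∣≥0 (y - x)))

  opaque
    der-* : ∀ {F x D} c → Der F x D → Der (λ y → c * F y) x (c * D)
    der-* {F} {x} {D} c (mkDer d) = mkDer λ ε 0<ε → from ε 0<ε (d (ε * inv 0<K) (pos* 0<ε (inv>0 0<K)))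
      where
      K : ℝ
      K = 1# + ∣ c ∣
      0<K : 0# < K
      0<K = pos+nn 0<1 (∣∣≥0 c)
      from : ∀ ε → 0# < ε → (∃ λ δ → 0# < δ × (∀ y → ∣ y - x ∣ < δ → ∣ F y - F x - D * (y - x) ∣ ≤ ε * inv 0<K * ∣ y - x ∣)) →
        ∃ λ δ → 0# < δ × (∀ y → ∣ y - x ∣ < δ → ∣ c * F y - c * F x - c * D * (y - x) ∣ ≤ ε * ∣ y - x ∣)
      from ε 0<ε (δ , 0<δ , h) = δ , 0<δ , λ y p → ≈≤ (trans (∣∣-cong (solve 6 (λ a b c d e f → a :* b :- a :* c :- a :* d :* (e :- f) := a :* (b :- c :- d :* (e :- f))) refl _ _ _ _ _ _)) (∣∣-* c _)) (≤-trans
        (*-mono (∣∣≥0 c) (≤-trans (by≤ 0≤1 (solve 1 (λ a → a :+ :1 := :1 :+ a :+ :0) refl _)) (≤-refl {K})) (∣∣≥0 _) (h y p)) (≤-reflexive (begin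
          K * (ε * inv 0<K * ∣ y - x ∣)   ≈⟨ (solve 4 (λ a b c d → (:1 :+ a) :* (b :* c :* d) := b :* d :* ((:1 :+ a) :* c)) refl _ _ _ _) ⟩
          ε * ∣ y - x ∣ * (K * inv 0<K)   ≈⟨ *-congˡ (inv-eq 0<K) ⟩
          ε * ∣ y - x ∣ * 1#              ≈⟨ *-identityʳ _ ⟩
          ε * ∣ y - x ∣                   ∎)))

  opaque
    der-cong : ∀ {F x D E} → D ≈ E → Der F x D → Der F x E
    der-cong {F} {x} {D} {E} D≈E (mkDer d) = mkDer λ ε 0<ε → from ε (d ε 0<ε)
      where
      from : ∀ ε → (∃ λ δ → 0# < δ × (∀ y → ∣ y - x ∣ < δ → ∣ F y - F x - D * (y - x) ∣ ≤ ε * ∣ y - x ∣)) →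
        ∃ λ δ → 0# < δ × (∀ y → ∣ y - x ∣ < δ → ∣ F y - F x - E * (y - x) ∣ ≤ ε * ∣ y - x ∣)
      from ε (δ , 0<δ , h) = δ , 0<δ , λ y p → ≈≤ (∣∣-cong (+-congˡ (-‿cong (*-congʳ (sym D≈E))))) (h y p)

  opaque
    der-sum : ∀ {n} (F : Fin n → ℝ → ℝ) (D : Vector ℝ n) {x} → (∀ i → Der (F i) x (D i)) → Der (λ y → sum (λ i → F i y)) x (sum D)
    der-sum {zero}  F D {x} h = der-const 0# x
    der-sum {suc n} F D {x} h = der-+ {F zero} {λ y → sum (λ i → F (suc i) y)} (h zero) (der-sum (F ∘ suc) (D ∘ suc) (h ∘ suc))

  opaque
    der-unique : ∀ {F x D E} → Der F x D → Der F x E → D ≈ E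
    der-unique {F} {x} {D} {E} (mkDer d) (mkDer e) = by≈ (∣∣≤0⇒≈0 {D - E} (arbitrarily-small λ ε 0<ε →
        from ε 0<ε (d (½ * ε) (½-pos 0<ε)) (e (½ * ε) (½-pos 0<ε)))) (solve 2 (λ a b → a :+ :0 := b :+ (a :- b)) refl _ _)
      where
      from : ∀ ε → 0# < ε →
        (∃ λ δ → 0# < δ × (∀ y → ∣ y - x ∣ < δ → ∣ F y - F x - D * (y - x) ∣ ≤ ½ * ε * ∣ y - x ∣)) →
        (∃ λ δ → 0# < δ × (∀ y → ∣ y - x ∣ < δ → ∣ F y - F x - E * (y - x) ∣ ≤ ½ * ε * ∣ y - x ∣)) → ∣ D - E ∣ ≤ ε
      from ε 0<ε (δ₁ , 0<δ₁ , h₁) (δ₂ , 0<δ₂ , h₂) with min₂ 0<δ₁ 0<δ₂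
      ... | δ , 0<δ , p₁ , p₂ = *-cancelʳ-≤ η 0<η (≈≤ (sym (trans (∣∣-* (D - E) η) (*-congˡ (∣∣-pos (<⇒≤ 0<η)))))
          (≈≤ (∣∣-cong split) (≤-trans (∣∣-+ _ _) (≤≈ (near E h₂ p₂ ⊞ ≈≤ (∣∣-neg _) (near D h₁ p₁)) (trans (solve 3 (λ a b c → a :* b :* (a :* c) :+ a :* b :* (a :* c) := (a :* b :+ a :* b) :* (a :* c)) refl _ _ _) (*-congʳ (½-eq ε)))))))
        where
        η y : ℝ
        η = ½ * δ
        y = x + η
        0<η : 0# < η
        0<η = ½-pos 0<δ
        ∣y-x∣ : ∣ y - x ∣ ≈ η
        ∣y-x∣ = trans (∣∣-cong (solve 3 (λ a b c → a :+ b :* c :- a := b :* c) refl _ _ _)) (∣∣-pos (<⇒≤ 0<η))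
        near : ∀ C {δ′} → (∀ y → ∣ y - x ∣ < δ′ → ∣ F y - F x - C * (y - x) ∣ ≤ ½ * ε * ∣ y - x ∣) → δ ≤ δ′ →
          ∣ F y - F x - C * (y - x) ∣ ≤ ½ * ε * η
        near C h q = ≤≈ (h y (≤-<-trans (≤-reflexive ∣y-x∣) (<-≤-trans (½-< 0<δ) q))) (*-congˡ ∣y-x∣)
        split : (D - E) * η ≈ F y - F x - E * (y - x) + - (F y - F x - D * (y - x))
        split = (solve 7 (λ a b c d e f g → (a :- b) :* (c :* d) := e :- f :- b :* (g :+ c :* d :- g) :- (e :- f :- a :* (g :+ c :* d :- g))) refl _ _ _ _ _ _ _)

  opaque
    -- Without a maximum, each point has a value F y above its own, and by continuity above those
    -- nearby. Compactness leaves finitely many such y; the one with the largest value would satisfy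
    -- F y < F y.
    extreme-value : ∀ F {a ℓ} → 0# ≤ ℓ → (∀ x → In a ℓ x → ContinuousAt F x) → ∃ λ c → In a ℓ c × (∀ y → In a ℓ y → F y ≤ F c)
    extreme-value F {a} {ℓ} 0≤ℓ cont = by-contradiction λ none → absurd (dominate 0≤ℓ (compact Dominated 0≤ℓ (local none)))
      where
      Dominated : ℝ → ℝ → Set
      Dominated v m = ∃ λ y → In a ℓ y × (∀ z → In v m z → F z < F y)
      above : ¬ (∃ λ c → In a ℓ c × (∀ y → In a ℓ y → F y ≤ F c)) → ∀ x → In a ℓ x → ∃ λ y → In a ℓ y × F x < F y
      above none x x∈ = by-contradiction λ no → none (x , x∈ , λ y y∈ → ≮⇒≥ λ p → no (y , y∈ , p))
      local : ¬ (∃ λ c → In a ℓ c × (∀ y → In a ℓ y → F y ≤ F c)) → ∀ x → In a ℓ x →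
        ∃ λ δ → 0# < δ × (∀ v m → 0# ≤ m → m < δ → a ≤ v → v + m ≤ a + ℓ → In v m x → Dominated v m)
      local none x x∈ = from (above none x x∈)
        where
        from : (∃ λ y → In a ℓ y × F x < F y) →
          ∃ λ δ → 0# < δ × (∀ v m → 0# ≤ m → m < δ → a ≤ v → v + m ≤ a + ℓ → In v m x → Dominated v m)
        from (y , y∈ , p) = from′ (cont x x∈ (F y - F x) (sub>0 p))
          where
          from′ : (∃ λ δ → 0# < δ × (∀ z → ∣ z - x ∣ < δ → ∣ F z - F x ∣ < F y - F x)) →
            ∃ λ δ → 0# < δ × (∀ v m → 0# ≤ m → m < δ → a ≤ v → v + m ≤ a + ℓ → In v m x → Dominated v m)
          from′ (δ , 0<δ , h) = δ , 0<δ , λ v m _ m<δ _ _ x∈v → y , y∈ , λ z z∈ →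
            by< (≤-<-trans (x≤∣x∣ _) (h z (≤-<-trans (∣-∣-In z∈ x∈v) m<δ))) (solve 3 (λ a b c → a :+ (b :- c) := b :+ (a :- c)) refl _ _ _)
      dominate : ∀ {v m} → 0# ≤ m → Tree Dominated v m → Dominated v m
      dominate 0≤m (leaf d) = d
      dominate {v} {m} 0≤m (node l r) = join (dominate (half≥0 0≤m) l) (dominate (half≥0 0≤m) r)
        where
        join : Dominated v (½ * m) → Dominated (v + ½ * m) (½ * m) → Dominated v m
        join (y₁ , y₁∈ , h₁) (y₂ , y₂∈ , h₂) with ≤-total (F y₁) (F y₂)
        ... | inj₁ p = y₂ , y₂∈ , λ z z∈ → bound z (In-split z∈)
          where
          bound : ∀ z → In v (½ * m) z ⊎ In (v + ½ * m) (½ * m) z → F z < F y₂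
          bound z (inj₁ q) = <-≤-trans (h₁ z q) p
          bound z (inj₂ q) = h₂ z q
        ... | inj₂ p = y₁ , y₁∈ , λ z z∈ → bound z (In-split z∈)
          where
          bound : ∀ z → In v (½ * m) z ⊎ In (v + ½ * m) (½ * m) z → F z < F y₁
          bound z (inj₁ q) = h₁ z q
          bound z (inj₂ q) = <-≤-trans (h₂ z q) p
      absurd : Dominated a ℓ → ⊥
      absurd (y , y∈ , h) = <-irrefl (h y y∈)

  opaque
    -- A step of length η in the direction of the sign of D would raise F by at least ½ ∣D∣ η.
    fermat : ∀ {F a b c D} → a < c → c < b → (∀ y → a ≤ y → y ≤ b → F y ≤ F c) → Der F c D → D ≈ 0#
    fermat {F} {a} {b} {c} {D} a<c c<b max (mkDer d) = by-contradiction λ D≉0 → from D≉0 (d (½ * ∣ D ∣) (½-pos (≉0⇒∣∣>0 D≉0)))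
      where
      from : ¬ (D ≈ 0#) → (∃ λ δ → 0# < δ × (∀ y → ∣ y - c ∣ < δ → ∣ F y - F c - D * (y - c) ∣ ≤ ½ * ∣ D ∣ * ∣ y - c ∣)) → ⊥
      from D≉0 (δ , 0<δ , h) = from₁ (min₂ (sub>0 a<c) (sub>0 c<b))
        where
        from₁ : (∃ λ η → 0# < η × η ≤ c - a × η ≤ b - c) → ⊥
        from₁ (η₁ , 0<η₁ , p , q) = from₂ (min₂ 0<η₁ (½-pos 0<δ))
          where
          from₂ : (∃ λ η → 0# < η × η ≤ η₁ × η ≤ ½ * δ) → ⊥
          from₂ (η , 0<η , r , s) = sign (∣∣-cases D)
            where
            η<δ : η < δ
            η<δ = ≤-<-trans s (½-< 0<δ)
            move : ∀ {σ} → ∣ σ ∣ ≈ η → σ ≤ b - c → a - c ≤ σ → D * σ ≈ ∣ D ∣ * η → ⊥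
            move {σ} ∣σ∣ σ≤ ≤σ e = <⇒≱ (½-pos (pos* (≉0⇒∣∣>0 D≉0) 0<η)) (by≤
                (-x≤∣x∣ (F (c + σ) - F c - D * (c + σ - c)) ⊞ h (c + σ) (≤-<-trans (≤-reflexive ∣y-c∣) η<δ) ⊞ max (c + σ) (by≤ ≤σ (solve 3 (λ a b c → a :+ b := c :+ b :+ (a :- c)) refl _ _ _)) (by≤ σ≤ (solve 3 (λ a b c → a :+ b :+ (c :- a) := c :+ b) refl _ _ _))
                  ⊞ ≤-reflexive (sym e) ⊞ *-monoˡ (½ * ∣ D ∣) (half≥0 (∣∣≥0 D)) (≤-reflexive ∣y-c∣) ⊞ ≤-reflexive (½-eq (∣ D ∣ * η))) (solve 10 (λ a b c d e f g h x8 x9 → a :* (b :* c) :+ (d :+ a :* b :* e :+ f :+ g :* h :+ a :* b :* c :+ b :* c) := :0 :+ (:- (x8 :- f :- g :* (x9 :+ h :- x9)) :+ d :+ x8 :+ b :* c :+ a :* b :* e :+ (a :* (b :* c) :+ a :* (b :* c)))) refl _ _ _ _ _ _ _ _ _ _))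
              where
              ∣y-c∣ : ∣ c + σ - c ∣ ≈ η
              ∣y-c∣ = trans (∣∣-cong (solve 2 (λ a b → a :+ b :- a := b) refl _ _)) ∣σ∣
            sign : (∣ D ∣ ≈ D) ⊎ (∣ D ∣ ≈ - D) → ⊥
            sign (inj₁ e) = move {η} (∣∣-pos (<⇒≤ 0<η)) (≤-trans r q) (by≤ (<⇒≤ a<c ⊞ <⇒≤ 0<η) (solve 3 (λ a b c → a :- b :+ (b :+ c) := c :+ (a :+ :0)) refl _ _ _)) (*-congʳ (sym e))
            sign (inj₂ e) = move { - η} (trans (∣∣-neg η) (∣∣-pos (<⇒≤ 0<η))) (by≤ (<⇒≤ c<b ⊞ <⇒≤ 0<η) (solve 3 (λ a b c → :- a :+ (b :+ a) := b :- c :+ (c :+ :0)) refl _ _ _)) (by≤ (≤-trans r p) (solve 3 (λ a b c → a :- b :+ (b :- a) := :- c :+ c) refl _ _ _))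
              (trans { j = - D * η} (solve 2 (λ a b → a :* (:- b) := (:- a) :* b) refl _ _) (*-congʳ (sym e)))

  opaque
    rolle : ∀ {F F′ : ℝ → ℝ} {a b} → a < b → (∀ x → a ≤ x → x ≤ b → Der F x (F′ x)) → F a ≈ F b → ∃ λ ξ → a ≤ ξ × ξ ≤ b × F′ ξ ≈ 0#
    rolle {F} {F′} {a} {b} a<b der Fa≈Fb =
        from (extreme-value F 0≤ℓ λ x x∈ → der-continuous (der′ x x∈))
             (extreme-value (λ x → - 1# * F x) 0≤ℓ λ x x∈ → der-continuous (der-* {F} (- 1#) (der′ x x∈)))
      where
      ℓ : ℝ
      ℓ = b - a
      0≤ℓ : 0# ≤ ℓ
      0≤ℓ = sub≥0 (<⇒≤ a<b)
      der′ : ∀ x → In a ℓ x → Der F x (F′ x)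
      der′ x (p , q) = der x p (≤≈ q (solve 2 (λ a b → a :+ (b :- a) := b) refl _ _))
      in′ : ∀ y → a ≤ y → y ≤ b → In a ℓ y
      in′ y p q = p , ≤≈ q (solve 2 (λ a b → a := b :+ (a :- b)) refl _ _)
      local : ∀ c → In a ℓ c → ContinuousAt F c
      local c c∈ = der-continuous (der′ c c∈)
      -- Being an endpoint is known only up to `_≈_`, which F respects because it is continuous.
      cong-at : ∀ {x y} → In a ℓ x → x ≈ y → F x ≈ F y
      cong-at {x} {y} x∈ e = sym (by≈ (∣∣≤0⇒≈0 {F y - F x} (arbitrarily-small λ ε 0<ε → near (local x x∈ ε 0<ε))) (solve 2 (λ a b → a :+ :0 := b :+ (a :- b)) refl _ _))
        where
        near : ∀ {ε} → (∃ λ δ → 0# < δ × (∀ z → ∣ z - x ∣ < δ → ∣ F z - F x ∣ < ε)) → ∣ F y - F x ∣ ≤ ε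
        near (δ , 0<δ , h) = <⇒≤ (h y (≤-<-trans (≤-reflexive (trans (∣∣-cong (trans (+-congʳ (sym e)) (solve 1 (λ a → a :- a := :0) refl _))) ∣0∣)) 0<δ))
      ends : ∀ c → In a ℓ c → (F c ≈ F a) ⊎ (a < c × c < b)
      ends c (p , q) with ≤⊎> c a | ≤⊎> b c
      ... | inj₁ r | _ = inj₁ (cong-at (p , q) (≤-antisym r p))
      ... | inj₂ r | inj₁ s = inj₁ (trans (cong-at (p , q) (≤-antisym (≤≈ q (solve 2 (λ a b → a :+ (b :- a) := b) refl _ _)) s)) (sym Fa≈Fb))
      ... | inj₂ r | inj₂ s = inj₂ (r , s)
      from : (∃ λ c → In a ℓ c × (∀ y → In a ℓ y → F y ≤ F c)) →
        (∃ λ c → In a ℓ c × (∀ y → In a ℓ y → - 1# * F y ≤ - 1# * F c)) → ∃ λ ξ → a ≤ ξ × ξ ≤ b × F′ ξ ≈ 0#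
      from (c , c∈ , max) (d , d∈ , min) with ends c c∈ | ends d d∈
      ... | inj₂ (p , q) | _ = c , <⇒≤ p , <⇒≤ q , fermat {F} p q (λ y r s → max y (in′ y r s)) (der′ c c∈)
      ... | inj₁ _ | inj₂ (p , q) = d , <⇒≤ p , <⇒≤ q , (begin
          F′ d               ≈⟨ (solve 1 (λ a → a := :- ((:- :1) :* a)) refl _) ⟩
          - (- 1# * F′ d)    ≈⟨ -‿cong (fermat {λ x → - 1# * F x} p q (λ y r s → min y (in′ y r s)) (der-* {F} (- 1#) (der′ d d∈))) ⟩
          - 0#               ≈⟨ (solve 0 (:- :0 := :0) refl) ⟩
          0#                 ∎)
      -- Maximum and minimum are both attained at the ends, so F is constant and the midpoint is a
      -- maximum as well.
      ... | inj₁ e | inj₁ e′ = m , <⇒≤ p , <⇒≤ q , fermat {F} p q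
            (λ y r s → ≤-trans (≤≈ (max y (in′ y r s)) (trans e (sym e′))) (by≤ (min m (in′ m (<⇒≤ p) (<⇒≤ q))) (solve 2 (λ a b → a :+ (:- :1) :* a := b :+ (:- :1) :* b) refl _ _))) (der m (<⇒≤ p) (<⇒≤ q))
        where
        m : ℝ
        m = a + ½ * (b - a)
        p : a < m
        p = by< (½-pos (sub>0 a<b)) (solve 3 (λ a b c → a :+ b :* (c :- a) := a :+ b :* (c :- a) :+ :0) refl _ _ _)
        q : m < b
        q = by< (½-< (sub>0 a<b)) (solve 3 (λ a b c → a :+ b :* (c :- a) :+ (c :- a) := c :+ b :* (c :- a)) refl _ _ _)

  opaque
    mean-value : ∀ {F F′ : ℝ → ℝ} {a b} → a < b → (∀ x → a ≤ x → x ≤ b → Der F x (F′ x)) → ∃ λ ξ → a ≤ ξ × ξ ≤ b × F b - F a ≈ F′ ξ * (b - a)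
    mean-value {F} {F′} {a} {b} a<b der = from (rolle {G} {λ x → (b - a) * F′ x + - (F b - F a) * 1#} a<b
        (λ x p q → der-+ {λ x → (b - a) * F x} (der-* {F} (b - a) (der x p q)) (der-* {λ y → y} (- (F b - F a)) (der-id x))) (solve 4 (λ a b c d → (a :- b) :* c :+ (:- (d :- c)) :* b := (a :- b) :* d :+ (:- (d :- c)) :* a) refl _ _ _ _))
      where
      G : ℝ → ℝ
      G x = (b - a) * F x + - (F b - F a) * x
      from : (∃ λ ξ → a ≤ ξ × ξ ≤ b × (b - a) * F′ ξ + - (F b - F a) * 1# ≈ 0#) → ∃ λ ξ → a ≤ ξ × ξ ≤ b × F b - F a ≈ F′ ξ * (b - a)
      from (ξ , p , q , e) = ξ , p , q , by≈ (sym e) (solve 5 (λ a b c d e → a :- b :+ ((c :- d) :* e :+ (:- (a :- b)) :* :1) := e :* (c :- d) :+ :0) refl _ _ _ _ _)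

  opaque
    lipschitz : ∀ {F F′ : ℝ → ℝ} {a b K} → (∀ x → a ≤ x → x ≤ b → Der F x (F′ x)) → (∀ x → a ≤ x → x ≤ b → ∣ F′ x ∣ ≤ K) →
      ∀ {x y} → a ≤ x → x ≤ b → a ≤ y → y ≤ b → ∣ F y - F x ∣ ≤ K * ∣ y - x ∣
    lipschitz {F} {F′} {a} {b} {K} der bound {x} {y} a≤x x≤b a≤y y≤b with ≤⊎> x y
    ... | inj₂ y<x = ≈≤ (∣∣-sub (F y) (F x)) (≤≈ (forward y<x a≤y x≤b) (*-congˡ (∣∣-sub x y)))
      where
      forward : ∀ {x y} → x < y → a ≤ x → y ≤ b → ∣ F y - F x ∣ ≤ K * ∣ y - x ∣
      forward {x} {y} x<y a≤x y≤b = from (mean-value {F} {F′} x<y (λ z p q → der z (≤-trans a≤x p) (≤-trans q y≤b)))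
        where
        from : (∃ λ ξ → x ≤ ξ × ξ ≤ y × F y - F x ≈ F′ ξ * (y - x)) → ∣ F y - F x ∣ ≤ K * ∣ y - x ∣
        from (ξ , p , q , e) = ≈≤ (trans (∣∣-cong e) (∣∣-* _ _)) (*-monoʳ _ (∣∣≥0 _) (bound ξ (≤-trans a≤x p) (≤-trans q y≤b)))
    ... | inj₁ x≤y with ≤⊎> y x
    ... | inj₂ x<y = from (mean-value {F} {F′} x<y (λ z p q → der z (≤-trans a≤x p) (≤-trans q y≤b)))
      where
      from : (∃ λ ξ → x ≤ ξ × ξ ≤ y × F y - F x ≈ F′ ξ * (y - x)) → ∣ F y - F x ∣ ≤ K * ∣ y - x ∣
      from (ξ , p , q , e) = ≈≤ (trans (∣∣-cong e) (∣∣-* _ _)) (*-monoʳ _ (∣∣≥0 _) (bound ξ (≤-trans a≤x p) (≤-trans q y≤b)))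
    -- Here x ≈ y and no interval is left for the mean value theorem; the estimate in `Der` gives F
    -- x ≈ F y.
    ... | inj₁ y≤x = from (Der.at (der x a≤x x≤b) 1# 0<1)
      where
      ∣y-x∣≈0 : ∣ y - x ∣ ≈ 0#
      ∣y-x∣≈0 = trans (∣∣-cong (trans (+-congʳ (≤-antisym y≤x x≤y)) (solve 1 (λ a → a :- a := :0) refl _))) ∣0∣
      from : (∃ λ δ → 0# < δ × (∀ z → ∣ z - x ∣ < δ → ∣ F z - F x - F′ x * (z - x) ∣ ≤ 1# * ∣ z - x ∣)) → ∣ F y - F x ∣ ≤ K * ∣ y - x ∣
      from (δ , 0<δ , h) = ≤-trans (≈≤ (∣∣-cong (solve 5 (λ a b c d e → a :- b := a :- b :- c :* (d :- e) :+ c :* (d :- e)) refl _ _ _ _ _)) (∣∣-+ (F y - F x - F′ x * (y - x)) (F′ x * (y - x))))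
        (≤≈ (h y (≤-<-trans (≤-reflexive ∣y-x∣≈0) 0<δ) ⊞ ≤-reflexive (∣∣-* (F′ x) (y - x)))
          (trans (+-cong (*-congˡ ∣y-x∣≈0) (*-congˡ ∣y-x∣≈0)) (trans (solve 1 (λ a → :1 :* :0 :+ a :* :0 := :0) refl _) (trans (sym (zeroʳ K)) (*-congˡ (sym ∣y-x∣≈0))))))

-- Null sets and dyadic covering proportions

module NullSets (em : ExcludedMiddle 0ℓ) (reals : CompleteOrderedField) where

  open Analysis em reals hiding (zero; ∣_∣; ContinuousAt)
  open OrderedField em reals
  open Numbers em reals
  open Calculus em reals
  open IntegerSolver commutativeRing
  open SetoidReasoning setoid

  partial : (ℕ → ℝ) → ℕ → ℝ
  partial x N = sum {N} (λ k → x (toℕ k))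

  opaque
    partial≥0 : ∀ {x} N → (∀ n → 0# ≤ x n) → 0# ≤ partial x N
    partial≥0 {x} N h = sum≥0 {N} {λ k → x (toℕ k)} (λ k → h (toℕ k))

  opaque
    partial-suc : ∀ {x} N → (∀ n → 0# ≤ x n) → partial x N ≤ partial x (suc N)
    partial-suc {x} zero h = partial≥0 {x} 1 h
    partial-suc {x} (suc N) h = ≤-refl ⊞ partial-suc {x ∘ suc} N (h ∘ suc)

  interleave : {A : Set} → (ℕ → A) → (ℕ → A) → ℕ → A
  interleave x y zero    = x zero
  interleave x y (suc n) = interleave y (x ∘ suc) n

  opaque
    interleave-left : ∀ k → ∃ λ n → ∀ {A : Set} (x y : ℕ → A) → interleave x y n ≡ x k
    interleave-right : ∀ k → ∃ λ n → ∀ {A : Set} (x y : ℕ → A) → interleave x y n ≡ y k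
    interleave-left zero    = zero , λ x y → ≡.refl
    interleave-left (suc k) = suc (proj₁ (interleave-right k)) , λ x y → proj₂ (interleave-right k) y (x ∘ suc)
    interleave-right k      = suc (proj₁ (interleave-left k)) , λ x y → proj₂ (interleave-left k) y (x ∘ suc)

  opaque
    interleave-cong : ∀ {A : Set} {x x′ y y′ : ℕ → A} n → (∀ m → m ℕ.≤ n → x m ≡ x′ m) → (∀ m → m ℕ.< n → y m ≡ y′ m) →
      interleave x y n ≡ interleave x′ y′ n
    interleave-cong zero    h k = h zero z≤n
    interleave-cong (suc n) h k = interleave-cong n (λ m p → k m (s≤s p)) (λ m p → h (suc m) (ℕ.≤-trans p (ℕ.n≤1+n n)))

  opaque
    partial-interleave : ∀ {A : Set} (f : A → ℝ) → (∀ a → 0# ≤ f a) → ∀ (x y : ℕ → A) N →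
      partial (f ∘ interleave x y) N ≤ partial (f ∘ x) N + partial (f ∘ y) N
    partial-interleave f f≥0 x y zero = by≤ (≤-refl {0#}) (solve 0 (:0 :+ :0 := :0 :+ :0 :+ :0) refl)
    partial-interleave f f≥0 x y (suc N) =
      by≤ (partial-interleave f f≥0 y (x ∘ suc) N ⊞ partial-suc {f ∘ y} N (λ n → f≥0 (y n))) (solve 6 (λ a b c d e f → a :+ b :+ (c :+ d :+ (e :+ f)) := a :+ d :+ (e :+ f) :+ (b :+ c)) refl _ _ _ _ _ _)

  record Interval : Set where
    constructor interval
    field
      lo hi : ℝ
      lo≤hi : lo ≤ hi

    length : ℝ
    length = hi - lo
  open Interval

  opaque
    length≥0 : ∀ I → 0# ≤ length I
    length≥0 I = sub≥0 (lo≤hi I)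

  degenerate : Interval
  degenerate = interval 0# 0# ≤-refl

  record Cover (E : Pred ℝ 0ℓ) (t : ℝ) : Set where
    constructor cover
    field
      intervals : ℕ → Interval
      covers    : ∀ x → E x → ∃ λ k → lo (intervals k) < x × x < hi (intervals k)
      total     : ∀ N → partial (length ∘ intervals) N ≤ t

  opaque
    Null⇒Cover : ∀ {E} → Null E → ∀ ε → 0# < ε → Cover E ε
    Null⇒Cover {E} null ε 0<ε = from (null ε 0<ε)
      where
      from : (∃ λ (a : ℕ → ℝ) → ∃ λ (b : ℕ → ℝ) → (∀ k → a k ≤ b k) × (∀ x → E x → ∃ λ k → a k < x × x < b k) ×
        (∀ N → sum {N} (λ k → b (toℕ k) - a (toℕ k)) ≤ ε)) → Cover E ε
      from (a , b , p , q , r) = cover (λ k → interval (a k) (b k) (p k)) q r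

  opaque
    Cover⇒Null : ∀ {E} → (∀ ε → 0# < ε → Cover E ε) → Null E
    Cover⇒Null {E} h ε 0<ε = from (h ε 0<ε)
      where
      from : Cover E ε → ∃ λ (a : ℕ → ℝ) → ∃ λ (b : ℕ → ℝ) → (∀ k → a k ≤ b k) × (∀ x → E x → ∃ λ k → a k < x × x < b k) ×
        (∀ N → sum {N} (λ k → b (toℕ k) - a (toℕ k)) ≤ ε)
      from (cover I c t) = lo ∘ I , hi ∘ I , (λ k → lo≤hi (I k)) , c , t

  opaque
    Cover-mono : ∀ {E F s t} → (∀ x → E x → F x) → s ≤ t → Cover F s → Cover E t
    Cover-mono sub s≤t (cover I c t) = cover I (λ x x∈ → c x (sub x x∈)) (λ N → ≤-trans (t N) s≤t)

  opaque
    Null-⊆ : ∀ {E F} → (∀ x → E x → F x) → Null F → Null E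
    Null-⊆ {E} {F} sub null = Cover⇒Null λ ε 0<ε → Cover-mono {E} {F} sub ≤-refl (Null⇒Cover null ε 0<ε)

  opaque
    Cover-∪ : ∀ {E F s t} → Cover E s → Cover F t → Cover (λ x → E x ⊎ F x) (s + t)
    Cover-∪ {E} {F} (cover I c t) (cover J d u) = cover (interleave I J)
        (λ { x (inj₁ p) → inI (c x p) ; x (inj₂ q) → inJ (d x q) })
        (λ N → ≤-trans (partial-interleave length length≥0 I J N) (t N ⊞ u N))
      where
      inI : ∀ {x} → (∃ λ k → lo (I k) < x × x < hi (I k)) → ∃ λ k → lo (interleave I J k) < x × x < hi (interleave I J k)
      inI {x} (k , p) = proj₁ (interleave-left k) , ≡.subst (λ K → lo K < x × x < hi K) (≡.sym (proj₂ (interleave-left k) I J)) p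
      inJ : ∀ {x} → (∃ λ k → lo (J k) < x × x < hi (J k)) → ∃ λ k → lo (interleave I J k) < x × x < hi (interleave I J k)
      inJ {x} (k , p) = proj₁ (interleave-right k) , ≡.subst (λ K → lo K < x × x < hi K) (≡.sym (proj₂ (interleave-right k) I J)) p

  -- merge enumerates all a i k; the fuel only makes the recursion structural.
  merge : (ℕ → ℕ → Interval) → ℕ → ℕ → ℕ → Interval
  merge a zero    i n = degenerate
  merge a (suc f) i   = interleave (a i) (merge a f (suc i))

  opaque
    -- Position n of an interleaving depends only on the positions below n of its second argument,
    -- so one unit of fuel per position suffices. The diagonal sequence `z` of `Null-⋃` therefore
    -- agrees with a single merge up to any bound.
    merge-stable : ∀ a f g i n → n ℕ.< f → n ℕ.< g → merge a f i n ≡ merge a g i n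
    merge-stable a (suc f) (suc g) i n (s≤s p) (s≤s q) = interleave-cong n (λ _ _ → ≡.refl)
      (λ m r → merge-stable a f g (suc i) m (ℕ.<-≤-trans r p) (ℕ.<-≤-trans r q))

  opaque
    merge-hits : ∀ j k → ∃ λ n → ∀ a f i → merge a (suc j ℕ.+ f) i n ≡ a (j ℕ.+ i) k
    merge-hits zero    k = proj₁ (interleave-left k) , λ a f i → proj₂ (interleave-left k) (a i) (merge a f (suc i))
    merge-hits (suc j) k = from (merge-hits j k)
      where
      from : (∃ λ n → ∀ a f i → merge a (suc j ℕ.+ f) i n ≡ a (j ℕ.+ i) k) → ∃ λ n → ∀ a f i → merge a (suc (suc j) ℕ.+ f) i n ≡ a (suc j ℕ.+ i) k
      from (n , h) = proj₁ (interleave-right n) , λ a f i → ≡.trans (proj₂ (interleave-right n) (a i) (merge a (suc j ℕ.+ f) (suc i)))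
        (≡.trans (h a f (suc i)) (≡.cong (λ l → a l k) (ℕ.+-suc j i)))

  opaque
    -- The sequence i contributes 2^-(i + 1) ε and the later ones again as much, which adds up to
    -- 2^-i ε.
    merge-total : ∀ a {ε} → 0# ≤ ε → (∀ i N → partial (length ∘ a i) N ≤ h2 (suc i) * ε) → ∀ f i N → partial (length ∘ merge a f i) N ≤ h2 i * ε
    merge-total a {ε} 0≤ε h zero i N = ≈≤ (sum-0 {N} λ _ → -‿inverseʳ 0#) (*-nonNeg (<⇒≤ (h2>0 i)) 0≤ε)
    merge-total a {ε} 0≤ε h (suc f) i N = ≤-trans (partial-interleave length length≥0 (a i) (merge a f (suc i)) N)
      (≤≈ (h i N ⊞ merge-total a 0≤ε h f (suc i) N) (trans (solve 3 (λ a b c → a :* b :* c :+ a :* b :* c := (a :* b :+ a :* b) :* c) refl _ _ _) (*-congʳ (½-eq (h2 i)))))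

  opaque
    Null-⋃ : ∀ {E : ℕ → Pred ℝ 0ℓ} → (∀ i → Null (E i)) → Null (λ x → ∃ λ i → E i x)
    Null-⋃ {E} null = Cover⇒Null λ ε 0<ε → union ε 0<ε (λ i → Null⇒Cover (null i) (h2 (suc i) * ε) (pos* (h2>0 (suc i)) 0<ε))
      where
      union : ∀ ε → 0# < ε → (∀ i → Cover (E i) (h2 (suc i) * ε)) → Cover (λ x → ∃ λ i → E i x) ε
      union ε 0<ε c = cover z covers total
        where
        a : ℕ → ℕ → Interval
        a i = Cover.intervals (c i)
        z : ℕ → Interval
        z n = merge a (suc n) 0 n
        z≡ : ∀ n f → n ℕ.< f → z n ≡ merge a f 0 n
        z≡ n f p = merge-stable a (suc n) f 0 n ℕ.≤-refl p
        covers : ∀ x → (∃ λ i → E i x) → ∃ λ k → lo (z k) < x × x < hi (z k)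
        covers x (i , x∈) = from (Cover.covers (c i) x x∈)
          where
          from : (∃ λ k → lo (a i k) < x × x < hi (a i k)) → ∃ λ k → lo (z k) < x × x < hi (z k)
          from (k , p) = from′ (merge-hits i k)
            where
            from′ : (∃ λ n → ∀ a f j → merge a (suc i ℕ.+ f) j n ≡ a (i ℕ.+ j) k) → ∃ λ k → lo (z k) < x × x < hi (z k)
            from′ (n , h) = n , ≡.subst (λ K → lo K < x × x < hi K) (≡.sym (≡.trans (z≡ n (suc i ℕ.+ n) (s≤s (ℕ.m≤n+m n i)))
              (≡.trans (h a n 0) (≡.cong (λ j → a j k) (ℕ.+-identityʳ i))))) p
        total : ∀ N → partial (length ∘ z) N ≤ ε
        total N = ≈≤ (sum-cong {N} (λ k → reflexive (≡.cong length (z≡ (toℕ k) N (Fin.toℕ<n k)))))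
          (≤≈ (merge-total a (<⇒≤ 0<ε) (λ i N → Cover.total (c i) N) N 0 N) (*-identityˡ ε))

  opaque
    Null-∅ : ∀ {E} → (∀ x → ¬ E x) → Null E
    Null-∅ h = Cover⇒Null λ ε 0<ε → cover (λ _ → degenerate) (λ x p → ⊥-elim (h x p))
      (λ N → ≈≤ (sum-0 {N} λ _ → -‿inverseʳ 0#) (<⇒≤ 0<ε))

  opaque
    Null-∪ : ∀ {E F} → Null E → Null F → Null (λ x → E x ⊎ F x)
    Null-∪ {E} {F} e f = Null-⊆ (λ { x (inj₁ p) → 0 , p ; x (inj₂ q) → 1 , q }) (Null-⋃ {both} null)
      where
      both : ℕ → Pred ℝ 0ℓ
      both zero    = E
      both (suc _) = F
      null : ∀ i → Null (both i)
      null zero    = e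
      null (suc _) = f

  data Sub : ℝ → ℝ → ℕ → ℝ → ℝ → Set where
    here  : ∀ {u ℓ} → Sub u ℓ 0 u ℓ
    left  : ∀ {u ℓ d v m} → Sub u (½ * ℓ) d v m → Sub u ℓ (suc d) v m
    right : ∀ {u ℓ d v m} → Sub (u + ½ * ℓ) (½ * ℓ) d v m → Sub u ℓ (suc d) v m

  opaque
    Sub-width : ∀ {u ℓ d v m} → Sub u ℓ d v m → m ≈ h2 d * ℓ
    Sub-width here = (solve 1 (λ a → a := :1 :* a) refl _)
    Sub-width (left s)  = trans (Sub-width s) (solve 3 (λ a b c → a :* (b :* c) := b :* a :* c) refl _ _ _)
    Sub-width (right s) = trans (Sub-width s) (solve 3 (λ a b c → a :* (b :* c) := b :* a :* c) refl _ _ _)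

  opaque
    Sub-≤ : ∀ {u ℓ d v m} → 0# ≤ ℓ → Sub u ℓ d v m → 0# ≤ m × u ≤ v × v + m ≤ u + ℓ
    Sub-≤ 0≤ℓ here = 0≤ℓ , ≤-refl , ≤-refl
    Sub-≤ {u} 0≤ℓ (left s) with Sub-≤ (half≥0 0≤ℓ) s
    ... | p , q , r = p , q , ≤-trans r (left≤ u 0≤ℓ)
    Sub-≤ {u} {ℓ} 0≤ℓ (right s) with Sub-≤ (half≥0 0≤ℓ) s
    ... | p , q , r = p , ≤-trans (by≤ (half≥0 0≤ℓ) (solve 3 (λ a b c → a :+ b :* c := a :+ b :* c :+ :0) refl _ _ _)) q , ≤≈ r (right≈ u ℓ)

  opaque
    Sub-In : ∀ {u ℓ d v m x} → 0# ≤ ℓ → Sub u ℓ d v m → In v m x → In u ℓ x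
    Sub-In 0≤ℓ s (p , q) with Sub-≤ 0≤ℓ s
    ... | _ , r , t = ≤-trans r p , ≤-trans q t

  -- Cov A u ℓ p: dyadic subcells of total proportion at most p cover A in [u, u + ℓ].
  data Cov (A : Pred ℝ 0ℓ) : ℝ → ℝ → ℝ → Set where
    all   : ∀ {u ℓ p} → 1# ≤ p → Cov A u ℓ p
    none  : ∀ {u ℓ p} → 0# ≤ p → (∀ x → In u ℓ x → ¬ A x) → Cov A u ℓ p
    split : ∀ {u ℓ p p₀ p₁} → Cov A u (½ * ℓ) p₀ → Cov A (u + ½ * ℓ) (½ * ℓ) p₁ → p₀ + p₁ ≤ p + p → Cov A u ℓ p

  opaque
    Cov-mono : ∀ {A B u ℓ p q} → 0# ≤ ℓ → (∀ x → In u ℓ x → A x → B x) → p ≤ q → Cov B u ℓ p → Cov A u ℓ q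
    Cov-mono 0≤ℓ sub p≤q (all r) = all (≤-trans r p≤q)
    Cov-mono 0≤ℓ sub p≤q (none r h) = none (≤-trans r p≤q) (λ x x∈ a → h x x∈ (sub x x∈ a))
    Cov-mono {A} {B} 0≤ℓ sub p≤q (split c d r) = split
      (Cov-mono {A} {B} (half≥0 0≤ℓ) (λ x x∈ → sub x (In-left 0≤ℓ x∈)) ≤-refl c)
      (Cov-mono {A} {B} (half≥0 0≤ℓ) (λ x x∈ → sub x (In-right 0≤ℓ x∈)) ≤-refl d) (≤-trans r (p≤q ⊞ p≤q))

  opaque
    halve≤ : ∀ {x y} → x + x ≤ y + y → x ≤ y
    halve≤ p = *-cancelʳ-≤ 2# 0<2 (by≤ p (solve 2 (λ a b → a :* (:1 :+ :1) :+ (b :+ b) := b :* (:1 :+ :1) :+ (a :+ a)) refl _ _))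

  opaque
    Cov≥0 : ∀ {A u ℓ p} → Cov A u ℓ p → 0# ≤ p
    Cov≥0 (all r) = ≤-trans 0≤1 r
    Cov≥0 (none r _) = r
    Cov≥0 {A} (split c d r) = halve≤ (≤-trans (≤≈ (Cov≥0 {A} c ⊞ Cov≥0 {A} d) refl) r)

  opaque
    Cov-full : ∀ {A u ℓ p} → 0# ≤ ℓ → (∀ x → In u ℓ x → A x) → Cov A u ℓ p → 1# ≤ p
    Cov-full 0≤ℓ h (all r) = r
    Cov-full {A} {u} 0≤ℓ h (none r k) = ⊥-elim (k u (≤-refl , by≤ 0≤ℓ (solve 2 (λ a b → a :+ b := a :+ b :+ :0) refl _ _)) (h u (≤-refl , by≤ 0≤ℓ (solve 2 (λ a b → a :+ b := a :+ b :+ :0) refl _ _))))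
    Cov-full {A} 0≤ℓ h (split c d r) = halve≤ (≤-trans
      (Cov-full {A} (half≥0 0≤ℓ) (λ x x∈ → h x (In-left 0≤ℓ x∈)) c ⊞ Cov-full {A} (half≥0 0≤ℓ) (λ x x∈ → h x (In-right 0≤ℓ x∈)) d) r)

  opaque
    -- Outside the given subcell nothing is gained: the siblings along its path are covered
    -- entirely. The uncovered share 1 - w is thus scaled by 2^-d.
    Sub⇒Cov : ∀ {A u ℓ d v m w} → Sub u ℓ d v m → w ≤ 1# → Cov A v m w → Cov A u ℓ (1# - h2 d * (1# - w))
    Sub⇒Cov {A} {u} {ℓ} here w≤1 c = Cov-step c
      where
      Cov-step : ∀ {w} → Cov A u ℓ w → Cov A u ℓ (1# - 1# * (1# - w))
      Cov-step (all r) = all (≤≈ r (solve 1 (λ a → a := :1 :- :1 :* (:1 :- a)) refl _))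
      Cov-step (none r h) = none (≤≈ r (solve 1 (λ a → a := :1 :- :1 :* (:1 :- a)) refl _)) h
      Cov-step (split c d r) = split c d (≤≈ r (solve 1 (λ a → a :+ a := :1 :- :1 :* (:1 :- a) :+ (:1 :- :1 :* (:1 :- a))) refl _))
    Sub⇒Cov {A} {d = suc d} {w = w} (left s) w≤1 c = split (Sub⇒Cov {A} s w≤1 c) (all {p = 1#} ≤-refl)
      (≤-reflexive (trans (+-congʳ (+-congˡ (-‿cong (*-congʳ (sym (½-eq (h2 d))))))) (solve 3 (λ a b c → :1 :- (a :* b :+ a :* b) :* (:1 :- c) :+ :1 := :1 :- a :* b :* (:1 :- c) :+ (:1 :- a :* b :* (:1 :- c))) refl _ _ _)))
    Sub⇒Cov {A} {d = suc d} {w = w} (right s) w≤1 c = split (all {p = 1#} ≤-refl) (Sub⇒Cov {A} s w≤1 c)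
      (≤-reflexive (trans (+-congˡ (+-congˡ (-‿cong (*-congʳ (sym (½-eq (h2 d))))))) (solve 3 (λ a b c → :1 :+ (:1 :- (a :* b :+ a :* b) :* (:1 :- c)) := :1 :- a :* b :* (:1 :- c) :+ (:1 :- a :* b :* (:1 :- c))) refl _ _ _)))

  -- A cell that is not covered by A contains a point outside A, whence the second hypothesis applies to it.
  opaque
    Cov-replace : ∀ {A E θ} d {u ℓ p} → 0# ≤ ℓ → 0# ≤ θ → θ ≤ 1# → Cov A u ℓ p →
      (∀ {v m} → Sub u ℓ d v m → (∃ λ x → In v m x × ¬ A x) → Cov E v m θ) → Cov E u ℓ (p + (1# - p) * θ)
    Cov-replace {A} {E} {θ} zero {u} {ℓ} {p} 0≤ℓ 0≤θ θ≤1 c h with lem (∃ λ x → In u ℓ x × ¬ A x)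
    ... | inj₁ q = Cov-mono {E} {E} 0≤ℓ (λ _ _ e → e) (by≤ (*-nonNeg (Cov≥0 {A} c) (sub≥0 θ≤1)) (solve 2 (λ a b → a :+ b :* (:1 :- a) := b :+ (:1 :- b) :* a :+ :0) refl _ _)) (h here q)
    ... | inj₂ q = all (by≤ (*-nonNeg (sub≥0 (Cov-full {A} 0≤ℓ (λ x x∈ → by-contradiction λ ¬a → q (x , x∈ , ¬a)) c)) (sub≥0 θ≤1)) (solve 2 (λ a b → :1 :+ (a :- :1) :* (:1 :- b) := a :+ (:1 :- a) :* b :+ :0) refl _ _))
    Cov-replace (suc d) {u} {ℓ} {p} 0≤ℓ 0≤θ θ≤1 (all r) h = all (by≤ (*-nonNeg (sub≥0 r) (sub≥0 θ≤1)) (solve 2 (λ a b → :1 :+ (a :- :1) :* (:1 :- b) := a :+ (:1 :- a) :* b :+ :0) refl _ _))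
    Cov-replace {A} {E} {θ} (suc d) {u} {ℓ} {p} 0≤ℓ 0≤θ θ≤1 (none r k) h = split
      (Cov-replace {A} {E} d (half≥0 0≤ℓ) 0≤θ θ≤1 (none {p = p} r λ x x∈ → k x (In-left 0≤ℓ x∈)) (λ s → h (left s)))
      (Cov-replace {A} {E} d (half≥0 0≤ℓ) 0≤θ θ≤1 (none {p = p} r λ x x∈ → k x (In-right 0≤ℓ x∈)) (λ s → h (right s))) ≤-refl
    Cov-replace {A} {E} {θ} (suc d) {u} {ℓ} {p} 0≤ℓ 0≤θ θ≤1 (split {p₀ = p₀} {p₁ = p₁} c₀ c₁ r) h = split
      (Cov-replace {A} {E} d (half≥0 0≤ℓ) 0≤θ θ≤1 c₀ (λ s → h (left s)))
      (Cov-replace {A} {E} d (half≥0 0≤ℓ) 0≤θ θ≤1 c₁ (λ s → h (right s)))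
      (by≤ (*-nonNeg (sub≥0 r) (sub≥0 θ≤1)) (solve 4 (λ a b c d → a :+ (:1 :- a) :* b :+ (c :+ (:1 :- c) :* b) :+ (d :+ d :- (a :+ c)) :* (:1 :- b) := d :+ (:1 :- d) :* b :+ (d :+ (:1 :- d) :* b) :+ :0) refl _ _ _ _))

  opaque
    -- The factor 3 arises because covers consist of open intervals: a closed cell is placed inside
    -- (u - ℓ, u + 2ℓ).
    Cov⇒Cover : ∀ {A u ℓ p} → 0# < ℓ → Cov A u ℓ p → Cover (λ x → In u ℓ x × A x) ((1# + 2#) * (p * ℓ))
    Cov⇒Cover {A} {u} {ℓ} {p} 0<ℓ (all r) = cover I
        (λ { x ((q , s) , _) → 0 , <-≤-trans (by< 0<ℓ (solve 2 (λ a b → a :- b :+ b := a :+ :0) refl _ _)) q , ≤-<-trans s (by< 0<ℓ (solve 2 (λ a b → a :+ b :+ b := a :+ b :+ b :+ :0) refl _ _)) }) total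
      where
      I : ℕ → Interval
      I zero    = interval (u - ℓ) (u + ℓ + ℓ) (by≤ (<⇒≤ 0<ℓ ⊞ <⇒≤ 0<ℓ ⊞ <⇒≤ 0<ℓ) (solve 2 (λ a b → a :- b :+ (b :+ b :+ b) := a :+ b :+ b :+ (:0 :+ :0 :+ :0)) refl _ _))
      I (suc _) = degenerate
      pℓ : 0# ≤ (p - 1#) * ℓ
      pℓ = *-nonNeg (sub≥0 r) (<⇒≤ 0<ℓ)
      total : ∀ N → partial (length ∘ I) N ≤ (1# + 2#) * (p * ℓ)
      total zero    = by≤ (pℓ ⊞ pℓ ⊞ pℓ ⊞ <⇒≤ 0<ℓ ⊞ <⇒≤ 0<ℓ ⊞ <⇒≤ 0<ℓ) (solve 2 (λ a b → :0 :+ ((a :- :1) :* b :+ (a :- :1) :* b :+ (a :- :1) :* b :+ b :+ b :+ b) := (:1 :+ (:1 :+ :1)) :* (a :* b) :+ (:0 :+ :0 :+ :0 :+ :0 :+ :0 :+ :0)) refl _ _)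
      total (suc N) = ≈≤ (+-congˡ (sum-0 {N} λ _ → -‿inverseʳ 0#)) (by≤ (pℓ ⊞ pℓ ⊞ pℓ) (solve 3 (λ a b c → a :+ b :+ b :- (a :- b) :+ :0 :+ ((c :- :1) :* b :+ (c :- :1) :* b :+ (c :- :1) :* b) := (:1 :+ (:1 :+ :1)) :* (c :* b) :+ (:0 :+ :0 :+ :0)) refl _ _ _))
    Cov⇒Cover {A} 0<ℓ (none r h) = cover (λ _ → degenerate) (λ { x (x∈ , a) → ⊥-elim (h x x∈ a) })
      (λ N → ≈≤ (sum-0 {N} λ _ → -‿inverseʳ 0#) (*-nonNeg (nn+ 0≤1 (<⇒≤ 0<2)) (*-nonNeg r (<⇒≤ 0<ℓ))))
    Cov⇒Cover {A} {u} {ℓ} {p} 0<ℓ (split {p₀ = p₀} {p₁ = p₁} c d r) = Cover-mono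
      (λ { x (x∈ , a) → side x a (In-split x∈) })
      (by≤ (*-monoʳ (½ * ℓ) (half≥0 (<⇒≤ 0<ℓ)) r ⊞ *-monoʳ (½ * ℓ) (half≥0 (<⇒≤ 0<ℓ)) r ⊞ *-monoʳ (½ * ℓ) (half≥0 (<⇒≤ 0<ℓ)) r
          ⊞ ≤-reflexive 3pℓ)
        (solve 5 (λ a b c d e → (:1 :+ (:1 :+ :1)) :* (a :* (b :* c)) :+ (:1 :+ (:1 :+ :1)) :* (d :* (b :* c)) :+ ((e :+ e) :* (b :* c) :+ (e :+ e) :* (b :* c) :+ (e :+ e) :* (b :* c) :+ (:1 :+ (:1 :+ :1)) :* (e :* c)) := (:1 :+ (:1 :+ :1)) :* (e :* c) :+ ((a :+ d) :* (b :* c) :+ (a :+ d) :* (b :* c) :+ (a :+ d) :* (b :* c) :+ (:1 :+ (:1 :+ :1)) :* (e :* (b :* c :+ b :* c)))) refl _ _ _ _ _))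
      (Cover-∪ (Cov⇒Cover {A} (½-pos 0<ℓ) c) (Cov⇒Cover {A} (½-pos 0<ℓ) d))
      where
      3pℓ : (1# + 2#) * (p * (½ * ℓ + ½ * ℓ)) ≈ (1# + 2#) * (p * ℓ)
      3pℓ = *-congˡ (*-congˡ (½-eq ℓ))
      side : ∀ x → A x → In u (½ * ℓ) x ⊎ In (u + ½ * ℓ) (½ * ℓ) x → (In u (½ * ℓ) x × A x) ⊎ (In (u + ½ * ℓ) (½ * ℓ) x × A x)
      side x a (inj₁ q) = inj₁ (q , a)
      side x a (inj₂ q) = inj₂ (q , a)

  opaque
    powers-vanish : ∀ {θ η} → 0# ≤ θ → θ < 1# → 0# < η → ∃ λ k → θ ^ k < η
    powers-vanish {θ} {η} 0≤θ θ<1 0<η = from (archimedean (inv 0<tη))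
      where
      t : ℝ
      t = 1# - θ
      0<tη : 0# < t * η
      0<tη = pos* (sub>0 θ<1) 0<η
      bernoulli : ∀ k → θ ^ k * (1# + fromℕ k * t) ≤ 1#
      bernoulli zero = ≤-reflexive (solve 1 (λ a → :1 :* (:1 :+ :0 :* (:1 :- a)) := :1) refl _)
      bernoulli (suc k) = ≤-trans (by≤ (*-nonNeg (*-nonNeg (^-nn k 0≤θ) (fromℕ≥0 (suc k))) (sq≥0 t)) (solve 3 (λ a b c → a :* b :* (:1 :+ (:1 :+ c) :* (:1 :- a)) :+ b :* (:1 :+ c) :* ((:1 :- a) :* (:1 :- a)) := b :* (:1 :+ c :* (:1 :- a)) :+ :0) refl _ _ _)) (bernoulli k)
      from : (∃ λ k → inv 0<tη < fromℕ k) → ∃ λ k → θ ^ k < η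
      from (k , p) = k , *-cancelʳ-< (1# + fromℕ k * t) (nn+ 0≤1 (*-nonNeg (fromℕ≥0 k) (sub≥0 (<⇒≤ θ<1))))
          (≤-<-trans (bernoulli k) (by< (*-monoʳ-< 0<tη p <⊞ <⇒≤ 0<η) (trans (+-congˡ refl) (trans (solve 3 (λ a b c → :1 :+ (a :* ((:1 :- b) :* c) :+ c) := c :* (:1 :+ a :* (:1 :- b)) :+ (:1 :+ :0)) refl _ _ _) (+-congˡ (+-congʳ (sym (trans (*-comm _ _) (inv-eq 0<tη)))))))))

  opaque
    -- A substitute for the Lebesgue density theorem that asks nothing of A: replacing each cell of
    -- a covering by its own covering of proportion θ multiplies the total proportion by θ, and k
    -- rounds give θ^k.
    thin⇒Null : ∀ {A u ℓ θ} → 0# < ℓ → 0# ≤ θ → θ < 1# → (∀ {d v m} → Sub u ℓ d v m → Cov A v m θ) → Null (λ x → In u ℓ x × A x)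
    thin⇒Null {A} {u} {ℓ} {θ} 0<ℓ 0≤θ θ<1 thin = Cover⇒Null λ ε 0<ε → from ε (powers-vanish 0≤θ θ<1 (pos* 0<ε (inv>0 0<3ℓ)))
      where
      0<3ℓ : 0# < (1# + 2#) * ℓ
      0<3ℓ = pos* (pos+ 0<1 0<2) 0<ℓ
      refine : ∀ {v m p} → (∀ {d w k} → Sub v m d w k → Cov A w k θ) → Cov A v m p → Cov A v m (p * θ)
      refine {v} {m} {p} h (all r) = weaken (≤≈ (*-monoʳ θ 0≤θ r) refl) (h here)
        where
        weaken : ∀ {v m q} → 1# * θ ≤ q → Cov A v m θ → Cov A v m q
        weaken s (all r) = all (≤-trans r (≤-trans (≤-reflexive (solve 1 (λ a → a := :1 :* a) refl _)) s))
        weaken s (none r h) = none (≤-trans r (≤-trans (≤-reflexive (solve 1 (λ a → a := :1 :* a) refl _)) s)) h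
        weaken s (split c d r) = split c d (by≤ (r ⊞ s ⊞ s) (solve 4 (λ a b c d → a :+ b :+ (c :+ c :+ d :+ d) := d :+ d :+ (a :+ b :+ :1 :* c :+ :1 :* c)) refl _ _ _ _))
      refine h (none r k) = none (*-nonNeg r 0≤θ) k
      refine h (split c d r) = split (refine (λ s → h (left s)) c) (refine (λ s → h (right s)) d) (by≤ (*-monoʳ θ 0≤θ r) (solve 4 (λ a b c d → a :* b :+ c :* b :+ (d :+ d) :* b := d :* b :+ d :* b :+ (a :+ c) :* b) refl _ _ _ _))
      power : ∀ k → Cov A u ℓ (θ ^ k)
      power zero    = all ≤-refl
      power (suc k) = commute (refine thin (power k))
        where
        commute : Cov A u ℓ (θ ^ k * θ) → Cov A u ℓ (θ * θ ^ k)
        commute (all r) = all (≤≈ r (solve 2 (λ a b → a :* b := b :* a) refl _ _))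
        commute (none r h) = none (≤≈ r (solve 2 (λ a b → a :* b := b :* a) refl _ _)) h
        commute (split c d r) = split c d (≤≈ r (solve 2 (λ a b → a :* b :+ a :* b := b :* a :+ b :* a) refl _ _))
      from : ∀ ε → (∃ λ k → θ ^ k < ε * inv 0<3ℓ) → Cover (λ x → In u ℓ x × A x) ε
      from ε (k , p) = Cover-mono (λ _ e → e) (<⇒≤ (≤-<-trans (≤-reflexive (solve 2 (λ a b → (:1 :+ (:1 :+ :1)) :* (a :* b) := a :* ((:1 :+ (:1 :+ :1)) :* b)) refl _ _)) (<-≤-trans (*-monoʳ-< 0<3ℓ p)
        (≤-reflexive (trans (*-assoc _ _ _) (trans (*-congˡ (trans (*-comm _ _) (inv-eq 0<3ℓ))) (*-identityʳ ε))))))) (Cov⇒Cover {A} 0<ℓ (power k))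

-- Exterior algebra in coordinates

module Exterior (em : ExcludedMiddle 0ℓ) (reals : CompleteOrderedField) where

  open Analysis em reals hiding (zero; ∣_∣; ContinuousAt)
  open OrderedField em reals
  open Numbers em reals
  open IntegerSolver commutativeRing
  open SetoidReasoning setoid

  Vect : ℕ → Set
  Vect n = Fin n → ℝ

  -- Multivectors, by their coordinates: the subset J ⊆ {0, …, n - 1} stands for
  -- the wedge product of the basis vectors in J, in increasing order.
  Ext : ℕ → Set
  Ext n = Vec Bool n → ℝ

  tail : ∀ {n} → Vect (suc n) → Vect n
  tail v i = v (suc i)

  infix 4 _≐_
  _≐_ : ∀ {n} → Ext n → Ext n → Set
  ω ≐ η = ∀ J → ω J ≈ η J

  -- With e₀ the first basis vector, v = v₀ e₀ + v′ and ω = ω₀ + e₀ ∧ ω₁, the product is v′ ∧ ω₀ +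
  -- e₀ ∧ (v₀ ω₀ - v′ ∧ ω₁).
  wedge : ∀ {n} → Vect n → Ext n → Ext n
  wedge v ω []          = 0#
  wedge v ω (false ∷ J) = wedge (tail v) (λ K → ω (false ∷ K)) J
  wedge v ω (true ∷ J)  = v zero * ω (false ∷ J) - wedge (tail v) (λ K → ω (true ∷ K)) J

  unit : ∀ {n} → Ext n
  unit []          = 1#
  unit (false ∷ J) = unit J
  unit (true ∷ J)  = 0#

  wedges : ∀ {n r} → Vec (Vect n) r → Ext n
  wedges []       = unit
  wedges (v ∷ vs) = wedge v (wedges vs)

  Span : ∀ {n r} → Vec (Vect n) r → Vect n → Set
  Span []       x = ∀ i → x i ≈ 0#
  Span (v ∷ vs) x = ∃ λ c → Span vs (λ i → x i - c * v i)

  Dep : ∀ {n r} → Vec (Vect n) r → Set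
  Dep []       = ⊥
  Dep (v ∷ vs) = Span vs v ⊎ Dep vs

  data _⊑_ {n r} : ∀ {s} → Vec (Vect n) s → Vec (Vect n) r → Set where
    []  : ∀ {us} → [] ⊑ us
    _∷_ : ∀ {s v us} {vs : Vec (Vect n) s} → Span us v → vs ⊑ us → (v ∷ vs) ⊑ us

  opaque
    Span-cong : ∀ {n r} (vs : Vec (Vect n) r) {x y} → (∀ i → x i ≈ y i) → Span vs x → Span vs y
    Span-cong []       e h = λ i → trans (sym (e i)) (h i)
    Span-cong (v ∷ vs) e (c , h) = c , Span-cong vs (λ i → +-congʳ (e i)) h

  opaque
    Span-0 : ∀ {n r} (vs : Vec (Vect n) r) {x} → (∀ i → x i ≈ 0#) → Span vs x
    Span-0 []       e = e
    Span-0 (v ∷ vs) e = 0# , Span-0 vs (λ i → trans (+-congʳ (e i)) (solve 1 (λ a → :0 :- :0 :* a := :0) refl _))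

  opaque
    Span-+ : ∀ {n r} (vs : Vec (Vect n) r) {x y} c → Span vs x → Span vs y → Span vs (λ i → x i + c * y i)
    Span-+ []       c h k = λ i → trans (+-cong (h i) (*-congˡ (k i))) (solve 1 (λ a → :0 :+ a :* :0 := :0) refl _)
    Span-+ (v ∷ vs) c (a , h) (b , k) = a + c * b , Span-cong vs (λ i → (solve 6 (λ a b c d e f → a :- b :* c :+ d :* (e :- f :* c) := a :+ d :* e :- (b :+ d :* f) :* c) refl _ _ _ _ _ _)) (Span-+ vs c h k)

  opaque
    Span-there : ∀ {n r v} (vs : Vec (Vect n) r) {x} → Span vs x → Span (v ∷ vs) x
    Span-there vs h = 0# , Span-cong vs (λ i → (solve 2 (λ a b → a := a :- :0 :* b) refl _ _)) h

  opaque
    Span-here : ∀ {n r} (v : Vect n) (vs : Vec (Vect n) r) → Span (v ∷ vs) v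
    Span-here v vs = 1# , Span-0 vs (λ i → (solve 1 (λ a → a :- :1 :* a := :0) refl _))

  opaque
    Span-⊑ : ∀ {n r s} (vs : Vec (Vect n) s) {us : Vec (Vect n) r} {x} → vs ⊑ us → Span vs x → Span us x
    Span-⊑ []       {us} [] h = Span-0 us h
    Span-⊑ (v ∷ vs) {us} (p ∷ ps) (c , h) = Span-cong us (λ i → (solve 3 (λ a b c → a :- b :* c :+ b :* c := a) refl _ _ _)) (Span-+ us c (Span-⊑ vs ps h) p)

  opaque
    ⊑-trans : ∀ {n r s t} {ws : Vec (Vect n) t} {vs : Vec (Vect n) s} {us : Vec (Vect n) r} → ws ⊑ vs → vs ⊑ us → ws ⊑ us
    ⊑-trans [] q = []
    ⊑-trans {vs = vs} (p ∷ ps) q = Span-⊑ vs q p ∷ ⊑-trans ps q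

  opaque
    ⊑-there : ∀ {n r s v} {vs : Vec (Vect n) s} {us : Vec (Vect n) r} → vs ⊑ us → vs ⊑ (v ∷ us)
    ⊑-there [] = []
    ⊑-there {us = us} (p ∷ ps) = Span-there us p ∷ ⊑-there ps

  opaque
    ⊑-refl : ∀ {n r} (vs : Vec (Vect n) r) → vs ⊑ vs
    ⊑-refl []       = []
    ⊑-refl (v ∷ vs) = Span-here v vs ∷ ⊑-there (⊑-refl vs)

  opaque
    wedge-cong : ∀ {n} {u v : Vect n} {ω η} → (∀ i → u i ≈ v i) → ω ≐ η → wedge u ω ≐ wedge v η
    wedge-cong e f []          = refl
    wedge-cong e f (false ∷ J) = wedge-cong (λ i → e (suc i)) (λ K → f (false ∷ K)) J
    wedge-cong e f (true ∷ J)  = +-cong (*-cong (e zero) (f (false ∷ J))) (-‿cong (wedge-cong (λ i → e (suc i)) (λ K → f (true ∷ K)) J))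

  opaque
    wedge-linˡ : ∀ {n} (u v : Vect n) c ω J → wedge (λ i → u i + c * v i) ω J ≈ wedge u ω J + c * wedge v ω J
    wedge-linˡ u v c ω []          = (solve 1 (λ a → :0 := :0 :+ a :* :0) refl _)
    wedge-linˡ u v c ω (false ∷ J) = wedge-linˡ (tail u) (tail v) c (λ K → ω (false ∷ K)) J
    wedge-linˡ u v c ω (true ∷ J)  = trans (+-congˡ (-‿cong (wedge-linˡ (tail u) (tail v) c (λ K → ω (true ∷ K)) J))) (solve 6 (λ a b c d e f → (a :+ b :* c) :* d :- (e :+ b :* f) := a :* d :- e :+ b :* (c :* d :- f)) refl _ _ _ _ _ _)

  opaque
    wedge-linʳ : ∀ {n} (v : Vect n) a b ω η J → wedge v (λ K → a * ω K + b * η K) J ≈ a * wedge v ω J + b * wedge v η J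
    wedge-linʳ v a b ω η []          = (solve 2 (λ a b → :0 := a :* :0 :+ b :* :0) refl _ _)
    wedge-linʳ v a b ω η (false ∷ J) = wedge-linʳ (tail v) a b (λ K → ω (false ∷ K)) (λ K → η (false ∷ K)) J
    wedge-linʳ v a b ω η (true ∷ J)  = trans (+-congˡ (-‿cong (wedge-linʳ (tail v) a b (λ K → ω (true ∷ K)) (λ K → η (true ∷ K)) J))) (solve 7 (λ a b c d e f g → a :* (b :* c :+ d :* e) :- (b :* f :+ d :* g) := b :* (a :* c :- f) :+ d :* (a :* e :- g)) refl _ _ _ _ _ _ _)

  opaque
    wedge-*ʳ : ∀ {n} (v : Vect n) a ω J → wedge v (λ K → a * ω K) J ≈ a * wedge v ω J
    wedge-*ʳ v a ω J = trans (wedge-cong (λ _ → refl) (λ K → (solve 2 (λ a b → a :* b := a :* b :+ :0 :* b) refl _ _)) J) (trans (wedge-linʳ v a 0# ω ω J) (solve 2 (λ a b → a :* b :+ :0 :* b := a :* b) refl _ _))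

  opaque
    wedge-0ʳ : ∀ {n} (v : Vect n) {ω} → (∀ J → ω J ≈ 0#) → ∀ J → wedge v ω J ≈ 0#
    wedge-0ʳ v {ω} h J = trans (wedge-cong {u = v} {v = v} {ω = ω} {η = λ K → 0# * 0#} (λ _ → refl) (λ K → trans (h K) (solve 0 (:0 := :0 :* :0) refl)) J)
      (trans (wedge-*ʳ v 0# (λ _ → 0#) J) (solve 1 (λ a → :0 :* a := :0) refl _))

  opaque
    wedge-0ˡ : ∀ {n} {v : Vect n} ω → (∀ i → v i ≈ 0#) → ∀ J → wedge v ω J ≈ 0#
    wedge-0ˡ {v = v} ω h []          = refl
    wedge-0ˡ {v = v} ω h (false ∷ J) = wedge-0ˡ (λ K → ω (false ∷ K)) (λ i → h (suc i)) J
    wedge-0ˡ {v = v} ω h (true ∷ J)  = trans (+-cong (*-congʳ (h zero)) (-‿cong (wedge-0ˡ (λ K → ω (true ∷ K)) (λ i → h (suc i)) J))) (solve 1 (λ a → :0 :* a :- :0 := :0) refl _)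

  opaque
    wedge-anti : ∀ {n} (u v : Vect n) ω J → wedge u (wedge v ω) J ≈ - wedge v (wedge u ω) J
    wedge-anti u v ω []          = (solve 0 (:0 := :- :0) refl)
    wedge-anti u v ω (false ∷ J) = wedge-anti (tail u) (tail v) (λ K → ω (false ∷ K)) J
    wedge-anti {suc n} u v ω (true ∷ J) = begin
      u zero * wedge v′ ω₀ J - wedge u′ (λ K → v zero * ω₀ K - wedge v′ ω₁ K) J   ≈⟨ +-congˡ (-‿cong (expand u′ v′ (v zero))) ⟩
      u zero * wedge v′ ω₀ J - (v zero * wedge u′ ω₀ J - wedge u′ (wedge v′ ω₁) J)   ≈⟨ +-congˡ (-‿cong (+-congˡ (-‿cong (wedge-anti u′ v′ ω₁ J)))) ⟩
      u zero * wedge v′ ω₀ J - (v zero * wedge u′ ω₀ J - - wedge v′ (wedge u′ ω₁) J) ≈⟨ (solve 5 (λ a b c d e → a :* b :- (c :* d :- (:- e)) := :- (c :* d :- (a :* b :- e))) refl _ _ _ _ _) ⟩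
      - (v zero * wedge u′ ω₀ J - (u zero * wedge v′ ω₀ J - wedge v′ (wedge u′ ω₁) J)) ≈⟨ -‿cong (+-congˡ (-‿cong (sym (expand v′ u′ (u zero))))) ⟩
      - (v zero * wedge u′ ω₀ J - wedge v′ (λ K → u zero * ω₀ K - wedge u′ ω₁ K) J) ∎
      where
      u′ v′ : Vect n
      u′ = tail u
      v′ = tail v
      ω₀ ω₁ : Ext n
      ω₀ K = ω (false ∷ K)
      ω₁ K = ω (true ∷ K)
      expand : ∀ x y c → wedge x (λ K → c * ω₀ K - wedge y ω₁ K) J ≈ c * wedge x ω₀ J - wedge x (wedge y ω₁) J
      expand x y c = trans (wedge-cong (λ _ → refl) (λ K → (solve 3 (λ a b c → a :* b :- c := a :* b :+ (:- :1) :* c) refl _ _ _)) J) (trans (wedge-linʳ x c (- 1#) ω₀ (wedge y ω₁) J) (solve 3 (λ a b c → a :* b :+ (:- :1) :* c := a :* b :- c) refl _ _ _))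

  opaque
    wedge-self : ∀ {n} (v : Vect n) ω J → wedge v (wedge v ω) J ≈ 0#
    wedge-self v ω J = no-zero-divisors {2#} (trans (solve 1 (λ a → (:1 :+ :1) :* a := a :+ a) refl _) (trans (+-congʳ (wedge-anti v v ω J)) (-‿inverseˡ _))) (pos⇒≉0 0<2)

  opaque
    wedge-bound : ∀ {n a b} (v : Vect n) ω → 0# ≤ a → 0# ≤ b → (∀ i → ∣ v i ∣ ≤ a) → (∀ J → ∣ ω J ∣ ≤ b) → ∀ J → ∣ wedge v ω J ∣ ≤ fromℕ n * (a * b)
    wedge-bound {a = a} {b} v ω 0≤a 0≤b h k [] = ≈≤ ∣0∣ (≤-reflexive (solve 2 (λ a b → :0 := :0 :* (a :* b)) refl _ _))
    wedge-bound {suc n} {a} {b} v ω 0≤a 0≤b h k (false ∷ J) =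
      ≤-trans (wedge-bound (tail v) (λ K → ω (false ∷ K)) 0≤a 0≤b (λ i → h (suc i)) (λ K → k (false ∷ K)) J) (by≤ (*-nonNeg 0≤a 0≤b) (solve 3 (λ a b c → a :* (b :* c) :+ b :* c := (:1 :+ a) :* (b :* c) :+ :0) refl _ _ _))
    wedge-bound {suc n} {a} {b} v ω 0≤a 0≤b h k (true ∷ J) =
      ≤-trans (∣∣-+ _ _) (≤≈ (≈≤ (∣∣-* _ _) (*-mono (∣∣≥0 _) (h zero) (∣∣≥0 _) (k (false ∷ J)))
        ⊞ ≈≤ (∣∣-neg _) (wedge-bound (tail v) (λ K → ω (true ∷ K)) 0≤a 0≤b (λ i → h (suc i)) (λ K → k (true ∷ K)) J)) (solve 3 (λ a b c → a :* b :+ c :* (a :* b) := (:1 :+ c) :* (a :* b)) refl _ _ _))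

  count : ∀ {n} → Vec Bool n → ℕ
  count []          = 0
  count (false ∷ J) = count J
  count (true ∷ J)  = suc (count J)

  opaque
    count≤ : ∀ {n} (J : Vec Bool n) → count J ℕ.≤ n
    count≤ []          = z≤n
    count≤ (false ∷ J) = ℕ.≤-trans (count≤ J) (ℕ.n≤1+n _)
    count≤ (true ∷ J)  = s≤s (count≤ J)

  Homogeneous : ∀ {n} → ℕ → Ext n → Set
  Homogeneous r ω = ∀ J → count J ≢ r → ω J ≈ 0#

  opaque
    unit-homogeneous : ∀ {n} → Homogeneous {n} 0 unit
    unit-homogeneous []          h = ⊥-elim (h ≡.refl)
    unit-homogeneous (false ∷ J) h = unit-homogeneous J h
    unit-homogeneous (true ∷ J)  h = refl

  opaque
    wedge-homogeneous : ∀ {n r} (v : Vect n) {ω} → Homogeneous r ω → Homogeneous (suc r) (wedge v ω)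
    wedge-homogeneous v h [] k = refl
    wedge-homogeneous v h (false ∷ J) k = wedge-homogeneous (tail v) (λ K → h (false ∷ K)) J k
    wedge-homogeneous {r = zero} v {ω} h (true ∷ J) k = trans (+-cong (*-congˡ (h (false ∷ J) (λ e → k (≡.cong suc e))))
      (-‿cong (wedge-0ʳ (tail v) (λ K → h (true ∷ K) (λ ())) J))) (solve 1 (λ a → a :* :0 :- :0 := :0) refl _)
    wedge-homogeneous {r = suc r} v {ω} h (true ∷ J) k = trans (+-cong (*-congˡ (h (false ∷ J) (λ e → k (≡.cong suc e))))
      (-‿cong (wedge-homogeneous (tail v) (λ K l → h (true ∷ K) (λ e → l (ℕ.suc-injective e))) J (λ e → k (≡.cong suc e))))) (solve 1 (λ a → a :* :0 :- :0 := :0) refl _)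

  opaque
    wedges-homogeneous : ∀ {n r} (vs : Vec (Vect n) r) → Homogeneous r (wedges vs)
    wedges-homogeneous []       = unit-homogeneous
    wedges-homogeneous (v ∷ vs) = wedge-homogeneous v (wedges-homogeneous vs)

  IntV : ∀ {n} → Vect n → Set
  IntV v = ∀ i → IsInt (v i)

  opaque
    wedge-int : ∀ {n} {v : Vect n} {ω} → IntV v → (∀ J → IsInt (ω J)) → ∀ J → IsInt (wedge v ω J)
    wedge-int p q []          = int-0
    wedge-int p q (false ∷ J) = wedge-int (λ i → p (suc i)) (λ K → q (false ∷ K)) J
    wedge-int p q (true ∷ J)  = int-- (int-* (p zero) (q (false ∷ J))) (wedge-int (λ i → p (suc i)) (λ K → q (true ∷ K)) J)

  opaque
    unit-int : ∀ {n} (J : Vec Bool n) → IsInt (unit J)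
    unit-int []          = int-1
    unit-int (false ∷ J) = unit-int J
    unit-int (true ∷ J)  = int-0

  opaque
    Span⇒wedge≈0 : ∀ {n r} (vs : Vec (Vect n) r) {x} → Span vs x → ∀ J → wedge x (wedges vs) J ≈ 0#
    Span⇒wedge≈0 []       {x} h J = wedge-0ˡ unit h J
    Span⇒wedge≈0 {n} (v ∷ vs) {x} (c , h) J = begin
      wedge x (wedge v ω) J                                           ≈⟨ wedge-cong (λ i → (solve 3 (λ a b c → a := a :- b :* c :+ b :* c) refl _ _ _)) (λ _ → refl) J ⟩
      wedge (λ i → (x i - c * v i) + c * v i) (wedge v ω) J           ≈⟨ wedge-linˡ (λ i → x i - c * v i) v c (wedge v ω) J ⟩
      wedge (λ i → x i - c * v i) (wedge v ω) J + c * wedge v (wedge v ω) J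
        ≈⟨ +-cong (wedge-anti _ v ω J) (*-congˡ (wedge-self v ω J)) ⟩
      - wedge v (wedge (λ i → x i - c * v i) ω) J + c * 0#            ≈⟨ +-congʳ (-‿cong (wedge-0ʳ v (Span⇒wedge≈0 vs h) J)) ⟩
      - 0# + c * 0#                                                   ≈⟨ (solve 1 (λ a → :- :0 :+ a :* :0 := :0) refl _) ⟩
      0#                                                              ∎
      where
      ω : Ext n
      ω = wedges vs

  opaque
    Dep⇒wedges≈0 : ∀ {n r} (vs : Vec (Vect n) r) → Dep vs → ∀ J → wedges vs J ≈ 0#
    Dep⇒wedges≈0 (v ∷ vs) (inj₁ h) = Span⇒wedge≈0 vs h
    Dep⇒wedges≈0 (v ∷ vs) (inj₂ d) = wedge-0ʳ v (Dep⇒wedges≈0 vs d)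

  HeadsVanish : ∀ {n r} → Vec (Vect (suc n)) r → Set
  HeadsVanish []       = Σ ℕ (λ _ → 0 ≡ 0)
  HeadsVanish (v ∷ vs) = v zero ≈ 0# × HeadsVanish vs

  -- The outcome of clearing the first column: `v` carries the pivot, the other vectors have first
  -- coordinate 0, and the exterior product has changed by a nonzero scalar only.
  record Pivot {n r} (vs : Vec (Vect (suc n)) r) : Set where
    field
      {size}   : ℕ
      v        : Vect (suc n)
      rest     : Vec (Vect (suc n)) size
      head≉0   : ¬ (v zero ≈ 0#)
      vanish   : HeadsVanish rest
      v-span   : Span vs v
      ⊑-rest   : rest ⊑ vs
      dep      : Dep rest → Dep vs
      scale    : ℝ
      scale≉0  : ¬ (scale ≈ 0#)
      wedges-≐ : ∀ J → wedges vs J ≈ scale * wedge v (wedges rest) J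

  opaque
    1≉0 : ¬ (1# ≈ 0#)
    1≉0 = pos⇒≉0 0<1

  opaque
    pivot : ∀ {n r} (vs : Vec (Vect (suc n)) r) → HeadsVanish vs ⊎ Pivot vs
    pivot [] = inj₁ (0 , ≡.refl)
    pivot {n} (w ∷ vs) with pivot vs
    ... | inj₁ z with lem (w zero ≈ 0#)
    ... | inj₁ w≈0 = inj₁ (w≈0 , z)
    ... | inj₂ w≉0 = inj₂ record
      { v = w ; rest = vs ; head≉0 = w≉0 ; vanish = z ; v-span = Span-here w vs ; ⊑-rest = ⊑-there (⊑-refl vs)
      ; dep = inj₂ ; scale = 1# ; scale≉0 = 1≉0 ; wedges-≐ = λ J → (solve 1 (λ a → a := :1 :* a) refl _) }
    pivot {n} (w ∷ vs) | inj₂ p = inj₂ record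
      { v = v ; rest = w′ ∷ rest ; head≉0 = head≉0 ; vanish = vanishes , vanish
      ; v-span = Span-there vs v-span
      ; ⊑-rest = (1# , Span-cong vs (λ i → (solve 4 (λ a b c d → :0 :* :0 :+ (:- (a :* b)) :* c := d :- a :* b :* c :- :1 :* d) refl _ _ _ _)) (Span-+ vs (- c) (Span-0 vs (λ i → zeroˡ (0#))) v-span)) ∷ ⊑-there ⊑-rest
      ; dep = λ { (inj₁ h) → inj₁ (Span-cong vs (λ i → (solve 4 (λ a b c d → a :- b :* c :* d :+ b :* c :* d := a) refl _ _ _ _)) (Span-+ vs c (Span-⊑ rest ⊑-rest h) v-span)) ; (inj₂ d) → inj₂ (dep d) }
      -- Putting the cleared vector behind the pivot exchanges two factors, hence the sign.
      ; scale = - scale ; scale≉0 = λ e → scale≉0 (trans (solve 1 (λ a → a := :- (:- a)) refl _) (trans (-‿cong e) (solve 0 (:- :0 := :0) refl)))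
      ; wedges-≐ = eq }
      where
      open Pivot p
      c : ℝ
      c = w zero * v zero ⁻¹[ head≉0 ]
      w′ : Vect (suc n)
      w′ i = w i - c * v i
      vanishes : w zero - c * v zero ≈ 0#
      vanishes = begin
        w zero - w zero * v zero ⁻¹[ head≉0 ] * v zero       ≈⟨ (solve 3 (λ a b c → a :- a :* b :* c := a :- a :* (c :* b)) refl _ _ _) ⟩
        w zero - w zero * (v zero * v zero ⁻¹[ head≉0 ])     ≈⟨ +-congˡ (-‿cong (*-congˡ (⁻¹-inverse _ head≉0))) ⟩
        w zero - w zero * 1#                                 ≈⟨ (solve 1 (λ a → a :- a :* :1 := :0) refl _) ⟩
        0#                                                   ∎
      eq : ∀ J → wedge w (wedges vs) J ≈ - scale * wedge v (wedge w′ (wedges rest)) J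
      eq J = begin
        wedge w (wedges vs) J                                      ≈⟨ wedge-cong (λ _ → refl) wedges-≐ J ⟩
        wedge w (λ K → scale * wedge v ω K) J                      ≈⟨ wedge-*ʳ w scale (wedge v ω) J ⟩
        scale * wedge w (wedge v ω) J                              ≈⟨ *-congˡ (wedge-cong (λ i → (solve 4 (λ a b c d → a := a :- b :* c :* d :+ b :* c :* d) refl _ _ _ _)) (λ _ → refl) J) ⟩
        scale * wedge (λ i → w′ i + c * v i) (wedge v ω) J         ≈⟨ *-congˡ (wedge-linˡ w′ v c (wedge v ω) J) ⟩
        scale * (wedge w′ (wedge v ω) J + c * wedge v (wedge v ω) J) ≈⟨ *-congˡ (+-cong (wedge-anti w′ v ω J) (*-congˡ (wedge-self v ω J))) ⟩
        scale * (- wedge v (wedge w′ ω) J + c * 0#)                ≈⟨ (solve 4 (λ a b c d → a :* (:- b :+ c :* d :* :0) := (:- a) :* b) refl _ _ _ _) ⟩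
        - scale * wedge v (wedge w′ ω) J                           ∎
        where
        ω : Ext (suc n)
        ω = wedges rest

  opaque
    wedges-tail : ∀ {n r} (vs : Vec (Vect (suc n)) r) J → wedges vs (false ∷ J) ≈ wedges (Vec.map tail vs) J
    wedges-tail []       J = refl
    wedges-tail (v ∷ vs) J = wedge-cong (λ _ → refl) (wedges-tail vs) J

  opaque
    wedges-head≈0 : ∀ {n r} (vs : Vec (Vect (suc n)) r) → HeadsVanish vs → ∀ J → wedges vs (true ∷ J) ≈ 0#
    wedges-head≈0 []       h J = refl
    wedges-head≈0 (v ∷ vs) (e , h) J = trans (+-cong (*-congʳ e) (-‿cong (wedge-0ʳ (tail v) (wedges-head≈0 vs h) J))) (solve 1 (λ a → :0 :* a :- :0 := :0) refl _)

  opaque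
    Span-tail : ∀ {n r} (vs : Vec (Vect (suc n)) r) {x} → HeadsVanish vs → x zero ≈ 0# → Span (Vec.map tail vs) (tail x) → Span vs x
    Span-tail []       h e k = λ { zero → e ; (suc i) → k i }
    Span-tail (v ∷ vs) (f , h) e (c , k) = c , Span-tail vs h (trans (+-cong e (-‿cong (*-congˡ f))) (solve 1 (λ a → :0 :- a :* :0 := :0) refl _)) k

  opaque
    Dep-tail : ∀ {n r} (vs : Vec (Vect (suc n)) r) → HeadsVanish vs → Dep (Vec.map tail vs) → Dep vs
    Dep-tail (v ∷ vs) (e , h) (inj₁ s) = inj₁ (Span-tail vs h e s)
    Dep-tail (v ∷ vs) (e , h) (inj₂ d) = inj₂ (Dep-tail vs h d)

  -- Gaussian elimination.
  opaque
    wedges≈0⇒Dep : ∀ {n r} (vs : Vec (Vect n) r) → (∀ J → wedges vs J ≈ 0#) → Dep vs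
    wedges≈0⇒Dep {zero} []       h = ⊥-elim (1≉0 (h []))
    wedges≈0⇒Dep {zero} (v ∷ vs) h = inj₁ (Span-0 vs λ ())
    wedges≈0⇒Dep {suc n} vs h with pivot vs
    ... | inj₁ z = Dep-tail vs z (wedges≈0⇒Dep (Vec.map tail vs) (λ J → trans (sym (wedges-tail vs J)) (h (false ∷ J))))
    ... | inj₂ p = dep (Dep-tail rest vanish (wedges≈0⇒Dep (Vec.map tail rest) (λ J → trans (sym (wedges-tail rest J)) (rest≈0 J))))
      where
      open Pivot p
      rest≈0 : ∀ J → wedges rest (false ∷ J) ≈ 0#
      rest≈0 J = no-zero-divisors (begin
        v zero * wedges rest (false ∷ J)             ≈⟨ (solve 2 (λ a b → a :* b := a :* b :- :0) refl _ _) ⟩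
        v zero * wedges rest (false ∷ J) - 0#        ≈⟨ +-congˡ (-‿cong (wedge-0ʳ (tail v) (wedges-head≈0 rest vanish) J)) ⟨
        wedge v (wedges rest) (true ∷ J)             ≈⟨ no-zero-divisors (trans (sym (wedges-≐ (true ∷ J))) (h (true ∷ J))) scale≉0 ⟩
        0#                                           ∎) head≉0

  opaque
    wedge≈0⇒Span : ∀ {n r} (vs : Vec (Vect n) r) {x} → ¬ (∀ J → wedges vs J ≈ 0#) → (∀ J → wedge x (wedges vs) J ≈ 0#) → Span vs x
    wedge≈0⇒Span vs {x} ≉0 h with wedges≈0⇒Dep (x ∷ vs) h
    ... | inj₁ s = s
    ... | inj₂ d = ⊥-elim (≉0 (Dep⇒wedges≈0 vs d))

  opaque
    -- Multivectors of degree above n vanish, so the product of x with the vectors is 0, while that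
    -- of the vectors alone is not.
    full-span : ∀ {n r} (vs : Vec (Vect n) r) → ¬ Dep vs → n ℕ.≤ r → ∀ x → Span vs x
    full-span vs ¬dep n≤r x = wedge≈0⇒Span vs (λ h → ¬dep (wedges≈0⇒Dep vs h))
      (λ J → wedges-homogeneous (x ∷ vs) J (λ e → ℕ.1+n≰n (ℕ.≤-trans (ℕ.≤-reflexive (≡.sym e)) (ℕ.≤-trans (count≤ J) n≤r))))

  -- The linear combinations of products of s vectors in the span of us.
  Products : ∀ {n r} → ℕ → Vec (Vect n) r → Ext n → Set
  Products zero    []       ω = ∃ λ m → ω ≐ (λ J → m * unit J)
  Products (suc s) []       ω = ∀ J → ω J ≈ 0#
  Products zero    (u ∷ us) ω = Products zero us ω
  Products (suc s) (u ∷ us) ω = ∃ λ A → ∃ λ X → Products (suc s) us A × Products s us X × ω ≐ (λ J → A J + wedge u X J)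

  opaque
    Products-cong : ∀ {n r} s (us : Vec (Vect n) r) {ω η} → ω ≐ η → Products s us ω → Products s us η
    Products-cong zero    []       e (m , h) = m , λ J → trans (sym (e J)) (h J)
    Products-cong (suc s) []       e h = λ J → trans (sym (e J)) (h J)
    Products-cong zero    (u ∷ us) e h = Products-cong zero us e h
    Products-cong (suc s) (u ∷ us) e (A , X , p , q , h) = A , X , p , q , λ J → trans (sym (e J)) (h J)

  opaque
    Products-lin : ∀ {n r} s (us : Vec (Vect n) r) a b {ω η} → Products s us ω → Products s us η → Products s us (λ J → a * ω J + b * η J)
    Products-lin zero    []       a b (m , h) (k , g) = a * m + b * k , λ J → trans (+-cong (*-congˡ (h J)) (*-congˡ (g J))) (solve 5 (λ a b c d e → a :* (b :* c) :+ d :* (e :* c) := (a :* b :+ d :* e) :* c) refl _ _ _ _ _)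
    Products-lin (suc s) []       a b h g = λ J → trans (+-cong (*-congˡ (h J)) (*-congˡ (g J))) (solve 2 (λ a b → a :* :0 :+ b :* :0 := :0) refl _ _)
    Products-lin zero    (u ∷ us) a b h g = Products-lin zero us a b h g
    Products-lin (suc s) (u ∷ us) a b (A , X , p , q , h) (B , Y , p′ , q′ , g) =
      (λ J → a * A J + b * B J) , (λ J → a * X J + b * Y J) , Products-lin (suc s) us a b p p′ , Products-lin s us a b q q′ ,
      λ J → trans (+-cong (*-congˡ (h J)) (*-congˡ (g J))) (trans (solve 6 (λ a b c d e f → a :* (b :+ c) :+ d :* (e :+ f) := a :* b :+ d :* e :+ (a :* c :+ d :* f)) refl _ _ _ _ _ _) (+-congˡ (sym (wedge-linʳ u a b X Y J))))

  opaque
    Products-* : ∀ {n r} s (us : Vec (Vect n) r) a {ω} → Products s us ω → Products s us (λ J → a * ω J)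
    Products-* s us a {ω} h = Products-cong s us {λ J → a * ω J + 0# * ω J} (λ J → (solve 2 (λ a b → a :* b :+ :0 :* b := a :* b) refl _ _)) (Products-lin s us a 0# h h)

  opaque
    Products-wedge : ∀ {n r} s (us : Vec (Vect n) r) {x ω} → Span us x → Products s us ω → Products (suc s) us (wedge x ω)
    Products-wedge s       []       {x} {ω} h p J = wedge-0ˡ ω h J
    Products-wedge zero    (u ∷ us) {x} {ω} (c , h) p =
      wedge (λ i → x i - c * u i) ω , (λ J → c * ω J) , Products-wedge zero us h p , Products-* zero us c p ,
      λ J → trans (wedge-cong (λ i → (solve 3 (λ a b c → a := a :- b :* c :+ b :* c) refl _ _ _)) (λ _ → refl) J) (trans (wedge-linˡ (λ i → x i - c * u i) u c ω J) (+-congˡ (sym (wedge-*ʳ u c ω J))))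
    Products-wedge {n} (suc s) (u ∷ us) {x} {ω} (c , h) (A , X , p , q , e) =
      wedge y A , (λ J → c * A J + - 1# * wedge y X J) , Products-wedge (suc s) us h p ,
      Products-lin (suc s) us c (- 1#) p (Products-wedge s us h q) , λ J → begin
        wedge x ω J                                              ≈⟨ wedge-cong (λ i → (solve 3 (λ a b c → a := a :- b :* c :+ b :* c) refl _ _ _)) (λ K → trans (e K) (solve 2 (λ a b → a :+ b := :1 :* a :+ :1 :* b) refl _ _)) J ⟩
        wedge (λ i → y i + c * u i) (λ K → 1# * A K + 1# * wedge u X K) J
          ≈⟨ wedge-linˡ y u c _ J ⟩
        wedge y (λ K → 1# * A K + 1# * wedge u X K) J + c * wedge u (λ K → 1# * A K + 1# * wedge u X K) J
          ≈⟨ +-cong (wedge-linʳ y 1# 1# A (wedge u X) J) (*-congˡ (wedge-linʳ u 1# 1# A (wedge u X) J)) ⟩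
        1# * wedge y A J + 1# * wedge y (wedge u X) J + c * (1# * wedge u A J + 1# * wedge u (wedge u X) J)
          ≈⟨ +-cong (+-congˡ (*-congˡ (wedge-anti y u X J))) (*-congˡ (+-congˡ (*-congˡ (wedge-self u X J)))) ⟩
        1# * wedge y A J + 1# * (- wedge u (wedge y X) J) + c * (1# * wedge u A J + 1# * 0#)
          ≈⟨ (solve 4 (λ a b c d → :1 :* a :+ :1 :* (:- b) :+ c :* (:1 :* d :+ :1 :* :0) := a :+ (c :* d :+ (:- :1) :* b)) refl _ _ _ _) ⟩
        wedge y A J + (c * wedge u A J + - 1# * wedge u (wedge y X) J)
          ≈⟨ +-congˡ (sym (wedge-linʳ u c (- 1#) A (wedge y X) J)) ⟩
        wedge y A J + wedge u (λ K → c * A K + - 1# * wedge y X K) J ∎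
      where
      y : Vect n
      y i = x i - c * u i

  opaque
    Products-unit : ∀ {n r} (us : Vec (Vect n) r) → Products zero us unit
    Products-unit []       = 1# , λ J → (solve 1 (λ a → a := :1 :* a) refl _)
    Products-unit (u ∷ us) = Products-unit us

  opaque
    Products-wedges : ∀ {n r s} (us : Vec (Vect n) r) {ws : Vec (Vect n) s} → ws ⊑ us → Products s us (wedges ws)
    Products-wedges us [] = Products-unit us
    Products-wedges {s = suc s} us (p ∷ ps) = Products-wedge s us p (Products-wedges us ps)

  opaque
    Products-over : ∀ {n r} s (us : Vec (Vect n) r) {ω} → r ℕ.< s → Products s us ω → ∀ J → ω J ≈ 0#
    Products-over (suc s) []       p h = h
    Products-over (suc s) (u ∷ us) (s≤s p) (A , X , q , t , e) J = trans (e J) (trans (+-cong (Products-over (suc s) us (ℕ.m<n⇒m<1+n p) q J)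
      (wedge-0ʳ u (Products-over s us p t) J)) (solve 0 (:0 :+ :0 := :0) refl))

  opaque
    Products-top : ∀ {n r} (us : Vec (Vect n) r) {ω} → Products r us ω → ∃ λ m → ω ≐ (λ J → m * wedges us J)
    Products-top []       h = h
    Products-top {r = suc r} (u ∷ us) {ω} (A , X , q , t , e) = from (Products-top us t)
      where
      from : (∃ λ m → X ≐ (λ J → m * wedges us J)) → ∃ λ m → ω ≐ (λ J → m * wedge u (wedges us) J)
      from (m , h) = m , λ J → trans (e J) (trans (+-cong (Products-over (suc r) us ℕ.≤-refl q J)
        (trans (wedge-cong (λ _ → refl) h J) (wedge-*ʳ u m (wedges us) J))) (solve 2 (λ a b → :0 :+ a :* b := a :* b) refl _ _))

  opaque
    -- The top exterior power of the span of r vectors is at most a line; m is the determinant that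
    -- expresses `ws` in terms of `us`.
    proportional : ∀ {n r} {ws us : Vec (Vect n) r} → ws ⊑ us → ∃ λ m → wedges ws ≐ (λ J → m * wedges us J)
    proportional {us = us} p = Products-top us (Products-wedges us p)

  ⟨_,_⟩ : ∀ {n} → Vect n → Vect n → ℝ
  ⟨ s , v ⟩ = sum (λ i → s i * v i)

  -- The contraction by the covector s; the sign comes from passing e₀.
  ι : ∀ {n} → Vect n → Ext n → Ext n
  ι s ω []          = 0#
  ι s ω (false ∷ J) = ι (tail s) (λ K → ω (false ∷ K)) J + s zero * ω (true ∷ J)
  ι s ω (true ∷ J)  = - ι (tail s) (λ K → ω (true ∷ K)) J

  opaque
    ι-cong : ∀ {n} {s t : Vect n} {ω η} → (∀ i → s i ≈ t i) → ω ≐ η → ι s ω ≐ ι t η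
    ι-cong e f []          = refl
    ι-cong e f (false ∷ J) = +-cong (ι-cong (λ i → e (suc i)) (λ K → f (false ∷ K)) J) (*-cong (e zero) (f (true ∷ J)))
    ι-cong e f (true ∷ J)  = -‿cong (ι-cong (λ i → e (suc i)) (λ K → f (true ∷ K)) J)

  opaque
    ι-lin : ∀ {n} (s : Vect n) a b ω η J → ι s (λ K → a * ω K + b * η K) J ≈ a * ι s ω J + b * ι s η J
    ι-lin s a b ω η []          = (solve 2 (λ a b → :0 := a :* :0 :+ b :* :0) refl _ _)
    ι-lin s a b ω η (false ∷ J) = trans (+-congʳ (ι-lin (tail s) a b (λ K → ω (false ∷ K)) (λ K → η (false ∷ K)) J)) (solve 7 (λ a b c d e f g → a :* b :+ c :* d :+ e :* (a :* f :+ c :* g) := a :* (b :+ e :* f) :+ c :* (d :+ e :* g)) refl _ _ _ _ _ _ _)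
    ι-lin s a b ω η (true ∷ J)  = trans (-‿cong (ι-lin (tail s) a b (λ K → ω (true ∷ K)) (λ K → η (true ∷ K)) J)) (solve 4 (λ a b c d → :- (a :* b :+ c :* d) := a :* (:- b) :+ c :* (:- d)) refl _ _ _ _)

  opaque
    ι-linˡ : ∀ {n} (s t : Vect n) c ω J → ι (λ i → s i + c * t i) ω J ≈ ι s ω J + c * ι t ω J
    ι-linˡ s t c ω []          = (solve 1 (λ a → :0 := :0 :+ a :* :0) refl _)
    ι-linˡ s t c ω (false ∷ J) = trans (+-congʳ (ι-linˡ (tail s) (tail t) c (λ K → ω (false ∷ K)) J)) (solve 6 (λ a b c d e f → a :+ b :* c :+ (d :+ b :* e) :* f := a :+ d :* f :+ b :* (c :+ e :* f)) refl _ _ _ _ _ _)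
    ι-linˡ s t c ω (true ∷ J)  = trans (-‿cong (ι-linˡ (tail s) (tail t) c (λ K → ω (true ∷ K)) J)) (solve 3 (λ a b c → :- (a :+ b :* c) := :- a :+ b :* (:- c)) refl _ _ _)

  opaque
    ι-0 : ∀ {n} (s : Vect n) {ω} → (∀ J → ω J ≈ 0#) → ∀ J → ι s ω J ≈ 0#
    ι-0 s h []          = refl
    ι-0 s h (false ∷ J) = trans (+-cong (ι-0 (tail s) (λ K → h (false ∷ K)) J) (*-congˡ (h (true ∷ J)))) (solve 1 (λ a → :0 :+ a :* :0 := :0) refl _)
    ι-0 s h (true ∷ J)  = trans (-‿cong (ι-0 (tail s) (λ K → h (true ∷ K)) J)) (solve 0 (:- :0 := :0) refl)

  opaque
    ι-unit : ∀ {n} (s : Vect n) J → ι s unit J ≈ 0#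
    ι-unit s []          = refl
    ι-unit s (false ∷ J) = trans (+-congʳ (ι-unit (tail s) J)) (solve 1 (λ a → :0 :+ a :* :0 := :0) refl _)
    ι-unit s (true ∷ J)  = trans (-‿cong (ι-0 (tail s) (λ _ → refl) J)) (solve 0 (:- :0 := :0) refl)

  opaque
    -- Contraction is an antiderivation. This is what makes `shear` multiplicative.
    ι-wedge : ∀ {n} (s v : Vect n) ω J → ι s (wedge v ω) J ≈ ⟨ s , v ⟩ * ω J - wedge v (ι s ω) J
    ι-wedge s v ω []          = (solve 1 (λ a → :0 := :0 :* a :- :0) refl _)
    ι-wedge {suc n} s v ω (false ∷ J) = begin
      ι s′ (wedge v′ ω₀) J + s zero * (v zero * ω₀ J - wedge v′ ω₁ J)                     ≈⟨ +-congʳ (ι-wedge s′ v′ ω₀ J) ⟩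
      ⟨ s′ , v′ ⟩ * ω₀ J - wedge v′ (ι s′ ω₀) J + s zero * (v zero * ω₀ J - wedge v′ ω₁ J)   ≈⟨ (solve 6 (λ a b c d e f → a :* b :- c :+ d :* (e :* b :- f) := (d :* e :+ a) :* b :- (:1 :* c :+ d :* f)) refl _ _ _ _ _ _) ⟩
      (s zero * v zero + ⟨ s′ , v′ ⟩) * ω₀ J - (1# * wedge v′ (ι s′ ω₀) J + s zero * wedge v′ ω₁ J)
        ≈⟨ +-congˡ (-‿cong (sym (wedge-linʳ v′ 1# (s zero) (ι s′ ω₀) ω₁ J))) ⟩
      (s zero * v zero + ⟨ s′ , v′ ⟩) * ω₀ J - wedge v′ (λ K → 1# * ι s′ ω₀ K + s zero * ω₁ K) J
        ≈⟨ +-congˡ (-‿cong (wedge-cong (λ _ → refl) (λ K → (solve 3 (λ a b c → :1 :* a :+ b :* c := a :+ b :* c) refl _ _ _)) J)) ⟩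
      (s zero * v zero + ⟨ s′ , v′ ⟩) * ω₀ J - wedge v′ (λ K → ι s′ ω₀ K + s zero * ω₁ K) J ∎
      where
      s′ v′ : Vect n
      s′ = tail s
      v′ = tail v
      ω₀ ω₁ : Ext n
      ω₀ K = ω (false ∷ K)
      ω₁ K = ω (true ∷ K)
    ι-wedge {suc n} s v ω (true ∷ J) = begin
      - ι s′ (λ K → v zero * ω₀ K - wedge v′ ω₁ K) J                          ≈⟨ -‿cong (trans (ι-cong (λ _ → refl) (λ K → (solve 3 (λ a b c → a :* b :- c := a :* b :+ (:- :1) :* c) refl _ _ _)) J) (ι-lin s′ (v zero) (- 1#) ω₀ (wedge v′ ω₁) J)) ⟩
      - (v zero * ι s′ ω₀ J + - 1# * ι s′ (wedge v′ ω₁) J)                    ≈⟨ -‿cong (+-congˡ (*-congˡ (ι-wedge s′ v′ ω₁ J))) ⟩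
      - (v zero * ι s′ ω₀ J + - 1# * (⟨ s′ , v′ ⟩ * ω₁ J - wedge v′ (ι s′ ω₁) J))   ≈⟨ (solve 6 (λ a b c d e f → :- (a :* b :+ (:- :1) :* (c :* d :- e)) := (f :* a :+ c) :* d :- (a :* (b :+ f :* d) :- (:- :1) :* e)) refl _ _ _ _ _ _) ⟩
      (s zero * v zero + ⟨ s′ , v′ ⟩) * ω₁ J - (v zero * (ι s′ ω₀ J + s zero * ω₁ J) - - 1# * wedge v′ (ι s′ ω₁) J)
        ≈⟨ +-congˡ (-‿cong (+-congˡ (-‿cong (trans (sym (wedge-*ʳ v′ (- 1#) (ι s′ ω₁) J)) (wedge-cong (λ _ → refl) (λ K → (solve 1 (λ a → (:- :1) :* a := :- a) refl _)) J))))) ⟩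
      (s zero * v zero + ⟨ s′ , v′ ⟩) * ω₁ J - (v zero * (ι s′ ω₀ J + s zero * ω₁ J) - wedge v′ (λ K → - ι s′ ω₁ K) J) ∎
      where
      s′ v′ : Vect n
      s′ = tail s
      v′ = tail v
      ω₀ ω₁ : Ext n
      ω₀ K = ω (false ∷ K)
      ω₁ K = ω (true ∷ K)

  opaque
    ι-bound : ∀ {n a b} (s : Vect n) ω → 0# ≤ a → 0# ≤ b → (∀ i → ∣ s i ∣ ≤ a) → (∀ J → ∣ ω J ∣ ≤ b) → ∀ J → ∣ ι s ω J ∣ ≤ fromℕ n * (a * b)
    ι-bound s ω 0≤a 0≤b h k [] = ≈≤ ∣0∣ (≤-reflexive (solve 2 (λ a b → :0 := :0 :* (a :* b)) refl _ _))
    ι-bound {suc n} {a} {b} s ω 0≤a 0≤b h k (true ∷ J) = ≈≤ (∣∣-neg _)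
      (≤-trans (ι-bound (tail s) (λ K → ω (true ∷ K)) 0≤a 0≤b (λ i → h (suc i)) (λ K → k (true ∷ K)) J) (by≤ (*-nonNeg 0≤a 0≤b) (solve 3 (λ a b c → a :* (b :* c) :+ b :* c := (:1 :+ a) :* (b :* c) :+ :0) refl _ _ _)))
    ι-bound {suc n} {a} {b} s ω 0≤a 0≤b h k (false ∷ J) =
      ≤-trans (∣∣-+ _ _) (≤≈ (ι-bound (tail s) (λ K → ω (false ∷ K)) 0≤a 0≤b (λ i → h (suc i)) (λ K → k (false ∷ K)) J
        ⊞ ≈≤ (∣∣-* _ _) (*-mono (∣∣≥0 _) (h zero) (∣∣≥0 _) (k (true ∷ J)))) (solve 3 (λ a b c → a :* (b :* c) :+ b :* c := (:1 :+ a) :* (b :* c)) refl _ _ _))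

  -- The map on multivectors induced by the shear x₀ ↦ x₀ + ⟨ s , (x₁, …, xₙ) ⟩.
  shear : ∀ {n} → Vect n → Ext (suc n) → Ext (suc n)
  shear s ω (false ∷ J) = ω (false ∷ J)
  shear s ω (true ∷ J)  = ω (true ∷ J) + ι s (λ K → ω (false ∷ K)) J

  shearᵥ : ∀ {n} → Vect n → Vect (suc n) → Vect (suc n)
  shearᵥ s v zero    = v zero + ⟨ s , tail v ⟩
  shearᵥ s v (suc i) = v (suc i)

  opaque
    shear-cong : ∀ {n} {s t : Vect n} {ω η} → (∀ i → s i ≈ t i) → ω ≐ η → shear s ω ≐ shear t η
    shear-cong e f (false ∷ J) = f (false ∷ J)
    shear-cong e f (true ∷ J)  = +-cong (f (true ∷ J)) (ι-cong e (λ K → f (false ∷ K)) J)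

  opaque
    shear-lin : ∀ {n} (s : Vect n) a b ω η J → shear s (λ K → a * ω K + b * η K) J ≈ a * shear s ω J + b * shear s η J
    shear-lin s a b ω η (false ∷ J) = refl
    shear-lin s a b ω η (true ∷ J)  = trans (+-congˡ (ι-lin s a b (λ K → ω (false ∷ K)) (λ K → η (false ∷ K)) J)) (solve 6 (λ a b c d e f → a :* b :+ c :* d :+ (a :* e :+ c :* f) := a :* (b :+ e) :+ c :* (d :+ f)) refl _ _ _ _ _ _)

  opaque
    shear-unit : ∀ {n} (s : Vect n) → shear s unit ≐ unit
    shear-unit s (false ∷ J) = refl
    shear-unit s (true ∷ J)  = trans (+-congˡ (ι-unit s J)) (solve 0 (:0 :+ :0 := :0) refl)

  opaque
    shear-wedge : ∀ {n} (s : Vect n) v ω → shear s (wedge v ω) ≐ wedge (shearᵥ s v) (shear s ω)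
    shear-wedge s v ω (false ∷ J) = refl
    shear-wedge {n} s v ω (true ∷ J) = begin
      v zero * ω₀ J - wedge v′ ω₁ J + ι s (wedge v′ ω₀) J                          ≈⟨ +-congˡ (ι-wedge s v′ ω₀ J) ⟩
      v zero * ω₀ J - wedge v′ ω₁ J + (⟨ s , v′ ⟩ * ω₀ J - wedge v′ (ι s ω₀) J)       ≈⟨ (solve 5 (λ a b c d e → a :* b :- c :+ (d :* b :- e) := (a :+ d) :* b :- (:1 :* c :+ :1 :* e)) refl _ _ _ _ _) ⟩
      (v zero + ⟨ s , v′ ⟩) * ω₀ J - (1# * wedge v′ ω₁ J + 1# * wedge v′ (ι s ω₀) J)  ≈⟨ +-congˡ (-‿cong (sym (wedge-linʳ v′ 1# 1# ω₁ (ι s ω₀) J))) ⟩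
      (v zero + ⟨ s , v′ ⟩) * ω₀ J - wedge v′ (λ K → 1# * ω₁ K + 1# * ι s ω₀ K) J      ≈⟨ +-congˡ (-‿cong (wedge-cong (λ _ → refl) (λ K → (solve 2 (λ a b → :1 :* a :+ :1 :* b := a :+ b) refl _ _)) J)) ⟩
      (v zero + ⟨ s , v′ ⟩) * ω₀ J - wedge v′ (λ K → ω₁ K + ι s ω₀ K) J             ∎
      where
      v′ : Vect n
      v′ = tail v
      ω₀ ω₁ : Ext n
      ω₀ K = ω (false ∷ K)
      ω₁ K = ω (true ∷ K)

  opaque
    shear-shear : ∀ {n} (s t : Vect n) ω → shear t (shear s ω) ≐ shear (λ i → s i + 1# * t i) ω
    shear-shear s t ω (false ∷ J) = refl
    shear-shear s t ω (true ∷ J)  = trans (solve 3 (λ a b c → a :+ b :+ c := a :+ (b :+ :1 :* c)) refl _ _ _) (+-congˡ (sym (ι-linˡ s t 1# (λ K → ω (false ∷ K)) J)))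

  opaque
    shear-zero : ∀ {n} {s : Vect n} ω → (∀ i → s i ≈ 0#) → shear s ω ≐ ω
    shear-zero ω h (false ∷ J) = refl
    shear-zero {s = s} ω h (true ∷ J) = trans (+-congˡ (vanish s h (λ K → ω (false ∷ K)) J)) (solve 1 (λ a → a :+ :0 := a) refl _)
      where
      vanish : ∀ {n} (s : Vect n) → (∀ i → s i ≈ 0#) → ∀ ω J → ι s ω J ≈ 0#
      vanish s h ω []          = refl
      vanish s h ω (false ∷ J) = trans (+-cong (vanish (tail s) (λ i → h (suc i)) (λ K → ω (false ∷ K)) J) (*-congʳ (h zero))) (solve 1 (λ a → :0 :+ :0 :* a := :0) refl _)
      vanish s h ω (true ∷ J)  = trans (-‿cong (vanish (tail s) (λ i → h (suc i)) (λ K → ω (true ∷ K)) J)) (solve 0 (:- :0 := :0) refl)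

  opaque
    shear-bound : ∀ {n a b} (s : Vect n) ω → 0# ≤ a → 0# ≤ b → (∀ i → ∣ s i ∣ ≤ a) → (∀ J → ∣ ω J ∣ ≤ b) → ∀ J → ∣ shear s ω J ∣ ≤ (1# + fromℕ n * a) * b
    shear-bound {n} {a} {b} s ω 0≤a 0≤b h k (false ∷ J) = ≤-trans (k (false ∷ J)) (by≤ (*-nonNeg (*-nonNeg (fromℕ≥0 n) 0≤a) 0≤b) (solve 3 (λ a b c → a :+ b :* c :* a := (:1 :+ b :* c) :* a :+ :0) refl _ _ _))
    shear-bound s ω 0≤a 0≤b h k (true ∷ J) = ≤-trans (∣∣-+ _ _) (≤≈ (k (true ∷ J) ⊞ ι-bound s (λ K → ω (false ∷ K)) 0≤a 0≤b h (λ K → k (false ∷ K)) J) (solve 3 (λ a b c → a :+ b :* (c :* a) := (:1 :+ b :* c) :* a) refl _ _ _))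

  -- Coordinate 0 belongs to the constant function and is left alone; only the coordinates paired
  -- with the functions of the curve are sheared.
  tilt : ∀ {n} → Vect n → Ext (suc (suc n)) → Ext (suc (suc n))
  tilt s ω (b ∷ J) = shear s (λ K → ω (b ∷ K)) J

  tiltᵥ : ∀ {n} → Vect n → Vect (suc (suc n)) → Vect (suc (suc n))
  tiltᵥ s v zero    = v zero
  tiltᵥ s v (suc i) = shearᵥ s (tail v) i

  opaque
    tilt-unit : ∀ {n} (s : Vect n) → tilt s unit ≐ unit
    tilt-unit s (false ∷ J) = shear-unit s J
    tilt-unit s (true ∷ J)  = trans (trans (shear-cong {s = s} {t = s} {ω = λ _ → 0#} {η = λ K → 0# * 0# + 0# * 0#} (λ _ → refl) (λ _ → (solve 0 (:0 := :0 :* :0 :+ :0 :* :0) refl)) J) (shear-lin s 0# 0# (λ _ → 0#) (λ _ → 0#) J)) (solve 1 (λ a → :0 :* a :+ :0 :* a := :0) refl _)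

  opaque
    tilt-cong : ∀ {n} (s : Vect n) {ω η} → ω ≐ η → tilt s ω ≐ tilt s η
    tilt-cong s f (b ∷ J) = shear-cong (λ _ → refl) (λ K → f (b ∷ K)) J

  opaque
    tilt-wedge : ∀ {n} (s : Vect n) v ω → tilt s (wedge v ω) ≐ wedge (tiltᵥ s v) (tilt s ω)
    tilt-wedge s v ω (false ∷ J) = shear-wedge s (tail v) (λ K → ω (false ∷ K)) J
    tilt-wedge {n} s v ω (true ∷ J) = begin
      shear s (λ K → v zero * ω₀ K - wedge (tail v) ω₁ K) J              ≈⟨ shear-cong (λ _ → refl) (λ K → (solve 3 (λ a b c → a :* b :- c := a :* b :+ (:- :1) :* c) refl _ _ _)) J ⟩
      shear s (λ K → v zero * ω₀ K + - 1# * wedge (tail v) ω₁ K) J       ≈⟨ shear-lin s (v zero) (- 1#) ω₀ (wedge (tail v) ω₁) J ⟩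
      v zero * shear s ω₀ J + - 1# * shear s (wedge (tail v) ω₁) J       ≈⟨ +-congˡ (trans (solve 1 (λ a → (:- :1) :* a := :- a) refl _) (-‿cong (shear-wedge s (tail v) ω₁ J))) ⟩
      v zero * shear s ω₀ J - wedge (shearᵥ s (tail v)) (shear s ω₁) J   ∎
      where
      ω₀ ω₁ : Ext (suc n)
      ω₀ K = ω (false ∷ K)
      ω₁ K = ω (true ∷ K)

  opaque
    tilt-inverse : ∀ {n} (s : Vect n) ω → tilt (λ i → - s i) (tilt s ω) ≐ ω
    tilt-inverse s ω (b ∷ J) = trans (shear-shear s (λ i → - s i) (λ K → ω (b ∷ K)) J) (shear-zero (λ K → ω (b ∷ K)) (λ i → (solve 1 (λ a → a :+ :1 :* (:- a) := :0) refl _)) J)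

  opaque
    tilt-bound : ∀ {n a b} (s : Vect n) ω → 0# ≤ a → 0# ≤ b → (∀ i → ∣ s i ∣ ≤ a) → (∀ J → ∣ ω J ∣ ≤ b) → ∀ J → ∣ tilt s ω J ∣ ≤ (1# + fromℕ n * a) * b
    tilt-bound s ω 0≤a 0≤b h k (c ∷ J) = shear-bound s (λ K → ω (c ∷ K)) 0≤a 0≤b h (λ K → k (c ∷ K)) J

  -- The eigenvalue, on the basis multivector J, of the diagonal map with entries d.
  factor : ∀ {n} → Vect n → Vec Bool n → ℝ
  factor d []          = 1#
  factor d (false ∷ J) = factor (tail d) J
  factor d (true ∷ J)  = d zero * factor (tail d) J

  opaque
    factor-wedge : ∀ {n} (d v : Vect n) ω J → factor d J * wedge v ω J ≈ wedge (λ i → d i * v i) (λ K → factor d K * ω K) J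
    factor-wedge d v ω []          = (solve 0 (:1 :* :0 := :0) refl)
    factor-wedge d v ω (false ∷ J) = factor-wedge (tail d) (tail v) (λ K → ω (false ∷ K)) J
    factor-wedge {suc n} d v ω (true ∷ J) = begin
      d zero * F J * (v zero * ω₀ J - wedge v′ ω₁ J)                        ≈⟨ (solve 5 (λ a b c d e → a :* b :* (c :* d :- e) := a :* c :* (b :* d) :- a :* (b :* e)) refl _ _ _ _ _) ⟩
      d zero * v zero * (F J * ω₀ J) - d zero * (F J * wedge v′ ω₁ J)       ≈⟨ +-congˡ (-‿cong (*-congˡ (factor-wedge (tail d) v′ ω₁ J))) ⟩
      d zero * v zero * (F J * ω₀ J) - d zero * wedge dv (λ K → F K * ω₁ K) J    ≈⟨ +-congˡ (-‿cong (sym (wedge-*ʳ dv (d zero) (λ K → F K * ω₁ K) J))) ⟩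
      d zero * v zero * (F J * ω₀ J) - wedge dv (λ K → d zero * (F K * ω₁ K)) J  ≈⟨ +-congˡ (-‿cong (wedge-cong (λ _ → refl) (λ K → (solve 3 (λ a b c → a :* (b :* c) := a :* b :* c) refl _ _ _)) J)) ⟩
      d zero * v zero * (F J * ω₀ J) - wedge dv (λ K → d zero * F K * ω₁ K) J    ∎
      where
      v′ dv : Vect n
      v′ = tail v
      dv i = d (suc i) * v (suc i)
      F : Vec Bool n → ℝ
      F = factor (tail d)
      ω₀ ω₁ : Ext n
      ω₀ K = ω (false ∷ K)
      ω₁ K = ω (true ∷ K)

  opaque
    factor-unit : ∀ {n} (d : Vect n) J → factor d J * unit J ≈ unit J
    factor-unit d []          = (solve 0 (:1 :* :1 := :1) refl)
    factor-unit d (false ∷ J) = factor-unit (tail d) J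
    factor-unit d (true ∷ J)  = (solve 2 (λ a b → a :* b :* :0 := :0) refl _ _)

  opaque
    factor>0 : ∀ {n} {d : Vect n} → (∀ i → 0# < d i) → ∀ J → 0# < factor d J
    factor>0 h []          = 0<1
    factor>0 h (false ∷ J) = factor>0 (λ i → h (suc i)) J
    factor>0 h (true ∷ J)  = pos* (h zero) (factor>0 (λ i → h (suc i)) J)

  full : ∀ {n} → Vec Bool n
  full {n} = Vec.replicate n true

  opaque
    factor-full : ∀ {n} {d : Vect n} → (∀ i → 0# < d i) → (∀ i → d i ≤ 1#) → ∀ J → factor d full ≤ factor d J
    factor-full h k []          = ≤-refl
    factor-full h k (true ∷ J)  = *-monoˡ _ (<⇒≤ (h zero)) (factor-full (λ i → h (suc i)) (λ i → k (suc i)) J)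
    factor-full {d = d} h k (false ∷ J) = ≤-trans (by≤ (*-nonNeg (sub≥0 (k zero)) (<⇒≤ (factor>0 (λ i → h (suc i)) full))) (solve 2 (λ a b → a :* b :+ (:1 :- a) :* b := b :+ :0) refl _ _))
      (factor-full (λ i → h (suc i)) (λ i → k (suc i)) J)

  opaque
    -- Of the entries omitted by J all but one are estimated by 1. The one that is kept gives
    -- `initial` its gain of `p2 (e i)`.
    factor-missing : ∀ {n} {d : Vect n} → (∀ i → 0# < d i) → (∀ i → d i ≤ 1#) → ∀ J → count J ℕ.< n → ∃ λ i → factor d full ≤ factor d J * d i
    factor-missing {d = d} h k (false ∷ J) p = zero , ≤≈ (*-monoˡ _ (<⇒≤ (h zero)) (factor-full (λ i → h (suc i)) (λ i → k (suc i)) J)) (solve 2 (λ a b → a :* b := b :* a) refl _ _)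
    factor-missing {d = d} h k (true ∷ J) (s≤s p) with factor-missing {d = tail d} (λ i → h (suc i)) (λ i → k (suc i)) J p
    ... | i , q = suc i , ≤≈ (*-monoˡ _ (<⇒≤ (h zero)) q) (solve 3 (λ a b c → a :* (b :* c) := a :* b :* c) refl _ _ _)

  -- The coefficients of the linear form s ↦ `ι s ω J`: up to sign, the coordinates of ω at J
  -- enlarged by one index.
  coefficient : ∀ {n} → Ext n → Vec Bool n → Vect n
  coefficient ω (false ∷ J) zero    = ω (true ∷ J)
  coefficient ω (true ∷ J)  zero    = 0#
  coefficient ω (false ∷ J) (suc i) = coefficient (λ K → ω (false ∷ K)) J i
  coefficient ω (true ∷ J)  (suc i) = - coefficient (λ K → ω (true ∷ K)) J i

  opaque
    ι-coefficient : ∀ {n} (s : Vect n) ω J → ι s ω J ≈ sum (λ i → coefficient ω J i * s i)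
    ι-coefficient s ω []          = refl
    ι-coefficient s ω (false ∷ J) = trans (+-congʳ (ι-coefficient (tail s) (λ K → ω (false ∷ K)) J)) (solve 3 (λ a b c → a :+ b :* c := c :* b :+ a) refl _ _ _)
    ι-coefficient {suc n} s ω (true ∷ J) = begin
      - ι (tail s) ω₁ J                                          ≈⟨ -‿cong (ι-coefficient (tail s) ω₁ J) ⟩
      - sum (λ i → coefficient ω₁ J i * s (suc i))               ≈⟨ (solve 2 (λ a b → :- a := :0 :* b :+ (:- :1) :* a) refl _ _) ⟩
      0# * s zero + - 1# * sum (λ i → coefficient ω₁ J i * s (suc i))    ≈⟨ +-congˡ (sym (sum-* (- 1#) (λ i → coefficient ω₁ J i * s (suc i)))) ⟩
      0# * s zero + sum (λ i → - 1# * (coefficient ω₁ J i * s (suc i)))  ≈⟨ +-congˡ (sum-cong {f = λ i → - 1# * (coefficient ω₁ J i * s (suc i))} {g = λ i → - coefficient ω₁ J i * s (suc i)} λ i → (solve 2 (λ a b → (:- :1) :* (a :* b) := (:- a) :* b) refl _ _)) ⟩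
      0# * s zero + sum (λ i → - coefficient ω₁ J i * s (suc i)) ∎
      where
      ω₁ : Ext n
      ω₁ K = ω (true ∷ K)

  opaque
    -- Removing the smallest index of J leaves such a K.
    coefficient-hits : ∀ {n r} (ω : Ext n) J → count J ≡ suc r → ∃ λ K → count K ≡ r × ∃ λ i → ∣ coefficient ω K i ∣ ≈ ∣ ω J ∣
    coefficient-hits ω (true ∷ J) e = false ∷ J , ℕ.suc-injective e , zero , refl
    coefficient-hits ω (false ∷ J) e with coefficient-hits (λ K → ω (false ∷ K)) J e
    ... | K , p , i , q = false ∷ K , p , suc i , q

  opaque
    factor-ι : ∀ {n} (d s t : Vect n) ω → (∀ i → t i * d i ≈ s i) → ∀ J → ι t (λ K → factor d K * ω K) J ≈ factor d J * ι s ω J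
    factor-ι d s t ω h []          = (solve 0 (:0 := :1 :* :0) refl)
    factor-ι d s t ω h (false ∷ J) = trans (+-congʳ (factor-ι (tail d) (tail s) (tail t) (λ K → ω (false ∷ K)) (λ i → h (suc i)) J))
      (trans (solve 5 (λ a b c d e → a :* b :+ c :* (d :* a :* e) := a :* b :+ a :* (c :* d :* e)) refl _ _ _ _ _) (trans (+-congˡ (*-congˡ (*-congʳ (h zero)))) (sym (distribˡ _ _ _))))
    factor-ι {suc n} d s t ω h (true ∷ J) = begin
      - ι (tail t) (λ K → d zero * F K * ω₁ K) J         ≈⟨ -‿cong (ι-cong (λ _ → refl) (λ K → (solve 3 (λ a b c → a :* b :* c := a :* (b :* c) :+ :0 :* :0) refl _ _ _)) J) ⟩
      - ι (tail t) (λ K → d zero * (F K * ω₁ K) + 0# * 0#) J   ≈⟨ -‿cong (ι-lin (tail t) (d zero) 0# (λ K → F K * ω₁ K) (λ _ → 0#) J) ⟩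
      - (d zero * ι (tail t) (λ K → F K * ω₁ K) J + 0# * ι (tail t) (λ _ → 0#) J)   ≈⟨ -‿cong (+-congʳ (*-congˡ (factor-ι (tail d) (tail s) (tail t) ω₁ (λ i → h (suc i)) J))) ⟩
      - (d zero * (F J * ι (tail s) ω₁ J) + 0# * ι (tail t) (λ _ → 0#) J)          ≈⟨ (solve 4 (λ a b c d → :- (a :* (b :* c) :+ :0 :* d) := a :* b :* (:- c)) refl _ _ _ _) ⟩
      d zero * F J * (- ι (tail s) ω₁ J)                 ∎
      where
      F : Vec Bool n → ℝ
      F = factor (tail d)
      ω₁ : Ext n
      ω₁ K = ω (true ∷ K)

-- Goodness of linear combinations of the coordinate functions

module Goodness (em : ExcludedMiddle 0ℓ) (reals : CompleteOrderedField) where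

  open Analysis em reals hiding (zero; ∣_∣; ContinuousAt)
  open OrderedField em reals
  open Numbers em reals
  open Calculus em reals
  open NullSets em reals
  open IntegerSolver commutativeRing
  open SetoidReasoning setoid

  basis : ∀ {n} → Fin n → Vector ℝ n
  basis zero    zero    = 1#
  basis zero    (suc j) = 0#
  basis (suc i) zero    = 0#
  basis (suc i) (suc j) = basis i j

  opaque
    basis-self : ∀ {n} (i : Fin n) → basis i i ≈ 1#
    basis-self zero    = refl
    basis-self (suc i) = basis-self i

  opaque
    sum-basis : ∀ {n} (i : Fin n) (h : Vector ℝ n) → sum (λ k → basis i k * h k) ≈ h i
    sum-basis zero    h = trans (+-congˡ (sum-0 {f = λ k → 0# * h (suc k)} λ k → zeroˡ _)) (solve 1 (λ a → :1 :* a :+ :0 := a) refl _)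
    sum-basis (suc i) h = trans (+-congˡ (sum-basis i (λ k → h (suc k)))) (solve 2 (λ a b → :0 :* a :+ b := b) refl _ _)

  dbl : ℕ → ℕ
  dbl zero    = zero
  dbl (suc n) = suc (suc (dbl n))

  opaque
    dbl-mono : ∀ {m n} → m ℕ.≤ n → dbl m ℕ.≤ dbl n
    dbl-mono z≤n     = z≤n
    dbl-mono (s≤s p) = s≤s (s≤s (dbl-mono p))

  -- This replaces a lower bound on the measure of A: meeting every dyadic cell of a fixed depth is
  -- what the mean value theorem can exploit, and its failure leaves a whole subcell free of A.
  HitAll : Pred ℝ 0ℓ → ℕ → ℝ → ℝ → Set
  HitAll A zero    u ℓ = ∃ λ x → In u ℓ x × A x
  HitAll A (suc s) u ℓ = HitAll A s u (½ * ℓ) × HitAll A s (u + ½ * ℓ) (½ * ℓ)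

  opaque
    hit-point : ∀ {A} s {u ℓ} → 0# ≤ ℓ → HitAll A s u ℓ → ∃ λ x → In u ℓ x × A x
    hit-point zero    0≤ℓ h = h
    hit-point {A} (suc s) 0≤ℓ (h , _) with hit-point {A} s (half≥0 0≤ℓ) h
    ... | x , x∈ , a = x , In-left 0≤ℓ x∈ , a

  opaque
    HitAll-coarser : ∀ {A s t u ℓ} → 0# ≤ ℓ → s ℕ.≤ t → HitAll A t u ℓ → HitAll A s u ℓ
    HitAll-coarser {A} {t = t} 0≤ℓ z≤n h = hit-point {A} t 0≤ℓ h
    HitAll-coarser {A} 0≤ℓ (s≤s p) (h , k) = HitAll-coarser {A} (half≥0 0≤ℓ) p h , HitAll-coarser {A} (half≥0 0≤ℓ) p k

  opaque
    HitAll-mono : ∀ {A B} s {u ℓ} → (∀ x → A x → B x) → HitAll A s u ℓ → HitAll B s u ℓ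
    HitAll-mono zero    sub (x , x∈ , a) = x , x∈ , sub x a
    HitAll-mono (suc s) sub (h , k) = HitAll-mono s sub h , HitAll-mono s sub k

  opaque
    HitAll-everywhere : ∀ {A} s {u ℓ} → 0# ≤ ℓ → (∀ x → In u ℓ x → A x) → HitAll A s u ℓ
    HitAll-everywhere zero {u} 0≤ℓ h = u , (≤-refl , by≤ 0≤ℓ (solve 2 (λ a b → a :+ b := a :+ b :+ :0) refl _ _)) , h u (≤-refl , by≤ 0≤ℓ (solve 2 (λ a b → a :+ b := a :+ b :+ :0) refl _ _))
    HitAll-everywhere (suc s) 0≤ℓ h = HitAll-everywhere s (half≥0 0≤ℓ) (λ x x∈ → h x (In-left 0≤ℓ x∈)) ,
      HitAll-everywhere s (half≥0 0≤ℓ) (λ x x∈ → h x (In-right 0≤ℓ x∈))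

  opaque
    hit-or-free : ∀ A s u ℓ → HitAll A s u ℓ ⊎ (∃ λ v → ∃ λ m → Sub u ℓ s v m × (∀ x → In v m x → ¬ A x))
    hit-or-free A zero u ℓ with lem (∃ λ x → In u ℓ x × A x)
    ... | inj₁ h = inj₁ h
    ... | inj₂ h = inj₂ (u , ℓ , here , λ x x∈ a → h (x , x∈ , a))
    hit-or-free A (suc s) u ℓ with hit-or-free A s u (½ * ℓ) | hit-or-free A s (u + ½ * ℓ) (½ * ℓ)
    ... | inj₁ h | inj₁ k = inj₁ (h , k)
    ... | inj₂ (v , m , p , q) | _ = inj₂ (v , m , left p , q)
    ... | inj₁ _ | inj₂ (v , m , p , q) = inj₂ (v , m , right p , q)

  -- Derivatives g 0 = f, …, g l of the coordinate functions on the cell [u₀, u₀ + ℓ₀].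
  record Curve (n : ℕ) : Set where
    field
      l          : ℕ
      g          : ℕ → Fin n → ℝ → ℝ
      u₀ ℓ₀ Λ μ  : ℝ
      0<ℓ₀       : 0# < ℓ₀
      ℓ₀≤1       : ℓ₀ ≤ 1#
      0<μ        : 0# < μ
      derivative : ∀ x → In u₀ ℓ₀ x → ∀ j → j ℕ.< l → ∀ i → Der (g j i) x (g (suc j) i x)
      bounded    : ∀ x → In u₀ ℓ₀ x → ∀ j → j ℕ.≤ l → ∀ i → ∣ g j i x ∣ ≤ Λ
      nondegenerate : ∀ (c : Vector ℝ n) → ∃ λ o → suc o ℕ.≤ l × (∀ x → In u₀ ℓ₀ x → ∀ (k : Fin n) → μ * ∣ c k ∣ ≤ ∣ sum (λ i → c i * g (suc o) i x) ∣)

  opaque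
    ^-pos : ∀ {x} n → 0# < x → 0# < x ^ n
    ^-pos zero    p = 0<1
    ^-pos (suc n) p = pos* p (^-pos n p)

  opaque
    ^-*-dist : ∀ x y n → (x * y) ^ n ≈ x ^ n * y ^ n
    ^-*-dist x y zero    = (solve 0 (:1 := :1 :* :1) refl)
    ^-*-dist x y (suc n) = trans (*-congˡ (^-*-dist x y n)) (solve 4 (λ a b c d → a :* b :* (c :* d) := a :* c :* (b :* d)) refl _ _ _ _)

  opaque
    ^-cong : ∀ {x y} n → x ≈ y → x ^ n ≈ y ^ n
    ^-cong zero    e = refl
    ^-cong (suc n) e = *-cong e (^-cong n e)

  opaque
    ^-≤1 : ∀ {x m n} → 0# ≤ x → x ≤ 1# → m ℕ.≤ n → x ^ n ≤ x ^ m
    ^-≤1 {n = zero}  p q z≤n = ≤-refl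
    ^-≤1 {x} {n = suc n} p q z≤n = ≤-trans (by≤ (*-nonNeg (^-nn n p) (sub≥0 q)) (solve 2 (λ a b → a :* b :+ b :* (:1 :- a) := b :+ :0) refl _ _)) (^-≤1 {x} {0} {n} p q z≤n)
    ^-≤1 {x} p q (s≤s r) = *-monoˡ x p (^-≤1 p q r)

  module Good {n : ℕ} (C : Curve n) where
    open Curve C

    comb : ℝ → Vector ℝ n → ℕ → ℝ → ℝ
    comb c₀ c zero    x = c₀ + sum (λ i → c i * g 0 i x)
    comb c₀ c (suc j) x = sum (λ i → c i * g (suc j) i x)

    opaque
      comb-der : ∀ c₀ c j → j ℕ.< l → ∀ x → In u₀ ℓ₀ x → Der (comb c₀ c j) x (comb c₀ c (suc j) x)
      comb-der c₀ c j j<l x x∈ = go j j<l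
        where
        terms : ∀ j → j ℕ.< l → Der (λ y → sum (λ i → c i * g j i y)) x (sum (λ i → c i * g (suc j) i x))
        terms j j<l = der-sum (λ i y → c i * g j i y) (λ i → c i * g (suc j) i x) (λ i → der-* {g j i} (c i) (derivative x x∈ j j<l i))
        go : ∀ j → j ℕ.< l → Der (comb c₀ c j) x (comb c₀ c (suc j) x)
        go zero    j<l = der-cong (+-identityˡ _) (der-+ {λ _ → c₀} {λ y → sum (λ i → c i * g 0 i y)} (der-const c₀ x) (terms 0 j<l))
        go (suc j) j<l = terms (suc j) j<l

    -- From order j to order j + 1, `small-derivative` uses two points at least ℓ/2 apart, in
    -- quarters of length ℓ/4 on which order j is at most K j t (4/ℓ)^j. Their difference quotient
    -- is at most 4 · 4^j K j t / ℓ^(j + 1). As each order passes to quarters, order j takes the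
    -- depth `dbl j`.
    K : ℕ → ℝ
    K zero    = 1#
    K (suc j) = 4# * (4# ^ j * K j)

    opaque
      1≤4 : 1# ≤ 4#
      1≤4 = by≤ (0≤1 ⊞ 0≤1 ⊞ 0≤1) (solve 0 (:1 :+ (:1 :+ :1 :+ :1) := :1 :+ :1 :+ (:1 :+ :1) :+ (:0 :+ :0 :+ :0)) refl)
      1≤4^ : ∀ j → 1# ≤ 4# ^ j
      1≤4^ zero    = ≤-refl
      1≤4^ (suc j) = ≤-trans (≤-reflexive (solve 0 (:1 := :1 :* :1) refl)) (*-mono 0≤1 1≤4 0≤1 (1≤4^ j))
      K≥0 : ∀ j → 0# ≤ K j
      K≥0 zero    = 0≤1
      K≥0 (suc j) = *-nonNeg (<⇒≤ 0<4) (*-nonNeg (≤-trans 0≤1 (1≤4^ j)) (K≥0 j))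
      K-suc : ∀ j → K j ≤ K (suc j)
      K-suc j = by≤ (*-monoʳ (K j) (K≥0 j) (*-mono 0≤1 1≤4 0≤1 (1≤4^ j))) (solve 2 (λ a b → a :+ (:1 :+ :1 :+ (:1 :+ :1)) :* b :* a := (:1 :+ :1 :+ (:1 :+ :1)) :* (b :* a) :+ :1 :* :1 :* a) refl _ _)
      K-mono : ∀ {i j} → i ℕ.≤ j → K i ≤ K j
      K-mono {zero} {zero} z≤n = ≤-refl
      K-mono {zero} {suc j} z≤n = ≤-trans (K-mono {0} {j} z≤n) (K-suc j)
      K-mono (s≤s {i} {j} p) = *-monoˡ 4# (<⇒≤ 0<4) (*-mono (≤-trans 0≤1 (1≤4^ i)) (4^-mono p) (K≥0 i) (K-mono p))
        where
        4^-mono : ∀ {i j} → i ℕ.≤ j → 4# ^ i ≤ 4# ^ j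
        4^-mono {j = j} z≤n = 1≤4^ j
        4^-mono (s≤s p) = *-monoˡ 4# (<⇒≤ 0<4) (4^-mono p)

    opaque
      quarter : ∀ ℓ → 4# * (½ * (½ * ℓ)) ≈ ℓ
      quarter ℓ = trans (solve 2 (λ a b → (:1 :+ :1 :+ (:1 :+ :1)) :* (a :* (a :* b)) := a :* (a :* b) :+ a :* (a :* b) :+ (a :* (a :* b) :+ a :* (a :* b))) refl _ _) (trans (+-cong (½-eq (½ * ℓ)) (½-eq (½ * ℓ))) (½-eq ℓ))
      -- The mean value theorem between the first and the last quarter of the cell.
      small-derivative : ∀ c₀ c t b j {u ℓ} → b ℕ.+ j ℕ.≤ l → u₀ ≤ u → u + ℓ ≤ u₀ + ℓ₀ → 0# < ℓ →
        HitAll (λ x → ∣ comb c₀ c b x ∣ ≤ t) (dbl j) u ℓ →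
        ∃ λ ξ → In u ℓ ξ × ∣ comb c₀ c (b ℕ.+ j) ξ ∣ * ℓ ^ j ≤ K j * t
      small-derivative c₀ c t b zero {u} {ℓ} _ _ _ _ (x , x∈ , p) = x , x∈ ,
        ≡.subst (λ i → ∣ comb c₀ c i x ∣ * 1# ≤ 1# * t) (≡.sym (ℕ.+-identityʳ b)) (by≤ p (solve 2 (λ a b → a :* :1 :+ b := :1 :* b :+ a) refl _ _))
      small-derivative c₀ c t b (suc j) {u} {ℓ} b+j≤l u₀≤u u+ℓ≤ 0<ℓ ((h₀ , _) , (_ , h₃)) =
        combine (small-derivative c₀ c t b j b+j≤l′ u₀≤u q₀ 0<q h₀)
                (small-derivative c₀ c t b j b+j≤l′ q₁ q₂ 0<q h₃)
        where
        q : ℝ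
        q = ½ * (½ * ℓ)
        0<q : 0# < q
        0<q = ½-pos (½-pos 0<ℓ)
        0≤ℓ : 0# ≤ ℓ
        0≤ℓ = <⇒≤ 0<ℓ
        b+j<l : b ℕ.+ j ℕ.< l
        b+j<l = ≡.subst (ℕ._≤ l) (ℕ.+-suc b j) b+j≤l
        b+j≤l′ : b ℕ.+ j ℕ.≤ l
        b+j≤l′ = ℕ.≤-trans (ℕ.n≤1+n _) b+j<l
        half : ½ * ℓ + ½ * ℓ ≈ ℓ
        half = ½-eq ℓ
        quart : q + q ≈ ½ * ℓ
        quart = ½-eq (½ * ℓ)
        q₀ : u + q ≤ u₀ + ℓ₀
        q₀ = ≤-trans (by≤ (<⇒≤ 0<q ⊞ <⇒≤ 0<q ⊞ <⇒≤ 0<q ⊞ ≤-reflexive quart ⊞ ≤-reflexive quart ⊞ ≤-reflexive half) (solve 3 (λ a b c → a :+ b :* (b :* c) :+ (b :* (b :* c) :+ b :* (b :* c) :+ b :* (b :* c) :+ b :* c :+ b :* c :+ c) := a :+ c :+ (:0 :+ :0 :+ :0 :+ (b :* (b :* c) :+ b :* (b :* c)) :+ (b :* (b :* c) :+ b :* (b :* c)) :+ (b :* c :+ b :* c))) refl _ _ _)) u+ℓ≤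
        q₁ : u₀ ≤ u + ½ * ℓ + q
        q₁ = ≤-trans u₀≤u (by≤ (half≥0 0≤ℓ ⊞ <⇒≤ 0<q) (solve 3 (λ a b c → a :+ (b :* c :+ b :* (b :* c)) := a :+ b :* c :+ b :* (b :* c) :+ (:0 :+ :0)) refl _ _ _))
        q₂ : u + ½ * ℓ + q + q ≤ u₀ + ℓ₀
        q₂ = ≤-trans (by≤ (≤-reflexive quart ⊞ ≤-reflexive half) (solve 3 (λ a b c → a :+ b :* c :+ b :* (b :* c) :+ b :* (b :* c) :+ (b :* c :+ c) := a :+ c :+ (b :* (b :* c) :+ b :* (b :* c) :+ (b :* c :+ b :* c))) refl _ _ _)) u+ℓ≤
        G : ℝ → ℝ
        G = comb c₀ c (b ℕ.+ j)
        G′ : ℝ → ℝ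
        G′ = comb c₀ c (suc (b ℕ.+ j))
        combine : (∃ λ ξ → In u q ξ × ∣ G ξ ∣ * q ^ j ≤ K j * t) → (∃ λ ξ → In (u + ½ * ℓ + q) q ξ × ∣ G ξ ∣ * q ^ j ≤ K j * t) →
          ∃ λ ξ → In u ℓ ξ × ∣ comb c₀ c (b ℕ.+ suc j) ξ ∣ * ℓ ^ suc j ≤ K (suc j) * t
        combine (x , (x₁ , x₂) , p) (y , (y₁ , y₂) , r) = finish (mean-value {G} {G′} x<y
            (λ z z₁ z₂ → comb-der c₀ c (b ℕ.+ j) b+j<l z (≤-trans u₀≤u (≤-trans x₁ z₁) , ≤-trans z₂ (≤-trans y₂ q₂))))
          where
          gap : ½ * ℓ ≤ y - x
          gap = by≤ (x₂ ⊞ y₁) (solve 5 (λ a b c d e → a :* b :+ (c :+ a :* (a :* b) :+ d) := d :- e :+ (e :+ (c :+ a :* b :+ a :* (a :* b)))) refl _ _ _ _ _)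
          x<y : x < y
          x<y = by< (<-≤-trans (½-pos 0<ℓ) gap) (solve 2 (λ a b → a :+ (b :- a) := b :+ :0) refl _ _)
          finish : (∃ λ ξ → x ≤ ξ × ξ ≤ y × G y - G x ≈ G′ ξ * (y - x)) →
            ∃ λ ξ → In u ℓ ξ × ∣ comb c₀ c (b ℕ.+ suc j) ξ ∣ * ℓ ^ suc j ≤ K (suc j) * t
          finish (ξ , ξ₁ , ξ₂ , e) = ξ , (≤-trans x₁ ξ₁ , ≤-trans ξ₂ (≤-trans y₂ (by≤ (≤-reflexive quart ⊞ ≤-reflexive half) (solve 3 (λ a b c → a :+ b :* c :+ b :* (b :* c) :+ b :* (b :* c) :+ (b :* c :+ c) := a :+ c :+ (b :* (b :* c) :+ b :* (b :* c) :+ (b :* c :+ b :* c))) refl _ _ _)))) ,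
            ≡.subst (λ i → ∣ comb c₀ c i ξ ∣ * ℓ ^ suc j ≤ K (suc j) * t) (≡.sym (ℕ.+-suc b j)) bound
            where
            D : ℝ
            D = ∣ G′ ξ ∣
            step : D * (½ * ℓ) ≤ ∣ G y ∣ + ∣ G x ∣
            step = ≤-trans (*-monoˡ D (∣∣≥0 _) (≤-trans gap (x≤∣x∣ (y - x)))) (≈≤ (trans (sym (∣∣-* _ _)) (∣∣-cong (sym e)))
              (≤≈ (∣∣-+ (G y) (- G x)) (+-congˡ (∣∣-neg (G x)))))
            power : ℓ ^ j ≈ 4# ^ j * q ^ j
            power = trans (^-cong j (sym (quarter ℓ))) (^-*-dist 4# q j)
            bound : D * (ℓ * ℓ ^ j) ≤ 4# * (4# ^ j * K j) * t
            bound = begin-≤ (begin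
                D * (ℓ * ℓ ^ j)                                 ≈⟨ *-congˡ (*-cong (sym half) power) ⟩
                D * ((½ * ℓ + ½ * ℓ) * (4# ^ j * q ^ j))        ≈⟨ (solve 5 (λ a b c d e → a :* ((b :* c :+ b :* c) :* (d :* e)) := (:1 :+ :1) :* d :* (a :* (b :* c) :* e)) refl _ _ _ _ _) ⟩
                2# * 4# ^ j * (D * (½ * ℓ) * q ^ j)             ∎)
              (*-monoˡ (2# * 4# ^ j) (*-nonNeg (<⇒≤ 0<2) (≤-trans 0≤1 (1≤4^ j)))
                (≤-trans (*-monoʳ (q ^ j) (^-nn j (<⇒≤ 0<q)) step) (≈≤ (distribʳ _ _ _) (r ⊞ p)))) (solve 3 (λ a b c → (:1 :+ :1) :* a :* (b :* c :+ b :* c) := (:1 :+ :1 :+ (:1 :+ :1)) :* (a :* b) :* c) refl _ _ _)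
              where
              begin-≤ : ∀ {a b c d} → a ≈ b → b ≤ c → c ≈ d → a ≤ d
              begin-≤ e p f = ≈≤ e (≤≈ p f)

    opaque
      -- Some derivative of the combination is at least μ ∣c k∣ on the whole cell by nondegeneracy,
      -- but small at one point by `small-derivative`.
      coefficient-small : ∀ c₀ c t {u ℓ} → 0# ≤ t → u₀ ≤ u → u + ℓ ≤ u₀ + ℓ₀ → 0# < ℓ →
        HitAll (λ x → ∣ comb c₀ c 0 x ∣ ≤ t) (dbl l) u ℓ →
        ∃ λ o → o ℕ.≤ l × (∀ k → ℓ ^ o * ∣ c k ∣ ≤ K l * t * inv 0<μ)
      coefficient-small c₀ c t {u} {ℓ} 0≤t u₀≤u u+ℓ≤ 0<ℓ h = from (nondegenerate c)
        where
        from : (∃ λ o → suc o ℕ.≤ l × (∀ x → In u₀ ℓ₀ x → ∀ k → μ * ∣ c k ∣ ≤ ∣ comb c₀ c (suc o) x ∣)) →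
          ∃ λ o → o ℕ.≤ l × (∀ k → ℓ ^ o * ∣ c k ∣ ≤ K l * t * inv 0<μ)
        from (o , o<l , low) = suc o , o<l , from′ (small-derivative c₀ c t 0 (suc o) o<l u₀≤u u+ℓ≤ 0<ℓ
            (HitAll-coarser {λ x → ∣ comb c₀ c 0 x ∣ ≤ t} (<⇒≤ 0<ℓ) (dbl-mono o<l) h))
          where
          from′ : (∃ λ ξ → In u ℓ ξ × ∣ comb c₀ c (suc o) ξ ∣ * ℓ ^ suc o ≤ K (suc o) * t) → ∀ k → ℓ ^ suc o * ∣ c k ∣ ≤ K l * t * inv 0<μ
          from′ (ξ , (p , q) , b) k = *-cancelʳ-≤ μ 0<μ (≤-trans (≈≤ (solve 4 (λ a b c d → a :* b :* c :* d := d :* c :* (a :* b)) refl _ _ _ _) (*-monoʳ _ (^-nn (suc o) (<⇒≤ 0<ℓ)) (low ξ (≤-trans u₀≤u p , ≤-trans q u+ℓ≤) k)))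
            (≤-trans b (≤≈ (*-monoʳ t 0≤t (K-mono o<l)) (sym (trans (*-assoc _ _ _) (trans (*-congˡ (trans (*-comm _ _) (inv-eq 0<μ))) (*-identityʳ _)))))))

    -- `M d` bounds the derivative d orders below the one that controls the coefficients, in units
    -- of t over a power of ℓ. At the top the coefficients themselves are used. Each order further
    -- down adds the small value at one point, at most `K l`, and twice the previous bound for
    -- moving by at most 2ℓ.
    M : ℕ → ℝ
    M zero    = fromℕ n * (Λ * (K l * inv 0<μ))
    M (suc d) = K l + 2# * M d

    opaque
      Λ≥0 : Fin n → 0# ≤ Λ
      Λ≥0 i = ≤-trans (∣∣≥0 _) (bounded u₀ (≤-refl , by≤ (<⇒≤ 0<ℓ₀) (solve 2 (λ a b → a :+ b := a :+ b :+ :0) refl _ _)) 0 z≤n i)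
      M≥0 : ∀ d → 0# ≤ M d
      M≥0 (suc d) = nn+ (K≥0 l) (*-nonNeg (<⇒≤ 0<2) (M≥0 d))
      M≥0 zero = go n (λ i → Λ≥0 i)
        where
        go : ∀ n → (Fin n → 0# ≤ Λ) → 0# ≤ fromℕ n * (Λ * (K l * inv 0<μ))
        go zero    h = ≤-reflexive (solve 3 (λ a b c → :0 := :0 :* (a :* (b :* c))) refl _ _ _)
        go (suc n) h = *-nonNeg (fromℕ≥0 (suc n)) (*-nonNeg (h zero) (*-nonNeg (K≥0 l) (inv≥0 0<μ)))
      M-suc : ∀ d → M d ≤ M (suc d)
      M-suc d = by≤ (K≥0 l ⊞ M≥0 d) (solve 2 (λ a b → a :+ (b :+ a) := b :+ (:1 :+ :1) :* a :+ (:0 :+ :0)) refl _ _)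
      M-mono : ∀ {d e} → d ℕ.≤ e → M d ≤ M e
      M-mono {zero} {zero} z≤n = ≤-refl
      M-mono {zero} {suc e} z≤n = ≤-trans (M-mono {0} {e} z≤n) (M-suc e)
      M-mono (s≤s p) = ≤-refl ⊞ *-monoˡ 2# (<⇒≤ 0<2) (M-mono p)
      sum-small : ∀ (c : Vector ℝ n) o t {ℓ} j → 0# ≤ ℓ ^ o → j ℕ.≤ l → (∀ k → ℓ ^ o * ∣ c k ∣ ≤ K l * t * inv 0<μ) →
        ∀ x → In u₀ ℓ₀ x → ∣ sum (λ i → c i * g j i x) ∣ * ℓ ^ o ≤ M 0 * t
      sum-small c o t {ℓ} j 0≤X j≤l small x x∈ = ≈≤ (begin
          ∣ sum (λ i → c i * g j i x) ∣ * X            ≈⟨ *-congˡ (sym (∣∣-pos 0≤X)) ⟩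
          ∣ sum (λ i → c i * g j i x) ∣ * ∣ X ∣        ≈⟨ sym (∣∣-* _ _) ⟩
          ∣ sum (λ i → c i * g j i x) * X ∣            ≈⟨ ∣∣-cong (*-comm _ _) ⟩
          ∣ X * sum (λ i → c i * g j i x) ∣            ≈⟨ ∣∣-cong (sym (sum-* X (λ i → c i * g j i x))) ⟩
          ∣ sum (λ i → X * (c i * g j i x)) ∣          ∎)
        (≤≈ (∣sum∣≤ {f = λ i → X * (c i * g j i x)} {c = K l * t * inv 0<μ * Λ} term) (solve 5 (λ a b c d e → a :* (b :* c :* d :* e) := a :* (e :* (b :* d)) :* c) refl _ _ _ _ _))
        where
        X : ℝ
        X = ℓ ^ o
        term : ∀ i → ∣ X * (c i * g j i x) ∣ ≤ K l * t * inv 0<μ * Λ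
        term i = ≈≤ (begin
            ∣ X * (c i * g j i x) ∣                ≈⟨ ∣∣-cong (sym (*-assoc _ _ _)) ⟩
            ∣ X * c i * g j i x ∣                  ≈⟨ ∣∣-* _ _ ⟩
            ∣ X * c i ∣ * ∣ g j i x ∣              ≈⟨ *-congʳ (trans (∣∣-* _ _) (*-congʳ (∣∣-pos 0≤X))) ⟩
            X * ∣ c i ∣ * ∣ g j i x ∣              ∎)
          (*-mono (*-nonNeg 0≤X (∣∣≥0 _)) (small i) (∣∣≥0 _) (bounded x x∈ j j≤l i))

      -- Goodness in the sense of Kleinbock and Margulis, with dyadic cells in place of measures:
      -- the order supplied by nondegeneracy bounds the coefficients, and the bound descends through
      -- the lower orders to the function. The conclusion reaches a cell of up to twice the length,
      -- so that smallness on a half passes to the parent in `not-small-child`.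
      good : ∀ c₀ c t {u ℓ u′ ℓ′} → 0# ≤ t → 0# < ℓ → u₀ ≤ u′ → u′ + ℓ′ ≤ u₀ + ℓ₀ → u′ ≤ u → u + ℓ ≤ u′ + ℓ′ → ℓ′ ≤ 2# * ℓ →
        HitAll (λ x → ∣ comb c₀ c 0 x ∣ ≤ t) (dbl l) u ℓ → ∀ x → In u′ ℓ′ x → ∣ comb c₀ c 0 x ∣ ≤ M l * t
      good c₀ c t {u} {ℓ} {u′} {ℓ′} 0≤t 0<ℓ u₀≤u′ u′+ℓ′≤ u′≤u u+ℓ≤ ℓ′≤ h x x∈ = top (coefficient-order (nondegenerate c))
        where
        0≤ℓ : 0# ≤ ℓ
        0≤ℓ = <⇒≤ 0<ℓ
        u₀≤u : u₀ ≤ u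
        u₀≤u = ≤-trans u₀≤u′ u′≤u
        u+ℓ≤₀ : u + ℓ ≤ u₀ + ℓ₀
        u+ℓ≤₀ = ≤-trans u+ℓ≤ u′+ℓ′≤
        inside : ∀ {x} → In u′ ℓ′ x → In u₀ ℓ₀ x
        inside (p , q) = ≤-trans u₀≤u′ p , ≤-trans q u′+ℓ′≤
        point : ∀ j → j ℕ.≤ l → ∃ λ ξ → In u ℓ ξ × ∣ comb c₀ c j ξ ∣ * ℓ ^ j ≤ K j * t
        point j j≤l = small-derivative c₀ c t 0 j j≤l u₀≤u u+ℓ≤₀ 0<ℓ (HitAll-coarser {λ x → ∣ comb c₀ c 0 x ∣ ≤ t} 0≤ℓ (dbl-mono j≤l) h)
        coefficient-order : (∃ λ o → suc o ℕ.≤ l × (∀ x → In u₀ ℓ₀ x → ∀ k → μ * ∣ c k ∣ ≤ ∣ comb c₀ c (suc o) x ∣)) →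
          ∃ λ o → suc o ℕ.≤ l × (∀ k → ℓ ^ suc o * ∣ c k ∣ ≤ K l * t * inv 0<μ)
        coefficient-order (o , o<l , low) = o , o<l , from (point (suc o) o<l)
          where
          from : (∃ λ ξ → In u ℓ ξ × ∣ comb c₀ c (suc o) ξ ∣ * ℓ ^ suc o ≤ K (suc o) * t) → ∀ k → ℓ ^ suc o * ∣ c k ∣ ≤ K l * t * inv 0<μ
          from (ξ , (p , q) , b) k = *-cancelʳ-≤ μ 0<μ (≤-trans (≈≤ (solve 4 (λ a b c d → a :* b :* c :* d := d :* c :* (a :* b)) refl _ _ _ _) (*-monoʳ _ (^-nn (suc o) 0≤ℓ) (low ξ (≤-trans u₀≤u p , ≤-trans q u+ℓ≤₀) k)))
            (≤-trans b (≤≈ (*-monoʳ t 0≤t (K-mono o<l)) (sym (trans (*-assoc _ _ _) (trans (*-congˡ (trans (*-comm _ _) (inv-eq 0<μ))) (*-identityʳ _)))))))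
        top : (∃ λ o → suc o ℕ.≤ l × (∀ k → ℓ ^ suc o * ∣ c k ∣ ≤ K l * t * inv 0<μ)) → ∣ comb c₀ c 0 x ∣ ≤ M l * t
        top (o , o<l , small) = ≤-trans (≈≤ (sym (*-identityʳ _)) (descend (suc o) 0 (ℕ.+-identityʳ (suc o)) x x∈)) (*-monoʳ t 0≤t (M-mono o<l))
          where
          descend : ∀ d j → d ℕ.+ j ≡ suc o → ∀ x → In u′ ℓ′ x → ∣ comb c₀ c j x ∣ * ℓ ^ j ≤ M d * t
          descend zero .(suc o) ≡.refl x x∈ = sum-small c (suc o) t (suc o) (^-nn (suc o) 0≤ℓ) o<l small x (inside x∈)
          descend (suc d) j e x x∈ = from (point j j≤l)
            where
            j<l : j ℕ.< l
            j<l = ℕ.≤-trans (≡.subst (suc j ℕ.≤_) e (s≤s (ℕ.m≤n+m j d))) o<l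
            j≤l : j ℕ.≤ l
            j≤l = ℕ.≤-trans (ℕ.n≤1+n j) j<l
            0<X : 0# < ℓ ^ suc j
            0<X = ^-pos (suc j) 0<ℓ
            B : ℝ
            B = M d * t * inv 0<X
            bound : ∀ y → u′ ≤ y → y ≤ u′ + ℓ′ → ∣ comb c₀ c (suc j) y ∣ ≤ B
            bound y p q = *-cancelʳ-≤ (ℓ ^ suc j) 0<X (≤≈ (descend d (suc j) (≡.trans (ℕ.+-suc d j) e) y (p , q))
              (sym (trans (*-assoc _ _ _) (trans (*-congˡ (trans (*-comm _ _) (inv-eq 0<X))) (*-identityʳ _)))))
            from : (∃ λ ξ → In u ℓ ξ × ∣ comb c₀ c j ξ ∣ * ℓ ^ j ≤ K j * t) → ∣ comb c₀ c j x ∣ * ℓ ^ j ≤ M (suc d) * t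
            from (ξ , (p , q) , b) = ≤-trans (*-monoʳ (ℓ ^ j) (^-nn j 0≤ℓ) move) (≤≈ (≈≤ (distribʳ _ _ _) (≤-trans b (*-monoʳ t 0≤t (K-mono j≤l)) ⊞ ≤-refl)) (begin
                K l * t + B * (2# * ℓ) * ℓ ^ j                    ≈⟨ (solve 6 (λ a b c d e f → a :* b :+ c :* b :* d :* ((:1 :+ :1) :* e) :* f := a :* b :+ (:1 :+ :1) :* (c :* b) :* (e :* f :* d)) refl _ _ _ _ _ _) ⟩
                K l * t + 2# * (M d * t) * (ℓ ^ suc j * inv 0<X)  ≈⟨ +-congˡ (*-congˡ (inv-eq 0<X)) ⟩
                K l * t + 2# * (M d * t) * 1#                     ≈⟨ (solve 3 (λ a b c → a :* b :+ (:1 :+ :1) :* (c :* b) :* :1 := (a :+ (:1 :+ :1) :* c) :* b) refl _ _ _) ⟩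
                (K l + 2# * M d) * t                              ∎))
              where
              ξ∈ : In u′ ℓ′ ξ
              ξ∈ = ≤-trans u′≤u p , ≤-trans q u+ℓ≤
              B≥0 : 0# ≤ B
              B≥0 = *-nonNeg (*-nonNeg (M≥0 d) 0≤t) (inv≥0 0<X)
              move : ∣ comb c₀ c j x ∣ ≤ ∣ comb c₀ c j ξ ∣ + B * (2# * ℓ)
              move = ≤-trans (≈≤ (∣∣-cong (solve 2 (λ a b → a := b :+ (a :- b)) refl _ _)) (∣∣-+ (comb c₀ c j ξ) (comb c₀ c j x - comb c₀ c j ξ)))
                (≤-refl ⊞ ≤-trans (lipschitz {comb c₀ c j} {comb c₀ c (suc j)} (λ y r s → comb-der c₀ c j j<l y (inside (r , s))) bound
                  (proj₁ ξ∈) (proj₂ ξ∈) (proj₁ x∈) (proj₂ x∈)) (*-monoˡ B B≥0 (≤-trans (∣-∣-In x∈ ξ∈) ℓ′≤)))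

      -- On a fixed cell the powers of ℓ in `coefficient-small` are constants, and c₀ is recovered
      -- from the value at u. The dependence of B on the cell is harmless, since the exponents of
      -- the lattice are chosen after it.
      coefficients-bounded : ∀ {u ℓ} → u₀ ≤ u → u + ℓ ≤ u₀ + ℓ₀ → 0# < ℓ → ∃ λ B → 0# < B × (∀ c₀ c t → 0# ≤ t →
        (∀ x → In u ℓ x → ∣ comb c₀ c 0 x ∣ ≤ t) → ∣ c₀ ∣ ≤ B * t × (∀ k → ∣ c k ∣ ≤ B * t))
      coefficients-bounded {u} {ℓ} u₀≤u u+ℓ≤ 0<ℓ = B , 0<B , λ c₀ c t 0≤t h →
          from c₀ c t 0≤t h (coefficient-small c₀ c t 0≤t u₀≤u u+ℓ≤ 0<ℓ (HitAll-everywhere (dbl l) (<⇒≤ 0<ℓ) h))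
        where
        X Y B : ℝ
        X = ℓ ^ l
        0<X : 0# < X
        0<X = ^-pos l 0<ℓ
        Y = K l * inv 0<μ
        B = 1# + (Y + M 0) * inv 0<X
        0≤Y : 0# ≤ Y
        0≤Y = *-nonNeg (K≥0 l) (inv≥0 0<μ)
        0<B : 0# < B
        0<B = pos+nn 0<1 (*-nonNeg (nn+ 0≤Y (M≥0 0)) (inv≥0 0<X))
        ℓ≤1 : ℓ ≤ 1#
        ℓ≤1 = ≤-trans (by≤ (u₀≤u ⊞ u+ℓ≤) (solve 4 (λ a b c d → a :+ (b :+ (c :+ d)) := d :+ (c :+ (b :+ a))) refl _ _ _ _)) ℓ₀≤1
        cancel : ∀ {z w} → X * z ≤ w → z ≤ w * inv 0<X
        cancel {z} {w} p = *-cancelʳ-≤ X 0<X (≤-trans (≤-reflexive (*-comm _ _)) (≤≈ p (sym (trans (*-assoc _ _ _) (trans (*-congˡ (trans (*-comm _ _) (inv-eq 0<X))) (*-identityʳ _))))))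
        from : ∀ c₀ c t → 0# ≤ t → (∀ x → In u ℓ x → ∣ comb c₀ c 0 x ∣ ≤ t) → (∃ λ o → o ℕ.≤ l × (∀ k → ℓ ^ o * ∣ c k ∣ ≤ K l * t * inv 0<μ)) →
          ∣ c₀ ∣ ≤ B * t × (∀ k → ∣ c k ∣ ≤ B * t)
        from c₀ c t 0≤t h (o , o≤l , small) = bound₀ , λ k → ≤-trans (cancel (small′ k))
            (by≤ (0≤t ⊞ *-nonNeg (*-nonNeg (M≥0 0) (inv≥0 0<X)) 0≤t) (solve 6 (λ a b c d e f → a :* b :* c :* d :+ (b :+ e :* (f :* (a :* c)) :* d :* b) := (:1 :+ (a :* c :+ e :* (f :* (a :* c))) :* d) :* b :+ (:0 :+ :0)) refl _ _ _ _ _ _))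
          where
          small′ : ∀ k → ℓ ^ l * ∣ c k ∣ ≤ K l * t * inv 0<μ
          small′ k = ≤-trans (*-monoʳ _ (∣∣≥0 _) (^-≤1 (<⇒≤ 0<ℓ) ℓ≤1 o≤l)) (small k)
          u∈ : In u ℓ u
          u∈ = ≤-refl , by≤ (<⇒≤ 0<ℓ) (solve 2 (λ a b → a :+ b := a :+ b :+ :0) refl _ _)
          Σ₀ : ℝ
          Σ₀ = sum (λ i → c i * g 0 i u)
          Σ₀≤ : ∣ Σ₀ ∣ ≤ M 0 * t * inv 0<X
          Σ₀≤ = cancel (≈≤ (*-comm _ _) (sum-small c l t 0 (<⇒≤ 0<X) z≤n small′ u (≤-trans u₀≤u ≤-refl , ≤-trans (by≤ (<⇒≤ 0<ℓ) (solve 2 (λ a b → a :+ b := a :+ b :+ :0) refl _ _)) u+ℓ≤)))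
          bound₀ : ∣ c₀ ∣ ≤ B * t
          bound₀ = ≤-trans (≈≤ (∣∣-cong (solve 2 (λ a b → a := a :+ b :- b) refl _ _)) (≤-trans (∣∣-+ (c₀ + Σ₀) (- Σ₀)) (h u u∈ ⊞ ≈≤ (∣∣-neg _) Σ₀≤)))
            (by≤ (*-nonNeg (*-nonNeg 0≤Y (inv≥0 0<X)) 0≤t) (solve 6 (λ a b c d e f → a :+ b :* (c :* (d :* e)) :* a :* f :+ d :* e :* f :* a := (:1 :+ (d :* e :+ b :* (c :* (d :* e))) :* f) :* a :+ :0) refl _ _ _ _ _ _))

      -- Taking t = 0 and starting from order 1, zeros in all these subcells would produce a zero of
      -- the higher derivative of the i-th function that nondegeneracy bounds below by μ.
      derivative-not-everywhere-zero : ∀ i {u ℓ} → u₀ ≤ u → u + ℓ ≤ u₀ + ℓ₀ → 0# < ℓ → ¬ HitAll (λ x → g 1 i x ≈ 0#) (dbl l) u ℓ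
      derivative-not-everywhere-zero i {u} {ℓ} u₀≤u u+ℓ≤ 0<ℓ h = from (nondegenerate (basis i))
        where
        from : (∃ λ o → suc o ℕ.≤ l × (∀ x → In u₀ ℓ₀ x → ∀ k → μ * ∣ basis i k ∣ ≤ ∣ comb 0# (basis i) (suc o) x ∣)) → ⊥
        from (o , o<l , low) = from′ (small-derivative 0# (basis i) 0# 1 o o<l u₀≤u u+ℓ≤ 0<ℓ
            (HitAll-coarser {λ x → ∣ comb 0# (basis i) 1 x ∣ ≤ 0#} (<⇒≤ 0<ℓ) (dbl-mono (ℕ.≤-trans (ℕ.n≤1+n o) o<l))
              (HitAll-mono (dbl l) (λ x e → ≤-reflexive (trans (∣∣-cong (trans (sum-basis i (λ k → g 1 k x)) e)) ∣0∣)) h)))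
          where
          from′ : (∃ λ ξ → In u ℓ ξ × ∣ comb 0# (basis i) (suc o) ξ ∣ * ℓ ^ o ≤ K o * 0#) → ⊥
          from′ (ξ , (p , q) , b) = <⇒≱ (pos* (pos* 0<μ 0<1) (^-pos o 0<ℓ)) (≤-trans
            (*-monoʳ _ (^-nn o (<⇒≤ 0<ℓ)) (≤-trans (≤-reflexive (*-congˡ (sym (trans (∣∣-cong (basis-self i)) (∣∣-pos 0≤1)))))
              (low ξ (≤-trans u₀≤u p , ≤-trans q u+ℓ≤) i))) (≤≈ b (zeroʳ _)))

-- Quantitative nondivergence for an abstract system of subspaces

module Nondivergence (em : ExcludedMiddle 0ℓ) (reals : CompleteOrderedField) where

  open Analysis em reals hiding (zero; ∣_∣; ContinuousAt)
  open OrderedField em reals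
  open Numbers em reals
  open Calculus em reals
  open NullSets em reals
  open Goodness em reals
  open IntegerSolver commutativeRing

  -- The setting of the Kleinbock–Margulis argument: P stands for the rational
  -- subspaces, Lt V x t says that the covolume of V at x is less than t, and
  -- V ⋈ W that one of V and W is a proper subspace of the other.
  record System : Set₁ where
    infix 4 _⋈_
    field
      P         : Set
      Lt        : P → ℝ → ℝ → Set
      _⋈_       : P → P → Set
      rank      : P → ℕ
      Primitive : P → Set
      u₀ ℓ₀ c δ : ℝ
      s         : ℕ
      Lt-mono   : ∀ {V x t t′} → t ≤ t′ → Lt V x t → Lt V x t′
      ⋈-rank    : ∀ {V W} → V ⋈ W → rank V ≢ rank W
      saturate : ∀ V S → All (V ⋈_) S → ∃ λ W → Primitive W × All (W ⋈_) S × (∀ x t → Lt V x t → Lt W x t)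
      0<c       : 0# < c
      c≤1       : c ≤ 1#
      0<δ       : 0# < δ
      good      : ∀ V {t u ℓ u′ ℓ′} → 0# < t → 0# < ℓ → u₀ ≤ u′ → u′ + ℓ′ ≤ u₀ + ℓ₀ → u′ ≤ u → u + ℓ ≤ u′ + ℓ′ → ℓ′ ≤ 2# * ℓ →
                  HitAll (λ x → Lt V x (c * t)) s u ℓ → ∀ x → In u′ ℓ′ x → Lt V x t
      steady    : ∀ V {x y t} → 0# < t → In u₀ ℓ₀ x → In u₀ ℓ₀ y → ∣ x - y ∣ ≤ δ → Lt V x t → Lt V y (2# * t)

  module _ (Σ₀ : System) where
    open System Σ₀

    -- A marking is a flag extending S whose new members have covolume between ε and 1 at x, and to
    -- which no compatible subspace of covolume below ε can be added.
    data Marked (ε : ℝ) (S : List P) (x : ℝ) : Set where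
      stop : (∀ V → All (V ⋈_) S → ¬ Lt V x ε) → Marked ε S x
      more : ∀ V → Primitive V → All (V ⋈_) S → Lt V x 1# → ¬ Lt V x ε → Marked ε (V ∷ S) x → Marked ε S x

    Small : P → ℝ → ℝ → ℝ → Set
    Small V t u ℓ = ∀ x → In u ℓ x → Lt V x t

    -- Members of a flag have different ranks, so each new one uses up a rank in the list R. This
    -- bounds the length of flags and drives the induction in `marked-cover`.
    Free : ℕ → List P → Set
    Free r S = ∃ λ (R : Fin r → ℕ) → ∀ V → All (V ⋈_) S → ∃ λ i → R i ≡ rank V

    -- One factor c is lost in passing to the half on which a subspace V is first small, and one
    -- more in finding a subcell of depth s on which V is never too small. For the other subspaces
    -- the second loss is one factor per level, s in all. The exponent s + 2 covers both c² and c^(s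
    -- + 1).
    κ : ℝ
    κ = c ^ suc (suc s)

    opaque
      Free-0 : ∀ {S V} → Free 0 S → ¬ All (V ⋈_) S
      Free-0 {V = V} (R , h) p with () ← proj₁ (h V p)

      Free-suc : ∀ {r S V} → Free (suc r) S → All (V ⋈_) S → Free r (V ∷ S)
      Free-suc {r} {S} {V} (R , h) p = from (h V p)
        where
        from : (∃ λ i → R i ≡ rank V) → Free r (V ∷ S)
        from (i , e) = (λ j → R (punchIn i j)) , λ { W (W⋈V ∷ q) → used W W⋈V (h W q) }
          where
          used : ∀ W → W ⋈ V → (∃ λ j → R j ≡ rank W) → ∃ λ j → R (punchIn i j) ≡ rank W
          used W W⋈V (j , f) = punchOut i≢j , ≡.trans (≡.cong R (Fin.punchIn-punchOut i≢j)) f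
            where
            i≢j : i ≢ j
            i≢j i≡j = ⋈-rank W⋈V (≡.trans (≡.sym f) (≡.trans (≡.cong R (≡.sym i≡j)) e))

      c^>0 : ∀ n → 0# < c ^ n
      c^>0 n = ^-pos n 0<c

      not-small-child : ∀ {V t u ℓ v m} → 0# < t → 0# < m → u₀ ≤ u → u + ℓ ≤ u₀ + ℓ₀ → u ≤ v → v + m ≤ u + ℓ → ℓ ≤ 2# * m →
        ¬ Small V t u ℓ → ¬ Small V (c * t) v m
      not-small-child {V} 0<t 0<m p q r w d ¬small small = ¬small (good V 0<t 0<m p q r w d (HitAll-everywhere s (<⇒≤ 0<m) small))

      double : ∀ ℓ → ℓ ≤ 2# * (½ * ℓ)
      double ℓ = ≤-reflexive (trans (sym (½-eq ℓ)) (solve 2 (λ a b → a :* b :+ a :* b := (:1 :+ :1) :* (a :* b)) refl _ _))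

      not-small-sub : ∀ {V t u ℓ d v m} → 0# < t → 0# < ℓ → u₀ ≤ u → u + ℓ ≤ u₀ + ℓ₀ → Sub u ℓ d v m → ¬ Small V t u ℓ → ¬ Small V (c ^ d * t) v m
      not-small-sub {V} {t} 0<t 0<ℓ p q here ¬small small = ¬small (λ x x∈ → Lt-mono (≤-reflexive (solve 1 (λ a → :1 :* a := a) refl _)) (small x x∈))
      not-small-sub {V} {t} {u} {ℓ} {suc d} 0<t 0<ℓ p q (left σ) ¬small small =
        not-small-sub {V} (pos* 0<c 0<t) (½-pos 0<ℓ) p (≤-trans (left≤ u (<⇒≤ 0<ℓ)) q) σ
          (not-small-child {V} 0<t (½-pos 0<ℓ) p q ≤-refl (left≤ u (<⇒≤ 0<ℓ)) (double ℓ) ¬small)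
          (λ x x∈ → Lt-mono (≤-reflexive (solve 3 (λ a b c → a :* b :* c := b :* (a :* c)) refl _ _ _)) (small x x∈))
      not-small-sub {V} {t} {u} {ℓ} {suc d} 0<t 0<ℓ p q (right σ) ¬small small =
        not-small-sub {V} (pos* 0<c 0<t) (½-pos 0<ℓ) (≤-trans p u≤) (≈≤ (right≈ u ℓ) q) σ
          (not-small-child {V} 0<t (½-pos 0<ℓ) p q u≤ (≤-reflexive (right≈ u ℓ)) (double ℓ) ¬small)
          (λ x x∈ → Lt-mono (≤-reflexive (solve 3 (λ a b c → a :* b :* c := b :* (a :* c)) refl _ _ _)) (small x x∈))
        where
        u≤ : u ≤ u + ½ * ℓ
        u≤ = by≤ (half≥0 (<⇒≤ 0<ℓ)) (solve 3 (λ a b c → a :+ b :* c := a :+ b :* c :+ :0) refl _ _ _)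

      free-subcell : ∀ {V t u ℓ} → 0# < t → 0# < ℓ → u₀ ≤ u → u + ℓ ≤ u₀ + ℓ₀ → ¬ Small V t u ℓ →
        ∃ λ v → ∃ λ m → Sub u ℓ s v m × (∀ x → In v m x → ¬ Lt V x (c * t))
      free-subcell {V} {t} {u} {ℓ} 0<t 0<ℓ p q ¬small with hit-or-free (λ x → Lt V x (c * t)) s u ℓ
      ... | inj₁ h = ⊥-elim (¬small (good V 0<t 0<ℓ p q ≤-refl ≤-refl (by≤ (<⇒≤ 0<ℓ) (solve 1 (λ a → a :+ a := (:1 :+ :1) :* a :+ :0) refl _)) h))
      ... | inj₂ f = f

      -- Descend through the dyadic tree to the first cell on which some V compatible with S is
      -- small; on a subcell of fixed relative size V is not too small, and one goes on with V ∷ S.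
      marked-cover : ∀ r S → Free r S → ∀ e {ε θ u ℓ} → 0# < ε → 0# < θ → θ ≤ 1# → 2# * ε ≤ κ ^ r * θ →
        0# < ℓ → u₀ ≤ u → u + ℓ ≤ u₀ + ℓ₀ → h2 e * ℓ ≤ δ → (∀ V → All (V ⋈_) S → ¬ Small V θ u ℓ) →
        Cov (λ x → ¬ Marked ε S x) u ℓ (1# - h2 (r ℕ.* s))
      marked-cover r S free zero {ε} {θ} {u} {ℓ} 0<ε 0<θ θ≤1 2ε≤ 0<ℓ p q fine H =
        -- The cell is now no longer than δ: a subspace below ε at x would be below 2ε ≤ θ on the
        -- whole cell, against `H`.
        none (by≤ (h2≤1 (r ℕ.* s)) (solve 1 (λ a → :0 :+ :1 := :1 :- a :+ a) refl _)) λ x x∈ ¬marked → ¬marked (stop λ V compatible lt →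
          H V compatible (λ y y∈ → Lt-mono 2ε≤θ (steady V 0<ε (inside x∈) (inside y∈) (≤-trans (∣-∣-In x∈ y∈) (≈≤ (solve 1 (λ a → a := :1 :* a) refl _) fine)) lt)))
        where
        κ^≤1 : ∀ r → κ ^ r ≤ 1#
        κ^≤1 r = ^-≤1 {κ} {0} {r} (<⇒≤ (c^>0 (suc (suc s)))) (^-≤1 {c} {0} {suc (suc s)} (<⇒≤ 0<c) c≤1 z≤n) z≤n
        2ε≤θ : 2# * ε ≤ θ
        2ε≤θ = ≤-trans 2ε≤ (by≤ (*-monoʳ θ (<⇒≤ 0<θ) (κ^≤1 r)) (solve 2 (λ a b → a :* b :+ :1 :* b := b :+ a :* b) refl _ _))
        inside : ∀ {x} → In u ℓ x → In u₀ ℓ₀ x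
        inside (a , b) = ≤-trans p a , ≤-trans b q
      marked-cover r S free (suc e) {ε} {θ} {u} {ℓ} 0<ε 0<θ θ≤1 2ε≤ 0<ℓ p q fine H = split
          (child ≤-refl (left≤ u (<⇒≤ 0<ℓ))) (child (by≤ (half≥0 (<⇒≤ 0<ℓ)) (solve 3 (λ a b c → a :+ b :* c := a :+ b :* c :+ :0) refl _ _ _)) (≤-reflexive (right≈ u ℓ))) ≤-refl
        where
        m : ℝ
        m = ½ * ℓ
        0<m : 0# < m
        0<m = ½-pos 0<ℓ
        fine′ : h2 e * m ≤ δ
        fine′ = ≤-trans (≤-reflexive (solve 3 (λ a b c → a :* (b :* c) := b :* a :* c) refl _ _ _)) fine
        child : ∀ {v} → u ≤ v → v + m ≤ u + ℓ → Cov (λ x → ¬ Marked ε S x) v m (1# - h2 (r ℕ.* s))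
        child {v} u≤v v≤ = decide (lem (∃ λ V → All (V ⋈_) S × Small V θ v m))
          where
          p′ : u₀ ≤ v
          p′ = ≤-trans p u≤v
          q′ : v + m ≤ u₀ + ℓ₀
          q′ = ≤-trans v≤ q
          decide : (∃ λ V → All (V ⋈_) S × Small V θ v m) ⊎ ¬ (∃ λ V → All (V ⋈_) S × Small V θ v m) →
            Cov (λ x → ¬ Marked ε S x) v m (1# - h2 (r ℕ.* s))
          decide (inj₂ ∄) = marked-cover r S free e 0<ε 0<θ θ≤1 2ε≤ 0<m p′ q′ fine′ (λ V compatible small → ∄ (V , compatible , small))
          decide (inj₁ (V₀ , V₀⋈S , small₀)) = choose r free 2ε≤ (saturate V₀ S V₀⋈S)
            where
            choose : ∀ r → Free r S → 2# * ε ≤ κ ^ r * θ →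
              (∃ λ V → Primitive V × All (V ⋈_) S × (∀ x t → Lt V₀ x t → Lt V x t)) → Cov (λ x → ¬ Marked ε S x) v m (1# - h2 (r ℕ.* s))
            choose zero free′ _ (V , _ , V⋈S , _) = ⊥-elim (Free-0 free′ V⋈S)
            choose (suc r′) free′ 2ε≤′ (V , prim , V⋈S , V₀⇒V) = deepen (free-subcell {V} (pos* 0<c 0<θ) 0<m p′ q′ (not-small V V⋈S))
              where
              not-small : ∀ V → All (V ⋈_) S → ¬ Small V (c * θ) v m
              not-small V V⋈S = not-small-child {V} 0<θ 0<m p q u≤v v≤ (double ℓ) (H V V⋈S)
              deepen : (∃ λ w → ∃ λ k → Sub v m s w k × (∀ x → In w k x → ¬ Lt V x (c * (c * θ)))) →
                Cov (λ x → ¬ Marked ε S x) v m (1# - h2 (s ℕ.+ r′ ℕ.* s))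
              deepen (w , k , σ , big) = Cov-mono {_} {λ x → ¬ Marked ε S x} (<⇒≤ 0<m) (λ _ _ a → a)
                (≤-reflexive (trans (solve 2 (λ a b → :1 :- a :* (:1 :- (:1 :- b)) := :1 :- a :* b) refl _ _) (+-congˡ (-‿cong (sym (h2-+ s (r′ ℕ.* s)))))))
                (Sub⇒Cov {λ x → ¬ Marked ε S x} σ (by≤ (<⇒≤ (h2>0 (r′ ℕ.* s))) (solve 1 (λ a → :1 :- a :+ a := :1 :+ :0) refl _)) inner)
                where
                bounds : 0# ≤ k × v ≤ w × w + k ≤ v + m
                bounds = Sub-≤ (<⇒≤ 0<m) σ
                0<k : 0# < k
                0<k = <-≤-trans (pos* (h2>0 s) 0<m) (≤-reflexive (sym (Sub-width σ)))
                θ′ : ℝ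
                θ′ = κ * θ
                0<κ : 0# < κ
                0<κ = c^>0 (suc (suc s))
                κ≤1 : κ ≤ 1#
                κ≤1 = ^-≤1 {c} {0} {suc (suc s)} (<⇒≤ 0<c) c≤1 z≤n
                θ′≤ccθ : θ′ ≤ c * (c * θ)
                θ′≤ccθ = by≤ (*-monoʳ θ (<⇒≤ 0<θ) (*-monoˡ c (<⇒≤ 0<c) (*-monoˡ c (<⇒≤ 0<c) (^-≤1 {c} {0} {s} (<⇒≤ 0<c) c≤1 z≤n)))) (solve 3 (λ a b c → a :* (a :* b) :* c :+ a :* (a :* :1) :* c := a :* (a :* c) :+ a :* (a :* b) :* c) refl _ _ _)
                θ′≤c^scθ : θ′ ≤ c ^ s * (c * θ)
                θ′≤c^scθ = by≤ (*-monoʳ (c ^ s * (c * θ)) (<⇒≤ (pos* (c^>0 s) (pos* 0<c 0<θ))) c≤1) (solve 3 (λ a b c → a :* (a :* b) :* c :+ :1 :* (b :* (a :* c)) := b :* (a :* c) :+ a :* (b :* (a :* c))) refl _ _ _)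
                2ε≤θ′ : 2# * ε ≤ κ ^ r′ * θ′
                2ε≤θ′ = ≤≈ 2ε≤′ (solve 4 (λ a b c d → a :* (a :* b) :* c :* d := c :* (a :* (a :* b) :* d)) refl _ _ _ _)
                ε≤ccθ : ε ≤ c * (c * θ)
                ε≤ccθ = ≤-trans (by≤ (<⇒≤ 0<ε) (solve 1 (λ a → a :+ a := (:1 :+ :1) :* a :+ :0) refl _)) (≤-trans 2ε≤θ′ (≤-trans
                  (by≤ (*-monoʳ θ′ (<⇒≤ (pos* 0<κ 0<θ)) (^-≤1 {κ} {0} {r′} (<⇒≤ 0<κ) κ≤1 z≤n)) (solve 4 (λ a b c d → a :* (b :* (b :* c) :* d) :+ :1 :* (b :* (b :* c) :* d) := b :* (b :* c) :* d :+ a :* (b :* (b :* c) :* d)) refl _ _ _ _)) θ′≤ccθ))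
                inner : Cov (λ x → ¬ Marked ε S x) w k (1# - h2 (r′ ℕ.* s))
                inner = Cov-mono {_} {λ x → ¬ Marked ε (V ∷ S) x} (proj₁ bounds)
                  (λ x x∈ ¬marked marked → ¬marked (more V prim V⋈S
                    (Lt-mono θ≤1 (V₀⇒V x θ (small₀ x (Sub-In (<⇒≤ 0<m) σ x∈)))) (λ lt → big x x∈ (Lt-mono ε≤ccθ lt)) marked)) ≤-refl
                  (marked-cover r′ (V ∷ S) (Free-suc free′ V⋈S) e 0<ε (pos* 0<κ 0<θ)
                    (≤-trans (by≤ (*-monoʳ θ (<⇒≤ 0<θ) κ≤1) (solve 3 (λ a b c → a :* (a :* b) :* c :+ :1 :* c := c :+ a :* (a :* b) :* c) refl _ _ _)) θ≤1) 2ε≤θ′ 0<k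
                    (≤-trans p′ (proj₁ (proj₂ bounds))) (≤-trans (proj₂ (proj₂ bounds)) q′)
                    (≤-trans (*-monoˡ (h2 e) (<⇒≤ (h2>0 e)) (≤-trans (≤-reflexive (Sub-width σ)) (by≤ (*-monoʳ m (<⇒≤ 0<m) (h2≤1 s)) (solve 3 (λ a b c → a :* (b :* c) :+ :1 :* (b :* c) := b :* c :+ a :* (b :* c)) refl _ _ _)))) fine′)
                    (λ { W (W⋈V ∷ W⋈S) smallW → not-small-sub {W} (pos* 0<c 0<θ) 0<m p′ q′ σ (not-small W W⋈S)
                      (λ x x∈ → Lt-mono θ′≤c^scθ (smallW x x∈)) }))

-- Lattices along the curve and their short vectors

module TiltedLattice (em : ExcludedMiddle 0ℓ) (reals : CompleteOrderedField) where

  open Analysis em reals hiding (zero; ∣_∣; ContinuousAt)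
  open OrderedField em reals
  open Numbers em reals
  open Calculus em reals
  open NullSets em reals
  open Exterior em reals
  open Goodness em reals
  open Nondivergence em reals
  open IntegerSolver commutativeRing
  private module ≈R = SetoidReasoning setoid
  open ≈R using (begin_; step-≈-⟩; step-≈-⟨; _∎)

  data AllInt {n} : ∀ {r} → Vec (Vect n) r → Set where
    []  : AllInt []
    _∷_ : ∀ {r v} {vs : Vec (Vect n) r} → IntV v → AllInt vs → AllInt (v ∷ vs)

  opaque
    wedges-int : ∀ {n r} {vs : Vec (Vect n) r} → AllInt vs → ∀ J → IsInt (wedges vs J)
    wedges-int []       J = unit-int J
    wedges-int (p ∷ ps) J = wedge-int p (wedges-int ps) J

  opaque
    nonzero-coordinate : ∀ {n} {ω : Ext n} → ¬ (∀ J → ω J ≈ 0#) → ∃ λ J → ¬ (ω J ≈ 0#)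
    nonzero-coordinate h = by-contradiction λ none → h λ J → by-contradiction λ ne → none (J , ne)

  opaque
    count-full : ∀ {n} (J : Vec Bool n) → count J ≡ n → J ≡ full
    count-full []          e = ≡.refl
    count-full (true ∷ J)  e = ≡.cong (true ∷_) (count-full J (ℕ.suc-injective e))
    count-full (false ∷ J) e = ⊥-elim (ℕ.1+n≰n (≡.subst (ℕ._≤ _) e (count≤ J)))

  opaque
    unit-bound : ∀ {n} (J : Vec Bool n) → ∣ unit J ∣ ≤ 1#
    unit-bound []          = ≤-reflexive (∣∣-pos 0≤1)
    unit-bound (false ∷ J) = unit-bound J
    unit-bound (true ∷ J)  = ≈≤ ∣0∣ 0≤1

  module Constants {n : ℕ} (C : Curve (suc n)) where
    open Curve C
    open Good C

    opaque
      0<Mˢ : 0# < 1# + M l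
      0<Mˢ = pos+nn 0<1 (M≥0 l)

    -- `κ₀` is the constant `κ` of the systems below. `ε₀` satisfies 2 ε₀ = κ₀^(n + 1), as
    -- `marked-cover` demands for n + 1 possible ranks and θ = 1. `ε₁` absorbs the factor n + 2 ≤
    -- 2^(n + 2) of `wedge-bound`. They depend on the curve alone and not on the tilt or the scales,
    -- which makes the covering radius uniform.
    κ₀ ε₀ ε₁ : ℝ
    κ₀ = inv 0<Mˢ ^ suc (suc (dbl l))
    ε₀ = ½ * κ₀ ^ suc n
    ε₁ = ½ * (ε₀ * inv (p2>0 (suc (suc n))))

    opaque
      c≤1 : inv 0<Mˢ ≤ 1#
      c≤1 = by≤ (≤-reflexive (inv-eq 0<Mˢ) ⊞ *-nonNeg (M≥0 l) (inv≥0 0<Mˢ)) (solve 2 (λ a b → a :+ (:1 :+ b :* a) := :1 :+ ((:1 :+ b) :* a :+ :0)) refl _ _)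

      0<κ₀ : 0# < κ₀
      0<κ₀ = ^-pos (suc (suc (dbl l))) (inv>0 0<Mˢ)

      0<ε₀ : 0# < ε₀
      0<ε₀ = ½-pos (^-pos (suc n) 0<κ₀)

      ε₀≤1 : ε₀ ≤ 1#
      ε₀≤1 = ≤-trans (*-monoˡ ½ (<⇒≤ 0<½) (^-≤1 {κ₀} {0} {suc n} (<⇒≤ 0<κ₀)
        (^-≤1 {inv 0<Mˢ} {0} {suc (suc (dbl l))} (inv≥0 0<Mˢ) c≤1 z≤n) z≤n)) (≤-trans (≤-reflexive (*-identityʳ ½)) ½≤1)

      0<ε₁ : 0# < ε₁
      0<ε₁ = ½-pos (pos* 0<ε₀ (inv>0 (p2>0 (suc (suc n)))))

  module Lattice {n : ℕ} (C : Curve (suc n)) (s : Vect n) (k : ℕ) (e : Fin (suc n) → ℕ) where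
    open Curve C
    open Good C
    open Constants C

    f : Fin (suc n) → ℝ → ℝ
    f = g 0

    -- The curve in the coordinates dual to the tilt x₀ ↦ x₀ + ⟨ s , (x₁, …, xₙ) ⟩.
    fᵗ : Fin (suc n) → ℝ → ℝ
    fᵗ zero    x = f zero x
    fᵗ (suc i) x = f (suc i) x - s i * f zero x

    w : Vect (suc n)
    w i = h2 (e i)

    -- The factor `p2 (e i)` undoes the scaling by `w i`, which is applied before the shear.
    shift : ℝ → Vect (suc n)
    shift x i = p2 k * p2 (e i) * fᵗ i x

    D : Vect (suc (suc n))
    D zero    = p2 k
    D (suc i) = w i

    scaled : Ext (suc (suc n)) → Ext (suc (suc n))
    scaled ω K = factor D K * tilt s ω K

    -- The action on multivectors of the matrix sending an integer vector (a₀, …) to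
    -- 2ᵏ (a₀ + a₁ f₁(x) + …) followed by its tilted coordinates divided by 2^eᵢ.
    act : ℝ → Ext (suc (suc n)) → Ext (suc (suc n))
    act x ω = shear (shift x) (scaled ω)

    actᵥ : ℝ → Vect (suc (suc n)) → Vect (suc (suc n))
    actᵥ x a = shearᵥ (shift x) (λ i → D i * tiltᵥ s a i)

    opaque
      act-cong : ∀ x {ω η} → ω ≐ η → act x ω ≐ act x η
      act-cong x h = shear-cong (λ _ → refl) (λ K → *-congˡ (tilt-cong s h K))

      act-wedge : ∀ x a ω → act x (wedge a ω) ≐ wedge (actᵥ x a) (act x ω)
      act-wedge x a ω J = trans (shear-cong (λ _ → refl) (λ K → trans (*-congˡ (tilt-wedge s a ω K)) (factor-wedge D (tiltᵥ s a) (tilt s ω) K)) J)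
        (shear-wedge (shift x) (λ i → D i * tiltᵥ s a i) (scaled ω) J)

      act-unit : ∀ x → act x unit ≐ unit
      act-unit x J = trans (shear-cong (λ _ → refl) (λ K → trans (*-congˡ (tilt-unit s K)) (factor-unit D K)) J) (shear-unit (shift x) J)

      tilt-* : ∀ m ω J → tilt s (λ K → m * ω K) J ≈ m * tilt s ω J
      tilt-* m ω J = trans (tilt-cong s {λ K → m * ω K} {λ K → m * ω K + 0# * ω K} (λ K → (solve 2 (λ a b → a :* b := a :* b :+ :0 :* b) refl _ _)) J) (lin J)
        where
        lin : ∀ J → tilt s (λ K → m * ω K + 0# * ω K) J ≈ m * tilt s ω J
        lin (b ∷ J) = trans (shear-lin s m 0# (λ K → ω (b ∷ K)) (λ K → ω (b ∷ K)) J) (solve 2 (λ a b → a :* b :+ :0 :* b := a :* b) refl _ _)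

      act-* : ∀ x m ω J → act x (λ K → m * ω K) J ≈ m * act x ω J
      act-* x m ω J = trans (shear-cong {ω = scaled (λ K → m * ω K)} {η = λ K → m * scaled ω K + 0# * scaled ω K} (λ _ → refl)
        (λ K → trans (*-congˡ (tilt-* m ω K)) (solve 3 (λ a b c → a :* (b :* c) := b :* (a :* c) :+ :0 :* (a :* c)) refl _ _ _)) J) (trans (shear-lin (shift x) m 0# (scaled ω) (scaled ω) J) (solve 2 (λ a b → a :* b :+ :0 :* b := a :* b) refl _ _))

      tilt-homogeneous : ∀ {r} (vs : Vec (Vect (suc (suc n))) r) → Homogeneous r (tilt s (wedges vs))
      tilt-homogeneous vs J h = trans (commutes vs J) (wedges-homogeneous (Vec.map (tiltᵥ s) vs) J h)
        where
        commutes : ∀ {r} (vs : Vec (Vect (suc (suc n))) r) → tilt s (wedges vs) ≐ wedges (Vec.map (tiltᵥ s) vs)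
        commutes []       J = tilt-unit s J
        commutes (v ∷ vs) J = trans (tilt-wedge s v (wedges vs) J) (wedge-cong (λ _ → refl) (commutes vs) J)

    -- Turns coefficients with respect to the tilted functions `fᵗ` into coefficients with respect
    -- to `f`, for which goodness is known. That s is constant is used here.
    toComb : ℝ → Vect (suc n) → Vect (suc n)
    toComb Q γ zero    = Q * (γ zero - sum (λ i → γ (suc i) * s i))
    toComb Q γ (suc i) = Q * γ (suc i)

    opaque
      comb-shift : ∀ c₀ Q γ x → c₀ + Q * sum (λ i → γ i * fᵗ i x) ≈ comb c₀ (toComb Q γ) 0 x
      comb-shift c₀ Q γ x = +-congˡ (begin
        Q * (γ zero * f zero x + sum (λ i → γ (suc i) * (f (suc i) x - s i * f zero x)))
          ≈⟨ *-congˡ (+-congˡ (sum-cong {f = λ i → γ (suc i) * (f (suc i) x - s i * f zero x)}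
               {g = λ i → γ (suc i) * f (suc i) x + - f zero x * (γ (suc i) * s i)} (λ i → (solve 4 (λ a b c d → a :* (b :- c :* d) := a :* b :+ (:- d) :* (a :* c)) refl _ _ _ _)))) ⟩
        Q * (γ zero * f zero x + sum (λ i → γ (suc i) * f (suc i) x + - f zero x * (γ (suc i) * s i)))
          ≈⟨ *-congˡ (+-congˡ (trans (sum-+ (λ i → γ (suc i) * f (suc i) x) (λ i → - f zero x * (γ (suc i) * s i)))
               (+-congˡ (sum-* (- f zero x) (λ i → γ (suc i) * s i))))) ⟩
        Q * (γ zero * f zero x + (sum (λ i → γ (suc i) * f (suc i) x) + - f zero x * sum (λ i → γ (suc i) * s i)))
          ≈⟨ (solve 5 (λ a b c d e → a :* (b :* c :+ (d :+ (:- c) :* e)) := a :* (b :- e) :* c :+ a :* d) refl _ _ _ _ _) ⟩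
        Q * (γ zero - sum (λ i → γ (suc i) * s i)) * f zero x + Q * sum (λ i → γ (suc i) * f (suc i) x)
          ≈⟨ +-congˡ (sym (sum-* Q (λ i → γ (suc i) * f (suc i) x))) ⟩
        Q * (γ zero - sum (λ i → γ (suc i) * s i)) * f zero x + sum (λ i → Q * (γ (suc i) * f (suc i) x))
          ≈⟨ +-congˡ (sum-cong {f = λ i → Q * (γ (suc i) * f (suc i) x)} {g = λ i → Q * γ (suc i) * f (suc i) x} (λ i → (solve 3 (λ a b c → a :* (b :* c) := a :* b :* c) refl _ _ _))) ⟩
        Q * (γ zero - sum (λ i → γ (suc i) * s i)) * f zero x + sum (λ i → Q * γ (suc i) * f (suc i) x) ∎)

    bottom : Ext (suc (suc n)) → Ext (suc n)
    bottom ω K = tilt s ω (false ∷ K)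

    opaque
      -- As functions of x the coordinates of a transformed multivector are combinations of 1 and
      -- the coordinate functions, so that goodness applies to covolumes.
      act-true : ∀ ω K x → act x ω (true ∷ K) ≈
        comb (p2 k * factor w K * tilt s ω (true ∷ K)) (toComb (p2 k * factor w K) (coefficient (bottom ω) K)) 0 x
      act-true ω K x = trans (+-congˡ (begin
          ι (shift x) (λ L → factor w L * bottom ω L) K
            ≈⟨ factor-ι w (λ i → p2 k * fᵗ i x) (shift x) (bottom ω) rescale K ⟩
          factor w K * ι (λ i → p2 k * fᵗ i x) (bottom ω) K
            ≈⟨ *-congˡ (ι-coefficient (λ i → p2 k * fᵗ i x) (bottom ω) K) ⟩
          factor w K * sum (λ i → γ i * (p2 k * fᵗ i x))
            ≈⟨ *-congˡ (trans (sum-cong {f = λ i → γ i * (p2 k * fᵗ i x)} {g = λ i → p2 k * (γ i * fᵗ i x)} (λ i → (solve 3 (λ a b c → a :* (b :* c) := b :* (a :* c)) refl _ _ _)))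
                 (sum-* (p2 k) (λ i → γ i * fᵗ i x))) ⟩
          factor w K * (p2 k * sum (λ i → γ i * fᵗ i x))
            ≈⟨ (solve 5 (λ a b c d e → a :* (b :* (c :* d :+ e)) := b :* a :* (c :* d :+ e)) refl _ _ _ _ _) ⟩
          p2 k * factor w K * sum (λ i → γ i * fᵗ i x) ∎))
        (comb-shift (p2 k * factor w K * tilt s ω (true ∷ K)) (p2 k * factor w K) γ x)
        where
        γ : Vect (suc n)
        γ = coefficient (bottom ω) K
        rescale : ∀ i → shift x i * w i ≈ p2 k * fᵗ i x
        rescale i = begin
          p2 k * p2 (e i) * fᵗ i x * h2 (e i)      ≈⟨ (solve 4 (λ a b c d → a :* b :* c :* d := a :* c :* (b :* d)) refl _ _ _ _) ⟩
          p2 k * fᵗ i x * (p2 (e i) * h2 (e i))    ≈⟨ *-congˡ (p2-h2 (e i)) ⟩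
          p2 k * fᵗ i x * 1#                       ≈⟨ *-identityʳ _ ⟩
          p2 k * fᵗ i x                            ∎

      act-comb : ∀ ω J → ∃ λ c₀ → ∃ λ c → ∀ x → act x ω J ≈ comb c₀ c 0 x
      act-comb ω (true ∷ K)  = p2 k * factor w K * tilt s ω (true ∷ K) , toComb (p2 k * factor w K) (coefficient (bottom ω) K) , act-true ω K
      act-comb ω (false ∷ K) = scaled ω (false ∷ K) , (λ _ → 0#) , λ x →
        sym (trans (+-congˡ (sum-0 {f = λ i → 0# * g 0 i x} (λ i → zeroˡ _))) (solve 2 (λ a b → a :* b :+ :0 := a :* b) refl _ _))

    -- Covolumes are measured by the largest coordinate, because each coordinate is a single
    -- combination of the functions of the curve.
    Below : Ext (suc (suc n)) → ℝ → ℝ → Set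
    Below ω x t = ∀ J → ∣ act x ω J ∣ < t

    -- Rank and basis of a rational subspace other than 0 and the whole space.
    record Subspace : Set where
      constructor subspace
      field
        {size}  : ℕ
        vectors : Vec (Vect (suc (suc n))) size
        integral : AllInt vectors
        nonzero : ¬ (∀ J → wedges vectors J ≈ 0#)
        size≥1  : 1 ℕ.≤ size
        size≤   : size ℕ.≤ suc n
    open Subspace

    _⋈_ : Subspace → Subspace → Set
    V ⋈ W = (size V ℕ.< size W × vectors V ⊑ vectors W) ⊎ (size W ℕ.< size V × vectors W ⊑ vectors V)

    -- The usual notion, that the vectors generate all integer points of their span, is replaced by
    -- the comparison of covolumes that it would imply. This spares the structure theory of
    -- sublattices.
    Primitive : Subspace → Set
    Primitive U = ∀ (ws : Vec (Vect (suc (suc n))) (size U)) → AllInt ws → ¬ (∀ J → wedges ws J ≈ 0#) → ws ⊑ vectors U →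
      ∀ x t → Below (wedges ws) x t → Below (wedges (vectors U)) x t

    opaque
      -- Integral systems of this rank in the span have proportional products, so it is enough to
      -- minimise one coordinate J that does not vanish; its absolute value is a natural number. The
      -- factor from the minimal product to any other one then has absolute value at least 1.
      saturation : ∀ V → ∃ λ U → Primitive U × size U ≡ size V × vectors U ⊑ vectors V × vectors V ⊑ vectors U
      saturation V = from (nonzero-coordinate (nonzero V))
        where
        ω : Ext (suc (suc n))
        ω = wedges (vectors V)
        Candidate : Vec Bool (suc (suc n)) → ℕ → Set
        Candidate J K = ∃ λ (us : Vec (Vect (suc (suc n))) (size V)) → AllInt us × ¬ (∀ J → wedges us J ≈ 0#) × us ⊑ vectors V ×
          ∣ wedges us J ∣ ≈ fromℕ K
        from : (∃ λ J → ¬ (ω J ≈ 0#)) → ∃ λ U → Primitive U × size U ≡ size V × vectors U ⊑ vectors V × vectors V ⊑ vectors U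
        from (J , ωJ≉0) = from′ (int-∣∣ (wedges-int (integral V) J))
          where
          from′ : (∃ λ K → ∣ ω J ∣ ≈ fromℕ K) → ∃ λ U → Primitive U × size U ≡ size V × vectors U ⊑ vectors V × vectors V ⊑ vectors U
          from′ (K₀ , e₀) = from″ (least (Candidate J) (K₀ , vectors V , integral V , nonzero V , ⊑-refl (vectors V) , e₀))
            where
            from″ : (∃ λ K → Candidate J K × (∀ L → Candidate J L → K ℕ.≤ L)) →
              ∃ λ U → Primitive U × size U ≡ size V × vectors U ⊑ vectors V × vectors V ⊑ vectors U
            from″ (K , (us , int , us≉0 , us⊑ , eK) , minimal) =
              subspace us int us≉0 (size≥1 V) (size≤ V) , prim , ≡.refl , us⊑ , back (vectors V) (λ v v∈ → v∈)
              where
              η : Ext (suc (suc n))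
              η = wedges us
              m : ∃ λ m → η ≐ (λ L → m * ω L)
              m = proportional us⊑
              ηJ≉0 : ¬ (η J ≈ 0#)
              ηJ≉0 z = us≉0 λ L → trans (proj₂ m L) (trans (*-congʳ m≈0) (zeroˡ _))
                where
                m≈0 : proj₁ m ≈ 0#
                m≈0 = no-zero-divisors (trans (*-comm _ _) (trans (sym (proj₂ m J)) z)) ωJ≉0
              back : ∀ {r} (ws : Vec (Vect (suc (suc n))) r) → (∀ v → Span ws v → Span (vectors V) v) → ws ⊑ us
              back []       h = []
              back (v ∷ ws) h = wedge≈0⇒Span us us≉0 (λ L → trans (wedge-cong (λ _ → refl) (proj₂ m) L)
                (trans (wedge-*ʳ v (proj₁ m) ω L) (trans (*-congˡ (Span⇒wedge≈0 (vectors V) (h v (Span-here v ws)) L)) (zeroʳ _)))) ∷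
                back ws (λ x x∈ → h x (Span-there ws x∈))
              prim : ∀ (ws : Vec (Vect (suc (suc n))) (size V)) → AllInt ws → ¬ (∀ J → wedges ws J ≈ 0#) → ws ⊑ us →
                ∀ x t → Below (wedges ws) x t → Below η x t
              prim ws intw ws≉0 ws⊑ x t below L = compare (proportional ws⊑) (int-∣∣ (wedges-int intw J))
                where
                compare : (∃ λ m → wedges ws ≐ (λ L → m * η L)) → (∃ λ K → ∣ wedges ws J ∣ ≈ fromℕ K) → ∣ act x η L ∣ < t
                compare (m′ , e′) (K′ , eK′) = ≤-<-trans (≤-trans (by≤ (*-monoʳ _ (∣∣≥0 (act x η L)) 1≤m′) (solve 2 (λ a b → a :+ b :* a := b :* a :+ :1 :* a) refl _ _))
                    (≤-reflexive (trans (sym (∣∣-* _ _)) (∣∣-cong (trans (sym (act-* x m′ η L)) (act-cong x (λ I → sym (e′ I)) L)))))) (below L)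
                  where
                  1≤m′ : 1# ≤ ∣ m′ ∣
                  1≤m′ = *-cancelʳ-≤ ∣ η J ∣ (≉0⇒∣∣>0 ηJ≉0) (≈≤ (*-identityˡ _) (≈≤ eK (≤-trans
                    (fromℕ-mono (minimal K′ (ws , intw , ws≉0 , ⊑-trans ws⊑ us⊑ , eK′)))
                    (≤-reflexive (trans (sym eK′) (trans (∣∣-cong (e′ J)) (∣∣-* _ _)))))))

      -- A nonzero integral multivector has a coordinate of absolute value at least 1, and the
      -- inverse tilt enlarges coordinates by at most 1 + n σ. If all tilted coordinates were
      -- smaller, undoing the tilt would give at most ½.
      tilt-large : ∀ {σ} → 0# ≤ σ → (∀ i → ∣ s i ∣ ≤ σ) → (0<T : 0# < 1# + fromℕ n * σ) → ∀ {ω} → (∀ J → IsInt (ω J)) → ¬ (∀ J → ω J ≈ 0#) →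
        ∃ λ J → ½ * inv 0<T ≤ ∣ tilt s ω J ∣
      tilt-large {σ} 0≤σ s≤ 0<T {ω} int ω≉0 = from (nonzero-coordinate ω≉0)
        where
        τ : ℝ
        τ = ½ * inv 0<T
        from : (∃ λ J → ¬ (ω J ≈ 0#)) → ∃ λ J → τ ≤ ∣ tilt s ω J ∣
        from (J , ωJ≉0) = by-contradiction λ none → <⇒≱ ½<1 (≤-trans (int≥1 (int J) ωJ≉0)
          (≈≤ (∣∣-cong (sym (tilt-inverse s ω J))) (≤≈ (tilt-bound (λ i → - s i) (tilt s ω) 0≤σ (half≥0 (inv≥0 0<T))
            (λ i → ≈≤ (∣∣-neg (s i)) (s≤ i)) (λ L → <⇒≤ (≰⇒> λ p → none (L , p))) J)
            (trans (solve 4 (λ a b c d → (:1 :+ a :* b) :* (c :* d) := c :* ((:1 :+ a :* b) :* d)) refl _ _ _ _) (trans (*-congˡ (inv-eq 0<T)) (*-identityʳ ½))))))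

    module _ {σ : ℝ} (0≤σ : 0# ≤ σ) (s≤ : ∀ i → ∣ s i ∣ ≤ σ) where

      0<T : 0# < 1# + fromℕ n * σ
      0<T = pos+nn 0<1 (*-nonNeg (fromℕ≥0 n) 0≤σ)

      opaque
        1≤l : 1 ℕ.≤ l
        1≤l = from (nondegenerate (λ _ → 0#))
          where
          from : (∃ λ o → suc o ℕ.≤ l × (∀ x → In u₀ ℓ₀ x → ∀ (k : Fin (suc n)) → μ * ∣ 0# ∣ ≤ ∣ sum (λ i → 0# * g (suc o) i x) ∣)) → 1 ℕ.≤ l
          from (o , p , _) = ℕ.≤-trans (s≤s z≤n) p

        f-lipschitz : ∀ i {x y} → In u₀ ℓ₀ x → In u₀ ℓ₀ y → ∣ f i y - f i x ∣ ≤ Λ * ∣ y - x ∣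
        f-lipschitz i (p , q) (r , t) = lipschitz {f i} {g 1 i} (λ x a b → derivative x (a , b) 0 1≤l i) (λ x a b → bounded x (a , b) 1 1≤l i) p q r t

        fᵗ-lipschitz : ∀ i {x y} → In u₀ ℓ₀ x → In u₀ ℓ₀ y → ∣ fᵗ i y - fᵗ i x ∣ ≤ (1# + σ) * Λ * ∣ y - x ∣
        fᵗ-lipschitz zero {x} {y} x∈ y∈ = ≤-trans (f-lipschitz zero x∈ y∈) (by≤ (*-nonNeg (*-nonNeg 0≤σ (Λ≥0 zero)) (∣∣≥0 (y - x))) (solve 3 (λ a b c → a :* b :+ c :* a :* b := (:1 :+ c) :* a :* b :+ :0) refl _ _ _))
        fᵗ-lipschitz (suc i) {x} {y} x∈ y∈ = ≈≤ (∣∣-cong (solve 5 (λ a b c d e → a :- b :* c :- (d :- b :* e) := a :- d :- b :* (c :- e)) refl _ _ _ _ _)) (≤-trans (∣∣-+ (f (suc i) y - f (suc i) x) (- (s i * (f zero y - f zero x))))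
          (≤≈ (f-lipschitz (suc i) x∈ y∈ ⊞ ≈≤ (trans (∣∣-neg _) (∣∣-* _ _)) (*-mono (∣∣≥0 _) (s≤ i) (∣∣≥0 _) (f-lipschitz zero x∈ y∈))) (solve 3 (λ a b c → a :* b :+ c :* (a :* b) := (:1 :+ c) :* a :* b) refl _ _ _)))

      E A : ℝ
      E = sum (λ i → p2 (e i))
      A = p2 k * E * ((1# + σ) * Λ)

      opaque
        0≤A : 0# ≤ A
        0≤A = *-nonNeg (*-nonNeg (<⇒≤ (p2>0 k)) (sum≥0 {f = λ i → p2 (e i)} λ i → <⇒≤ (p2>0 (e i)))) (*-nonNeg (nn+ 0≤1 0≤σ) (Λ≥0 zero))

        0<nA : 0# < 1# + fromℕ (suc n) * A
        0<nA = pos+nn 0<1 (*-nonNeg (fromℕ≥0 (suc n)) 0≤A)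

        shift-lipschitz : ∀ i {x y} → In u₀ ℓ₀ x → In u₀ ℓ₀ y → ∣ shift y i + - 1# * shift x i ∣ ≤ A * ∣ y - x ∣
        shift-lipschitz i {x} {y} x∈ y∈ = ≈≤ (trans (∣∣-cong (solve 4 (λ a b c d → a :* b :* c :+ (:- :1) :* (a :* b :* d) := a :* b :* (c :- d)) refl _ _ _ _)) (trans (∣∣-* (p2 k * p2 (e i)) (fᵗ i y - fᵗ i x)) (*-congʳ (∣∣-pos (<⇒≤ (pos* (p2>0 k) (p2>0 (e i))))))))
          (≤≈ (*-mono (<⇒≤ (pos* (p2>0 k) (p2>0 (e i))))
            (*-monoˡ (p2 k) (<⇒≤ (p2>0 k)) (term≤sum {f = λ i → p2 (e i)} (λ i → <⇒≤ (p2>0 (e i))) i)) (∣∣≥0 _) (fᵗ-lipschitz i x∈ y∈)) (solve 6 (λ a b c d e f → a :* (b :+ c) :* ((:1 :+ d) :* e :* f) := a :* (b :+ c) :* ((:1 :+ d) :* e) :* f) refl _ _ _ _ _ _))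

        -- The actions at x and y differ by a shear whose entries are at most A ∣y - x∣; at the
        -- distance allowed it adds at most t to each coordinate.
        act-steady : ∀ ω {x y t} → 0# < t → In u₀ ℓ₀ x → In u₀ ℓ₀ y → ∣ x - y ∣ ≤ inv 0<nA → Below ω x t → Below ω y (2# * t)
        act-steady ω {x} {y} {t} 0<t x∈ y∈ near below J = ≤-<-trans (≤-reflexive (∣∣-cong (moved J))) (bound J)
          where
          δv : Vect (suc n)
          δv i = shift y i + - 1# * shift x i
          a : ℝ
          a = A * ∣ y - x ∣
          na≤1 : fromℕ (suc n) * a ≤ 1#
          na≤1 = ≤-trans (*-monoˡ (fromℕ (suc n)) (fromℕ≥0 (suc n)) (*-monoˡ A 0≤A (≈≤ (∣∣-sub y x) near)))
            (by≤ (≤-reflexive (inv-eq 0<nA) ⊞ inv≥0 0<nA) (solve 7 (λ a b c d e f g → (:1 :+ a) :* (b :* (c :+ d) :* ((:1 :+ e) :* f) :* g) :+ (:1 :+ g) := :1 :+ ((:1 :+ (:1 :+ a) :* (b :* (c :+ d) :* ((:1 :+ e) :* f))) :* g :+ :0)) refl _ _ _ _ _ _ _))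
          moved : act y ω ≐ shear δv (act x ω)
          moved J = sym (trans (shear-shear (shift x) δv (scaled ω) J) (shear-cong (λ i → (solve 4 (λ a b c d → a :* b :* c :+ :1 :* (a :* b :* d :+ (:- :1) :* (a :* b :* c)) := a :* b :* d) refl _ _ _ _)) (λ _ → refl) J))
          bound : ∀ J → ∣ shear δv (act x ω) J ∣ < 2# * t
          bound (false ∷ J) = <-trans (below (false ∷ J)) (by< 0<t (solve 1 (λ a → a :+ a := (:1 :+ :1) :* a :+ :0) refl _))
          bound (true ∷ J) = ≤-<-trans (∣∣-+ _ _) (<-≤-trans (below (true ∷ J) <⊞
            ι-bound δv (λ K → act x ω (false ∷ K)) (*-nonNeg 0≤A (∣∣≥0 _)) (<⇒≤ 0<t) (λ i → shift-lipschitz i x∈ y∈) (λ K → <⇒≤ (below (false ∷ K))) J)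
            (by≤ (*-monoʳ t (<⇒≤ 0<t) na≤1) (solve 8 (λ a b c d e f g h → a :+ (:1 :+ b) :* (c :* (d :+ e) :* ((:1 :+ f) :* g) :* h :* a) :+ :1 :* a := (:1 :+ :1) :* a :+ (:1 :+ b) :* (c :* (d :+ e) :* ((:1 :+ f) :* g) :* h) :* a) refl _ _ _ _ _ _ _ _)))

      opaque
        act-good : ∀ ω {t u ℓ u′ ℓ′} → 0# < t → 0# < ℓ → u₀ ≤ u′ → u′ + ℓ′ ≤ u₀ + ℓ₀ → u′ ≤ u → u + ℓ ≤ u′ + ℓ′ → ℓ′ ≤ 2# * ℓ →
          HitAll (λ x → Below ω x (inv 0<Mˢ * t)) (dbl l) u ℓ → ∀ x → In u′ ℓ′ x → Below ω x t
        act-good ω {t} {u} {ℓ} {u′} {ℓ′} 0<t 0<ℓ a b c d ℓ′≤ hits x x∈ J = from (act-comb ω J)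
          where
          from : (∃ λ c₀ → ∃ λ c → ∀ x → act x ω J ≈ comb c₀ c 0 x) → ∣ act x ω J ∣ < t
          from (c₀ , cs , eq) = ≤-<-trans (≤-reflexive (∣∣-cong (eq x))) (≤-<-trans
            (good c₀ cs (inv 0<Mˢ * t) (<⇒≤ (pos* (inv>0 0<Mˢ) 0<t)) 0<ℓ a b c d ℓ′≤
              (HitAll-mono (dbl l) (λ y below → ≈≤ (∣∣-cong (sym (eq y))) (<⇒≤ (below J))) hits) x x∈)
            (by< {a = M l * (inv 0<Mˢ * t)} {b = t} (pos* (inv>0 0<Mˢ) 0<t) (begin
                M l * (inv 0<Mˢ * t) + inv 0<Mˢ * t    ≈⟨ (solve 3 (λ a b c → a :* (b :* c) :+ b :* c := (:1 :+ a) :* b :* c) refl _ _ _) ⟩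
                (1# + M l) * inv 0<Mˢ * t              ≈⟨ *-congʳ (inv-eq 0<Mˢ) ⟩
                1# * t                                 ≈⟨ (solve 1 (λ a → :1 :* a := a :+ :0) refl _) ⟩
                t + 0#                                 ∎)))

        saturate : ∀ V S → All (V ⋈_) S → ∃ λ W → Primitive W × All (W ⋈_) S × (∀ x t → Below (wedges (vectors V)) x t → Below (wedges (vectors W)) x t)
        saturate V S V⋈S = from (saturation V)
          where
          from : (∃ λ U → Primitive U × size U ≡ size V × vectors U ⊑ vectors V × vectors V ⊑ vectors U) →
            ∃ λ W → Primitive W × All (W ⋈_) S × (∀ x t → Below (wedges (vectors V)) x t → Below (wedges (vectors W)) x t)
          from (subspace us int us≉0 a b , prim , ≡.refl , U⊑V , V⊑U) = subspace us int us≉0 a b , prim ,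
            All.map (λ { (inj₁ (p , q)) → inj₁ (p , ⊑-trans U⊑V q) ; (inj₂ (p , q)) → inj₂ (p , ⊑-trans q V⊑U) }) V⋈S ,
            prim (vectors V) (integral V) (nonzero V) V⊑U

        ⋈-size : ∀ {V W} → V ⋈ W → size V ≢ size W
        ⋈-size (inj₁ (p , _)) e = ℕ.<⇒≢ p e
        ⋈-size (inj₂ (p , _)) e = ℕ.<⇒≢ p (≡.sym e)

      system : System
      system = record
        { P = Subspace ; Lt = λ V → Below (wedges (vectors V)) ; _⋈_ = _⋈_ ; rank = size ; Primitive = Primitive
        ; u₀ = u₀ ; ℓ₀ = ℓ₀ ; c = inv 0<Mˢ ; δ = inv 0<nA ; s = dbl l
        ; Lt-mono = λ p below J → <-≤-trans (below J) p ; ⋈-rank = λ {V} {W} → ⋈-size {V} {W} ; saturate = saturate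
        ; 0<c = inv>0 0<Mˢ ; c≤1 = c≤1 ; 0<δ = inv>0 0<nA
        ; good = λ V → act-good (wedges (vectors V)) ; steady = λ V → act-steady (wedges (vectors V)) }

      opaque
        -- In top degree the action is multiplication by its determinant, 2^k times the product of
        -- the `w i`, and a nonzero integer has absolute value at least 1.
        full-large : 1# ≤ p2 k * factor w full → ∀ {r} (vs : Vec (Vect (suc (suc n))) r) → AllInt vs → ¬ (∀ J → wedges vs J ≈ 0#) → r ≡ suc (suc n) →
          ∀ x → ∃ λ J → 1# ≤ ∣ act x (wedges vs) J ∣
        full-large big vs int vs≉0 ≡.refl x = full , ≤-trans (int≥1 (wedges-int int full) ω≉0)
            (≤-trans (by≤ (*-monoʳ ∣ ω full ∣ (∣∣≥0 _) big) (solve 4 (λ a b c d → a :+ b :* (c :* d) :* a := b :* (c :* d) :* a :+ :1 :* a) refl _ _ _ _)) (≤-reflexive (sym value)))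
          where
          ω : Ext (suc (suc n))
          ω = wedges vs
          ω≉0 : ¬ (ω full ≈ 0#)
          ω≉0 z = vs≉0 λ J → vanish J
            where
            vanish : ∀ J → ω J ≈ 0#
            vanish J with count J ℕ.≟ suc (suc n)
            ... | no  ne = wedges-homogeneous vs J ne
            ... | yes eq = ≡.subst (λ I → ω I ≈ 0#) (≡.sym (count-full J eq)) z
          low : ∀ {m} (J : Vec Bool m) {r} → m ℕ.< r → count J ≢ r
          low J m<r eq = ℕ.<⇒≱ m<r (≡.subst (ℕ._≤ _) eq (count≤ J))
          value : ∣ act x ω full ∣ ≈ p2 k * factor w full * ∣ ω full ∣
          value = begin
            ∣ act x ω full ∣                                    ≈⟨ ∣∣-cong (+-cong (*-congˡ (trans (+-congˡ (ι-0 s (λ K → wedges-homogeneous vs (true ∷ false ∷ K)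
                                                                     (low (true ∷ K) ℕ.≤-refl)) full)) (+-identityʳ _)))
                                                                     (ι-0 (shift x) (λ K → trans (*-congˡ (tilt-homogeneous vs (false ∷ K) (low K ℕ.≤-refl))) (zeroʳ (factor D (false ∷ K)))) full)) ⟩
            ∣ p2 k * factor w full * ω full + 0# ∣              ≈⟨ ∣∣-cong (solve 4 (λ a b c d → a :* (b :* c) :* d :+ :0 := a :* (b :* c) :* d) refl _ _ _ _) ⟩
            ∣ p2 k * factor w full * ω full ∣                   ≈⟨ ∣∣-* _ _ ⟩
            ∣ p2 k * factor w full ∣ * ∣ ω full ∣               ≈⟨ *-congʳ (∣∣-pos (≤-trans 0≤1 big)) ⟩
            p2 k * factor w full * ∣ ω full ∣                   ∎

        w>0 : ∀ i → 0# < w i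
        w>0 i = h2>0 (e i)

        w≤1 : ∀ i → w i ≤ 1#
        w≤1 i = h2≤1 (e i)

        -- Covolumes of proper subspaces tend to infinity with the exponents.
        initial : 1# ≤ p2 k * factor w full → ∀ {u ℓ B} → 0# < ℓ → 0# < B →
          (∀ c₀ c t → 0# ≤ t → (∀ x → In u ℓ x → ∣ comb c₀ c 0 x ∣ ≤ t) → ∣ c₀ ∣ ≤ B * t × (∀ i → ∣ c i ∣ ≤ B * t)) →
          (∀ i → B * (1# + fromℕ n * σ) < p2 (e i) * (½ * inv 0<T)) →
          ∀ V → ¬ (∀ x → In u ℓ x → Below (wedges (vectors V)) x 1#)
        initial big {u} {ℓ} {B} 0<ℓ 0<B control large V small = from (tilt-large 0≤σ s≤ 0<T (wedges-int (integral V)) (nonzero V))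
          where
          ω : Ext (suc (suc n))
          ω = wedges (vectors V)
          T τ : ℝ
          T = 1# + fromℕ n * σ
          τ = ½ * inv 0<T
          0≤τ : 0# ≤ τ
          0≤τ = half≥0 (inv≥0 0<T)
          coefs : ∀ K → ∣ p2 k * factor w K * tilt s ω (true ∷ K) ∣ ≤ B × (∀ i → ∣ toComb (p2 k * factor w K) (coefficient (bottom ω) K) i ∣ ≤ B)
          coefs K = tidy (control (p2 k * factor w K * tilt s ω (true ∷ K)) (toComb (p2 k * factor w K) (coefficient (bottom ω) K)) 1# 0≤1 (λ x x∈ → ≈≤ (∣∣-cong (sym (act-true ω K x))) (<⇒≤ (small x x∈ (true ∷ K)))))
            where
            tidy : ∀ {a} {b : Vect (suc n)} → ∣ a ∣ ≤ B * 1# × (∀ i → ∣ b i ∣ ≤ B * 1#) → ∣ a ∣ ≤ B × (∀ i → ∣ b i ∣ ≤ B)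
            tidy (p , q) = ≤≈ p (*-identityʳ B) , λ i → ≤≈ (q i) (*-identityʳ B)
          -- Since K omits some i, the bound on the determinant gives `p2 (e i)` ≤
          -- `p2 k * factor w K`, which `large` excludes.
          impossible : ∀ K → count K ℕ.< suc n → (p2 k * factor w K) * τ ≤ B * T → ⊥
          impossible K c<n le = missing (factor-missing {d = w} w>0 w≤1 K c<n)
            where
            missing : (∃ λ i → factor w full ≤ factor w K * w i) → ⊥
            missing (i , p) = <⇒≱ (large i) (≤-trans (*-monoʳ τ 0≤τ p2≤) le)
              where
              p2≤ : p2 (e i) ≤ p2 k * factor w K
              p2≤ = ≤-trans (by≤ (*-monoʳ (p2 (e i)) (<⇒≤ (p2>0 (e i))) big) (solve 4 (λ a b c d → a :+ b :* (c :* d) :* a := b :* (c :* d) :* a :+ :1 :* a) refl _ _ _ _))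
                (≤-trans (*-monoʳ (p2 (e i)) (<⇒≤ (p2>0 (e i))) (*-monoˡ (p2 k) (<⇒≤ (p2>0 k)) p))
                (≤-reflexive (trans (solve 4 (λ a b c d → a :* (b :* c) :* d := a :* b :* (d :* c)) refl _ _ _ _) (trans (*-congˡ (p2-h2 (e i))) (*-identityʳ _)))))
          B≤BT : B ≤ B * T
          B≤BT = by≤ (*-nonNeg (<⇒≤ 0<B) (*-nonNeg (fromℕ≥0 n) 0≤σ)) (solve 3 (λ a b c → a :+ a :* (b :* c) := a :* (:1 :+ b :* c) :+ :0) refl _ _ _)
          Q≥0 : ∀ K → 0# ≤ p2 k * factor w K
          Q≥0 K = <⇒≤ (pos* (p2>0 k) (factor>0 w>0 K))
          rank-of : ∀ J → τ ≤ ∣ tilt s ω J ∣ → 0# < τ → count J ≡ size V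
          rank-of J p 0<τ with count J ℕ.≟ size V
          ... | yes eq = eq
          ... | no ne = ⊥-elim (<⇒≱ 0<τ (≤-trans p (≤-reflexive (trans (∣∣-cong (tilt-homogeneous (vectors V) J ne)) ∣0∣))))
          from : (∃ λ J → τ ≤ ∣ tilt s ω J ∣) → ⊥
          -- A large coordinate appears in the action as a constant term if its index set contains
          -- 0, and otherwise as a coefficient of one of the functions.
          from (true ∷ K , p) = impossible K (ℕ.≤-trans (ℕ.≤-reflexive (rank-of (true ∷ K) p (½-pos (inv>0 0<T)))) (size≤ V))
            (≤-trans (*-monoˡ _ (Q≥0 K) p) (≤-trans (≤-reflexive (trans (*-congʳ (sym (∣∣-pos (Q≥0 K)))) (sym (∣∣-* _ _)))) (≤-trans (proj₁ (coefs K)) B≤BT)))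
          from (false ∷ J , p) = hit (coefficient-hits (bottom ω) J (≡.trans (rank-of (false ∷ J) p (½-pos (inv>0 0<T))) (≡.sym (ℕ.m+[n∸m]≡n (size≥1 V)))))
            where
            hit : (∃ λ K → count K ≡ size V ℕ.∸ 1 × ∃ λ i → ∣ coefficient (bottom ω) K i ∣ ≈ ∣ bottom ω J ∣) → ⊥
            hit (K , cK , i , eq) = impossible K (ℕ.≤-trans (ℕ.≤-reflexive (≡.trans (≡.cong suc cK) (ℕ.m+[n∸m]≡n (size≥1 V)))) (size≤ V))
                (≤-trans (*-monoˡ Q (Q≥0 K) (≤≈ p (sym eq))) (by-index i))
              where
              Q : ℝ
              Q = p2 k * factor w K
              γ : Vect (suc n)
              γ = coefficient (bottom ω) K
              absorb : ∀ y → Q * ∣ y ∣ ≈ ∣ Q * y ∣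
              absorb y = trans (*-congʳ (sym (∣∣-pos (Q≥0 K)))) (sym (∣∣-* _ _))
              by-index : ∀ i → Q * ∣ γ i ∣ ≤ B * T
              by-index (suc i) = ≈≤ (absorb _) (≤-trans (proj₂ (coefs K) (suc i)) B≤BT)
              -- `toComb` mixes the zeroth coefficient with the others, and separating it costs the
              -- factor T.
              by-index zero = ≈≤ (absorb _) (≈≤ (∣∣-cong (trans (solve 4 (λ a b c d → a :* b :* c := a :* b :* (c :- d) :+ a :* b :* d) refl _ _ _ _) (+-congˡ (sym (sum-* Q (λ i → γ (suc i) * s i))))))
                (≤-trans (∣∣-+ (Q * (γ zero - sum (λ i → γ (suc i) * s i))) (sum (λ i → Q * (γ (suc i) * s i))))
                (≤≈ (proj₂ (coefs K) zero ⊞ ∣sum∣≤ {f = λ i → Q * (γ (suc i) * s i)} {c = B * σ} (λ i → ≈≤ (trans (∣∣-cong (sym (*-assoc _ _ _))) (∣∣-* _ _))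
                  (*-mono (∣∣≥0 _) (proj₂ (coefs K) (suc i)) (∣∣≥0 _) (s≤ i)))) (solve 3 (λ a b c → a :+ b :* (a :* c) := a :* (:1 :+ b :* c)) refl _ _ _))))

      Nonshort : ℝ → Set
      Nonshort x = ∀ a → IntV a → ¬ (∀ i → a i ≈ 0#) → ∃ λ i → ε₁ ≤ ∣ actᵥ x a i ∣

      -- A vector a shorter than ε₁ would enlarge the largest member B of the flag not containing
      -- it to a subspace of covolume less than ε₀.
      record Base (a : Vect (suc (suc n))) (x : ℝ) (S : List Subspace) : Set where
        field
          {dim}    : ℕ
          base     : Vec (Vect (suc (suc n))) dim
          int      : AllInt base
          nonzero₀ : ¬ (∀ J → wedges base J ≈ 0#)
          a∉       : ¬ Span base a
          dim≤     : dim ℕ.≤ suc n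
          bound    : ∀ J → ∣ act x (wedges base) J ∣ ≤ 1#
          versus   : ∀ V → All (V ⋈_) S → (size V ℕ.< dim × vectors V ⊑ base) ⊎ (dim ℕ.< size V × base ⊑ vectors V)
          members  : All (λ V → (Span (vectors V) a × base ⊑ vectors V × dim ℕ.< size V) ⊎ (vectors V ⊑ base × size V ℕ.≤ dim)) S

      data Flag (x : ℝ) : List Subspace → Set where
        []  : Flag x []
        _∷_ : ∀ {V S} → (All (V ⋈_) S × Primitive V × Below (wedges (vectors V)) x 1# × ¬ Below (wedges (vectors V)) x ε₀) → Flag x S → Flag x (V ∷ S)

      opaque
        -- The members are taken in the order in which they joined the flag, beginning with rank 0
        -- and product 1. The base moves up to a member exactly when that member contains it and
        -- misses `a`. Every member thus either contains both the base and `a` or lies in the base.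
        find-base : ∀ {a x S} → ¬ (∀ i → a i ≈ 0#) → Flag x S → Base a x S
        find-base {a} {x} a≉0 [] = record
          { base = [] ; int = [] ; nonzero₀ = λ h → one (suc (suc n)) h ; a∉ = a≉0 ; dim≤ = z≤n
          ; bound = λ J → ≈≤ (∣∣-cong (act-unit x J)) (unit-bound J) ; versus = λ V _ → inj₂ (size≥1 V , []) ; members = [] }
          where
          one : ∀ m → ¬ (∀ (J : Vec Bool m) → unit J ≈ 0#)
          one zero    h = 1≉0 (h [])
          one (suc m) h = one m (λ J → h (false ∷ J))
        find-base {a} {x} {V ∷ S} a≉0 ((V⋈S , _ , below , _) ∷ flag) with find-base {a} a≉0 flag | lem (Span (vectors V) a)
        ... | B | inj₁ a∈V = record
          { base = base ; int = int ; nonzero₀ = nonzero₀ ; a∉ = a∉ ; dim≤ = dim≤ ; bound = bound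
          ; versus = λ { W (_ ∷ q) → versus W q } ; members = inj₁ (contains (versus V V⋈S)) ∷ members }
          where
          open Base B
          contains : (size V ℕ.< dim × vectors V ⊑ base) ⊎ (dim ℕ.< size V × base ⊑ vectors V) → Span (vectors V) a × base ⊑ vectors V × dim ℕ.< size V
          contains (inj₁ (_ , V⊑)) = ⊥-elim (a∉ (Span-⊑ (vectors V) V⊑ a∈V))
          contains (inj₂ (p , ⊑V)) = a∈V , ⊑V , p
        ... | B | inj₂ a∉V = compare (versus V V⋈S)
          where
          open Base B
          compare : (size V ℕ.< dim × vectors V ⊑ base) ⊎ (dim ℕ.< size V × base ⊑ vectors V) → Base a x (V ∷ S)
          compare (inj₁ (p , V⊑)) = record
            { base = base ; int = int ; nonzero₀ = nonzero₀ ; a∉ = a∉ ; dim≤ = dim≤ ; bound = bound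
            ; versus = λ { W (_ ∷ q) → versus W q } ; members = inj₂ (V⊑ , ℕ.<⇒≤ p) ∷ members }
          compare (inj₂ (p , ⊑V)) = record
            { base = vectors V ; int = integral V ; nonzero₀ = nonzero V ; a∉ = a∉V ; dim≤ = size≤ V ; bound = λ J → <⇒≤ (below J)
            ; versus = λ { W (q ∷ _) → q } ; members = inj₂ (⊑-refl (vectors V) , ℕ.≤-refl) ∷ rebase V⋈S members }
            where
            rebase : ∀ {T} → All (V ⋈_) T → All (λ W → (Span (vectors W) a × base ⊑ vectors W × dim ℕ.< size W) ⊎ (vectors W ⊑ base × size W ℕ.≤ dim)) T →
              All (λ W → (Span (vectors W) a × vectors V ⊑ vectors W × size V ℕ.< size W) ⊎ (vectors W ⊑ vectors V × size W ℕ.≤ size V)) T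
            rebase [] [] = []
            rebase (inj₁ (q , V⊑W) ∷ qs) (inj₁ (a∈ , _) ∷ ms) = inj₁ (a∈ , V⊑W , q) ∷ rebase qs ms
            rebase {W ∷ _} (inj₂ (q , W⊑V) ∷ qs) (inj₁ (a∈ , _) ∷ ms) = ⊥-elim (a∉V (Span-⊑ (vectors W) W⊑V a∈))
            rebase (q ∷ qs) (inj₂ (W⊑ , r) ∷ ms) = inj₂ (⊑-trans W⊑ ⊑V , ℕ.<⇒≤ (ℕ.≤-<-trans r p)) ∷ rebase qs ms

        wedge-short : ∀ {a x r} (vs : Vec (Vect (suc (suc n))) r) → (∀ i → ∣ actᵥ x a i ∣ < ε₁) → (∀ J → ∣ act x (wedges vs) J ∣ ≤ 1#) →
          Below (wedges (a ∷ vs)) x ε₀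
        wedge-short {a} {x} vs short bound J = ≤-<-trans (≤-reflexive (∣∣-cong (act-wedge x a (wedges vs) J))) (≤-<-trans
          (wedge-bound (actᵥ x a) (act x (wedges vs)) (<⇒≤ 0<ε₁) 0≤1 (λ i → <⇒≤ (short i)) bound J)
          (≤-<-trans (*-monoʳ _ (<⇒≤ (pos* 0<ε₁ 0<1)) (≤-trans (by≤ 0≤1 (solve 1 (λ a → :1 :+ (:1 :+ a) :+ :1 := :1 :+ (:1 :+ (:1 :+ a)) :+ :0) refl _)) (fromℕ≤p2 (suc (suc n)))))
          (≤-<-trans (≤-reflexive (trans (solve 6 (λ a b c d e f → (a :+ a :+ (a :+ a)) :* (b :* (b :* (c :* (c :* d) :* e) :* f) :* :1) := b :* (b :* (c :* (c :* d) :* e)) :* ((a :+ a :+ (a :+ a)) :* f)) refl _ _ _ _ _ _) (trans (*-congˡ (inv-eq (p2>0 (suc (suc n))))) (*-identityʳ _)))) (½-< 0<ε₀))))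

        -- Adding a short `a` to the base gives a space W of covolume below `ε₀`. A primitive space
        -- with the span of W and covolume not below `ε₀` contradicts primitivity. Otherwise W, if
        -- proper, is compatible with the whole flag, against maximality. In full rank the covolume
        -- is at least 1.
        not-short : ∀ {a x S} → 1# ≤ p2 k * factor w full → IntV a → ¬ (∀ i → a i ≈ 0#) → Flag x S →
          (∀ V → All (V ⋈_) S → ¬ Below (wedges (vectors V)) x ε₀) → ¬ (∀ i → ∣ actᵥ x a i ∣ < ε₁)
        not-short {a} {x} {S} big int-a a≉0 flag maximal short = contradict (find-base a≉0 flag)
          where
          contradict : Base a x S → ⊥
          contradict B = decide (lem (∃ λ V → size V ≡ suc dim × Primitive V × ¬ Below (wedges (vectors V)) x ε₀ × (base ⊑ vectors V × Span (vectors V) a)))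
            where
            open Base B
            W : Vec (Vect (suc (suc n))) (suc dim)
            W = a ∷ base
            W≉0 : ¬ (∀ J → wedges W J ≈ 0#)
            W≉0 h = a∉ (wedge≈0⇒Span base nonzero₀ h)
            W-small : Below (wedges W) x ε₀
            W-small = wedge-short base short bound
            decide : (∃ λ V → size V ≡ suc dim × Primitive V × ¬ Below (wedges (vectors V)) x ε₀ × (base ⊑ vectors V × Span (vectors V) a)) ⊎
              ¬ (∃ λ V → size V ≡ suc dim × Primitive V × ¬ Below (wedges (vectors V)) x ε₀ × (base ⊑ vectors V × Span (vectors V) a)) → ⊥
            decide (inj₁ (subspace vs i v≉0 p q , ≡.refl , prim , large , ⊑V , a∈)) = large (prim W (int-a ∷ int) W≉0 (a∈ ∷ ⊑V) x ε₀ W-small)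
            decide (inj₂ ∄) with suc dim ℕ.≤? suc n
            ... | yes dim<n = maximal (subspace W (int-a ∷ int) W≉0 (s≤s z≤n) dim<n) (compatible flag members) W-small
              where
              compatible : ∀ {T} → Flag x T → All (λ V → (Span (vectors V) a × base ⊑ vectors V × dim ℕ.< size V) ⊎ (vectors V ⊑ base × size V ℕ.≤ dim)) T →
                All (subspace W (int-a ∷ int) W≉0 (s≤s z≤n) dim<n ⋈_) T
              compatible [] [] = []
              compatible {V ∷ _} ((_ , prim , _ , large) ∷ fs) (inj₁ (a∈ , ⊑V , p) ∷ ms) =
                inj₁ (ℕ.≤∧≢⇒< p (λ eq → ∄ (V , ≡.sym eq , prim , large , ⊑V , a∈)) , a∈ ∷ ⊑V) ∷ compatible fs ms
              compatible (_ ∷ fs) (inj₂ (V⊑ , p) ∷ ms) = inj₂ (s≤s p , ⊑-trans V⊑ (⊑-there (⊑-refl base))) ∷ compatible fs ms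
            ... | no dim≥n = at-top (full-large big W (int-a ∷ int) W≉0 (≡.cong suc (ℕ.≤-antisym dim≤ (ℕ.≤-pred (ℕ.≰⇒> dim≥n)))) x)
              where
              at-top : (∃ λ J → 1# ≤ ∣ act x (wedges W) J ∣) → ⊥
              at-top (J , p) = <⇒≱ (<-≤-trans (W-small J) ε₀≤1) p

        marked⇒nonshort : 1# ≤ p2 k * factor w full → ∀ {x S} → Flag x S → Marked system ε₀ S x → Nonshort x
        marked⇒nonshort big flag (stop maximal) a int a≉0 = by-contradiction λ none →
          not-short big int a≉0 flag maximal (λ i → ≰⇒> λ p → none (i , p))
        marked⇒nonshort big flag (more V prim V⋈S below large marked) = marked⇒nonshort big ((V⋈S , prim , below , large) ∷ flag) marked

        nonshort-cover : 1# ≤ p2 k * factor w full → ∀ {u ℓ B} → u₀ ≤ u → u + ℓ ≤ u₀ + ℓ₀ → 0# < ℓ → 0# < B →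
          (∀ c₀ c t → 0# ≤ t → (∀ x → In u ℓ x → ∣ comb c₀ c 0 x ∣ ≤ t) → ∣ c₀ ∣ ≤ B * t × (∀ i → ∣ c i ∣ ≤ B * t)) →
          (∀ i → B * (1# + fromℕ n * σ) < p2 (e i) * (½ * inv 0<T)) →
          Cov (λ x → ¬ Nonshort x) u ℓ (1# - h2 (suc n ℕ.* dbl l))
        nonshort-cover big {u} {ℓ} p q 0<ℓ 0<B control large = from (∃h2*< (<⇒≤ 0<ℓ) (inv>0 0<nA))
          where
          free : Free system (suc n) []
          free = (λ i → suc (toℕ i)) , λ V _ → index V (size≥1 V) (size≤ V)
            where
            index : ∀ V → 1 ℕ.≤ size V → size V ℕ.≤ suc n → ∃ λ (i : Fin (suc n)) → suc (toℕ i) ≡ size V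
            index (subspace {suc r} _ _ _ _ _) _ (s≤s r≤n) = fromℕ< {r} {suc n} (s≤s r≤n) , ≡.cong suc (Fin.toℕ-fromℕ< (s≤s r≤n))
          two-halves : 2# * ε₀ ≈ κ system ^ suc n * 1#
          two-halves = begin
            2# * (½ * κ system ^ suc n)                        ≈⟨ (solve 4 (λ a b c d → (:1 :+ :1) :* (a :* (b :* (b :* c) :* d)) := a :* (b :* (b :* c) :* d) :+ a :* (b :* (b :* c) :* d)) refl _ _ _ _) ⟩
            ½ * κ system ^ suc n + ½ * κ system ^ suc n        ≈⟨ ½-eq (κ system ^ suc n) ⟩
            κ system ^ suc n                                   ≈⟨ sym (*-identityʳ _) ⟩
            κ system ^ suc n * 1#                              ∎
          from : (∃ λ m → h2 m * ℓ < inv 0<nA) → Cov (λ x → ¬ Nonshort x) u ℓ (1# - h2 (suc n ℕ.* dbl l))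
          from (m , fine) = Cov-mono {_} {λ x → ¬ Marked system ε₀ [] x} (<⇒≤ 0<ℓ)
            (λ x _ ¬nonshort marked → ¬nonshort (marked⇒nonshort big [] marked)) ≤-refl
            (marked-cover system (suc n) [] free m 0<ε₀ 0<1 ≤-refl (≤-reflexive two-halves)
              0<ℓ p q (<⇒≤ fine) (λ V _ → initial big 0<ℓ 0<B control large V))

-- Transference: from short vectors to the covering radius of the dual lattice

module Transference (em : ExcludedMiddle 0ℓ) (reals : CompleteOrderedField) where

  open Analysis em reals hiding (zero; ∣_∣; ContinuousAt)
  open OrderedField em reals
  open Numbers em reals
  open Calculus em reals
  open Exterior em reals
  open Goodness em reals
  open TiltedLattice em reals
  open IntegerSolver commutativeRing
  open SetoidReasoning setoid

  record Linear {n} (g : Vect n → ℝ) : Set where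
    constructor linear
    field
      resp : ∀ {x y} → (∀ i → x i ≈ y i) → g x ≈ g y
      lin  : ∀ x c y → g (λ i → x i + c * y i) ≈ g x + c * g y

  opaque
    linear-0 : ∀ {n} {g : Vect n → ℝ} → Linear g → ∀ {x} → (∀ i → x i ≈ 0#) → g x ≈ 0#
    linear-0 {g = g} (linear resp lin) {x} h = begin
      g x                          ≈⟨ resp (λ i → trans (h i) (trans (sym (h i)) (trans (sym (+-identityʳ _)) (trans (+-congˡ (sym (trans (*-congˡ (h i)) (zeroʳ _)))) refl)))) ⟩
      g (λ i → x i + - 1# * x i)   ≈⟨ lin x (- 1#) x ⟩
      g x + - 1# * g x             ≈⟨ (solve 1 (λ a → a :+ (:- :1) :* a := :0) refl _) ⟩
      0#                           ∎

  opaque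
    linear-basis : ∀ {n} {g : Vect n → ℝ} → Linear g → ∀ v → g v ≈ sum (λ i → v i * g (basis i))
    linear-basis {zero}  {g} l v = linear-0 l (λ ())
    linear-basis {suc n} {g} l@(linear resp lin) v = begin
      g v                                                  ≈⟨ resp (λ { zero → (solve 1 (λ a → a := :0 :+ a :* :1) refl _) ; (suc i) → (solve 2 (λ a b → a := a :+ b :* :0) refl _ _) }) ⟩
      g (λ i → pad (tail v) i + v zero * basis zero i)     ≈⟨ lin (pad (tail v)) (v zero) (basis zero) ⟩
      g (pad (tail v)) + v zero * g (basis zero)           ≈⟨ +-comm _ _ ⟩
      v zero * g (basis zero) + g (pad (tail v))           ≈⟨ +-congˡ (linear-basis {n} {λ u → g (pad u)} padded (tail v)) ⟩
      v zero * g (basis zero) + sum (λ i → v (suc i) * g (pad (basis i)))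
        ≈⟨ +-congˡ (sum-cong {f = λ i → v (suc i) * g (pad (basis i))} {g = λ i → v (suc i) * g (basis (suc i))}
             (λ i → *-congˡ (resp (λ { zero → refl ; (suc j) → refl })))) ⟩
      v zero * g (basis zero) + sum (λ i → v (suc i) * g (basis (suc i))) ∎
      where
      pad : Vect n → Vect (suc n)
      pad u zero    = 0#
      pad u (suc i) = u i
      padded : Linear (λ u → g (pad u))
      padded = linear (λ e → resp (λ { zero → refl ; (suc i) → e i }))
        (λ x c y → trans (resp (λ { zero → (solve 1 (λ a → :0 := :0 :+ a :* :0) refl _) ; (suc i) → refl })) (lin (pad x) c (pad y)))

  record Form (n : ℕ) : Set where
    field
      b    : Vect n → Vect n → ℝ
      comm : ∀ x y → b x y ≈ b y x
      resp : ∀ {x y} z → (∀ i → x i ≈ y i) → b x z ≈ b y z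
      lin  : ∀ x c y z → b (λ i → x i + c * y i) z ≈ b x z + c * b y z
      nn   : ∀ x → 0# ≤ b x x

  -- The sum M + 2M + 4M + ⋯ of r terms: each projection along a nearly shortest vector doubles the
  -- constant M that bounds the lattice vectors away from 0.
  reach : ℝ → ℕ → ℝ
  reach M zero    = 0#
  reach M (suc r) = M + reach (2# * M) r

  opaque
    reach≥0 : ∀ {M} r → 0# ≤ M → 0# ≤ reach M r
    reach≥0 zero    p = ≤-refl
    reach≥0 (suc r) p = nn+ p (reach≥0 r (*-nonNeg (<⇒≤ 0<2) p))

  module _ {n : ℕ} where

    private
      module Step (B : Form n) (d : Vect n) (d≉0 : ¬ (Form.b B d d ≈ 0#)) where
        open Form B

        0<bd : 0# < b d d
        0<bd = ≰⇒> λ p → d≉0 (≤-antisym p (nn d))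

        β : ℝ
        β = inv 0<bd

        opaque
          β-eq : b d d * β ≈ 1#
          β-eq = inv-eq 0<bd

          expand : ∀ x c → b (λ i → x i + c * d i) (λ i → x i + c * d i) ≈ b x x + (c + c) * b x d + c * c * b d d
          expand x c = begin
            b y y                                                ≈⟨ lin x c d y ⟩
            b x y + c * b d y                                    ≈⟨ +-cong (comm x y) (*-congˡ (comm d y)) ⟩
            b y x + c * b y d                                    ≈⟨ +-cong (lin x c d x) (*-congˡ (lin x c d d)) ⟩
            b x x + c * b d x + c * (b x d + c * b d d)          ≈⟨ +-congʳ (+-congˡ (*-congˡ (comm d x))) ⟩
            b x x + c * b x d + c * (b x d + c * b d d)          ≈⟨ (solve 4 (λ a b c d → a :+ b :* c :+ b :* (c :+ b :* d) := a :+ (b :+ b) :* c :+ b :* b :* d) refl _ _ _ _) ⟩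
            b x x + (c + c) * b x d + c * c * b d d              ∎
            where
            y : Vect n
            y i = x i + c * d i

        b′ : Vect n → Vect n → ℝ
        b′ x y = b x y - b x d * b y d * β

        opaque
          -- The value of b′ is the value of b at the orthogonal projection along d.
          complete-square : ∀ x m → b (λ i → x i + - m * d i) (λ i → x i + - m * d i) ≈ b′ x x + (b x d * β - m) * (b x d * β - m) * b d d
          complete-square x m = begin
            b (λ i → x i + - m * d i) (λ i → x i + - m * d i)             ≈⟨ expand x (- m) ⟩
            b x x + (- m + - m) * b x d + - m * - m * b d d               ≈⟨ (solve 5 (λ a b c d e → a :+ (:- b :- b) :* c :+ (:- b) :* (:- b) :* d := a :- c :* c :* e :+ c :* c :* e :* :1 :- (b :+ b) :* c :* :1 :+ b :* b :* d) refl _ _ _ _ _) ⟩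
            b x x - b x d * b x d * β + (b x d * b x d * β) * 1# - (m + m) * b x d * 1# + m * m * b d d
              ≈⟨ +-congʳ (+-cong (+-congˡ (*-congˡ (sym β-eq))) (-‿cong (*-congˡ (sym β-eq)))) ⟩
            b x x - b x d * b x d * β + (b x d * b x d * β) * (b d d * β) - (m + m) * b x d * (b d d * β) + m * m * b d d
              ≈⟨ (solve 5 (λ a b c d e → a :- b :* b :* c :+ b :* b :* c :* (d :* c) :- (e :+ e) :* b :* (d :* c) :+ e :* e :* d := a :- b :* b :* c :+ (b :* c :- e) :* (b :* c :- e) :* d) refl _ _ _ _ _) ⟩
            b x x - b x d * b x d * β + (b x d * β - m) * (b x d * β - m) * b d d ∎

          b′≥0 : ∀ x → 0# ≤ b′ x x
          b′≥0 x = ≤≈ (nn (λ i → x i + - (b x d * β) * d i)) (trans (complete-square x (b x d * β)) (solve 4 (λ a b c d → a :- b :* b :* c :+ (b :* c :- b :* c) :* (b :* c :- b :* c) :* d := a :- b :* b :* c) refl _ _ _ _))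

          b′≤b : ∀ x → b′ x x ≤ b x x
          b′≤b x = by≤ (*-nonNeg (sq≥0 (b x d)) (inv≥0 0<bd)) (solve 3 (λ a b c → a :- b :* b :* c :+ b :* b :* c := a :+ :0) refl _ _ _)

          b′-kills-d : ∀ y → b′ d y ≈ 0#
          b′-kills-d y = trans (+-congˡ (-‿cong (trans (solve 3 (λ a b c → a :* b :* c := b :* (a :* c)) refl _ _ _) (trans (*-congˡ β-eq) (*-identityʳ _))))) (trans (+-congʳ (comm d y)) (-‿inverseʳ _))

        form′ : Form n
        form′ = record
          { b    = b′
          ; comm = λ x y → +-cong (comm x y) (-‿cong (*-congʳ (*-comm _ _)))
          ; resp = λ z e → +-cong (resp z e) (-‿cong (*-congʳ (*-congʳ (resp d e))))
          ; lin  = λ x c y z → trans (+-cong (lin x c y z) (-‿cong (*-congʳ (*-congʳ (lin x c y d))))) (distribute x c y z)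
          ; nn   = b′≥0 }
          where
          opaque
            distribute : ∀ x c y z → b x z + c * b y z - (b x d + c * b y d) * b z d * β ≈ b x z - b x d * b z d * β + c * (b y z - b y d * b z d * β)
            distribute x c y z = (solve 7 (λ a b c d e f g → a :+ b :* c :- (d :+ b :* e) :* f :* g := a :- d :* f :* g :+ b :* (c :- e :* f :* g)) refl _ _ _ _ _ _ _)

    -- A shortest vector up to the factor 2 in squared length. Passing repeatedly to a vector of
    -- less than half the squared length must stop, since lengths that are not 0 are bounded below.
    NearMinimal : Form n → Vect n → Set
    NearMinimal B d = IntV d × ¬ (Form.b B d d ≈ 0#) × (∀ a → IntV a → ¬ (Form.b B a a ≈ 0#) → Form.b B d d ≤ 2# * Form.b B a a)

    opaque
      near-minimal : (B : Form n) (M : ℝ) → 0# < M → (∀ a → IntV a → ¬ (Form.b B a a ≈ 0#) → 1# ≤ Form.b B a a * (M * M)) →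
        ∀ a → IntV a → ¬ (Form.b B a a ≈ 0#) → ∃ (NearMinimal B)
      near-minimal B M 0<M low a int a≉0 = launch (∃p2≥ (b a a * (M * M)))
        where
        open Form B
        0<M² : 0# < M * M
        0<M² = pos* 0<M 0<M
        descend : ∀ k a → IntV a → ¬ (b a a ≈ 0#) → b a a * (M * M) ≤ p2 k → ∃ (NearMinimal B)
        descend zero a int a≉0 p = a , int , a≉0 , λ c int-c c≉0 → ≤-trans (*-cancelʳ-≤ (M * M) 0<M² (≤-trans p (low c int-c c≉0))) (by≤ (nn c) (solve 1 (λ a → a :+ a := (:1 :+ :1) :* a :+ :0) refl _))
        descend (suc k) a int a≉0 p with lem (∃ λ c → IntV c × ¬ (b c c ≈ 0#) × 2# * b c c < b a a)
        ... | inj₁ (c , int-c , c≉0 , q) = descend k c int-c c≉0 (halve (≤-trans (≤-reflexive (solve 2 (λ a b → a :* (b :* b) :+ a :* (b :* b) := (:1 :+ :1) :* a :* (b :* b)) refl _ _)) (≤-trans (*-monoʳ (M * M) (<⇒≤ 0<M²) (<⇒≤ q)) p)))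
          where
          halve : ∀ {x y} → x + x ≤ y + y → x ≤ y
          halve h = *-cancelʳ-≤ 2# 0<2 (by≤ h (solve 2 (λ a b → a :* (:1 :+ :1) :+ (b :+ b) := b :* (:1 :+ :1) :+ (a :+ a)) refl _ _))
        ... | inj₂ ∄ = a , int , a≉0 , λ c int-c c≉0 → ≮⇒≥ λ q → ∄ (c , int-c , c≉0 , q)
        launch : (∃ λ k → b a a * (M * M) ≤ p2 k) → ∃ (NearMinimal B)
        launch (k , p) = descend k a int a≉0 p

      -- A lattice without short vectors has a dual lattice of bounded covering radius; b runs through
      -- the squared norms of the successive projections of a reduced basis.
      integral-functional : ∀ r {t} (ds : Vec (Vect n) t) → ¬ Dep ds → n ℕ.≤ t ℕ.+ r → (B : Form n) (M : ℝ) → 0# < M →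
        (∀ a → IntV a → ¬ (Form.b B a a ≈ 0#) → 1# ≤ Form.b B a a * (M * M)) → (∀ x → Span ds x → ∀ y → Form.b B x y ≈ 0#) →
        (g : Vect n → ℝ) → Linear g → (∀ a → IntV a → Form.b B a a ≈ 0# → IsInt (g a)) →
        ∃ λ h → Linear h × (∀ a → IntV a → IsInt (h a)) × (∀ v γ → 0# ≤ γ → Form.b B v v ≤ γ * γ → ∣ h v - g v ∣ ≤ reach M r * γ)
      -- The independent vectors `ds` on which the form vanishes now span the space, so all integer
      -- vectors have length 0 and g is integral already.
      integral-functional zero ds ¬dep n≤ B M 0<M low kill g lg integral = g , lg ,
        (λ a int → integral a int (kill a (full-span ds ¬dep (≡.subst (n ℕ.≤_) (ℕ.+-identityʳ _) n≤) a) a)) ,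
        λ v γ _ _ → ≤-reflexive (trans (∣∣-cong (-‿inverseʳ _)) (trans ∣0∣ (sym (zeroˡ γ))))
      integral-functional (suc r) {t} ds ¬dep n≤ B M 0<M low kill g lg integral with lem (∃ λ a → IntV a × ¬ (Form.b B a a ≈ 0#))
      ... | inj₂ ∄ = g , lg , (λ a int → integral a int (by-contradiction λ ne → ∄ (a , int , ne))) ,
        λ v γ 0≤γ _ → ≤-trans (≤-reflexive (trans (∣∣-cong (-‿inverseʳ _)) ∣0∣)) (*-nonNeg (reach≥0 (suc r) (<⇒≤ 0<M)) 0≤γ)
      ... | inj₁ (a₀ , int₀ , a₀≉0) = reduce (near-minimal B M 0<M low a₀ int₀ a₀≉0)
        where
        open Form B
        Goal : Set
        Goal = ∃ λ h → Linear h × (∀ a → IntV a → IsInt (h a)) × (∀ v γ → 0# ≤ γ → b v v ≤ γ * γ → ∣ h v - g v ∣ ≤ reach M (suc r) * γ)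
        reduce : ∃ (NearMinimal B) → Goal
        reduce (d , int-d , d≉0 , minimal) = adjust (nearest (g d))
          where
          open Step B d d≉0
          module g = Linear lg
          0<2M : 0# < 2# * M
          0<2M = pos* 0<2 0<M
          residue : ∀ a → IntV a → ∃ λ m → IsInt m × ∣ b a d * β - m ∣ ≤ ½ × IntV (λ i → a i + - m * d i) ×
            b (λ i → a i + - m * d i) (λ i → a i + - m * d i) ≤ b′ a a + ½ * (½ * b d d)
          residue a int = from (nearest (b a d * β))
            where
            from : (∃ λ m → IsInt m × ∣ b a d * β - m ∣ ≤ ½) → ∃ λ m → IsInt m × ∣ b a d * β - m ∣ ≤ ½ × IntV (λ i → a i + - m * d i) ×
              b (λ i → a i + - m * d i) (λ i → a i + - m * d i) ≤ b′ a a + ½ * (½ * b d d)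
            from (m , int-m , p) = m , int-m , p , (λ i → int-+ (int i) (int-* (int-neg int-m) (int-d i))) ,
              ≤-trans (≤-reflexive (complete-square a m)) (≤-refl ⊞ ≤≈ (*-monoʳ (b d d) (<⇒≤ 0<bd) (≈≤ (sym (∣∣²≈ _)) (*-mono (∣∣≥0 _) p (∣∣≥0 _) p))) (*-assoc _ _ _))
          quarter≤ : ∀ {x} → b d d ≤ 2# * (x + ½ * (½ * b d d)) → b d d ≤ 2# * 2# * x
          quarter≤ p = by≤ (p ⊞ p ⊞ ≤-reflexive (½-eq (½ * b d d)) ⊞ ≤-reflexive (½-eq (½ * b d d)) ⊞ ≤-reflexive (½-eq (b d d))) (solve 3 (λ a b c → a :+ ((:1 :+ :1) :* (b :+ c :* (c :* a)) :+ (:1 :+ :1) :* (b :+ c :* (c :* a)) :+ c :* a :+ c :* a :+ a) := (:1 :+ :1) :* (:1 :+ :1) :* b :+ (a :+ a :+ (c :* (c :* a) :+ c :* (c :* a)) :+ (c :* (c :* a) :+ c :* (c :* a)) :+ (c :* a :+ c :* a))) refl _ _ _)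
          -- Reducing `a` modulo d leaves length at most b′ a a + ¼ b d d. As d is nearly minimal, b
          -- d d ≤ 2 (b′ a a + ¼ b d d), that is b d d ≤ 4 b′ a a; this is where M doubles.
          low′ : ∀ a → IntV a → ¬ (b′ a a ≈ 0#) → 1# ≤ b′ a a * (2# * M * (2# * M))
          low′ a int a≉0 = from (residue a int)
            where
            from : (∃ λ m → IsInt m × ∣ b a d * β - m ∣ ≤ ½ × IntV (λ i → a i + - m * d i) ×
              b (λ i → a i + - m * d i) (λ i → a i + - m * d i) ≤ b′ a a + ½ * (½ * b d d)) → 1# ≤ b′ a a * (2# * M * (2# * M))
            from (m , int-m , _ , int′ , p) = ≤-trans (low d int-d d≉0) (≤≈ (*-monoʳ (M * M) (<⇒≤ (pos* 0<M 0<M))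
              (quarter≤ (≤-trans (minimal (λ i → a i + - m * d i) int′ nonzero) (*-monoˡ 2# (<⇒≤ 0<2) p)))) (solve 4 (λ a b c d → (:1 :+ :1) :* (:1 :+ :1) :* (a :- b :* b :* c) :* (d :* d) := (a :- b :* b :* c) :* ((:1 :+ :1) :* d :* ((:1 :+ :1) :* d))) refl _ _ _ _))
              where
              nonzero : ¬ (b (λ i → a i + - m * d i) (λ i → a i + - m * d i) ≈ 0#)
              nonzero z = a≉0 (≤-antisym (≤-trans (by≤ (*-nonNeg (sq≥0 (b a d * β - m)) (<⇒≤ 0<bd)) (solve 5 (λ a b c d e → a :- b :* b :* c :+ (b :* c :- d) :* (b :* c :- d) :* e := a :- b :* b :* c :+ (b :* c :- d) :* (b :* c :- d) :* e :+ :0) refl _ _ _ _ _))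
                (≤-reflexive (trans (sym (complete-square a m)) z))) (b′≥0 a))
          kill′ : ∀ x → Span (d ∷ ds) x → ∀ y → b′ x y ≈ 0#
          kill′ x (c , h) y = begin
            b′ x y                                ≈⟨ Form.resp form′ y (λ i → (solve 3 (λ a b c → a := a :- b :* c :+ b :* c) refl _ _ _)) ⟩
            b′ (λ i → z i + c * d i) y            ≈⟨ Form.lin form′ z c d y ⟩
            b′ z y + c * b′ d y                   ≈⟨ +-cong (+-cong (kill z h y) (-‿cong (*-congʳ (*-congʳ (kill z h d))))) (*-congˡ (b′-kills-d y)) ⟩
            0# - 0# * b y d * β + c * 0#          ≈⟨ (solve 3 (λ a b c → :0 :- :0 :* a :* b :+ c :* :0 := :0) refl _ _ _) ⟩
            0#                                    ∎
            where
            z : Vect n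
            z i = x i - c * d i
          ¬dep′ : ¬ Dep (d ∷ ds)
          ¬dep′ (inj₁ h) = d≉0 (kill d h d)
          ¬dep′ (inj₂ h) = ¬dep h
          adjust : (∃ λ m → IsInt m × ∣ g d - m ∣ ≤ ½) → Goal
          adjust (m₀ , int-m₀ , near₀) = finish (integral-functional r (d ∷ ds) ¬dep′ (≡.subst (n ℕ.≤_) (ℕ.+-suc t r) n≤)
              form′ (2# * M) 0<2M low′ kill′ g₁ lg₁ integral₁)
            where
            -- g is corrected by a multiple of the coordinate along d so as to take the nearest
            -- integer `m₀` at d.
            ν : ℝ
            ν = m₀ - g d
            g₁ : Vect n → ℝ
            g₁ v = g v + ν * (b v d * β)
            lg₁ : Linear g₁
            lg₁ = linear (λ e → +-cong (g.resp e) (*-congˡ (*-congʳ (resp d e))))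
              (λ x c y → trans (+-cong (g.lin x c y) (*-congˡ (*-congʳ (lin x c y d)))) (arrange (g x) c (g y) (b x d) (b y d)))
              where
              arrange : ∀ p c q r s → p + c * q + ν * ((r + c * s) * β) ≈ p + ν * (r * β) + c * (q + ν * (s * β))
              arrange p c q r s = (solve 8 (λ a b c d e f g h → a :+ b :* c :+ (d :- e) :* ((f :+ b :* g) :* h) := a :+ (d :- e) :* (f :* h) :+ b :* (c :+ (d :- e) :* (g :* h))) refl _ _ _ _ _ _ _ _)
            g₁d : IsInt (g₁ d)
            g₁d = int-cong (begin
              m₀                       ≈⟨ (solve 2 (λ a b → a := b :+ (a :- b) :* :1) refl _ _) ⟩
              g d + (m₀ - g d) * 1#    ≈⟨ +-congˡ (*-congˡ (sym β-eq)) ⟩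
              g₁ d                     ∎) int-m₀
            -- A vector on which b′ vanishes is reduced modulo d to one on which b vanishes, for
            -- near-minimality excludes small positive lengths. There g is integral and the
            -- correction is 0, and the multiple of d contributes an integer.
            integral₁ : ∀ a → IntV a → b′ a a ≈ 0# → IsInt (g₁ a)
            integral₁ a int z = from (residue a int)
              where
              from : (∃ λ m → IsInt m × ∣ b a d * β - m ∣ ≤ ½ × IntV (λ i → a i + - m * d i) ×
                b (λ i → a i + - m * d i) (λ i → a i + - m * d i) ≤ b′ a a + ½ * (½ * b d d)) → IsInt (g₁ a)
              from (m , int-m , _ , int′ , p) = int-cong (begin
                  g₁ a′ + m * g₁ d                  ≈⟨ sym (Linear.lin lg₁ a′ m d) ⟩
                  g₁ (λ i → a′ i + m * d i)         ≈⟨ Linear.resp lg₁ (λ i → (solve 3 (λ a b c → a :+ (:- b) :* c :+ b :* c := a) refl _ _ _)) ⟩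
                  g₁ a                              ∎) (int-+ (int-cong (sym g₁a′) (integral a′ int′ a′≈0)) (int-* int-m g₁d))
                where
                a′ : Vect n
                a′ i = a i + - m * d i
                c : ℝ
                c = b a d * β - m
                a′≈0 : b a′ a′ ≈ 0#
                a′≈0 = by-contradiction λ ne → <⇒≱ 0<bd (≤≈ (quarter≤ (≤-trans (minimal a′ int′ ne) (*-monoˡ 2# (<⇒≤ 0<2) p))) (trans (*-congˡ z) (zeroʳ _)))
                c²≈0 : c * c * b d d ≈ 0#
                c²≈0 = begin
                  c * c * b d d             ≈⟨ (solve 4 (λ a b c d → (a :* b :- c) :* (a :* b :- c) :* d := :0 :+ (a :* b :- c) :* (a :* b :- c) :* d) refl _ _ _ _) ⟩
                  0# + c * c * b d d        ≈⟨ +-congʳ (sym z) ⟩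
                  b′ a a + c * c * b d d    ≈⟨ sym (complete-square a m) ⟩
                  b a′ a′                   ≈⟨ a′≈0 ⟩
                  0#                        ∎
                c≈0 : c ≈ 0#
                c≈0 = by-contradiction λ c≉0 → d≉0 (no-zero-divisors (no-zero-divisors (trans (sym (*-assoc _ _ _)) c²≈0) c≉0) c≉0)
                g₁a′ : g₁ a′ ≈ g a′
                g₁a′ = begin
                  g a′ + ν * (b a′ d * β)                       ≈⟨ +-congˡ (*-congˡ (*-congʳ (lin a (- m) d d))) ⟩
                  g a′ + ν * ((b a d + - m * b d d) * β)        ≈⟨ (solve 7 (λ a b c d e f g → a :+ (b :- c) :* ((d :+ (:- e) :* f) :* g) := a :+ (b :- c) :* (d :* g :- e :* (f :* g))) refl _ _ _ _ _ _ _) ⟩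
                  g a′ + ν * (b a d * β - m * (b d d * β))      ≈⟨ +-congˡ (*-congˡ (+-congˡ (-‿cong (trans (*-congˡ β-eq) (*-identityʳ m))))) ⟩
                  g a′ + ν * c                                  ≈⟨ +-congˡ (*-congˡ c≈0) ⟩
                  g a′ + ν * 0#                                 ≈⟨ (solve 3 (λ a b c → a :+ (b :- c) :* :0 := a) refl _ _ _) ⟩
                  g a′                                          ∎
            finish : (∃ λ h → Linear h × (∀ a → IntV a → IsInt (h a)) × (∀ v γ → 0# ≤ γ → b′ v v ≤ γ * γ → ∣ h v - g₁ v ∣ ≤ reach (2# * M) r * γ)) → Goal
            finish (h , lh , int-h , close) = h , lh , int-h , λ v γ 0≤γ p →
              ≤-trans (≈≤ (∣∣-cong (solve 6 (λ a b c d e f → a :- b := a :- (b :+ (c :- d) :* (e :* f)) :+ (c :- d) :* (e :* f)) refl _ _ _ _ _ _)) (∣∣-+ (h v - g₁ v) (ν * (b v d * β))))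
                (≤≈ (close v γ 0≤γ (≤-trans (b′≤b v) p) ⊞ correction v γ 0≤γ p) (solve 3 (λ a b c → a :* b :+ c :* b := (c :+ a) :* b) refl _ _ _))
              where
              ∣ν∣≤1 : ν * ν ≤ 1#
              ∣ν∣≤1 = ≈≤ (sym (∣∣²≈ ν)) (≤≈ (*-mono (∣∣≥0 ν) ∣ν∣≤ (∣∣≥0 ν) ∣ν∣≤) (*-identityˡ 1#))
                where
                ∣ν∣≤ : ∣ ν ∣ ≤ 1#
                ∣ν∣≤ = ≤-trans (≈≤ (∣∣-sub m₀ (g d)) near₀) ½≤1
              β≤M² : β ≤ M * M
              β≤M² = ≤-trans (≤-reflexive (sym (*-identityˡ β))) (≤-trans (*-monoʳ β (inv≥0 0<bd) (low d int-d d≉0))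
                (≤-reflexive (trans (solve 3 (λ a b c → a :* (b :* b) :* c := a :* c :* (b :* b)) refl _ _ _) (trans (*-congʳ β-eq) (*-identityˡ _)))))
              -- The Cauchy-Schwarz inequality (b v d)² β ≤ b v v, in the form 0 ≤ b′ v v, together
              -- with β ≤ M².
              correction : ∀ v γ → 0# ≤ γ → b v v ≤ γ * γ → ∣ ν * (b v d * β) ∣ ≤ M * γ
              correction v γ 0≤γ p = sq≤⇒∣∣≤ (*-nonNeg (<⇒≤ 0<M) 0≤γ) (≤-trans (≤-reflexive (solve 4 (λ a b c d → (a :- b) :* (c :* d) :* ((a :- b) :* (c :* d)) := (a :- b) :* (a :- b) :* (c :* c :* d :* d)) refl _ _ _ _))
                (≤≈ (*-mono (sq≥0 ν) ∣ν∣≤1 (*-nonNeg (*-nonNeg (sq≥0 (b v d)) (inv≥0 0<bd)) (inv≥0 0<bd))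
                  (*-mono (*-nonNeg (sq≥0 (b v d)) (inv≥0 0<bd)) (≤-trans (by≤ (b′≥0 v) (solve 3 (λ a b c → a :* a :* b :+ (c :- a :* a :* b) := c :+ :0) refl _ _ _)) p) (inv≥0 0<bd) β≤M²)) (solve 2 (λ a b → :1 :* (a :* a :* (b :* b)) := b :* a :* (b :* a)) refl _ _)))

  module Approximation {n : ℕ} (C : Curve (suc n)) (s : Vect n) (k : ℕ) (e : Fin (suc n) → ℕ)
                       {σ : ℝ} (0≤σ : 0# ≤ σ) (s≤ : ∀ i → ∣ s i ∣ ≤ σ) where
    open Constants C
    open Lattice C s k e

    R : ℝ
    R = reach (inv 0<ε₁) (suc (suc n))

    module _ (x : ℝ) where

      X : Fin (suc (suc n)) → Vect (suc (suc n)) → ℝ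
      X i a = actᵥ x a i

      opaque
        tiltᵥ-linear : ∀ i → Linear (λ a → tiltᵥ s a i)
        tiltᵥ-linear zero = linear (λ h → h zero) (λ _ _ _ → refl)
        tiltᵥ-linear (suc zero) = linear
          (λ {a} {c} h → +-cong (h (suc zero)) (sum-cong {f = λ i → s i * a (suc (suc i))} {g = λ i → s i * c (suc (suc i))} (λ i → *-congˡ (h (suc (suc i))))))
          (λ a c b → trans (+-congˡ (trans (sum-cong {f = λ i → s i * (a (suc (suc i)) + c * b (suc (suc i)))}
              {g = λ i → s i * a (suc (suc i)) + c * (s i * b (suc (suc i)))} (λ i → (solve 4 (λ a b c d → a :* (b :+ c :* d) := a :* b :+ c :* (a :* d)) refl _ _ _ _)))
            (trans (sum-+ (λ i → s i * a (suc (suc i))) (λ i → c * (s i * b (suc (suc i))))) (+-congˡ (sum-* c (λ i → s i * b (suc (suc i)))))))) (solve 5 (λ a b c d e → a :+ b :* c :+ (d :+ b :* e) := a :+ d :+ b :* (c :+ e)) refl _ _ _ _ _))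
        tiltᵥ-linear (suc (suc i)) = linear (λ h → h (suc (suc i))) (λ _ _ _ → refl)

        combination-linear : ∀ {m N} (c : Vector ℝ m) (h : Fin m → Vect N → ℝ) → (∀ i → Linear (h i)) → Linear (λ a → sum (λ i → c i * h i a))
        combination-linear c h l = linear
          (λ {a} {b} p → sum-cong {f = λ i → c i * h i a} {g = λ i → c i * h i b} (λ i → *-congˡ (Linear.resp (l i) p)))
          (λ a t b → trans (sum-cong {f = λ i → c i * h i (λ j → a j + t * b j)} {g = λ i → c i * h i a + t * (c i * h i b)}
              (λ i → trans (*-congˡ (Linear.lin (l i) a t b)) (solve 4 (λ a b c d → a :* (b :+ c :* d) := a :* b :+ c :* (a :* d)) refl _ _ _ _)))
            (trans (sum-+ (λ i → c i * h i a) (λ i → t * (c i * h i b))) (+-congˡ (sum-* t (λ i → c i * h i b)))))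

        X-linear : ∀ i → Linear (X i)
        X-linear zero = linear
          (λ p → +-cong (*-congˡ (p zero)) (Linear.resp sums p))
          (λ a c b → trans (+-congˡ (Linear.lin sums a c b)) (solve 13 (λ a b c d e f g h x8 x9 x10 x11 x12 → a :* (b :+ c :* d) :+ (a :* e :* f :* (g :* (h :+ x8)) :+ x9 :+ c :* (a :* e :* f :* (g :* (x10 :+ x11)) :+ x12)) := a :* b :+ (a :* e :* f :* (g :* (h :+ x8)) :+ x9) :+ c :* (a :* d :+ (a :* e :* f :* (g :* (x10 :+ x11)) :+ x12))) refl _ _ _ _ _ _ _ _ _ _ _ _ _))
          where
          scaled-tilt : ∀ i → Linear (λ a → D (suc i) * tiltᵥ s a (suc i))
          scaled-tilt i = linear (λ p → *-congˡ (Linear.resp (tiltᵥ-linear (suc i)) p))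
            (λ a c b → trans (*-congˡ (Linear.lin (tiltᵥ-linear (suc i)) a c b)) (solve 4 (λ a b c d → a :* (b :+ c :* d) := a :* b :+ c :* (a :* d)) refl _ _ _ _))
          sums : Linear (λ a → sum (λ i → shift x i * (D (suc i) * tiltᵥ s a (suc i))))
          sums = combination-linear (shift x) (λ i a → D (suc i) * tiltᵥ s a (suc i)) scaled-tilt
        X-linear (suc i) = linear (λ p → *-congˡ (Linear.resp (tiltᵥ-linear (suc i)) p))
          (λ a c b → trans (*-congˡ (Linear.lin (tiltᵥ-linear (suc i)) a c b)) (solve 4 (λ a b c d → a :* (b :+ c :* d) := a :* b :+ c :* (a :* d)) refl _ _ _ _))

      norm : Form (suc (suc n))
      norm = record
        { b = λ a b → sum (λ i → X i a * X i b)
        ; comm = λ a b → sum-cong {f = λ i → X i a * X i b} {g = λ i → X i b * X i a} (λ i → *-comm _ _)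
        ; resp = λ {a} {c} b p → sum-cong {f = λ i → X i a * X i b} {g = λ i → X i c * X i b} (λ i → *-congʳ (Linear.resp (X-linear i) p))
        ; lin = λ a c b z → trans (sum-cong {f = λ i → X i (λ j → a j + c * b j) * X i z} {g = λ i → X i a * X i z + c * (X i b * X i z)}
              (λ i → trans (*-congʳ (Linear.lin (X-linear i) a c b)) (arrange (X i a) c (X i b) (X i z))))
            (trans (sum-+ (λ i → X i a * X i z) (λ i → c * (X i b * X i z))) (+-congˡ (sum-* c (λ i → X i b * X i z))))
        ; nn = λ a → sum≥0 {f = λ i → X i a * X i a} (λ i → sq≥0 (X i a)) }
        where
        opaque
          arrange : ∀ p c q r → (p + c * q) * r ≈ p * r + c * (q * r)
          arrange p c q r = (solve 4 (λ a b c d → (a :+ b :* c) :* d := a :* d :+ b :* (c :* d)) refl _ _ _ _)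

      -- The vector whose only nonzero normalised coordinate is the i-th one.
      dualTail : Fin (suc n) → Vect (suc n)
      dualTail zero    = basis zero
      dualTail (suc j) zero    = - s j
      dualTail (suc j) (suc i) = basis j i

      dual : Fin (suc n) → Vect (suc (suc n))
      dual i zero    = - fᵗ i x
      dual i (suc j) = dualTail i j

      opaque
        dual-tilt : ∀ i j → tiltᵥ s (dual i) (suc j) ≈ basis i j
        dual-tilt zero    zero    = trans (+-congˡ (sum-0 {f = λ i → s i * 0#} (λ i → zeroʳ (s i)))) (solve 0 (:1 :+ :0 := :1) refl)
        dual-tilt (suc j) zero    = trans (+-congˡ (trans (sum-cong {f = λ i → s i * basis j i} {g = λ i → basis j i * s i} (λ i → *-comm _ _)) (sum-basis j s))) (-‿inverseˡ (s j))
        dual-tilt zero    (suc i) = refl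
        dual-tilt (suc j) (suc i) = refl

        dual-X₀ : ∀ i → X zero (dual i) ≈ 0#
        dual-X₀ i = begin
          p2 k * - fᵗ i x + sum (λ j → shift x j * (w j * tiltᵥ s (dual i) (suc j)))
            ≈⟨ +-congˡ (trans (sum-cong {f = λ j → shift x j * (w j * tiltᵥ s (dual i) (suc j))} {g = λ j → basis i j * (shift x j * w j)}
                 (λ j → trans (*-congˡ (*-congˡ (dual-tilt i j))) (solve 5 (λ a b c d e → a :* b :* c :* (d :* e) := e :* (a :* b :* c :* d)) refl _ _ _ _ _))) (sum-basis i (λ j → shift x j * w j))) ⟩
          p2 k * - fᵗ i x + p2 k * p2 (e i) * fᵗ i x * h2 (e i)       ≈⟨ (solve 4 (λ a b c d → a :* (:- b) :+ a :* c :* b :* d := a :* (:- b) :+ a :* b :* (c :* d)) refl _ _ _ _) ⟩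
          p2 k * - fᵗ i x + p2 k * fᵗ i x * (p2 (e i) * h2 (e i))     ≈⟨ +-congˡ (trans (*-congˡ (p2-h2 (e i))) (*-identityʳ _)) ⟩
          p2 k * - fᵗ i x + p2 k * fᵗ i x                             ≈⟨ (solve 2 (λ a b → a :* (:- b) :+ a :* b := :0) refl _ _) ⟩
          0#                                                          ∎

        dual-norm : ∀ i → Form.b norm (dual i) (dual i) ≈ w i * w i
        dual-norm i = begin
          X zero (dual i) * X zero (dual i) + sum (λ j → (w j * tiltᵥ s (dual i) (suc j)) * (w j * tiltᵥ s (dual i) (suc j)))
            ≈⟨ +-cong (trans (*-congʳ (dual-X₀ i)) (zeroˡ _)) (trans (sum-cong {f = λ j → (w j * tiltᵥ s (dual i) (suc j)) * (w j * tiltᵥ s (dual i) (suc j))}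
                 {g = λ j → basis i j * (w j * w j * basis i j)} (λ j → trans (*-cong (*-congˡ (dual-tilt i j)) (*-congˡ (dual-tilt i j))) (solve 2 (λ a b → a :* b :* (a :* b) := b :* (a :* a :* b)) refl _ _))) (sum-basis i (λ j → w j * w j * basis i j))) ⟩
          0# + w i * w i * basis i i     ≈⟨ trans (+-identityˡ _) (trans (*-congˡ (basis-self i)) (*-identityʳ _)) ⟩
          w i * w i                      ∎

        origin-norm : Form.b norm (basis zero) (basis zero) ≈ p2 k * p2 k
        origin-norm = trans (+-cong (*-cong first first) (sum-0 {f = λ j → (w j * tiltᵥ s (basis zero) (suc j)) * (w j * tiltᵥ s (basis zero) (suc j))}
          (λ j → trans (*-congʳ (trans (*-congˡ (rest j)) (zeroʳ _))) (zeroˡ _)))) (+-identityʳ _)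
          where
          rest : ∀ j → tiltᵥ s (basis zero) (suc j) ≈ 0#
          rest zero    = trans (+-congˡ (sum-0 {f = λ i → s i * 0#} (λ i → zeroʳ (s i)))) (solve 0 (:0 :+ :0 := :0) refl)
          rest (suc j) = refl
          first : X zero (basis zero) ≈ p2 k
          first = trans (+-cong (*-identityʳ (p2 k)) (sum-0 {f = λ j → shift x j * (w j * tiltᵥ s (basis zero) (suc j))}
            (λ j → trans (*-congˡ (trans (*-congˡ (rest j)) (zeroʳ _))) (zeroʳ _)))) (+-identityʳ _)

      -- The error P - q f(x), with its component along (1, s) removed from all coordinates but the
      -- first.
      offset : ℝ → Vect (suc n) → Fin (suc n) → ℝ
      offset q P zero    = P zero - q * f zero x
      offset q P (suc i) = P (suc i) - q * f (suc i) x - s i * (P zero - q * f zero x)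

      opaque
        evaluate : ∀ {h} → Linear h → ∀ i → h (dual i) ≈ offset (h (basis zero)) (λ j → h (basis (suc j))) i
        evaluate {h} l zero = trans (linear-basis l (dual zero)) (trans (+-congˡ (sum-basis zero (λ j → h (basis (suc j))))) (solve 3 (λ a b c → (:- a) :* b :+ c := c :- b :* a) refl _ _ _))
        evaluate {h} l (suc j) = trans (linear-basis l (dual (suc j))) (trans (+-congˡ (+-congˡ (sum-basis j (λ i → h (basis (suc (suc i))))))) (solve 6 (λ a b c d e f → (:- (a :- b :* c)) :* d :+ ((:- b) :* e :+ f) := f :- d :* a :- b :* (e :- d :* c)) refl _ _ _ _ _ _))

        -- An integral functional is an integer point (q, P), read off at the standard basis. At
        -- `basis zero` and at the vectors `dual i`, of norms 2^k and 2^-eᵢ, its values are q and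
        -- the offsets; τ is the functional with values Q and y i at these vectors.
        approximate : Nonshort 0≤σ s≤ x → ∀ Q (y : Vect (suc n)) → ∃ λ q → ∃ λ P → IsInt q × IntV P ×
          ∣ q - Q ∣ ≤ R * p2 k × (∀ i → ∣ offset q P i - y i ∣ ≤ R * h2 (e i))
        approximate nonshort Q y = from (integral-functional (suc (suc n)) [] (λ ()) ℕ.≤-refl norm M (inv>0 0<ε₁) low
            (λ a h b → sum-0 {f = λ i → X i a * X i b} (λ i → trans (*-congʳ (linear-0 (X-linear i) h)) (zeroˡ _))) τ τ-linear integral)
          where
          M : ℝ
          M = inv 0<ε₁
          c : Vect (suc (suc n))
          c zero    = 1#
          c (suc i) = f i x
          τ : Vect (suc (suc n)) → ℝ
          τ a = Q * sum (λ i → c i * a i) + sum (λ j → y j * tiltᵥ s a (suc j))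
          coordinate : ∀ i → Linear (λ (a : Vect (suc (suc n))) → a i)
          coordinate i = linear (λ h → h i) (λ _ _ _ → refl)
          τ-linear : Linear τ
          τ-linear = linear (λ p → +-cong (*-congˡ (Linear.resp l₁ p)) (Linear.resp l₂ p))
            (λ a c b → trans (+-cong (*-congˡ (Linear.lin l₁ a c b)) (Linear.lin l₂ a c b)) (solve 14 (λ a b c d e f g h x8 x9 x10 x11 x12 x13 → a :* (:1 :* b :+ (c :* d :+ e) :+ f :* (:1 :* g :+ (c :* h :+ x8))) :+ (x9 :* (d :+ x10) :+ x11 :+ f :* (x9 :* (h :+ x12) :+ x13)) := a :* (:1 :* b :+ (c :* d :+ e)) :+ (x9 :* (d :+ x10) :+ x11) :+ f :* (a :* (:1 :* g :+ (c :* h :+ x8)) :+ (x9 :* (h :+ x12) :+ x13))) refl _ _ _ _ _ _ _ _ _ _ _ _ _ _))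
            where
            l₁ : Linear (λ a → sum (λ i → c i * a i))
            l₁ = combination-linear c (λ i a → a i) coordinate
            l₂ : Linear (λ a → sum (λ j → y j * tiltᵥ s a (suc j)))
            l₂ = combination-linear y (λ j a → tiltᵥ s a (suc j)) (λ j → tiltᵥ-linear (suc j))
          low : ∀ a → IntV a → ¬ (Form.b norm a a ≈ 0#) → 1# ≤ Form.b norm a a * (M * M)
          low a int a≉0 = bound (nonshort a int λ z → a≉0 (sum-0 {f = λ i → X i a * X i a} (λ i → trans (*-congʳ (linear-0 (X-linear i) z)) (zeroˡ _))))
            where
            bound : (∃ λ i → ε₁ ≤ ∣ X i a ∣) → 1# ≤ Form.b norm a a * (M * M)
            bound (i , p) = ≤-trans (≤-reflexive (sym (trans (solve 6 (λ a b c d e f → a :* (a :* (b :* (b :* c) :* d) :* e) :* (a :* (a :* (b :* (b :* c) :* d) :* e)) :* (f :* f) := a :* (a :* (b :* (b :* c) :* d) :* e) :* f :* (a :* (a :* (b :* (b :* c) :* d) :* e) :* f)) refl _ _ _ _ _ _) (trans (*-cong (inv-eq 0<ε₁) (inv-eq 0<ε₁)) (*-identityˡ 1#)))))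
              (*-monoʳ (M * M) (sq≥0 M) (≤-trans (*-mono (<⇒≤ 0<ε₁) p (<⇒≤ 0<ε₁) p)
                (≈≤ (∣∣²≈ _) (term≤sum {f = λ i → X i a * X i a} (λ i → sq≥0 (X i a)) i))))
          integral : ∀ a → IntV a → Form.b norm a a ≈ 0# → IsInt (τ a)
          integral a int z = int-cong (sym (linear-0 τ-linear (λ i → by-contradiction λ ne → <⇒≱ 0<1 (≤≈ (low′ (λ h → ne (h i))) (trans (*-congʳ z) (zeroˡ _)))))) int-0
            where
            low′ : ¬ (∀ i → a i ≈ 0#) → 1# ≤ Form.b norm a a * (M * M)
            low′ a≉0 = bound (nonshort a int a≉0)
              where
              bound : (∃ λ i → ε₁ ≤ ∣ X i a ∣) → 1# ≤ Form.b norm a a * (M * M)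
              bound (i , p) = ⊥-elim (<⇒≱ 0<ε₁ (≤-trans p (sq≤⇒∣∣≤ ≤-refl (≤-trans (term≤sum {f = λ i → X i a * X i a} (λ i → sq≥0 (X i a)) i)
                (≤-reflexive (trans z (sym (zeroˡ 0#))))))))
          τ-origin : τ (basis zero) ≈ Q
          τ-origin = trans (+-cong (*-congˡ (trans (+-congˡ (sum-0 {f = λ i → f i x * 0#} (λ i → zeroʳ _))) (solve 0 (:1 :* :1 :+ :0 := :1) refl)))
            (sum-0 {f = λ j → y j * tiltᵥ s (basis zero) (suc j)} (λ { zero → trans (*-congˡ (trans (+-congˡ (sum-0 {f = λ i → s i * 0#} (λ i → zeroʳ (s i)))) (+-identityʳ 0#))) (zeroʳ _) ; (suc j) → zeroʳ _ })))
            (trans (+-identityʳ _) (*-identityʳ Q))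
          τ-dual : ∀ i → τ (dual i) ≈ y i
          τ-dual i = trans (+-cong (trans (*-congˡ (vanish i)) (zeroʳ Q)) (trans (sum-cong {f = λ j → y j * tiltᵥ s (dual i) (suc j)} {g = λ j → basis i j * y j}
              (λ j → trans (*-congˡ (dual-tilt i j)) (*-comm _ _))) (sum-basis i y))) (+-identityˡ _)
            where
            vanish : ∀ i → 1# * - fᵗ i x + sum (λ j → f j x * dualTail i j) ≈ 0#
            vanish zero = trans (+-congˡ (+-congˡ (sum-0 {f = λ j → f (suc j) x * 0#} (λ j → zeroʳ _)))) (solve 1 (λ a → :1 :* (:- a) :+ (a :* :1 :+ :0) := :0) refl _)
            vanish (suc i) = trans (+-congˡ (+-congˡ (trans (sum-cong {f = λ j → f (suc j) x * basis i j} {g = λ j → basis i j * f (suc j) x} (λ j → *-comm _ _))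
              (sum-basis i (λ j → f (suc j) x))))) (solve 3 (λ a b c → :1 :* (:- (a :- b :* c)) :+ (c :* (:- b) :+ a) := :0) refl _ _ _)
          from : (∃ λ h → Linear h × (∀ a → IntV a → IsInt (h a)) × (∀ v γ → 0# ≤ γ → Form.b norm v v ≤ γ * γ → ∣ h v - τ v ∣ ≤ R * γ)) →
            ∃ λ q → ∃ λ P → IsInt q × IntV P × ∣ q - Q ∣ ≤ R * p2 k × (∀ i → ∣ offset q P i - y i ∣ ≤ R * h2 (e i))
          from (h , lh , int-h , close) = h (basis zero) , (λ j → h (basis (suc j))) , int-h (basis zero) (int-basis zero) , (λ j → int-h (basis (suc j)) (int-basis (suc j))) ,
            ≈≤ (∣∣-cong (+-congˡ (-‿cong (sym τ-origin)))) (close (basis zero) (p2 k) (<⇒≤ (p2>0 k)) (≤-reflexive origin-norm)) ,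
            λ i → ≈≤ (∣∣-cong (+-cong (sym (evaluate lh i)) (-‿cong (sym (τ-dual i))))) (close (dual i) (w i) (<⇒≤ (h2>0 (e i))) (≤-reflexive (dual-norm i)))
            where
            int-basis : ∀ {m} (i : Fin m) → IntV (basis i)
            int-basis zero    zero    = int-1
            int-basis zero    (suc j) = int-0
            int-basis (suc i) zero    = int-0
            int-basis (suc i) (suc j) = int-basis i j

-- Inapproximable points on a curve with steep first coordinate

module Thinness (em : ExcludedMiddle 0ℓ) (reals : CompleteOrderedField) where

  open Analysis em reals hiding (zero; ∣_∣; ContinuousAt)
  open OrderedField em reals
  open Numbers em reals
  open Calculus em reals
  open NullSets em reals
  open Exterior em reals
  open Goodness em reals
  open TiltedLattice em reals
  open Transference em reals
  open IntegerSolver commutativeRing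
  open SetoidReasoning setoid

  opaque
    Tree⇒Cov : ∀ {P A u ℓ p} → 0# < ℓ → (∀ v m → 0# < m → P v m → Cov A v m p) → Tree P u ℓ → Cov A u ℓ p
    Tree⇒Cov 0<ℓ h (leaf p) = h _ _ 0<ℓ p
    Tree⇒Cov {A = A} 0<ℓ h (node l r) = split (Tree⇒Cov {A = A} (½-pos 0<ℓ) h l) (Tree⇒Cov {A = A} (½-pos 0<ℓ) h r) ≤-refl

  total : ∀ {n} → (Fin n → ℕ) → ℕ
  total {zero}  e = 0
  total {suc n} e = e zero ℕ.+ total (λ i → e (suc i))

  opaque
    factor-total : ∀ {n} (e : Fin n → ℕ) → factor (λ i → h2 (e i)) full ≈ h2 (total e)
    factor-total {zero}  e = refl
    factor-total {suc n} e = trans (*-congˡ (factor-total (λ i → e (suc i)))) (sym (h2-+ (e zero) (total (λ i → e (suc i)))))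

  opaque
    total-+ : ∀ {n} (e : Fin n → ℕ) c → total (λ i → e i ℕ.+ c) ≡ total e ℕ.+ n ℕ.* c
    total-+ {zero}  e c = ≡.refl
    total-+ {suc n} e c = ≡.trans (≡.cong (e zero ℕ.+ c ℕ.+_) (total-+ (λ i → e (suc i)) c))
      (≡.trans (ℕ.+-assoc (e zero) c _) (≡.trans (≡.cong (e zero ℕ.+_) (≡.trans (≡.sym (ℕ.+-assoc c _ _))
        (≡.trans (≡.cong (ℕ._+ n ℕ.* c) (ℕ.+-comm c _)) (ℕ.+-assoc (total (λ i → e (suc i))) c (n ℕ.* c))))) (≡.sym (ℕ.+-assoc (e zero) _ _))))

  opaque
    total≤ : ∀ {n} (e : Fin n → ℕ) (h : Vect n) → (∀ i → fromℕ (e i) ≤ h i + 1#) → fromℕ (total e) ≤ sum h + fromℕ n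
    total≤ {zero}  e h p = ≤-reflexive (solve 0 (:0 := :0 :+ :0) refl)
    total≤ {suc n} e h p = ≈≤ (fromℕ-+ (e zero) (total (λ i → e (suc i)))) (≤≈ (p zero ⊞ total≤ (λ i → e (suc i)) (λ i → h (suc i)) (λ i → p (suc i))) (solve 3 (λ a b c → a :+ :1 :+ (b :+ c) := a :+ b :+ (:1 :+ c)) refl _ _ _))

  opaque
    fitting-level : ∀ {y m} → 0# < y → y < m → ∃ λ d → y ≤ h2 d * m × h2 d * m ≤ 2# * y
    fitting-level {y} {m} 0<y y<m = from (∃h2*< (<⇒≤ (<-trans 0<y y<m)) (pos* 0<2 0<y))
      where
      from : (∃ λ d → h2 d * m < 2# * y) → ∃ λ d → y ≤ h2 d * m × h2 d * m ≤ 2# * y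
      from (d₀ , p₀) = from′ (least (λ d → h2 d * m ≤ 2# * y) (d₀ , <⇒≤ p₀))
        where
        from′ : (∃ λ d → h2 d * m ≤ 2# * y × (∀ d′ → h2 d′ * m ≤ 2# * y → d ℕ.≤ d′)) → ∃ λ d → y ≤ h2 d * m × h2 d * m ≤ 2# * y
        from′ (zero , p , _) = 0 , ≤≈ (<⇒≤ y<m) (sym (*-identityˡ m)) , p
        from′ (suc d , p , min) = suc d , *-cancelʳ-≤ 2# 0<2 (≤-trans (≤-reflexive (*-comm y 2#)) (≤-trans (<⇒≤ (≰⇒> λ q → ℕ.1+n≰n (min d q)))
          (≤-reflexive (trans (sym (½-eq (h2 d * m))) (solve 3 (λ a b c → a :* (b :* c) :+ a :* (b :* c) := a :* b :* c :* (:1 :+ :1)) refl _ _ _))))) , p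

  opaque
    -- The intermediate value theorem stopped after d bisections. A single zero would not be enough:
    -- what is removed from `E` is a cell of relative width 2^-d.
    sign-change : (B : ℝ → ℝ) → ∀ d {u ℓ} → 0# ≤ ℓ → (∀ x y → In u ℓ x → x ≈ y → B x ≈ B y) → 0# ≤ B u → B (u + ℓ) ≤ 0# →
      ∃ λ v → ∃ λ m → Sub u ℓ d v m × 0# ≤ B v × B (v + m) ≤ 0#
    sign-change B zero {u} {ℓ} 0≤ℓ resp p q = u , ℓ , here , p , q
    sign-change B (suc d) {u} {ℓ} 0≤ℓ resp p q with ≤-total (B (u + ½ * ℓ)) 0#
    ... | inj₁ r = goLeft (sign-change B d (half≥0 0≤ℓ) (λ x y x∈ → resp x y (In-left 0≤ℓ x∈)) p r)
      where
      goLeft : (∃ λ v → ∃ λ m → Sub u (½ * ℓ) d v m × 0# ≤ B v × B (v + m) ≤ 0#) → ∃ λ v → ∃ λ m → Sub u ℓ (suc d) v m × 0# ≤ B v × B (v + m) ≤ 0#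
      goLeft (v , m , σ , a , b) = v , m , left σ , a , b
    ... | inj₂ r = goRight (sign-change B d (half≥0 0≤ℓ) (λ x y x∈ → resp x y (In-right 0≤ℓ x∈)) r
        (≈≤ (sym (resp (u + ℓ) (u + ½ * ℓ + ½ * ℓ) (by≤ 0≤ℓ (solve 2 (λ a b → a :+ b := a :+ b :+ :0) refl _ _) , ≤-refl) (sym (right≈ u ℓ)))) q))
      where
      goRight : (∃ λ v → ∃ λ m → Sub (u + ½ * ℓ) (½ * ℓ) d v m × 0# ≤ B v × B (v + m) ≤ 0#) → ∃ λ v → ∃ λ m → Sub u ℓ (suc d) v m × 0# ≤ B v × B (v + m) ≤ 0#
      goRight (v , m , σ , a , b) = v , m , right σ , a , b

  -- A dyadic certificate that q times the largest ∣q xᵢ - θᵢ∣^(1/Wᵢ) is at most 2^-(m₀ + 1): an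
  -- error of at most 2^-(jᵢ + 1) with K Wᵢ ≤ jᵢ + 1 has its power bounded by 2^-K, by `root≤`.
  Approximable : ∀ {n} → Vect n → Vect n → ℕ → ℕ → Vect n → Set
  Approximable {n} W θ N m₀ x = ∃ λ q → ∃ λ (P : Vect n) → ∃ λ K → ∃ λ (j : Fin n → ℕ) → IsInt q × IntV P × fromℕ N ≤ q × 0# < q × q * h2 K ≤ h2 (suc m₀) ×
    (∀ i → fromℕ K * W i ≤ fromℕ (suc (j i))) × (∀ i → ∣ q * x i - θ i - P i ∣ ≤ h2 (suc (j i)))

  opaque
    cancel-inv : ∀ {a b} (p : 0# < a) → b * inv p * a ≈ b
    cancel-inv {a} {b} p = trans (*-assoc _ _ _) (trans (*-congˡ (trans (*-comm _ _) (inv-eq p))) (*-identityʳ b))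

  opaque
    p2h2 : ∀ k x → p2 k * (x * h2 k) ≈ x
    p2h2 k x = trans (solve 3 (λ a b c → a :* (b :* c) := a :* c :* b) refl _ _ _) (trans (*-congʳ (p2-h2 k)) (*-identityˡ x))

  opaque
    constant-split : ∀ g r t l o → 4# * g * r * t * (1# + l) * o ≈ 2# * (2# * g * r * t) * (1# + l) * o
    constant-split g r t l o = (solve 5 (λ a b c d e → (:1 :+ :1 :+ (:1 :+ :1)) :* a :* b :* c :* (:1 :+ d) :* e := (:1 :+ :1) :* ((:1 :+ :1) :* a :* b :* c) :* (:1 :+ d) :* e) refl _ _ _ _ _)

  opaque
    constant-error : ∀ {L l o d h} → 0# ≤ L → 0# ≤ o → 0# ≤ d → 0# ≤ h → 2# * l * o * d * (L * h) ≤ d * (2# * L * (1# + l) * o) * h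
    constant-error {L} {l} {o} {d} {h} p q r t = by≤ (*-nonNeg (*-nonNeg (*-nonNeg (*-nonNeg (<⇒≤ 0<2) p) q) r) t) (solve 5 (λ a b c d e → (:1 :+ :1) :* a :* b :* c :* (d :* e) :+ (:1 :+ :1) :* d :* b :* c :* e := c :* ((:1 :+ :1) :* d :* (:1 :+ a) :* b) :* e :+ :0) refl _ _ _ _ _)

  opaque
    slope-error : ∀ {η L l s h} → 0# ≤ η → 0# ≤ L → 0# ≤ l → 0# ≤ s → 0# ≤ h → 4# * η * (L * h) ≤ η * (2# * L * (1# + l) * (4# * (1# + s))) * h
    slope-error {η} {L} {l} {s} {h} p q r t v = by≤ (*-nonNeg (*-nonNeg (<⇒≤ 0<4) (*-nonNeg p (*-nonNeg q v)))
      (nn+ 0≤1 (*-nonNeg (<⇒≤ 0<2) (nn+ (nn+ r t) (*-nonNeg r t))))) (solve 5 (λ a b c d e → (:1 :+ :1 :+ (:1 :+ :1)) :* a :* (b :* c) :+ (:1 :+ :1 :+ (:1 :+ :1)) :* (a :* (b :* c)) :* (:1 :+ (:1 :+ :1) :* (d :+ e :+ d :* e)) := a :* ((:1 :+ :1) :* b :* (:1 :+ d) :* ((:1 :+ :1 :+ (:1 :+ :1)) :* (:1 :+ e))) :* c :+ :0) refl _ _ _ _ _)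

  module Thin {n : ℕ} (C : Curve (suc n)) (W θ : Vect (suc n)) (W>0 : ∀ i → 0# < W i) (W≤ : ∀ i → W i ≤ W zero) (ΣW≤1 : sum W ≤ 1#)
              {μ₁ ς : ℝ} (0<μ₁ : 0# < μ₁) (ς² : ς * ς ≈ 1#) (∣ς∣≤1 : ∣ ς ∣ ≤ 1#)
              (slope : ∀ x → In (Curve.u₀ C) (Curve.ℓ₀ C) x → μ₁ ≤ ς * Curve.g C 1 zero x)
              (continuous : ∀ x → In (Curve.u₀ C) (Curve.ℓ₀ C) x → ∀ i → ContinuousAt (Curve.g C 1 i) x)
              (N m₀ : ℕ) where
    open Curve C
    open Good C
    open Constants C

    f : Fin (suc n) → ℝ → ℝ
    f = g 0

    E : Pred ℝ 0ℓ
    E z = ¬ Approximable W θ N m₀ (λ i → f i z)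

    -- `σ` bounds the slopes against the first coordinate. Denominators lie between G⁻ 2^k and G⁺
    -- 2^k, and G⁻ is so large that over half a cell of width b the term q f₀ changes by at least (R
    -- Λ + 1) 2^k b, the bound on the first error at the centre. R₁ makes cells wide enough for the
    -- first lattice error to be at most 2^k b.
    σ R G⁻ G⁺ R₁ : ℝ
    σ  = Λ * inv 0<μ₁
    R  = reach (inv 0<ε₁) (suc (suc n))
    G⁻ = 1# + 2# * (R * Λ + 1#) * inv 0<μ₁
    G⁺ = G⁻ + 2# * R
    R₁ = 1# + R

    opaque
      0≤Λ : 0# ≤ Λ
      0≤Λ = Λ≥0 (zero {n})
      0≤σ : 0# ≤ σ
      0≤σ = *-nonNeg 0≤Λ (inv≥0 0<μ₁)
      0≤R : 0# ≤ R
      0≤R = reach≥0 (suc (suc n)) (inv≥0 0<ε₁)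
      0<R₁ : 0# < R₁
      0<R₁ = pos+nn 0<1 0≤R
      0≤RΛ+1 : 0# ≤ R * Λ + 1#
      0≤RΛ+1 = nn+ (*-nonNeg 0≤R 0≤Λ) 0≤1
      1≤G⁻ : 1# ≤ G⁻
      1≤G⁻ = ≤-trans (≤-reflexive (sym (+-identityʳ 1#))) (≤-refl ⊞ *-nonNeg (*-nonNeg (<⇒≤ 0<2) 0≤RΛ+1) (inv≥0 0<μ₁))
      G⁻≥ : 2# * (R * Λ + 1#) * inv 0<μ₁ ≤ G⁻
      G⁻≥ = ≤-trans (≤-reflexive (sym (+-identityˡ _))) (0≤1 ⊞ ≤-refl)
      0<G⁻ : 0# < G⁻
      0<G⁻ = <-≤-trans 0<1 1≤G⁻
      0<G⁺ : 0# < G⁺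
      0<G⁺ = pos+nn 0<G⁻ (*-nonNeg (<⇒≤ 0<2) 0≤R)
      1≤l : 1 ℕ.≤ l
      1≤l = from (nondegenerate (λ _ → 0#))
        where
        from : (∃ λ o → suc o ℕ.≤ l × (∀ x → In u₀ ℓ₀ x → ∀ (k : Fin (suc n)) → μ * ∣ 0# ∣ ≤ ∣ sum (λ i → 0# * g (suc o) i x) ∣)) → 1 ℕ.≤ l
        from (o , p , _) = ℕ.≤-trans (s≤s z≤n) p

    -- The exponents below are chosen so that 4 R ≤ 2^c₀ and G⁺ ≤ 2^(m - m₀ - 1).
    opaque
      c₀-spec : ∃ λ c₀ → 4# * R ≤ p2 c₀
      c₀-spec = ∃p2≥ (4# * R)
      m-spec : ∃ λ m → G⁺ * h2 m ≤ h2 (suc m₀)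
      m-spec = from (∃h2*< (<⇒≤ 0<G⁺) (h2>0 (suc m₀)))
        where
        from : (∃ λ m → h2 m * G⁺ < h2 (suc m₀)) → ∃ λ m → G⁺ * h2 m ≤ h2 (suc m₀)
        from (m , p) = m , ≈≤ (*-comm _ _) (<⇒≤ p)

    -- `τ` is the amount by which the exponent of the first coordinate is lowered to keep the
    -- determinant at least 1. It pays m for the required gain, n + 1 for rounding up the exponents
    -- and c₀ for each of the n finer scales in the other directions.
    c₀ m τ : ℕ
    c₀ = proj₁ c₀-spec
    m  = proj₁ m-spec
    τ  = m ℕ.+ suc n ℕ.+ n ℕ.* c₀

    -- Denominator times width of a cell is at most 2 G⁺ R₁ 2^τ times the first tolerance. Flatness
    -- η = 1/H and subcells of relative width below 1/H reduce the resulting errors to a quarter of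
    -- this tolerance, even after multiplication by a slope; hence the factor 4 (1 + σ).
    H : ℝ
    H = 4# * G⁺ * R₁ * p2 τ * (1# + Λ) * (4# * (1# + σ))

    opaque
      0<H : 0# < H
      0<H = pos* (pos* (pos* (pos* (pos* 0<4 0<G⁺) 0<R₁) (p2>0 τ)) (pos+nn 0<1 0≤Λ)) (pos* 0<4 (pos+nn 0<1 0≤σ))
      depth-spec : ∃ λ D → h2 D * H < 1#
      depth-spec = ∃h2*< (<⇒≤ 0<H) 0<1

    depth : ℕ
    depth = proj₁ depth-spec

    η : ℝ
    η = inv 0<H

    -- A leaf fixes one direction s for all its points. η is prescribed by H, whereas the width of a
    -- leaf is left open.
    Leaf : ℝ → ℝ → ℝ → ℝ → Set
    Leaf u ℓ v w = u ≤ v × v + w ≤ u + ℓ × ∃ λ (s : Vect n) → (∀ i → ∣ s i ∣ ≤ σ) × (∀ z → In v w z → ∀ i → ∣ g 1 (suc i) z + - s i * g 1 zero z ∣ ≤ η)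

    opaque
      leaves : ∀ {u ℓ} → u₀ ≤ u → u + ℓ ≤ u₀ + ℓ₀ → 0# < ℓ → Tree (Leaf u ℓ) u ℓ
      leaves {u} {ℓ} p q 0<ℓ = compact (Leaf u ℓ) (<⇒≤ 0<ℓ) local
        where
        local : ∀ x → In u ℓ x → ∃ λ δ → 0# < δ × (∀ v w → 0# ≤ w → w < δ → u ≤ v → v + w ≤ u + ℓ → In v w x → Leaf u ℓ v w)
        local x (x₁ , x₂) = radius (common-radius Near near)
          where
          x∈ : In u₀ ℓ₀ x
          x∈ = ≤-trans p x₁ , ≤-trans x₂ q
          0<D : 0# < ς * g 1 zero x
          0<D = <-≤-trans 0<μ₁ (slope x x∈)
          s : Vect n
          s i = g 1 (suc i) x * (ς * inv 0<D)
          s-eq : ∀ i → s i * g 1 zero x ≈ g 1 (suc i) x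
          s-eq i = begin
            g 1 (suc i) x * (ς * inv 0<D) * g 1 zero x       ≈⟨ (solve 4 (λ a b c d → a :* (b :* c) :* d := a :* (b :* d :* c)) refl _ _ _ _) ⟩
            g 1 (suc i) x * (ς * g 1 zero x * inv 0<D)       ≈⟨ *-congˡ (inv-eq 0<D) ⟩
            g 1 (suc i) x * 1#                               ≈⟨ *-identityʳ _ ⟩
            g 1 (suc i) x                                    ∎
          inv≤ : inv 0<D ≤ inv 0<μ₁
          inv≤ = *-cancelʳ-≤ (ς * g 1 zero x) 0<D (≈≤ (trans (*-comm _ _) (inv-eq 0<D)) (≤-trans (≤-reflexive (sym (trans (*-comm _ _) (inv-eq 0<μ₁))))
            (*-monoˡ (inv 0<μ₁) (inv≥0 0<μ₁) (slope x x∈))))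
          s≤ : ∀ i → ∣ s i ∣ ≤ σ
          s≤ i = ≈≤ (∣∣-* _ _) (*-mono (∣∣≥0 _) (bounded x x∈ 1 1≤l (suc i)) (∣∣≥0 _) (≈≤ (∣∣-* _ _) (≤≈ (*-mono (∣∣≥0 _) ∣ς∣≤1 (∣∣≥0 _)
            (≈≤ (∣∣-pos (inv≥0 0<D)) inv≤)) (*-identityˡ _))))
          Near : Fin n → ℝ → Set
          Near i δ = ∀ z → ∣ z - x ∣ < δ → ∣ g 1 (suc i) z + - s i * g 1 zero z ∣ ≤ η
          0<σ+1 : 0# < 1# + σ
          0<σ+1 = pos+nn 0<1 0≤σ
          ε₂ : ℝ
          ε₂ = ½ * (η * inv 0<σ+1)
          0<ε₂ : 0# < ½ * η
          0<ε₂ = ½-pos (inv>0 0<H)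
          near : ∀ i → ∃ λ δ → 0# < δ × (∀ δ′ → δ′ ≤ δ → Near i δ′)
          near i = from (continuous x x∈ (suc i) (½ * η) 0<ε₂) (continuous x x∈ zero ε₂ (½-pos (pos* (inv>0 0<H) (inv>0 0<σ+1))))
            where
            separate : ∀ z → g 1 (suc i) z + - s i * g 1 zero z ≈ g 1 (suc i) z - g 1 (suc i) x + - (s i * (g 1 zero z - g 1 zero x))
            separate z = begin
              g 1 (suc i) z + - s i * g 1 zero z                                              ≈⟨ (solve 6 (λ a b c d e f → a :+ (:- (b :* (c :* d))) :* e := a :- b :* (c :* d) :* f :- b :* (c :* d) :* (e :- f)) refl _ _ _ _ _ _) ⟩
              g 1 (suc i) z - s i * g 1 zero x + - (s i * (g 1 zero z - g 1 zero x))          ≈⟨ +-congʳ (+-congˡ (-‿cong (s-eq i))) ⟩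
              g 1 (suc i) z - g 1 (suc i) x + - (s i * (g 1 zero z - g 1 zero x))             ∎
            from : (∃ λ δ → 0# < δ × (∀ z → ∣ z - x ∣ < δ → ∣ g 1 (suc i) z - g 1 (suc i) x ∣ < ½ * η)) →
              (∃ λ δ → 0# < δ × (∀ z → ∣ z - x ∣ < δ → ∣ g 1 zero z - g 1 zero x ∣ < ε₂)) → ∃ λ δ → 0# < δ × (∀ δ′ → δ′ ≤ δ → Near i δ′)
            from (δ₁ , 0<δ₁ , h₁) (δ₂ , 0<δ₂ , h₂) with min₂ 0<δ₁ 0<δ₂
            ... | δ , 0<δ , r₁ , r₂ = δ , 0<δ , λ δ′ δ′≤ z z<δ′ → ≈≤ (∣∣-cong (separate z))
              (≤-trans (∣∣-+ (g 1 (suc i) z - g 1 (suc i) x) (- (s i * (g 1 zero z - g 1 zero x))))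
              (≤-trans (<⇒≤ (h₁ z (<-≤-trans z<δ′ (≤-trans δ′≤ r₁))) ⊞ ≈≤ (trans (∣∣-neg _) (∣∣-* _ _))
                (*-mono (∣∣≥0 _) (≤-trans (s≤ i) (by≤ 0≤1 (solve 2 (λ a b → a :* b :+ :1 := :1 :+ a :* b :+ :0) refl _ _))) (∣∣≥0 _) (<⇒≤ (h₂ z (<-≤-trans z<δ′ (≤-trans δ′≤ r₂))))))
              (≤-reflexive (begin
                ½ * η + (1# + σ) * (½ * (η * inv 0<σ+1))     ≈⟨ (solve 5 (λ a b c d e → a :* b :+ (:1 :+ c :* d) :* (a :* (b :* e)) := a :* b :+ a :* (b :* e :* (:1 :+ c :* d))) refl _ _ _ _ _) ⟩
                ½ * η + ½ * (η * inv 0<σ+1 * (1# + σ))       ≈⟨ +-congˡ (*-congˡ (cancel-inv 0<σ+1)) ⟩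
                ½ * η + ½ * η                                ≈⟨ ½-eq η ⟩
                η                                            ∎))))
          radius : (∃ λ δ → 0# < δ × (∀ i → Near i δ)) → ∃ λ δ → 0# < δ × (∀ v w → 0# ≤ w → w < δ → u ≤ v → v + w ≤ u + ℓ → In v w x → Leaf u ℓ v w)
          radius (δ , 0<δ , h) = δ , 0<δ , λ v w _ w<δ a b x∈v → a , b , s , s≤ , λ z z∈ i → h i z (≤-<-trans (∣-∣-In z∈ x∈v) w<δ)

      climb : ∀ {x y} → In u₀ ℓ₀ x → In u₀ ℓ₀ y → x < y → μ₁ * (y - x) ≤ ς * (f zero y - f zero x)
      climb {x} {y} (a , b) (c , d) x<y = from (mean-value {f zero} {g 1 zero} x<y (λ z p q → derivative z (≤-trans a p , ≤-trans q d) 0 1≤l zero))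
        where
        from : (∃ λ ξ → x ≤ ξ × ξ ≤ y × f zero y - f zero x ≈ g 1 zero ξ * (y - x)) → μ₁ * (y - x) ≤ ς * (f zero y - f zero x)
        from (ξ , p , q , e) = ≤-trans (*-monoʳ (y - x) (sub≥0 (<⇒≤ x<y)) (slope ξ (≤-trans a p , ≤-trans q d)))
          (≤-reflexive (trans (*-assoc _ _ _) (*-congˡ (sym e))))

      f₀-lipschitz : ∀ {x y} → In u₀ ℓ₀ x → In u₀ ℓ₀ y → ∣ f zero y - f zero x ∣ ≤ Λ * ∣ y - x ∣
      f₀-lipschitz (p , q) (r , t) = lipschitz {f zero} {g 1 zero} (λ x a b → derivative x (a , b) 0 1≤l zero) (λ x a b → bounded x (a , b) 1 1≤l zero) p q r t

      -- A cell of the right width containing a point x at which the lattice has no short vector has a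
      -- subcell of bounded depth free of E: the rational point P / q found by transference is so close
      -- to the curve in every direction but (1, s) that a zero of the first error makes all errors small.
      free-subcell-of-E : ∀ {u ℓ v w d a b x} (s : Vect n) (s≤ : ∀ i → ∣ s i ∣ ≤ σ) → u₀ ≤ u → u + ℓ ≤ u₀ + ℓ₀ → u ≤ v → v + w ≤ u + ℓ → 0# < w →
        (∀ z → In v w z → ∀ i → ∣ g 1 (suc i) z + - s i * g 1 zero z ∣ ≤ η) →
        (k : ℕ) (J : Fin (suc n) → ℕ) → (∀ i → fromℕ (k ℕ.+ m) * W i ≤ fromℕ (suc (J i))) → (∀ i → J i ℕ.≤ J zero) → τ ℕ.≤ suc (J zero) → N ℕ.≤ k →
        (e : Fin (suc n) → ℕ) → e zero ≡ suc (J zero) ℕ.∸ τ → (∀ i → e (suc i) ≡ suc (J (suc i)) ℕ.+ c₀) →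
        Sub v w d a b → R₁ * (h2 (e zero) * h2 k) ≤ b → b ≤ 2# * (R₁ * (h2 (e zero) * h2 k)) →
        In a b x → Lattice.Nonshort C s k e 0≤σ s≤ x → Cov E a b (1# - h2 depth)
      free-subcell-of-E {u} {ℓ} {v} {w} {d} {a} {b} {x} s s≤ u₀≤u u+ℓ≤ u≤v v+w≤ 0<w flat k J KW≤ J≤ τ≤ N≤k e e₀≡ e≡ sub b≥ b≤ x∈ nonshort =
          found (approximate x nonshort Q y)
        where
        open Lattice C s k e using (fᵗ)
        open Approximation C s k e 0≤σ s≤ using (approximate; offset)
        bounds : 0# ≤ b × v ≤ a × a + b ≤ v + w
        bounds = Sub-≤ (<⇒≤ 0<w) sub
        0≤b : 0# ≤ b
        0≤b = proj₁ bounds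
        inLeaf : ∀ {z} → In a b z → In v w z
        inLeaf (p , q) = ≤-trans (proj₁ (proj₂ bounds)) p , ≤-trans q (proj₂ (proj₂ bounds))
        leaf⊂root : ∀ {z} → In v w z → In u₀ ℓ₀ z
        leaf⊂root (p , q) = ≤-trans u₀≤u (≤-trans u≤v p) , ≤-trans q (≤-trans v+w≤ u+ℓ≤)
        inRoot : ∀ {z} → In a b z → In u₀ ℓ₀ z
        inRoot z∈ = leaf⊂root (inLeaf z∈)
        c Q : ℝ
        c = a + ½ * b
        -- The middle of the range of denominators; the error R 2^k stays within it.
        Q = (G⁻ + R) * p2 k
        c∈ : In a b c
        c∈ = by≤ (half≥0 0≤b) (solve 3 (λ a b c → a :+ b :* c := a :+ b :* c :+ :0) refl _ _ _) , left≤ a 0≤b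
        y : Vect (suc n)
        -- The first target aims at the centre c of the cell, for x may lie at an end and leave no
        -- room to move on one side. The others are the tilted -θ.
        y zero    = - θ zero + Q * (f zero c - f zero x)
        y (suc i) = - θ (suc i) + s i * θ zero
        h₀ hJ : ℝ
        h₀ = h2 (e zero)
        hJ = h2 (suc (J zero))
        h₀≡ : h₀ ≈ p2 τ * hJ
        h₀≡ = begin
          h₀                                       ≈⟨ sym (trans (*-congʳ (p2-h2 τ)) (*-identityˡ h₀)) ⟩
          p2 τ * h2 τ * h₀                         ≈⟨ *-assoc _ _ _ ⟩
          p2 τ * (h2 τ * h₀)                       ≈⟨ *-congˡ (sym (h2-+ τ (e zero))) ⟩
          p2 τ * h2 (τ ℕ.+ e zero)                 ≈⟨ *-congˡ (reflexive (≡.cong h2 (≡.trans (≡.cong (τ ℕ.+_) e₀≡) (ℕ.m+[n∸m]≡n τ≤)))) ⟩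
          p2 τ * hJ                                ∎
        found : (∃ λ q → ∃ λ P → IsInt q × IntV P × ∣ q - Q ∣ ≤ R * p2 k × (∀ i → ∣ offset x q P i - y i ∣ ≤ R * h2 (e i))) → Cov E a b (1# - h2 depth)
        found (q , P , int-q , int-P , near-q , near) = locate (sign-change B depth 0≤b B-resp B-left B-right)
          where
          q≥ : G⁻ * p2 k ≤ q
          q≥ = by≤ (≤-trans (-x≤∣x∣ (q - Q)) near-q) (solve 4 (λ a b c d → a :* b :+ c :* b := d :- (d :- (a :+ c) :* b)) refl _ _ _ _)
          q≤ : q ≤ G⁺ * p2 k
          q≤ = by≤ (≤-trans (x≤∣x∣ (q - Q)) near-q) (solve 4 (λ a b c d → a :+ b :* c := (d :+ (:1 :+ :1) :* b) :* c :+ (a :- (d :+ b) :* c)) refl _ _ _ _)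
          0<q : 0# < q
          0<q = <-≤-trans (pos* 0<G⁻ (p2>0 k)) q≥
          0≤q : 0# ≤ q
          0≤q = <⇒≤ 0<q
          A B : ℝ → ℝ
          A z = P zero - q * f zero z + θ zero
          B z = ς * A z
          f-resp : ∀ {z z′} → In u₀ ℓ₀ z → z ≈ z′ → f zero z ≈ f zero z′
          f-resp {z} {z′} z∈ z≈z′ = sym (by≈ (∣∣≤0⇒≈0 {f zero z′ - f zero z} (≤-trans (f₀-lipschitz z∈ (≤≈ (proj₁ z∈) z≈z′ , ≈≤ (sym z≈z′) (proj₂ z∈)))
            (≤-reflexive (trans (*-congˡ (trans (∣∣-cong (trans (+-congʳ (sym z≈z′)) (-‿inverseʳ z))) ∣0∣)) (zeroʳ Λ))))) (solve 2 (λ a b → a :+ :0 := b :+ (a :- b)) refl _ _))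
          B-resp : ∀ z z′ → In a b z → z ≈ z′ → B z ≈ B z′
          B-resp z z′ z∈ e′ = *-congˡ (+-congʳ (+-congˡ (-‿cong (*-congˡ (f-resp (inRoot z∈) e′)))))
          A-center : ∣ A c ∣ ≤ (R * Λ + 1#) * (p2 k * b)
          A-center = ≤-trans (≈≤ (∣∣-cong (solve 8 (λ a b c d e f g h → a :- b :* c :+ d := a :- b :* e :- (:- d :+ (f :+ g) :* h :* (c :- e)) :- (b :- (f :+ g) :* h) :* (c :- e)) refl _ _ _ _ _ _ _ _)) (∣∣-+ (offset x q P zero - y zero) (- ((q - Q) * (f zero c - f zero x)))))
            (≤-trans (near zero ⊞ ≈≤ (trans (∣∣-neg _) (∣∣-* _ _)) (*-mono (∣∣≥0 _) near-q (∣∣≥0 _) (≤-trans (f₀-lipschitz (inRoot x∈) (inRoot c∈))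
              (*-monoˡ Λ 0≤Λ (∣-∣-In c∈ x∈))))) (by≤ Rh₀≤ (solve 5 (λ a b c d e → a :* b :+ a :* c :* (d :* e) :+ c :* e := (a :* d :+ :1) :* (c :* e) :+ a :* b) refl _ _ _ _ _)))
            where
            Rh₀≤ : R * h₀ ≤ p2 k * b
            Rh₀≤ = ≤-trans (by≤ (<⇒≤ (h2>0 (e zero))) (solve 2 (λ a b → a :* b :+ b := (:1 :+ a) :* b :+ :0) refl _ _)) (≤-trans (≤-reflexive (sym (p2h2 k (R₁ * h₀))))
              (*-monoˡ (p2 k) (<⇒≤ (p2>0 k)) (≤-trans (≤-reflexive (*-assoc _ _ _)) b≥)))
          0<b : 0# < b
          0<b = <-≤-trans (pos* 0<R₁ (pos* (h2>0 (e zero)) (h2>0 k))) b≥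
          rise : (R * Λ + 1#) * (p2 k * b) ≤ q * (μ₁ * (½ * b))
          rise = ≤-trans (≤-reflexive (begin
              (R * Λ + 1#) * (p2 k * b)                                              ≈⟨ *-congˡ (*-congˡ (sym (½-eq b))) ⟩
              (R * Λ + 1#) * (p2 k * (½ * b + ½ * b))                                ≈⟨ (solve 5 (λ a b c d e → (a :* b :+ :1) :* (c :* (d :* e :+ d :* e)) := (:1 :+ :1) :* (a :* b :+ :1) :* (c :* (d :* e))) refl _ _ _ _ _) ⟩
              2# * (R * Λ + 1#) * (p2 k * (½ * b))                                   ≈⟨ *-congʳ (sym (cancel-inv 0<μ₁)) ⟩
              2# * (R * Λ + 1#) * inv 0<μ₁ * μ₁ * (p2 k * (½ * b))                   ∎))
            (≤-trans (≤-trans (≤-reflexive (solve 7 (λ a b c d e f g → (:1 :+ :1) :* (a :* b :+ :1) :* c :* d :* (e :* (f :* g)) := (:1 :+ :1) :* (a :* b :+ :1) :* c :* (e :* (d :* (f :* g)))) refl _ _ _ _ _ _ _)) (≤≈ (*-monoʳ (p2 k * (μ₁ * (½ * b))) (*-nonNeg (<⇒≤ (p2>0 k)) (*-nonNeg (<⇒≤ 0<μ₁) (half≥0 0≤b))) G⁻≥) (sym (*-assoc _ _ _)))) (*-monoʳ (μ₁ * (½ * b)) (*-nonNeg (<⇒≤ 0<μ₁) (half≥0 0≤b)) q≥))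
          ςA≤ : ∣ ς * A c ∣ ≤ q * (μ₁ * (½ * b))
          ςA≤ = ≈≤ (∣∣-* _ _) (≤-trans (*-monoʳ _ (∣∣≥0 _) ∣ς∣≤1) (≈≤ (*-identityˡ _) (≤-trans A-center rise)))
          left∈ : In a b a
          left∈ = ≤-refl , by≤ 0≤b (solve 2 (λ a b → a :+ b := a :+ b :+ :0) refl _ _)
          right∈ : In a b (a + b)
          right∈ = by≤ 0≤b (solve 2 (λ a b → a :+ b := a :+ b :+ :0) refl _ _) , ≤-refl
          -- B decreases at rate at least q μ₁, and half a cell makes up for the error at the
          -- centre.
          B-left : 0# ≤ B a
          B-left = by≤ (≤-trans (-x≤∣x∣ _) ςA≤ ⊞ *-monoˡ q 0≤q (climb (inRoot left∈) (inRoot c∈) (by< (½-pos 0<b) (solve 3 (λ a b c → a :+ b :* c := a :+ b :* c :+ :0) refl _ _ _)))) (solve 10 (λ a b c d e f g h x8 x9 → :0 :+ (a :* (b :* (c :* d)) :+ a :* (e :* (f :- g))) := e :* (h :- a :* g :+ x8) :+ (:- (e :* (h :- a :* f :+ x8)) :+ a :* (b :* (x9 :+ c :* d :- x9)))) refl _ _ _ _ _ _ _ _ _ _)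
          B-right : B (a + b) ≤ 0#
          B-right = by≤ (≤-trans (x≤∣x∣ _) ςA≤ ⊞ *-monoˡ q 0≤q (≤-trans (*-monoˡ μ₁ (<⇒≤ 0<μ₁) half-gap)
              (climb (inRoot c∈) (inRoot right∈) (by< (<-≤-trans (½-pos 0<b) half-gap) (solve 3 (λ a b c → a :+ b :* c :+ (a :+ c :- (a :+ b :* c)) := a :+ c :+ :0) refl _ _ _))))) (solve 9 (λ a b c d e f g h x8 → a :* (b :- c :* d :+ e) :+ (c :* (f :* (g :* h)) :+ c :* (a :* (d :- x8))) := :0 :+ (a :* (b :- c :* x8 :+ e) :+ c :* (f :* (g :* h)))) refl _ _ _ _ _ _ _ _ _)
            where
            half-gap : ½ * b ≤ a + b - c
            half-gap = by≤ (≤-reflexive (½-eq b)) (solve 3 (λ a b c → a :* b :+ b := c :+ b :- (c :+ a :* b) :+ (a :* b :+ a :* b)) refl _ _ _)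
          locate : (∃ λ v′ → ∃ λ m′ → Sub a b depth v′ m′ × 0# ≤ B v′ × B (v′ + m′) ≤ 0#) → Cov E a b (1# - h2 depth)
          locate (v′ , w′ , sub′ , B≥ , B≤) = Cov-mono {_} {E} 0≤b (λ _ _ z → z) (≤-reflexive (solve 1 (λ a → :1 :- a :* (:1 :- :0) := :1 :- a) refl _))
              (Sub⇒Cov {E} sub′ 0≤1 (none ≤-refl λ z z∈ bad → bad (q , P , k ℕ.+ m , J , int-q , int-P , N≤q , 0<q , q-small , KW≤ , close z z∈)))
            where
            bounds′ : 0# ≤ w′ × a ≤ v′ × v′ + w′ ≤ a + b
            bounds′ = Sub-≤ 0≤b sub′
            inCell : ∀ {z} → In v′ w′ z → In a b z
            inCell = Sub-In 0≤b sub′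
            N≤q : fromℕ N ≤ q
            N≤q = ≤-trans (≤-trans (by≤ 0≤1 (solve 1 (λ a → a :+ :1 := :1 :+ a :+ :0) refl _)) (≤-trans (fromℕ≤p2 N) (p2-mono N≤k))) (≤-trans (≤-trans (≤-reflexive (sym (*-identityˡ _))) (*-monoʳ (p2 k) (<⇒≤ (p2>0 k)) 1≤G⁻)) q≥)
            q-small : q * h2 (k ℕ.+ m) ≤ h2 (suc m₀)
            q-small = ≤-trans (*-monoʳ _ (<⇒≤ (h2>0 (k ℕ.+ m))) q≤) (≤-trans (≤-reflexive (trans (*-congˡ (h2-+ k m)) (trans (solve 5 (λ a b c d e → (a :+ (:1 :+ :1) :* b) :* c :* (d :* e) := (a :+ (:1 :+ :1) :* b) :* e :* (c :* d)) refl _ _ _ _ _) (trans (*-congˡ (p2-h2 k)) (*-identityʳ _))))) (proj₂ m-spec))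
            qb≤ : q * b ≤ 2# * G⁺ * R₁ * p2 τ * hJ
            qb≤ = ≤-trans (*-mono 0≤q q≤ 0≤b b≤) (≤-reflexive (begin
              G⁺ * p2 k * (2# * (R₁ * (h₀ * h2 k)))     ≈⟨ (solve 5 (λ a b c d e → (a :+ (:1 :+ :1) :* b) :* c :* ((:1 :+ :1) :* ((:1 :+ b) :* (d :* e))) := (:1 :+ :1) :* (a :+ (:1 :+ :1) :* b) :* (:1 :+ b) :* (c :* (d :* e))) refl _ _ _ _ _) ⟩
              2# * G⁺ * R₁ * (p2 k * (h₀ * h2 k))       ≈⟨ *-congˡ (trans (p2h2 k h₀) h₀≡) ⟩
              2# * G⁺ * R₁ * (p2 τ * hJ)                ≈⟨ (solve 5 (λ a b c d e → (:1 :+ :1) :* (a :+ (:1 :+ :1) :* b) :* (:1 :+ b) :* (c :* (d :* e)) := (:1 :+ :1) :* (a :+ (:1 :+ :1) :* b) :* (:1 :+ b) :* c :* (d :* e)) refl _ _ _ _ _) ⟩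
              2# * G⁺ * R₁ * p2 τ * hJ                  ∎))
            0≤hJ : 0# ≤ hJ
            0≤hJ = <⇒≤ (h2>0 (suc (J zero)))
            L : ℝ
            L = 2# * G⁺ * R₁ * p2 τ
            0≤L : 0# ≤ L
            0≤L = *-nonNeg (*-nonNeg (*-nonNeg (<⇒≤ 0<2) (<⇒≤ 0<G⁺)) (<⇒≤ 0<R₁)) (<⇒≤ (p2>0 τ))
            -- The first error changes sign on the subcell and is Lipschitz.
            ∣A∣≤ : ∀ z → In v′ w′ z → ∣ A z ∣ ≤ 2# * (q * (Λ * w′))
            ∣A∣≤ z z∈ = ≤-trans (≤-reflexive (trans (∣∣-cong (trans (sym (*-identityˡ _)) (trans (*-congʳ (sym ς²)) (*-assoc _ _ _)))) (∣∣-* ς (B z))))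
              (≤-trans (*-monoʳ _ (∣∣≥0 _) ∣ς∣≤1) (≈≤ (*-identityˡ _) (∣∣≤
                (by≤ (B≤ ⊞ move z∈ right′) (solve 8 (λ a b c d e f g h → a :* (b :- c :* d :+ e) :+ (:0 :+ (:1 :+ :1) :* (c :* (f :* g))) := (:1 :+ :1) :* (c :* (f :* g)) :+ (a :* (b :- c :* h :+ e) :+ (a :* (b :- c :* d :+ e) :- a :* (b :- c :* h :+ e)))) refl _ _ _ _ _ _ _ _)) (by≤ (B≥ ⊞ move left′ z∈) (solve 8 (λ a b c d e f g h → :- (a :* (b :- c :* d :+ e)) :+ (a :* (b :- c :* f :+ e) :+ (:1 :+ :1) :* (c :* (g :* h))) := (:1 :+ :1) :* (c :* (g :* h)) :+ (:0 :+ (a :* (b :- c :* f :+ e) :- a :* (b :- c :* d :+ e)))) refl _ _ _ _ _ _ _ _)))))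
              where
              left′ : In v′ w′ v′
              left′ = ≤-refl , by≤ (proj₁ bounds′) (solve 2 (λ a b → a :+ b := a :+ b :+ :0) refl _ _)
              right′ : In v′ w′ (v′ + w′)
              right′ = by≤ (proj₁ bounds′) (solve 2 (λ a b → a :+ b := a :+ b :+ :0) refl _ _) , ≤-refl
              gap : ∀ z z′ → In v′ w′ z → In v′ w′ z′ → ∣ B z - B z′ ∣ ≤ q * (Λ * w′)
              gap z z′ z∈ z′∈ = ≈≤ (trans (∣∣-cong (solve 6 (λ a b c d e f → a :* (b :- c :* d :+ e) :- a :* (b :- c :* f :+ e) := a :* c :* (f :- d)) refl _ _ _ _ _ _)) (∣∣-* (ς * q) (f zero z′ - f zero z)))
                (*-mono (∣∣≥0 _) (≈≤ (∣∣-* _ _) (≤≈ (*-mono (∣∣≥0 _) ∣ς∣≤1 (∣∣≥0 _) (≤-reflexive (∣∣-pos 0≤q))) (*-identityˡ q))) (∣∣≥0 _)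
                  (≤-trans (f₀-lipschitz (inRoot (inCell z∈)) (inRoot (inCell z′∈))) (*-monoˡ Λ 0≤Λ (∣-∣-In z′∈ z∈))))
              move : ∀ {z z′} → In v′ w′ z → In v′ w′ z′ → B z - B z′ ≤ 2# * (q * (Λ * w′))
              move {z} {z′} z∈ z′∈ = by≤ (x≤∣x∣ (B z - B z′) ⊞ gap z z′ z∈ z′∈ ⊞ *-nonNeg 0≤q (*-nonNeg 0≤Λ (proj₁ bounds′))) (solve 9 (λ a b c d e f g h x8 → a :* (b :- c :* d :+ e) :- a :* (b :- c :* f :+ e) :+ (g :+ c :* (h :* x8) :+ c :* (h :* x8)) := (:1 :+ :1) :* (c :* (h :* x8)) :+ (a :* (b :- c :* d :+ e) :- a :* (b :- c :* f :+ e) :+ g :+ :0)) refl _ _ _ _ _ _ _ _ _)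
            Ω : ℝ
            Ω = 4# * (1# + σ)
            0≤Ω : 0# ≤ Ω
            0≤Ω = *-nonNeg (<⇒≤ 0<4) (nn+ 0≤1 0≤σ)
            H≈ : H ≈ 2# * L * (1# + Λ) * Ω
            H≈ = constant-split G⁺ R₁ (p2 τ) Λ Ω
            arrange : ∀ q l h b o → 2# * (q * (l * (h * b))) * o ≈ 2# * l * o * h * (q * b)
            arrange q l h b o = (solve 5 (λ a b c d e → (:1 :+ :1) :* (a :* (b :* (c :* d))) :* e := (:1 :+ :1) :* b :* e :* c :* (a :* d)) refl _ _ _ _ _)
            A-small : ∀ z → In v′ w′ z → ∣ A z ∣ * Ω ≤ hJ
            A-small z z∈ = ≤-trans (*-monoʳ Ω 0≤Ω (∣A∣≤ z z∈)) (≈≤ width≈ (≤-trans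
              (*-monoˡ (2# * Λ * Ω * h2 depth) (*-nonNeg (*-nonNeg (*-nonNeg (<⇒≤ 0<2) 0≤Λ) 0≤Ω) (<⇒≤ (h2>0 depth))) qb≤)
              (≤-trans (constant-error {L} {Λ} {Ω} {h2 depth} {hJ} 0≤L 0≤Ω (<⇒≤ (h2>0 depth)) 0≤hJ)
              (≤-trans (*-monoʳ hJ 0≤hJ (≤-trans (≤-reflexive (*-congˡ (sym H≈))) (<⇒≤ (proj₂ depth-spec)))) (≤-reflexive (*-identityˡ hJ))))))
              where
              width≈ : 2# * (q * (Λ * w′)) * Ω ≈ 2# * Λ * Ω * h2 depth * (q * b)
              width≈ = trans (*-congʳ (*-congˡ (*-congˡ (*-congˡ (Sub-width sub′))))) (arrange q Λ (h2 depth) b Ω)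
            quarter₀ : ∀ {x y} → 0# ≤ x → x * (4# * (1# + σ)) ≤ y → 4# * x ≤ y
            quarter₀ {x} p q = ≤-trans (by≤ (*-nonNeg (*-nonNeg (<⇒≤ 0<4) p) 0≤σ) (solve 2 (λ a b → (:1 :+ :1 :+ (:1 :+ :1)) :* a :+ (:1 :+ :1 :+ (:1 :+ :1)) :* a :* b := a :* ((:1 :+ :1 :+ (:1 :+ :1)) :* (:1 :+ b)) :+ :0) refl _ _)) q
            quarterσ : ∀ {x y} → 0# ≤ x → x * (4# * (1# + σ)) ≤ y → 4# * (σ * x) ≤ y
            quarterσ {x} p q = ≤-trans (by≤ (*-nonNeg (<⇒≤ 0<4) p) (solve 2 (λ a b → (:1 :+ :1 :+ (:1 :+ :1)) :* (a :* b) :+ (:1 :+ :1 :+ (:1 :+ :1)) :* b := b :* ((:1 :+ :1 :+ (:1 :+ :1)) :* (:1 :+ a)) :+ :0) refl _ _)) q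
            close : ∀ z → In v′ w′ z → ∀ i → ∣ q * f i z - θ i - P i ∣ ≤ h2 (suc (J i))
            close z z∈ zero = ≈≤ (trans (∣∣-cong (solve 4 (λ a b c d → a :* b :- c :- d := :- (d :- a :* b :+ c)) refl _ _ _ _)) (∣∣-neg (A z))) (≤-trans (by≤ (∣∣≥0 (A z) ⊞ ∣∣≥0 (A z) ⊞ ∣∣≥0 (A z)) (solve 1 (λ a → a :+ (a :+ a :+ a) := (:1 :+ :1 :+ (:1 :+ :1)) :* a :+ (:0 :+ :0 :+ :0)) refl _)) (quarter₀ (∣∣≥0 (A z)) (A-small z z∈)))
            close z z∈ (suc i) = quarters (≤-trans (≤-reflexive (trans (∣∣-cong error≈) (∣∣-neg (e₁ + e₂ + e₃))))
                (≤-trans (∣∣-+ (e₁ + e₂) e₃) (∣∣-+ e₁ e₂ ⊞ ≤-refl))) part₁ part₂ part₃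
              where
              h : ℝ
              h = h2 (suc (J (suc i)))
              hJ≤h : hJ ≤ h
              hJ≤h = h2-anti (s≤s (J≤ (suc i)))
              F F′ : ℝ → ℝ
              F z = f (suc i) z + - s i * f zero z
              F′ z = g 1 (suc i) z + - s i * g 1 zero z
              F-der : ∀ z → v ≤ z → z ≤ v + w → Der F z (F′ z)
              F-der z p q = der-+ {f (suc i)} {λ y → - s i * f zero y} (derivative z (leaf⊂root (p , q)) 0 1≤l (suc i)) (der-* {f zero} (- s i) (derivative z (leaf⊂root (p , q)) 0 1≤l zero))
              z∈v : In v w z
              z∈v = inLeaf (inCell z∈)
              x∈v : In v w x
              x∈v = inLeaf x∈
              -- In order: the lattice error in tilted coordinates, the change of the tilted curve
              -- between x and z, and the first error carried back by undoing the tilt.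
              e₁ e₂ e₃ : ℝ
              e₁ = offset x q P (suc i) - y (suc i)
              e₂ = - (q * (F z - F x))
              e₃ = s i * A z
              error≈ : q * f (suc i) z - θ (suc i) - P (suc i) ≈ - (e₁ + e₂ + e₃)
              error≈ = (solve 10 (λ a b c d e f g h x8 x9 → a :* b :- c :- d := :- (d :- a :* e :- f :* (g :- a :* h) :- (:- c :+ f :* x8) :- a :* (b :+ (:- f) :* x9 :- (e :+ (:- f) :* h)) :+ f :* (g :- a :* x9 :+ x8))) refl _ _ _ _ _ _ _ _ _ _)
              part₁ : 4# * ∣ e₁ ∣ ≤ h
              part₁ = ≤-trans (*-monoˡ 4# (<⇒≤ 0<4) (near (suc i))) (≤-trans (≤-reflexive scale)
                (≤-trans (*-monoʳ (h * h2 c₀) (*-nonNeg (<⇒≤ (h2>0 (suc (J (suc i))))) (<⇒≤ (h2>0 c₀))) (proj₂ c₀-spec)) (≤-reflexive (p2h2 c₀ h))))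
                where
                scale : 4# * (R * h2 (e (suc i))) ≈ 4# * R * (h * h2 c₀)
                scale = trans (*-congˡ (*-congˡ (trans (reflexive (≡.cong h2 (e≡ i))) (h2-+ (suc (J (suc i))) c₀)))) (solve 4 (λ a b c d → (:1 :+ :1 :+ (:1 :+ :1)) :* (a :* (b :* c :* d)) := (:1 :+ :1 :+ (:1 :+ :1)) :* a :* (b :* c :* d)) refl _ _ _ _)
              part₂ : 4# * ∣ e₂ ∣ ≤ h
              part₂ = ≤-trans (*-monoˡ 4# (<⇒≤ 0<4) (≈≤ (trans (∣∣-neg _) (trans (∣∣-* _ _) (*-congʳ (∣∣-pos 0≤q)))) (*-monoˡ q 0≤q
                  (≤-trans (lipschitz {F} {F′} F-der (λ z p r → flat z (p , r) i) (proj₁ x∈v) (proj₂ x∈v) (proj₁ z∈v) (proj₂ z∈v)) (*-monoˡ η (inv≥0 0<H) (∣-∣-In (inCell z∈) x∈))))))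
                (≤-trans (≤-reflexive (regroup η b)) (≤-trans (*-monoˡ (4# * η) (*-nonNeg (<⇒≤ 0<4) (inv≥0 0<H)) qb≤) (≤-trans small hJ≤h)))
                where
                regroup : ∀ η b → 4# * (q * (η * b)) ≈ 4# * η * (q * b)
                regroup η b = (solve 3 (λ a b c → (:1 :+ :1 :+ (:1 :+ :1)) :* (a :* (b :* c)) := (:1 :+ :1 :+ (:1 :+ :1)) :* b :* (a :* c)) refl _ _ _)
                small : 4# * η * (L * hJ) ≤ hJ
                small = ≤-trans (slope-error {η} {L} {Λ} {σ} {hJ} (inv≥0 0<H) 0≤L 0≤Λ 0≤σ 0≤hJ)
                  (≤-reflexive (trans (*-congʳ (trans (*-congˡ (sym H≈)) (trans (*-comm _ _) (inv-eq 0<H)))) (*-identityˡ hJ)))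
              part₃ : 4# * ∣ e₃ ∣ ≤ h
              part₃ = ≤-trans (*-monoˡ 4# (<⇒≤ 0<4) (≈≤ (∣∣-* _ _) (*-monoʳ _ (∣∣≥0 _) (s≤ i)))) (≤-trans (quarterσ (∣∣≥0 (A z)) (A-small z z∈)) hJ≤h)
              quarters : ∀ {t p r o} → t ≤ p + r + o → 4# * p ≤ h → 4# * r ≤ h → 4# * o ≤ h → t ≤ h
              quarters t≤ a b c = *-cancelʳ-≤ 4# 0<4 (by≤ (*-monoʳ 4# (<⇒≤ 0<4) t≤ ⊞ a ⊞ b ⊞ c ⊞ <⇒≤ (h2>0 (suc (J (suc i))))) (solve 6 (λ a b c d e f → a :* (:1 :+ :1 :+ (:1 :+ :1)) :+ ((b :+ c :+ d) :* (:1 :+ :1 :+ (:1 :+ :1)) :+ e :* f :+ e :* f :+ e :* f :+ e :* f) := e :* f :* (:1 :+ :1 :+ (:1 :+ :1)) :+ (a :* (:1 :+ :1 :+ (:1 :+ :1)) :+ (:1 :+ :1 :+ (:1 :+ :1)) :* b :+ (:1 :+ :1 :+ (:1 :+ :1)) :* c :+ (:1 :+ :1 :+ (:1 :+ :1)) :* d :+ :0)) refl _ _ _ _ _ _))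

    θ* : ℝ
    θ* = 1# - h2 (suc n ℕ.* dbl l) * h2 depth

    opaque
      -- The leaf determines B, B the lower bound E₀ for the exponents, and these determine k. None
      -- of them enters `θ*`, which is therefore the same for all leaves, however narrow.
      leaf-cover : ∀ {u ℓ} → u₀ ≤ u → u + ℓ ≤ u₀ + ℓ₀ → ∀ v w → 0# < w → Leaf u ℓ v w → Cov E v w θ*
      leaf-cover {u} {ℓ} u₀≤u u+ℓ≤ v w 0<w (u≤v , v+w≤ , s , s≤ , flat) =
          choose (coefficients-bounded {v} {w} (≤-trans u₀≤u u≤v) (≤-trans v+w≤ u+ℓ≤) 0<w)
        where
        0<T : 0# < 1# + fromℕ n * σ
        0<T = pos+nn 0<1 (*-nonNeg (fromℕ≥0 n) 0≤σ)
        T t : ℝ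
        T = 1# + fromℕ n * σ
        t = ½ * inv 0<T
        0<t : 0# < t
        0<t = ½-pos (inv>0 0<T)
        Control : ℝ → Set
        Control B = ∀ c₀ c t → 0# ≤ t → (∀ x → In v w x → ∣ comb c₀ c 0 x ∣ ≤ t) → ∣ c₀ ∣ ≤ B * t × (∀ k → ∣ c k ∣ ≤ B * t)
        choose : (∃ λ B → 0# < B × Control B) → Cov E v w θ*
        choose (B , 0<B , control) = choose₁ (∃p2≥ (B * T * inv 0<t + 1#))
          where
          choose₁ : (∃ λ E₀ → B * T * inv 0<t + 1# ≤ p2 E₀) → Cov E v w θ*
          choose₁ (E₀ , E₀≥) = choose₂ (common-bound (λ i M → fromℕ (E₀ ℕ.+ τ) ≤ M * W i)
              (λ i → fromℕ (E₀ ℕ.+ τ) * inv (W>0 i) , λ M p → ≤-trans (≤-reflexive (sym (cancel-inv (W>0 i)))) (*-monoʳ (W i) (<⇒≤ (W>0 i)) p)))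
              (∃h2*< (<⇒≤ 0<R₁) 0<w)
            where
            choose₂ : (∃ λ M → ∀ i → fromℕ (E₀ ℕ.+ τ) ≤ M * W i) → (∃ λ k → h2 k * R₁ < w) → Cov E v w θ*
            choose₂ (M , M≥) (k₁ , R₁<w) = choose₃ (archimedean M)
              where
              choose₃ : (∃ λ k → M < fromℕ k) → Cov E v w θ*
              choose₃ (k₂ , M<k₂) = assemble (fitting-level 0<y y<w)
                where
                k Kₘ : ℕ
                -- The summands ensure large exponents, denominators at least N, and cells that fit
                -- into the leaf.
                k = k₂ ℕ.+ N ℕ.+ k₁
                Kₘ = k ℕ.+ m
                0≤KW : ∀ i → 0# ≤ fromℕ Kₘ * W i
                0≤KW i = *-nonNeg (fromℕ≥0 Kₘ) (<⇒≤ (W>0 i))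
                ceil : ∀ i → ∃ λ c → fromℕ Kₘ * W i ≤ fromℕ c × fromℕ c ≤ fromℕ Kₘ * W i + 1# × (∀ d → fromℕ Kₘ * W i ≤ fromℕ d → c ℕ.≤ d)
                ceil i = ceiling (fromℕ Kₘ * W i) (0≤KW i)
                J : Fin (suc n) → ℕ
                -- The tolerance is 2^-(J i + 1), a positive exponent being needed in `root≤`; a
                -- ceiling of 0 is thereby raised to 1.
                J i = proj₁ (ceil i) ℕ.∸ 1
                KW≤ : ∀ i → fromℕ Kₘ * W i ≤ fromℕ (suc (J i))
                KW≤ i = ≤-trans (proj₁ (proj₂ (ceil i))) (fromℕ-mono (ℕ.m≤n+m∸n (proj₁ (ceil i)) 1))
                ≤KW : ∀ i → fromℕ (suc (J i)) ≤ fromℕ Kₘ * W i + 1#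
                ≤KW i = from (proj₁ (ceil i)) (proj₁ (proj₂ (proj₂ (ceil i))))
                  where
                  from : ∀ c → fromℕ c ≤ fromℕ Kₘ * W i + 1# → fromℕ (suc (c ℕ.∸ 1)) ≤ fromℕ Kₘ * W i + 1#
                  from zero    p = by≤ (0≤KW i) (solve 2 (λ a b → :1 :+ :0 :+ a :* b := a :* b :+ :1 :+ :0) refl _ _)
                  from (suc c) p = p
                J≤ : ∀ i → J i ℕ.≤ J zero
                J≤ i = ℕ.∸-monoˡ-≤ 1 (proj₂ (proj₂ (proj₂ (ceil i))) (proj₁ (ceil zero))
                  (≤-trans (*-monoˡ (fromℕ Kₘ) (fromℕ≥0 Kₘ) (W≤ i)) (proj₁ (proj₂ (ceil zero)))))
                k₂≤Kₘ : k₂ ℕ.≤ Kₘ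
                k₂≤Kₘ = ℕ.≤-trans (ℕ.≤-trans (ℕ.m≤m+n k₂ N) (ℕ.m≤m+n (k₂ ℕ.+ N) k₁)) (ℕ.m≤m+n k m)
                N≤k : N ℕ.≤ k
                N≤k = ℕ.≤-trans (ℕ.m≤n+m N k₂) (ℕ.m≤m+n (k₂ ℕ.+ N) k₁)
                E₀τ≤ : ∀ i → E₀ ℕ.+ τ ℕ.≤ suc (J i)
                E₀τ≤ i = fromℕ-reflects-≤ (≤-trans (M≥ i) (≤-trans (*-monoʳ (W i) (<⇒≤ (W>0 i)) (≤-trans (<⇒≤ M<k₂) (fromℕ-mono k₂≤Kₘ))) (KW≤ i)))
                τ≤ : τ ℕ.≤ suc (J zero)
                τ≤ = ℕ.≤-trans (ℕ.m≤n+m τ E₀) (E₀τ≤ zero)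
                e : Fin (suc n) → ℕ
                e zero    = suc (J zero) ℕ.∸ τ
                e (suc i) = suc (J (suc i)) ℕ.+ c₀
                E₀≤e : ∀ i → E₀ ℕ.≤ e i
                E₀≤e zero    = ℕ.m+n≤o⇒m≤o∸n E₀ (E₀τ≤ zero)
                E₀≤e (suc i) = ℕ.≤-trans (ℕ.≤-trans (ℕ.m≤m+n E₀ τ) (E₀τ≤ (suc i))) (ℕ.m≤m+n _ c₀)
                large : ∀ i → B * T < p2 (e i) * t
                large i = <-≤-trans (<-≤-trans (≤-<-trans (≤-reflexive (sym (cancel-inv 0<t))) (*-monoʳ-< 0<t (by< 0<1 (solve 4 (λ a b c d → a :* (:1 :+ b :* c) :* d :+ :1 := a :* (:1 :+ b :* c) :* d :+ :1 :+ :0) refl _ _ _ _))))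
                  (*-monoʳ t (<⇒≤ 0<t) E₀≥)) (*-monoʳ t (<⇒≤ 0<t) (p2-mono (E₀≤e i)))
                total-J : total (λ i → suc (J i)) ℕ.≤ Kₘ ℕ.+ suc n
                total-J = fromℕ-reflects-≤ (≤-trans (total≤ (λ i → suc (J i)) (λ i → fromℕ Kₘ * W i) ≤KW)
                  (≤-trans (≈≤ (+-congʳ (sum-* (fromℕ Kₘ) W)) (≤≈ (*-monoˡ (fromℕ Kₘ) (fromℕ≥0 Kₘ) ΣW≤1) (*-identityʳ _) ⊞ ≤-refl))
                    (≤-reflexive (sym (fromℕ-+ Kₘ (suc n))))))
                total-e : total e ℕ.≤ k
                total-e = ℕ.+-cancelʳ-≤ τ (total e) k (ℕ.≤-trans (ℕ.≤-reflexive sum-e) (ℕ.≤-trans (ℕ.+-monoˡ-≤ (n ℕ.* c₀) total-J) (ℕ.≤-reflexive sum-τ)))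
                  where
                  rest : ℕ
                  rest = total (λ i → suc (J (suc i)))
                  sum-e : total e ℕ.+ τ ≡ total (λ i → suc (J i)) ℕ.+ n ℕ.* c₀
                  sum-e = ≡.trans (≡.cong (λ r → suc (J zero) ℕ.∸ τ ℕ.+ r ℕ.+ τ) (total-+ (λ i → suc (J (suc i))) c₀))
                    (≡.trans (ℕ.+-assoc (suc (J zero) ℕ.∸ τ) _ τ) (≡.trans (≡.cong (suc (J zero) ℕ.∸ τ ℕ.+_) (ℕ.+-comm (rest ℕ.+ n ℕ.* c₀) τ))
                    (≡.trans (≡.sym (ℕ.+-assoc (suc (J zero) ℕ.∸ τ) τ _)) (≡.trans (≡.cong (ℕ._+ (rest ℕ.+ n ℕ.* c₀)) (ℕ.m∸n+n≡m τ≤))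
                    (≡.sym (ℕ.+-assoc (suc (J zero)) rest (n ℕ.* c₀)))))))
                  sum-τ : Kₘ ℕ.+ suc n ℕ.+ n ℕ.* c₀ ≡ k ℕ.+ τ
                  sum-τ = ≡.trans (≡.cong (ℕ._+ n ℕ.* c₀) (ℕ.+-assoc k m (suc n))) (ℕ.+-assoc k (m ℕ.+ suc n) (n ℕ.* c₀))
                big : 1# ≤ p2 k * factor (λ i → h2 (e i)) full
                big = ≤-trans (≤-reflexive (sym (p2-h2 k))) (*-monoˡ (p2 k) (<⇒≤ (p2>0 k)) (≤≈ (h2-anti total-e) (sym (factor-total e))))
                y : ℝ
                y = R₁ * (h2 (e zero) * h2 k)
                0<y : 0# < y
                0<y = pos* 0<R₁ (pos* (h2>0 (e zero)) (h2>0 k))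
                y<w : y < w
                y<w = ≤-<-trans (≤-trans (*-monoˡ R₁ (<⇒≤ 0<R₁) (≤≈ (*-mono (<⇒≤ (h2>0 (e zero))) (h2≤1 (e zero)) (<⇒≤ (h2>0 k)) (h2-anti (ℕ.m≤n+m k₁ (k₂ ℕ.+ N)))) (*-identityˡ _)))
                  (≤-reflexive (*-comm _ _))) R₁<w
                open Lattice C s k e using (Nonshort; nonshort-cover)
                assemble : (∃ λ d → y ≤ h2 d * w × h2 d * w ≤ 2# * y) → Cov E v w θ*
                -- At depth d the cells have the width required. Those not inside the covering from
                -- nondivergence contain a nonshort point and lose a further share of 2^-`depth`.
                assemble (d , y≤ , ≤2y) = Cov-mono {_} {E} (<⇒≤ 0<w) (λ _ _ z → z) (≤-reflexive (arrange (h2 (suc n ℕ.* dbl l)) (h2 depth)))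
                    (Cov-replace {λ x → ¬ Nonshort 0≤σ s≤ x} {E} d (<⇒≤ 0<w) (by≤ (h2≤1 depth) (solve 1 (λ a → :0 :+ :1 := :1 :- a :+ a) refl _)) (by≤ (<⇒≤ (h2>0 depth)) (solve 1 (λ a → :1 :- a :+ a := :1 :+ :0) refl _))
                      (nonshort-cover 0≤σ s≤ big (≤-trans u₀≤u u≤v) (≤-trans v+w≤ u+ℓ≤) 0<w 0<B control large) cell)
                  where
                  arrange : ∀ a b → 1# - a + (1# - (1# - a)) * (1# - b) ≈ 1# - a * b
                  arrange a b = (solve 2 (λ a b → :1 :- a :+ (:1 :- (:1 :- a)) :* (:1 :- b) := :1 :- a :* b) refl _ _)
                  cell : ∀ {a b} → Sub v w d a b → (∃ λ x → In a b x × ¬ ¬ Nonshort 0≤σ s≤ x) → Cov E a b (1# - h2 depth)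
                  cell sub (x , x∈ , ¬¬nonshort) = free-subcell-of-E s s≤ u₀≤u u+ℓ≤ u≤v v+w≤ 0<w flat k J KW≤ J≤ τ≤ N≤k e ≡.refl (λ _ → ≡.refl) sub
                    (≤≈ y≤ (sym (Sub-width sub))) (≈≤ (Sub-width sub) ≤2y) x∈ (by-contradiction ¬¬nonshort)

      inapproximable-null : Null (λ x → In u₀ ℓ₀ x × E x)
      inapproximable-null = thin⇒Null {E} {u₀} {ℓ₀} {θ*} 0<ℓ₀ 0≤θ* θ*<1 thin
        where
        0<ab : 0# < h2 (suc n ℕ.* dbl l) * h2 depth
        0<ab = pos* (h2>0 (suc n ℕ.* dbl l)) (h2>0 depth)
        0≤θ* : 0# ≤ θ*
        0≤θ* = sub≥0 (≤≈ (*-mono (<⇒≤ (h2>0 (suc n ℕ.* dbl l))) (h2≤1 (suc n ℕ.* dbl l)) (<⇒≤ (h2>0 depth)) (h2≤1 depth)) (*-identityˡ 1#))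
        θ*<1 : θ* < 1#
        θ*<1 = by< 0<ab (solve 2 (λ a b → :1 :- a :* b :+ a :* b := :1 :+ :0) refl _ _)
        thin : ∀ {d v w} → Sub u₀ ℓ₀ d v w → Cov E v w θ*
        thin {d} {v} {w} sub = Tree⇒Cov {A = E} 0<w (leaf-cover p q) (leaves p q 0<w)
          where
          0<w : 0# < w
          0<w = <-≤-trans (pos* (h2>0 d) 0<ℓ₀) (≤-reflexive (sym (Sub-width sub)))
          p : u₀ ≤ v
          p = proj₁ (proj₂ (Sub-≤ (<⇒≤ 0<ℓ₀) sub))
          q : v + w ≤ u₀ + ℓ₀
          q = proj₂ (proj₂ (Sub-≤ (<⇒≤ 0<ℓ₀) sub))

  opaque
    -- By goodness every cell contains a subcell of fixed depth without zeros of the derivative.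
    critical-null : ∀ {n} (C : Curve n) i → Null (λ x → In (Curve.u₀ C) (Curve.ℓ₀ C) x × Curve.g C 1 i x ≈ 0#)
    critical-null C i = thin⇒Null {λ x → g 1 i x ≈ 0#} {u₀} {ℓ₀} {1# - h2 (dbl l) * (1# - 0#)} 0<ℓ₀ (by≤ (h2≤1 (dbl l)) (solve 1 (λ a → :0 :+ :1 := :1 :- a :* (:1 :- :0) :+ a) refl _)) (by< (h2>0 (dbl l)) (solve 1 (λ a → :1 :- a :* (:1 :- :0) :+ a := :1 :+ :0) refl _)) thin
      where
      open Curve C
      open Good C
      thin : ∀ {d v w} → Sub u₀ ℓ₀ d v w → Cov (λ x → g 1 i x ≈ 0#) v w (1# - h2 (dbl l) * (1# - 0#))
      thin {d} {v} {w} sub = from (hit-or-free (λ x → g 1 i x ≈ 0#) (dbl l) v w)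
        where
        bounds : 0# ≤ w × u₀ ≤ v × v + w ≤ u₀ + ℓ₀
        bounds = Sub-≤ (<⇒≤ 0<ℓ₀) sub
        from : HitAll (λ x → g 1 i x ≈ 0#) (dbl l) v w ⊎ (∃ λ a → ∃ λ b → Sub v w (dbl l) a b × (∀ x → In a b x → ¬ (g 1 i x ≈ 0#))) →
          Cov (λ x → g 1 i x ≈ 0#) v w (1# - h2 (dbl l) * (1# - 0#))
        from (inj₁ hit) = ⊥-elim (derivative-not-everywhere-zero i (proj₁ (proj₂ bounds)) (proj₂ (proj₂ bounds))
          (<-≤-trans (pos* (h2>0 d) 0<ℓ₀) (≤-reflexive (sym (Sub-width sub)))) hit)
        from (inj₂ (a , b , sub′ , free)) = Sub⇒Cov {λ x → g 1 i x ≈ 0#} sub′ 0≤1 (none ≤-refl free)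

-- Derivatives of the given map near a nondegenerate point

module Charts (em : ExcludedMiddle 0ℓ) (reals : CompleteOrderedField) where

  open Analysis em reals hiding (zero; ∣_∣; ContinuousAt)
  open OrderedField em reals
  open Numbers em reals
  open Calculus em reals
  open Exterior em reals
  open Goodness em reals
  open IntegerSolver commutativeRing
  open SetoidReasoning setoid

  opaque
    open-ball : ∀ {x y z δ} → ∣ z - y ∣ < δ - ∣ y - x ∣ → ∣ z - x ∣ < δ
    open-ball {x} {y} {z} {δ} p = ≤-<-trans (≈≤ (∣∣-cong (solve 3 (λ a b c → a :- b := a :- c :+ (c :- b)) refl _ _ _)) (∣∣-+ (z - y) (y - x))) (by< (p <⊞ ≤-refl {∣ y - x ∣}) (solve 3 (λ a b c → a :+ b :+ (c :- b :+ b) := c :+ (a :+ b)) refl _ _ _))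

  opaque
    center : ∀ {x δ} → 0# < δ → ∣ x - x ∣ < δ
    center p = ≤-<-trans (≤-reflexive (trans (∣∣-cong (solve 1 (λ a → a :- a := :0) refl _)) ∣0∣)) p

  opaque
    ∣∣-def-< : ∀ {x δ} → ∣ x ∣ < δ → Analysis.∣_∣ em reals x < δ
    ∣∣-def-< {x} {δ} = ≡.subst (λ t → t < δ) (∣∣-def x)

  opaque
    ∣∣-def-> : ∀ {x δ} → Analysis.∣_∣ em reals x < δ → ∣ x ∣ < δ
    ∣∣-def-> {x} {δ} = ≡.subst (λ t → t < δ) (≡.sym (∣∣-def x))

  -- G need not respect _≈_, so G (y + (z - y)) and G z are compared through F.
  opaque
    HasDerivativeAt⇒Der : ∀ {F G : ℝ → ℝ} {y D ρ} → 0# < ρ → (∀ z z′ → z ≈ z′ → ∣ z - y ∣ < ρ → F z ≈ G z′) → HasDerivativeAt G y D → Der F y D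
    HasDerivativeAt⇒Der {F} {G} {y} {D} {ρ} 0<ρ agree d = mkDer λ ε 0<ε → from ε 0<ε (d ε 0<ε)
      where
      at-y : F y ≈ G y
      at-y = agree y y refl (center 0<ρ)
      from : ∀ ε → 0# < ε → (∃ λ δ → 0# < δ × (∀ h (h≉0 : ¬ (h ≈ 0#)) → Analysis.∣_∣ em reals h < δ →
        Analysis.∣_∣ em reals ((G (y + h) - G y) * h ⁻¹[ h≉0 ] - D) < ε)) →
        ∃ λ δ → 0# < δ × (∀ z → ∣ z - y ∣ < δ → ∣ F z - F y - D * (z - y) ∣ ≤ ε * ∣ z - y ∣)
      from ε 0<ε (δ₁ , 0<δ₁ , h₁) = from′ (min₂ 0<δ₁ 0<ρ)
        where
        from′ : (∃ λ δ → 0# < δ × δ ≤ δ₁ × δ ≤ ρ) → ∃ λ δ → 0# < δ × (∀ z → ∣ z - y ∣ < δ → ∣ F z - F y - D * (z - y) ∣ ≤ ε * ∣ z - y ∣)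
        from′ (δ , 0<δ , δ≤δ₁ , δ≤ρ) = δ , 0<δ , λ z p → bound z p (lem (z - y ≈ 0#))
          where
          bound : ∀ z → ∣ z - y ∣ < δ → (z - y ≈ 0#) ⊎ ¬ (z - y ≈ 0#) → ∣ F z - F y - D * (z - y) ∣ ≤ ε * ∣ z - y ∣
          bound z p (inj₁ e) = ≈≤ (trans (∣∣-cong zero′) ∣0∣) (*-nonNeg (<⇒≤ 0<ε) (∣∣≥0 (z - y)))
            where
            z≈y : z ≈ y
            z≈y = by≈ e (solve 2 (λ a b → a :+ :0 := b :+ (a :- b)) refl _ _)
            zero′ : F z - F y - D * (z - y) ≈ 0#
            zero′ = trans (+-cong (+-cong (trans (agree z y z≈y (<-≤-trans p δ≤ρ)) (sym at-y)) refl) (-‿cong (*-congˡ e))) (solve 2 (λ a b → a :- a :- b :* :0 := :0) refl _ _)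
          bound z p (inj₂ h≉0) = ≈≤ (trans (∣∣-cong split) (∣∣-* quotient (z - y))) (*-monoʳ ∣ z - y ∣ (∣∣≥0 (z - y)) (<⇒≤ small))
            where
            h quotient : ℝ
            h = z - y
            quotient = (G (y + h) - G y) * h ⁻¹[ h≉0 ] - D
            small : ∣ quotient ∣ < ε
            small = ∣∣-def-> (h₁ h h≉0 (∣∣-def-< (<-≤-trans p δ≤δ₁)))
            expand : ∀ a b i → (a - b) * i * h ≈ (a - b) * (h * i)
            expand a b i = (solve 5 (λ a b c d e → (a :- b) :* c :* (d :- e) := (a :- b) :* ((d :- e) :* c)) refl _ _ _ _ _)
            split : F z - F y - D * h ≈ quotient * h
            split = begin
              F z - F y - D * h                                ≈⟨ +-congʳ (+-cong (agree z (y + h) (solve 2 (λ a b → a := b :+ (a :- b)) refl _ _) (<-≤-trans p δ≤ρ)) (-‿cong at-y)) ⟩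
              G (y + h) - G y - D * h                          ≈⟨ +-congʳ (*-identityʳ _) ⟨
              (G (y + h) - G y) * 1# - D * h                   ≈⟨ +-congʳ (*-congˡ (⁻¹-inverse h h≉0)) ⟨
              (G (y + h) - G y) * (h * h ⁻¹[ h≉0 ]) - D * h    ≈⟨ +-congʳ (expand (G (y + h)) (G y) (h ⁻¹[ h≉0 ])) ⟨
              (G (y + h) - G y) * h ⁻¹[ h≉0 ] * h - D * h      ≈⟨ factored (G (y + h)) (G y) (h ⁻¹[ h≉0 ]) ⟩
              quotient * h                                     ∎
              where
              factored : ∀ a b i → (a - b) * i * h - D * h ≈ ((a - b) * i - D) * h
              factored a b i = (solve 6 (λ a b c d e f → (a :- b) :* c :* (d :- e) :- f :* (d :- e) := ((a :- b) :* c :- f) :* (d :- e)) refl _ _ _ _ _ _)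

  opaque
    der-move : ∀ {F z z′ D} → z ≈ z′ → F z ≈ F z′ → Der F z′ D → Der F z D
    der-move {F} {z} {z′} {D} z≈z′ Fz≈ (mkDer d) = mkDer λ ε 0<ε → from ε (d ε 0<ε)
      where
      from : ∀ ε → (∃ λ δ → 0# < δ × (∀ y → ∣ y - z′ ∣ < δ → ∣ F y - F z′ - D * (y - z′) ∣ ≤ ε * ∣ y - z′ ∣)) →
        ∃ λ δ → 0# < δ × (∀ y → ∣ y - z ∣ < δ → ∣ F y - F z - D * (y - z) ∣ ≤ ε * ∣ y - z ∣)
      from ε (δ , 0<δ , h) = δ , 0<δ , λ y p → ≈≤ (∣∣-cong (+-cong (+-congˡ (-‿cong Fz≈)) (-‿cong (*-congˡ (shift y)))))
          (≤≈ (h y (≤-<-trans (≤-reflexive (∣∣-cong (sym (shift y)))) p)) (*-congˡ (∣∣-cong (sym (shift y)))))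
        where
        shift : ∀ y → y - z ≈ y - z′
        shift y = +-congˡ (-‿cong z≈z′)

  module _ {U : Pred ℝ 0ℓ} {n : ℕ} (f : Map U n) where

    open Func f using (to) renaming (cong to to-cong)

    opaque
      extend : Fin n → ℝ → ℝ
      extend i x with em {U x}
      ... | yes x∈U = to (x , x∈U) i
      ... | no  _   = 0#
      extend-∈ : ∀ i {x y} (y∈U : U y) → U x → x ≈ y → extend i x ≈ to (y , y∈U) i
      extend-∈ i {x} {y} y∈U x∈ x≈y with em {U x}
      ... | yes x∈U = to-cong {x , x∈U} {y , y∈U} x≈y i
      ... | no ¬x∈U = ⊥-elim (¬x∈U x∈)

    module Jet {l x₀ δ} {g : ℕ → ℝ → Vector ℝ n} (jet : IsJet f l x₀ δ g) where
      open IsJet jet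

      -- A jet comes with its point x₀. Its zeroth member is exchanged for `extend`, which does not
      -- depend on x₀, so that charts obtained from different points concern the same functions.
      G : ℕ → Fin n → ℝ → ℝ
      G zero    i x = extend i x
      G (suc j) i x = g (suc j) x i

      opaque
        -- The members of a jet need not respect `_≈_`. The zeroth one agrees with f, which does,
        -- and each further one is a derivative of its predecessor, hence determined by uniqueness.
        -- The induction runs jointly with `G-der`.
        G-agree : ∀ j → j ℕ.≤ l → ∀ i z z′ → z ≈ z′ → ∣ z - x₀ ∣ < δ → G j i z ≈ g j z′ i
        G-der : ∀ j → j ℕ.< l → ∀ i y → ∣ y - x₀ ∣ < δ → Der (G j i) y (G (suc j) i y)
        G-agree zero j≤l i z z′ z≈z′ z∈ = from (extends z (∣∣-def-< z∈))
            (extends z′ (∣∣-def-< (≤-<-trans (≤-reflexive (∣∣-cong (+-congʳ (sym z≈z′)))) z∈)))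
          where
          from : (∃ λ (z∈U : U z) → g 0 z ≋ to (z , z∈U)) → (∃ λ (z′∈U : U z′) → g 0 z′ ≋ to (z′ , z′∈U)) → extend i z ≈ g 0 z′ i
          from (z∈U , _) (z′∈U , e) = trans (extend-∈ i z′∈U z∈U z≈z′) (sym (e i))
        G-agree (suc j) j<l i z z′ z≈z′ z∈ = der-unique (G-der j j<l i z z∈)
            (der-move {G j i} z≈z′ (trans (agree z z′ z≈z′ z∈) (sym (agree z′ z′ refl z′∈))) (G-der j j<l i z′ z′∈))
          where
          agree : ∀ z z′ → z ≈ z′ → ∣ z - x₀ ∣ < δ → G j i z ≈ g j z′ i
          agree = G-agree j (ℕ.<⇒≤ j<l) i
          z′∈ : ∣ z′ - x₀ ∣ < δ
          z′∈ = ≤-<-trans (≤-reflexive (∣∣-cong (+-congʳ (sym z≈z′)))) z∈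
        G-der j j<l i y y∈ = HasDerivativeAt⇒Der {G j i} {λ z → g j z i} (sub>0 y∈)
          (λ z z′ z≈z′ p → G-agree j (ℕ.<⇒≤ j<l) i z z′ z≈z′ (open-ball p)) (derivative y (∣∣-def-< y∈) j j<l i)

        G-continuous : ∀ j → j ℕ.< l → ∀ i y → ∣ y - x₀ ∣ < δ → ContinuousAt (G (suc j) i) y
        G-continuous j j<l i y y∈ = from (ℕ.m≤n⇒m<n∨m≡n j<l)
          where
          from : (suc j ℕ.< l) ⊎ (suc j ≡ l) → ContinuousAt (G (suc j) i) y
          from (inj₁ p) = der-continuous {G (suc j) i} (G-der (suc j) p i y y∈)
          from (inj₂ e) ε 0<ε = near (≡.subst (λ k → Analysis.ContinuousAt em reals (λ z → g k z i) y) (≡.sym e) (continuous y (∣∣-def-< y∈) i) ε 0<ε)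
            where
            near : (∃ λ η → 0# < η × (∀ z → Analysis.∣_∣ em reals (z - y) < η → Analysis.∣_∣ em reals (g (suc j) z i - g (suc j) y i) < ε)) →
              ∃ λ η → 0# < η × (∀ z → ∣ z - y ∣ < η → ∣ G (suc j) i z - G (suc j) i y ∣ < ε)
            near (η , 0<η , h) = η , 0<η , λ z p → ∣∣-def-> (h z (∣∣-def-< p))

  opaque
    Span⇒combination : ∀ {n r} (v : Fin r → Vect n) {x} → Span (Vec.tabulate v) x → ∃ λ (c : Vector ℝ r) → ∀ i → sum (λ o → c o * v o i) ≈ x i
    Span⇒combination {r = zero}  v h = (λ ()) , λ i → sym (h i)
    Span⇒combination {n} {suc r} v {x} (a , h) = from (Span⇒combination (v ∘ suc) h)
      where
      from : (∃ λ (c : Vector ℝ r) → ∀ i → sum (λ o → c o * v (suc o) i) ≈ x i - a * v zero i) → ∃ λ (c : Vector ℝ (suc r)) → ∀ i → sum (λ o → c o * v o i) ≈ x i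
      from (c , e) = (λ { zero → a ; (suc o) → c o }) , λ i → trans (+-congˡ (e i)) (restore i)
        where
        restore : ∀ i → a * v zero i + (x i - a * v zero i) ≈ x i
        restore i = (solve 3 (λ a b c → a :* b :+ (c :- a :* b) := c) refl _ _ _)

  opaque
    Dep⇒combination : ∀ {n r} (v : Fin r → Vect n) → Dep (Vec.tabulate v) →
      ∃ λ (c : Vector ℝ r) → (∀ i → sum (λ o → c o * v o i) ≈ 0#) × ∃ λ o → ¬ (c o ≈ 0#)
    Dep⇒combination {n} {suc r} v (inj₁ h) = from (Span⇒combination (v ∘ suc) h)
      where
      from : (∃ λ (c : Vector ℝ r) → ∀ i → sum (λ o → c o * v (suc o) i) ≈ v zero i) →
        ∃ λ (c : Vector ℝ (suc r)) → (∀ i → sum (λ o → c o * v o i) ≈ 0#) × ∃ λ o → ¬ (c o ≈ 0#)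
      from (c , e) = (λ { zero → - 1# ; (suc o) → c o }) , (λ i → trans (+-congˡ (e i)) (cancel i)) , zero , λ p → 0≉1 (trans (sym neg0≈0) (trans (-‿cong (sym p)) neg-1≈1))
        where
        cancel : ∀ i → - 1# * v zero i + v zero i ≈ 0#
        cancel i = (solve 1 (λ a → (:- :1) :* a :+ a := :0) refl _)
        neg0≈0 : - 0# ≈ 0#
        neg0≈0 = (solve 0 (:- :0 := :0) refl)
        neg-1≈1 : - - 1# ≈ 1#
        neg-1≈1 = (solve 0 (:- (:- :1) := :1) refl)
    Dep⇒combination {n} {suc r} v (inj₂ d) = from (Dep⇒combination (v ∘ suc) d)
      where
      from : (∃ λ (c : Vector ℝ r) → (∀ i → sum (λ o → c o * v (suc o) i) ≈ 0#) × ∃ λ o → ¬ (c o ≈ 0#)) →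
        ∃ λ (c : Vector ℝ (suc r)) → (∀ i → sum (λ o → c o * v o i) ≈ 0#) × ∃ λ o → ¬ (c o ≈ 0#)
      from (c , e , o , c≉0) = (λ { zero → 0# ; (suc o) → c o }) , (λ i → trans (+-congˡ (e i)) (vanish i)) , suc o , c≉0
        where
        vanish : ∀ i → 0# * v zero i + 0# ≈ 0#
        vanish i = (solve 1 (λ a → :0 :* a :+ :0 := :0) refl _)

  opaque
    dual-basis : ∀ {n} (v : Fin n → Vect n) → LinearlyIndependent v → ∀ k → ∃ λ (c : Vector ℝ n) → ∀ i → sum (λ o → c o * v o i) ≈ basis k i
    dual-basis {n} v independent k = Span⇒combination v (full-span (Vec.tabulate v) (λ d → absurd (Dep⇒combination v d)) ℕ.≤-refl (basis k))
      where
      absurd : (∃ λ (c : Vector ℝ n) → (∀ i → sum (λ o → c o * v o i) ≈ 0#) × ∃ λ o → ¬ (c o ≈ 0#)) → ⊥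
      absurd (c , e , o , c≉0) = c≉0 (independent c e o)

-- Uniform nondegeneracy near a point

module LocalCurves (em : ExcludedMiddle 0ℓ) (reals : CompleteOrderedField) where

  open Analysis em reals hiding (zero; ∣_∣; ContinuousAt)
  open OrderedField em reals
  open Numbers em reals
  open Calculus em reals
  open NullSets em reals
  open Exterior em reals
  open Goodness em reals
  open Thinness em reals
  open Charts em reals
  open IntegerSolver commutativeRing
  open SetoidReasoning setoid

  opaque
    ∣sum∣≤sum : ∀ {n} (h : Vector ℝ n) → ∣ sum h ∣ ≤ sum (λ i → ∣ h i ∣)
    ∣sum∣≤sum {zero}  h = ≤-reflexive ∣0∣
    ∣sum∣≤sum {suc n} h = ≤-trans (∣∣-+ (h zero) (sum (h ∘ suc))) (≤-refl ⊞ ∣sum∣≤sum (h ∘ suc))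

  opaque
    -- At x₀ the coefficients are recovered from the values of the forms `L o` through `dual`, so
    -- the largest of these values is at least the sum of all ∣c k∣ divided by β. For the index o
    -- that attains it, a change of the entries by less than μ = ½ β⁻¹ costs at most half of this
    -- bound.
    independent-near : ∀ {n m} (L : Fin (suc n) → Fin m → ℝ → ℝ) {x₀} → (∀ o i → ContinuousAt (L o i) x₀) →
      (∀ k → ∃ λ (B : Vector ℝ (suc n)) → ∀ i → sum (λ o → B o * L o i x₀) ≈ basis k i) →
      ∃ λ μ → 0# < μ × ∃ λ δ → 0# < δ × (∀ (c : Vector ℝ m) → ∃ λ o → ∀ x → ∣ x - x₀ ∣ < δ → ∀ k → μ * ∣ c k ∣ ≤ ∣ sum (λ i → c i * L o i x) ∣)
    independent-near {n} {m} L {x₀} cont dual = μ , 0<μ , from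
        (common-radius (λ o δ → ∀ i x → ∣ x - x₀ ∣ < δ → ∣ L o i x - L o i x₀ ∣ < μ) λ o → extend-radius o
          (common-radius (λ i δ → ∀ x → ∣ x - x₀ ∣ < δ → ∣ L o i x - L o i x₀ ∣ < μ) λ i → restrict o i (cont o i μ 0<μ)))
      where
      row : Fin m → ℝ
      row k = sum (λ o → ∣ proj₁ (dual k) o ∣)
      row≥0 : ∀ k → 0# ≤ row k
      row≥0 k = sum≥0 {f = λ o → ∣ proj₁ (dual k) o ∣} (λ o → ∣∣≥0 _)
      β : ℝ
      β = 1# + sum row
      0<β : 0# < β
      0<β = pos+nn 0<1 (sum≥0 {f = row} row≥0)
      μ : ℝ
      μ = ½ * inv 0<β
      0<μ : 0# < μ
      0<μ = ½-pos (inv>0 0<β)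
      restrict : ∀ o i → (∃ λ δ → 0# < δ × (∀ x → ∣ x - x₀ ∣ < δ → ∣ L o i x - L o i x₀ ∣ < μ)) →
        ∃ λ δ → 0# < δ × (∀ δ′ → δ′ ≤ δ → ∀ x → ∣ x - x₀ ∣ < δ′ → ∣ L o i x - L o i x₀ ∣ < μ)
      restrict o i (δ , 0<δ , h) = δ , 0<δ , λ δ′ q x p → h x (<-≤-trans p q)
      extend-radius : ∀ o → (∃ λ δ → 0# < δ × (∀ i x → ∣ x - x₀ ∣ < δ → ∣ L o i x - L o i x₀ ∣ < μ)) →
        ∃ λ δ → 0# < δ × (∀ δ′ → δ′ ≤ δ → ∀ i x → ∣ x - x₀ ∣ < δ′ → ∣ L o i x - L o i x₀ ∣ < μ)
      extend-radius o (δ , 0<δ , h) = δ , 0<δ , λ δ′ q i x p → h i x (<-≤-trans p q)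
      from : (∃ λ δ → 0# < δ × (∀ o i x → ∣ x - x₀ ∣ < δ → ∣ L o i x - L o i x₀ ∣ < μ)) →
        ∃ λ δ → 0# < δ × (∀ (c : Vector ℝ m) → ∃ λ o → ∀ x → ∣ x - x₀ ∣ < δ → ∀ k → μ * ∣ c k ∣ ≤ ∣ sum (λ i → c i * L o i x) ∣)
      from (δ , 0<δ , near) = δ , 0<δ , λ (c : Vector ℝ m) → pick c (argmax (λ o → ∣ sum (λ i → c i * L o i x₀) ∣))
        where
        pick : ∀ (c : Vector ℝ m) → (∃ λ o → ∀ o′ → ∣ sum (λ i → c i * L o′ i x₀) ∣ ≤ ∣ sum (λ i → c i * L o i x₀) ∣) →
          ∃ λ o → ∀ x → ∣ x - x₀ ∣ < δ → ∀ k → μ * ∣ c k ∣ ≤ ∣ sum (λ i → c i * L o i x) ∣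
        pick c (o , largest) = o , λ x p k → ≤-trans (*-monoˡ μ (<⇒≤ 0<μ) (term≤sum {f = λ i → ∣ c i ∣} (λ i → ∣∣≥0 (c i)) k)) (bound x p)
          where
          M S : ℝ
          M = ∣ sum (λ i → c i * L o i x₀) ∣
          S = sum (λ i → ∣ c i ∣)
          0≤M : 0# ≤ M
          0≤M = ∣∣≥0 _
          coordinate : ∀ k → c k ≈ sum (λ o → proj₁ (dual k) o * sum (λ i → c i * L o i x₀))
          coordinate k = begin
            c k                                                       ≈⟨ sum-basis k c ⟨
            sum (λ i → basis k i * c i)                               ≈⟨ sum-cong {f = λ i → basis k i * c i} {g = λ i → sum (λ o → B o * (c i * L o i x₀))} column ⟩
            sum (λ i → sum (λ o → B o * (c i * L o i x₀)))            ≈⟨ sum-swap (λ i o → B o * (c i * L o i x₀)) ⟩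
            sum (λ o → sum (λ i → B o * (c i * L o i x₀)))            ≈⟨ sum-cong {f = λ o → sum (λ i → B o * (c i * L o i x₀))} {g = λ o → B o * sum (λ i → c i * L o i x₀)} (λ o → sum-* (B o) (λ i → c i * L o i x₀)) ⟩
            sum (λ o → B o * sum (λ i → c i * L o i x₀))              ∎
            where
            B : Vector ℝ (suc n)
            B = proj₁ (dual k)
            regroup : ∀ a b d → a * (b * d) ≈ b * (a * d)
            regroup a b d = (solve 3 (λ a b c → a :* (b :* c) := b :* (a :* c)) refl _ _ _)
            column : ∀ i → basis k i * c i ≈ sum (λ o → B o * (c i * L o i x₀))
            column i = trans (*-comm _ _) (trans (*-congˡ (sym (proj₂ (dual k) i)))
              (trans (sym (sum-* (c i) (λ o → B o * L o i x₀))) (sum-cong {f = λ o → c i * (B o * L o i x₀)} {g = λ o → B o * (c i * L o i x₀)} (λ o → regroup (c i) (B o) (L o i x₀)))))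
          c≤ : ∀ k → ∣ c k ∣ ≤ M * row k
          c≤ k = ≈≤ (∣∣-cong (coordinate k)) (≤-trans (∣sum∣≤sum (λ o → proj₁ (dual k) o * sum (λ i → c i * L o i x₀)))
            (≤≈ (sum-mono {f = λ o → ∣ proj₁ (dual k) o * sum (λ i → c i * L o i x₀) ∣} {g = λ o → M * ∣ proj₁ (dual k) o ∣}
              (λ o′ → ≈≤ (∣∣-* _ _) (≈≤ (*-comm _ _) (*-monoʳ _ (∣∣≥0 _) (largest o′))))) (sum-* M (λ o → ∣ proj₁ (dual k) o ∣))))
          S≤ : S ≤ M * β
          S≤ = ≤-trans (sum-mono {f = λ k → ∣ c k ∣} {g = λ k → M * row k} c≤) (≈≤ (sum-* M row) (by≤ 0≤M (solve 2 (λ a b → a :* b :+ a := a :* (:1 :+ b) :+ :0) refl _ _)))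
          S≤M : inv 0<β * S ≤ M
          S≤M = ≤-trans (*-monoˡ (inv 0<β) (inv≥0 0<β) S≤) (≤-reflexive (begin
            inv 0<β * (M * β)    ≈⟨ (solve 3 (λ a b c → a :* (b :* (:1 :+ c)) := b :* ((:1 :+ c) :* a)) refl _ _ _) ⟩
            M * (β * inv 0<β)    ≈⟨ *-congˡ (inv-eq 0<β) ⟩
            M * 1#               ≈⟨ *-identityʳ M ⟩
            M                    ∎))
          bound : ∀ x → ∣ x - x₀ ∣ < δ → μ * S ≤ ∣ sum (λ i → c i * L o i x) ∣
          bound x p = by≤ (≈≤ half S≤M ⊞ M≤) (solve 5 (λ a b c d e → a :* b :* c :+ (d :+ (e :+ a :* b :* c)) := e :+ (a :* b :* c :+ a :* b :* c :+ d)) refl _ _ _ _ _)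
            where
            half : μ * S + μ * S ≈ inv 0<β * S
            half = trans (+-cong (*-assoc _ _ _) (*-assoc _ _ _)) (½-eq (inv 0<β * S))
            value : ℝ
            value = sum (λ i → c i * L o i x)
            difference : sum (λ i → c i * L o i x₀) ≈ value + sum (λ i → c i * (L o i x₀ - L o i x))
            difference = trans (sum-cong {f = λ i → c i * L o i x₀} {g = λ i → c i * L o i x + c i * (L o i x₀ - L o i x)} (λ i → expand (c i) (L o i x₀) (L o i x)))
              (sum-+ (λ i → c i * L o i x) (λ i → c i * (L o i x₀ - L o i x)))
              where
              expand : ∀ a b d → a * b ≈ a * d + a * (b - d)
              expand a b d = (solve 3 (λ a b c → a :* b := a :* c :+ a :* (b :- c)) refl _ _ _)
            error : ∣ sum (λ i → c i * (L o i x₀ - L o i x)) ∣ ≤ μ * S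
            error = ≤-trans (∣sum∣≤sum (λ i → c i * (L o i x₀ - L o i x))) (≤≈ (sum-mono {f = λ i → ∣ c i * (L o i x₀ - L o i x) ∣} {g = λ i → μ * ∣ c i ∣}
              (λ i → ≈≤ (∣∣-* (c i) _) (≈≤ (*-comm _ _) (*-monoʳ _ (∣∣≥0 (c i)) (≈≤ (∣∣-sub _ _) (<⇒≤ (near o i x p))))))) (sum-* μ (λ i → ∣ c i ∣)))
            M≤ : M ≤ ∣ value ∣ + μ * S
            M≤ = ≈≤ (∣∣-cong difference) (≤-trans (∣∣-+ value _) (≤-refl ⊞ error))

-- Curves on small cells around a nondegenerate point

module ChartsNear (em : ExcludedMiddle 0ℓ) (reals : CompleteOrderedField) where

  open Analysis em reals hiding (zero; ∣_∣; ContinuousAt)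
  open OrderedField em reals
  open Numbers em reals
  open Calculus em reals
  open NullSets em reals
  open Exterior em reals
  open Goodness em reals
  open Thinness em reals
  open Charts em reals
  open LocalCurves em reals
  open IntegerSolver commutativeRing
  open SetoidReasoning setoid

  -- Cell and functions are prescribed by propositional equality, so that having a chart is a
  -- property of the cell; the union to be shown null then runs over cells and not over charts.
  Chart : ∀ {m} → (Fin m → ℝ → ℝ) → ℝ → ℝ → Curve m → Set
  Chart F u ℓ C = Curve.u₀ C ≡ u × Curve.ℓ₀ C ≡ ℓ × Curve.g C 0 ≡ F × (∀ x → In u ℓ x → ∀ i → ContinuousAt (Curve.g C 1 i) x)

  Sloped : ∀ {m} → ℝ → ℝ → Curve (suc m) → Set
  Sloped u ℓ C = ∃ λ μ₁ → ∃ λ ς → 0# < μ₁ × ς * ς ≈ 1# × ∣ ς ∣ ≤ 1# × (∀ x → In u ℓ x → μ₁ ≤ ς * Curve.g C 1 zero x)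

  opaque
    continuous-bounded : ∀ {m} (H : Fin m → ℝ → ℝ) {x₀} → (∀ i → ContinuousAt (H i) x₀) →
      ∃ λ δ → 0# < δ × ∃ λ Λ → ∀ i x → ∣ x - x₀ ∣ < δ → ∣ H i x ∣ ≤ Λ
    continuous-bounded {m} H {x₀} cont = from (common-radius (λ i δ → ∀ x → ∣ x - x₀ ∣ < δ → ∣ H i x - H i x₀ ∣ < 1#) λ i → restrict i (cont i 1# 0<1))
      where
      restrict : ∀ i → (∃ λ δ → 0# < δ × (∀ x → ∣ x - x₀ ∣ < δ → ∣ H i x - H i x₀ ∣ < 1#)) →
        ∃ λ δ → 0# < δ × (∀ δ′ → δ′ ≤ δ → ∀ x → ∣ x - x₀ ∣ < δ′ → ∣ H i x - H i x₀ ∣ < 1#)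
      restrict i (δ , 0<δ , h) = δ , 0<δ , λ δ′ q x p → h x (<-≤-trans p q)
      from : (∃ λ δ → 0# < δ × (∀ i x → ∣ x - x₀ ∣ < δ → ∣ H i x - H i x₀ ∣ < 1#)) →
        ∃ λ δ → 0# < δ × ∃ λ Λ → ∀ i x → ∣ x - x₀ ∣ < δ → ∣ H i x ∣ ≤ Λ
      from (δ , 0<δ , near) = δ , 0<δ , 1# + sum (λ i → ∣ H i x₀ ∣) , λ i x p → ≈≤ (∣∣-cong (recentre (H i x) (H i x₀)))
          (≤-trans (∣∣-+ (H i x - H i x₀) (H i x₀)) (<⇒≤ (near i x p) ⊞ term≤sum {f = λ i → ∣ H i x₀ ∣} (λ i → ∣∣≥0 (H i x₀)) i))
        where
        recentre : ∀ a b → a ≈ a - b + b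
        recentre a b = (solve 2 (λ a b → a := a :- b :+ b) refl _ _)

  opaque
    continuous-slope : ∀ (H : ℝ → ℝ) {x₀} → ContinuousAt H x₀ → ¬ (H x₀ ≈ 0#) →
      ∃ λ δ → 0# < δ × ∃ λ μ₁ → ∃ λ ς → 0# < μ₁ × ς * ς ≈ 1# × ∣ ς ∣ ≤ 1# × (∀ x → ∣ x - x₀ ∣ < δ → μ₁ ≤ ς * H x)
    continuous-slope H {x₀} cont H≉0 = from (cont μ₁ 0<μ₁) (∣∣-cases (H x₀))
      where
      μ₁ : ℝ
      μ₁ = ½ * ∣ H x₀ ∣
      0<μ₁ : 0# < μ₁
      0<μ₁ = ½-pos (≉0⇒∣∣>0 H≉0)
      from : (∃ λ δ → 0# < δ × (∀ x → ∣ x - x₀ ∣ < δ → ∣ H x - H x₀ ∣ < μ₁)) → (∣ H x₀ ∣ ≈ H x₀) ⊎ (∣ H x₀ ∣ ≈ - H x₀) →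
        ∃ λ δ → 0# < δ × ∃ λ μ₁ → ∃ λ ς → 0# < μ₁ × ς * ς ≈ 1# × ∣ ς ∣ ≤ 1# × (∀ x → ∣ x - x₀ ∣ < δ → μ₁ ≤ ς * H x)
      from (δ , 0<δ , near) (inj₁ e) = δ , 0<δ , μ₁ , 1# , 0<μ₁ , *-identityˡ 1# , ≤-reflexive (∣∣-pos 0≤1) ,
        λ x p → by≤ (≤-trans (-x≤∣x∣ (H x - H x₀)) (<⇒≤ (near x p)) ⊞ ≤-reflexive (trans (½-eq ∣ H x₀ ∣) e)) (identity (H x) (H x₀) μ₁)
        where
        identity : ∀ a b t → t + (t + b) ≈ 1# * a + (- (a - b) + (t + t))
        identity a b t = (solve 3 (λ a b c → a :+ (a :+ b) := :1 :* c :+ (:- (c :- b) :+ (a :+ a))) refl _ _ _)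
      from (δ , 0<δ , near) (inj₂ e) = δ , 0<δ , μ₁ , - 1# , 0<μ₁ , square , ≤-reflexive (trans (∣∣-neg 1#) (∣∣-pos 0≤1)) ,
        λ x p → by≤ (≤-trans (x≤∣x∣ (H x - H x₀)) (<⇒≤ (near x p)) ⊞ ≤-reflexive (trans (½-eq ∣ H x₀ ∣) e)) (identity (H x) (H x₀) μ₁)
        where
        square : - 1# * - 1# ≈ 1#
        square = (solve 0 ((:- :1) :* (:- :1) := :1) refl)
        identity : ∀ a b t → t + (t + - b) ≈ - 1# * a + (a - b + (t + t))
        identity a b t = (solve 3 (λ a b c → a :+ (a :- b) := (:- :1) :* c :+ (c :- b :+ (a :+ a))) refl _ _ _)

  module _ {U : Pred ℝ 0ℓ} {n : ℕ} (f : Map U (suc n)) {m : ℕ} (ι : Fin (suc m) → Fin (suc n))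
           (ι-basis : ∀ k i → basis (ι k) (ι i) ≈ basis k i) where

    coordinates : Fin (suc m) → ℝ → ℝ
    coordinates k = extend f (ι k)

    module _ {l x₀ δ} {g : ℕ → ℝ → Vector ℝ (suc n)} (jet : IsJet f l x₀ δ g) (0<δ : 0# < δ) (order : Fin (suc n) → Fin l)
             (independent : LinearlyIndependent (λ o → g (suc (toℕ (order o))) x₀)) where
      open Jet f jet

      Local : ℝ → Set
      Local ρ = ∀ u ℓ → 0# < ℓ → ℓ ≤ 1# → ℓ < ρ → In u ℓ x₀ → ∃ λ C → Chart coordinates u ℓ C × (Sloped u ℓ C ⊎ Der (coordinates zero) x₀ 0#)

      opaque
        0<l : 0 ℕ.< l
        0<l = ℕ.≤-trans (s≤s z≤n) (Fin.toℕ<n (order zero))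

        continuous₀ : ∀ j → j ℕ.≤ l → ∀ i → ContinuousAt (G j i) x₀
        continuous₀ zero    _   i = der-continuous {G 0 i} (G-der 0 0<l i x₀ (center 0<δ))
        continuous₀ (suc j) j<l i = G-continuous j j<l i x₀ (center 0<δ)

        bounded-near : ∃ λ ρ → 0# < ρ × ∃ λ Λ → ∀ j → j ℕ.≤ l → ∀ k x → ∣ x - x₀ ∣ < ρ → ∣ G j (ι k) x ∣ ≤ Λ
        bounded-near = from (common-radius (λ j ρ → ∃ λ Λ → ∀ k x → ∣ x - x₀ ∣ < ρ → ∣ G (toℕ j) (ι k) x ∣ ≤ Λ)
            λ j → restrict (toℕ j) (continuous-bounded (λ k → G (toℕ j) (ι k)) (λ k → continuous₀ (toℕ j) (ℕ.≤-pred (Fin.toℕ<n {suc l} j)) (ι k))))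
          where
          restrict : ∀ j → (∃ λ ρ → 0# < ρ × ∃ λ Λ → ∀ k x → ∣ x - x₀ ∣ < ρ → ∣ G j (ι k) x ∣ ≤ Λ) →
            ∃ λ ρ → 0# < ρ × (∀ ρ′ → ρ′ ≤ ρ → ∃ λ Λ → ∀ k x → ∣ x - x₀ ∣ < ρ′ → ∣ G j (ι k) x ∣ ≤ Λ)
          restrict j (ρ , 0<ρ , Λ , h) = ρ , 0<ρ , λ ρ′ q → Λ , λ k x p → h k x (<-≤-trans p q)
          from : (∃ λ ρ → 0# < ρ × (∀ (j : Fin (suc l)) → ∃ λ Λ → ∀ k x → ∣ x - x₀ ∣ < ρ → ∣ G (toℕ j) (ι k) x ∣ ≤ Λ)) →
            ∃ λ ρ → 0# < ρ × ∃ λ Λ → ∀ j → j ℕ.≤ l → ∀ k x → ∣ x - x₀ ∣ < ρ → ∣ G j (ι k) x ∣ ≤ Λ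
          from (ρ , 0<ρ , h) = ρ , 0<ρ , sum (λ j → ∣ proj₁ (h j) ∣) , λ j j≤l k x p →
            ≡.subst (λ o → ∣ G o (ι k) x ∣ ≤ sum (λ j → ∣ proj₁ (h j) ∣)) (Fin.toℕ-fromℕ< (s≤s j≤l))
              (≤-trans (proj₂ (h (fromℕ< (s≤s j≤l))) k x p) (≤-trans (x≤∣x∣ _) (term≤sum {f = λ j → ∣ proj₁ (h j) ∣} (λ j → ∣∣≥0 _) (fromℕ< (s≤s j≤l)))))

        nondegenerate-near : ∃ λ μ → 0# < μ × ∃ λ ρ → 0# < ρ × (∀ (c : Vector ℝ (suc m)) → ∃ λ o → ∀ x → ∣ x - x₀ ∣ < ρ → ∀ k →
          μ * ∣ c k ∣ ≤ ∣ sum (λ i → c i * G (suc (toℕ (order o))) (ι i) x) ∣)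
        nondegenerate-near = independent-near (λ o k → G (suc (toℕ (order o))) (ι k))
            (λ o k → continuous₀ (suc (toℕ (order o))) (Fin.toℕ<n (order o)) (ι k)) (λ k → from k (dual-basis (λ o → g (suc (toℕ (order o))) x₀) independent (ι k)))
          where
          from : ∀ k → (∃ λ (B : Vector ℝ (suc n)) → ∀ i → sum (λ o → B o * g (suc (toℕ (order o))) x₀ i) ≈ basis (ι k) i) →
            ∃ λ (B : Vector ℝ (suc n)) → ∀ i → sum (λ o → B o * G (suc (toℕ (order o))) (ι i) x₀) ≈ basis k i
          from k (B , e) = B , λ i → trans (e (ι i)) (ι-basis k i)

        charts-near : ∃ λ ρ → 0# < ρ × Local ρ
        charts-near = from bounded-near nondegenerate-near (lem (G 1 (ι zero) x₀ ≈ 0#))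
          where
          Slope : ℝ → Set
          Slope δ = ∃ λ μ₁ → ∃ λ ς → 0# < μ₁ × ς * ς ≈ 1# × ∣ ς ∣ ≤ 1# × (∀ x → ∣ x - x₀ ∣ < δ → μ₁ ≤ ς * G 1 (ι zero) x)
          build : ∀ {Λ μ ρ₁ ρ₂ ρ₃} → 0# < μ → 0# < ρ₁ → 0# < ρ₂ → 0# < ρ₃ →
            (∀ j → j ℕ.≤ l → ∀ k x → ∣ x - x₀ ∣ < ρ₁ → ∣ G j (ι k) x ∣ ≤ Λ) →
            (∀ (c : Vector ℝ (suc m)) → ∃ λ o → ∀ x → ∣ x - x₀ ∣ < ρ₂ → ∀ k → μ * ∣ c k ∣ ≤ ∣ sum (λ i → c i * G (suc (toℕ (order o))) (ι i) x) ∣) →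
            Slope ρ₃ ⊎ Der (coordinates zero) x₀ 0# → ∃ λ ρ → 0# < ρ × Local ρ
          build {Λ} {μ} {ρ₁} {ρ₂} {ρ₃} 0<μ 0<ρ₁ 0<ρ₂ 0<ρ₃ bound nondeg slope = shrink (min₂ 0<ρ₁ 0<ρ₂) (min₂ 0<ρ₃ 0<δ)
            where
            shrink : (∃ λ ρ → 0# < ρ × ρ ≤ ρ₁ × ρ ≤ ρ₂) → (∃ λ ρ → 0# < ρ × ρ ≤ ρ₃ × ρ ≤ δ) → ∃ λ ρ → 0# < ρ × Local ρ
            shrink (ρ₄ , 0<ρ₄ , ρ₄≤ρ₁ , ρ₄≤ρ₂) (ρ₅ , 0<ρ₅ , ρ₅≤ρ₃ , ρ₅≤δ) = meet (min₂ 0<ρ₄ 0<ρ₅)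
              where
              meet : (∃ λ ρ → 0# < ρ × ρ ≤ ρ₄ × ρ ≤ ρ₅) → ∃ λ ρ → 0# < ρ × Local ρ
              meet (ρ , 0<ρ , ρ≤ρ₄ , ρ≤ρ₅) = ρ , 0<ρ , chart
                where
                chart : Local ρ
                chart u ℓ 0<ℓ ℓ≤1 ℓ<ρ x₀∈ = C , (≡.refl , ≡.refl , ≡.refl , (λ x x∈ k → G-continuous 0 0<l (ι k) x (within ρ≤δ x∈))) , sloped slope
                  where
                  ρ≤δ : ρ ≤ δ
                  ρ≤δ = ≤-trans ρ≤ρ₅ ρ₅≤δ
                  within : ∀ {ρ′ x} → ρ ≤ ρ′ → In u ℓ x → ∣ x - x₀ ∣ < ρ′
                  within q x∈ = <-≤-trans (≤-<-trans (∣-∣-In x∈ x₀∈) ℓ<ρ) q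
                  nondegenerate : ∀ (c : Vector ℝ (suc m)) → ∃ λ o → suc o ℕ.≤ l × (∀ x → In u ℓ x → ∀ k → μ * ∣ c k ∣ ≤ ∣ sum (λ i → c i * G (suc o) (ι i) x) ∣)
                  nondegenerate c = pick (nondeg c)
                    where
                    pick : (∃ λ o → ∀ x → ∣ x - x₀ ∣ < ρ₂ → ∀ k → μ * ∣ c k ∣ ≤ ∣ sum (λ i → c i * G (suc (toℕ (order o))) (ι i) x) ∣) →
                      ∃ λ o → suc o ℕ.≤ l × (∀ x → In u ℓ x → ∀ k → μ * ∣ c k ∣ ≤ ∣ sum (λ i → c i * G (suc o) (ι i) x) ∣)
                    pick (o , h) = toℕ (order o) , Fin.toℕ<n (order o) , λ x x∈ → h x (within (≤-trans ρ≤ρ₄ ρ₄≤ρ₂) x∈)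
                  C : Curve (suc m)
                  C = record
                    { l = l ; g = λ j k → G j (ι k) ; u₀ = u ; ℓ₀ = ℓ ; Λ = Λ ; μ = μ
                    ; 0<ℓ₀ = 0<ℓ ; ℓ₀≤1 = ℓ≤1 ; 0<μ = 0<μ
                    ; derivative = λ x x∈ j j<l k → G-der j j<l (ι k) x (within ρ≤δ x∈)
                    ; bounded = λ x x∈ j j≤l k → bound j j≤l k x (within (≤-trans ρ≤ρ₄ ρ₄≤ρ₁) x∈)
                    ; nondegenerate = nondegenerate }
                  sloped : Slope ρ₃ ⊎ Der (coordinates zero) x₀ 0# → Sloped u ℓ C ⊎ Der (coordinates zero) x₀ 0#
                  sloped (inj₁ (μ₁ , ς , p , q , r , h)) = inj₁ (μ₁ , ς , p , q , r , λ x x∈ → h x (within (≤-trans ρ≤ρ₅ ρ₅≤ρ₃) x∈))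
                  sloped (inj₂ d) = inj₂ d
          from : (∃ λ ρ → 0# < ρ × ∃ λ Λ → ∀ j → j ℕ.≤ l → ∀ k x → ∣ x - x₀ ∣ < ρ → ∣ G j (ι k) x ∣ ≤ Λ) →
            (∃ λ μ → 0# < μ × ∃ λ ρ → 0# < ρ × (∀ (c : Vector ℝ (suc m)) → ∃ λ o → ∀ x → ∣ x - x₀ ∣ < ρ → ∀ k →
              μ * ∣ c k ∣ ≤ ∣ sum (λ i → c i * G (suc (toℕ (order o))) (ι i) x) ∣)) →
            (G 1 (ι zero) x₀ ≈ 0#) ⊎ ¬ (G 1 (ι zero) x₀ ≈ 0#) → ∃ λ ρ → 0# < ρ × Local ρ
          from (ρ₁ , 0<ρ₁ , Λ , bound) (μ , 0<μ , ρ₂ , 0<ρ₂ , nondeg) (inj₁ e) =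
            build 0<μ 0<ρ₁ 0<ρ₂ 0<1 bound nondeg (inj₂ (der-cong {G 0 (ι zero)} e (G-der 0 0<l (ι zero) x₀ (center 0<δ))))
          from (ρ₁ , 0<ρ₁ , Λ , bound) (μ , 0<μ , ρ₂ , 0<ρ₂ , nondeg) (inj₂ e) = steep (continuous-slope (G 1 (ι zero)) (G-continuous 0 0<l (ι zero) x₀ (center 0<δ)) e)
            where
            steep : (∃ λ ρ → 0# < ρ × Slope ρ) → ∃ λ ρ → 0# < ρ × Local ρ
            steep (ρ₃ , 0<ρ₃ , s) = build 0<μ 0<ρ₁ 0<ρ₂ 0<ρ₃ bound nondeg (inj₁ s)

-- Coordinates of positive weight

module Selections (em : ExcludedMiddle 0ℓ) (reals : CompleteOrderedField) where

  open Analysis em reals hiding (zero; ∣_∣; ContinuousAt)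
  open OrderedField em reals
  open Numbers em reals
  open Goodness em reals
  open IntegerSolver commutativeRing

  opaque
    basis-off : ∀ {n} {i j : Fin n} → i ≢ j → basis i j ≈ 0#
    basis-off {i = zero}  {zero}  i≢j = ⊥-elim (i≢j ≡.refl)
    basis-off {i = zero}  {suc j} i≢j = refl
    basis-off {i = suc i} {zero}  i≢j = refl
    basis-off {i = suc i} {suc j} i≢j = basis-off (i≢j ∘ ≡.cong suc)

  opaque
    basis-injective : ∀ {m n} (ι : Fin m → Fin n) → (∀ {k i} → ι k ≡ ι i → k ≡ i) → ∀ k i → basis (ι k) (ι i) ≈ basis k i
    basis-injective ι injective k i with k Fin.≟ i
    ... | yes ≡.refl = trans (basis-self (ι k)) (sym (basis-self k))
    ... | no k≢i     = trans (basis-off (k≢i ∘ injective)) (sym (basis-off k≢i))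

  -- The comparison of sums is applied to the weights with the largest one replaced by 0; together
  -- with that weight it bounds the sum over the selection by 1.
  Enumerates : ∀ {m n} → (Fin n → Set) → (Fin m → Fin n) → Set
  Enumerates {m} {n} P ι = (∀ k → P (ι k)) × (∀ {k i} → ι k ≡ ι i → k ≡ i) × (∀ j → P j → ∃ λ k → ι k ≡ j) ×
    (∀ (w v : Vector ℝ n) → (∀ j → 0# ≤ v j) → (∀ j → P j → w j ≤ v j) → sum (w ∘ ι) ≤ sum v)

  opaque
    enumeration : ∀ {n} (P : Fin n → Set) → ∃ λ m → Σ (Fin m → Fin n) (Enumerates P)
    enumeration {zero}  P = 0 , (λ ()) , (λ ()) , (λ {k} → λ _ → absurd k) , (λ ()) , λ w v _ _ → ≤-refl
      where
      absurd : ∀ {A : Set} → Fin 0 → A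
      absurd ()
    enumeration {suc n} P = from (enumeration (P ∘ suc)) (lem (P zero))
      where
      from : (∃ λ m → Σ (Fin m → Fin n) (Enumerates (P ∘ suc))) → P zero ⊎ ¬ P zero → ∃ λ m → Σ (Fin m → Fin (suc n)) (Enumerates P)
      from (m , ι , holds , injective , onto , sums) (inj₁ p) = suc m , ι′ , holds′ , injective′ , onto′ ,
          λ w v v≥0 w≤v → w≤v zero p ⊞ sums (w ∘ suc) (v ∘ suc) (v≥0 ∘ suc) (λ j → w≤v (suc j))
        where
        ι′ : Fin (suc m) → Fin (suc n)
        ι′ zero    = zero
        ι′ (suc k) = suc (ι k)
        holds′ : ∀ k → P (ι′ k)
        holds′ zero    = p
        holds′ (suc k) = holds k
        injective′ : ∀ {k i} → ι′ k ≡ ι′ i → k ≡ i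
        injective′ {zero}  {zero}  e = ≡.refl
        injective′ {suc k} {suc i} e = ≡.cong suc (injective (Fin.suc-injective e))
        onto′ : ∀ j → P j → ∃ λ k → ι′ k ≡ j
        onto′ zero    q = zero , ≡.refl
        onto′ (suc j) q = suc (proj₁ (onto j q)) , ≡.cong suc (proj₂ (onto j q))
      from (m , ι , holds , injective , onto , sums) (inj₂ ¬p) = m , suc ∘ ι , holds , injective ∘ Fin.suc-injective , onto′ ,
          λ w v v≥0 w≤v → ≤-trans (sums (w ∘ suc) (v ∘ suc) (v≥0 ∘ suc) (λ j → w≤v (suc j))) (by≤ (v≥0 zero) (solve 2 (λ a b → a :+ b := b :+ a :+ :0) refl _ _))
        where
        onto′ : ∀ j → P j → ∃ λ k → suc (ι k) ≡ j
        onto′ zero    q = ⊥-elim (¬p q)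
        onto′ (suc j) q = proj₁ (onto j q) , ≡.cong suc (proj₂ (onto j q))

  record Selection {n : ℕ} (w : Vector ℝ n) : Set where
    field
      m         : ℕ
      ι         : Fin (suc m) → Fin n
      injective : ∀ {k i} → ι k ≡ ι i → k ≡ i
      positive  : ∀ k → 0# < w (ι k)
      largest   : ∀ k → w (ι k) ≤ w (ι zero)
      onto      : ∀ j → 0# < w j → ∃ λ k → ι k ≡ j
      sum≤1     : sum (w ∘ ι) ≤ 1#

  opaque
    selection : ∀ {n} (w : Vector ℝ (suc n)) → IsWeight w → Selection w
    selection {n} w (w≥0 , sum≈1) = from (argmax w)
      where
      from : (∃ λ i → ∀ j → w j ≤ w i) → Selection w
      from (i , maximal) = collect (enumeration (λ j → 0# < w j × i ≢ j))
        where
        0<wᵢ : 0# < w i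
        0<wᵢ = ≰⇒> λ p → <⇒≱ 0<1 (≈≤ (sym sum≈1) (≤≈ (sum-mono {f = w} {g = λ _ → 0#} (λ j → ≤-trans (maximal j) p)) (sum-0 {f = λ (_ : Fin (suc n)) → 0#} (λ _ → refl))))
        collect : (∃ λ m → Σ (Fin m → Fin (suc n)) (Enumerates (λ j → 0# < w j × i ≢ j))) → Selection w
        collect (m , ι , holds , injective , onto , sums) = record
            { m = m ; ι = ι′ ; injective = λ {k} {j} → injective′ {k} {j} ; positive = positive′
            ; largest = λ k → maximal (ι′ k) ; onto = onto′ ; sum≤1 = sum≤ }
          where
          ι′ : Fin (suc m) → Fin (suc n)
          ι′ zero    = i
          ι′ (suc k) = ι k
          injective′ : ∀ {k j} → ι′ k ≡ ι′ j → k ≡ j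
          injective′ {zero}  {zero}  e = ≡.refl
          injective′ {zero}  {suc j} e = ⊥-elim (proj₂ (holds j) e)
          injective′ {suc k} {zero}  e = ⊥-elim (proj₂ (holds k) (≡.sym e))
          injective′ {suc k} {suc j} e = ≡.cong suc (injective e)
          positive′ : ∀ k → 0# < w (ι′ k)
          positive′ zero    = 0<wᵢ
          positive′ (suc k) = proj₁ (holds k)
          onto′ : ∀ j → 0# < w j → ∃ λ k → ι′ k ≡ j
          onto′ j 0<wⱼ with i Fin.≟ j
          ... | yes i≡j = zero , i≡j
          ... | no i≢j  = suc (proj₁ (onto j (0<wⱼ , i≢j))) , proj₂ (onto j (0<wⱼ , i≢j))
          -- The weights with the i-th one replaced by zero.
          v : Vector ℝ (suc n)
          v j = w j + - w i * basis i j
          off : ∀ j → i ≢ j → w j ≈ v j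
          off j i≢j = sym (trans (+-congˡ (trans (*-congˡ (basis-off i≢j)) (zeroʳ _))) (+-identityʳ (w j)))
          v≥0 : ∀ j → 0# ≤ v j
          v≥0 j with i Fin.≟ j
          ... | yes ≡.refl = ≤-reflexive (sym (trans (+-congˡ (*-congˡ (basis-self i))) (cancel (w i))))
            where
            cancel : ∀ a → a + - a * 1# ≈ 0#
            cancel a = (solve 1 (λ a → a :+ (:- a) :* :1 := :0) refl _)
          ... | no i≢j = ≤≈ (w≥0 j) (off j i≢j)
          sum-v : sum v ≈ 1# - w i
          sum-v = trans (sum-+ w (λ j → - w i * basis i j)) (+-cong sum≈1 (trans (sum-* (- w i) (basis i))
            (trans (*-congˡ (trans (sum-cong {f = basis i} {g = λ j → basis i j * 1#} (λ j → sym (*-identityʳ _))) (sum-basis i (λ _ → 1#)))) (*-identityʳ _))))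
          sum≤ : sum (w ∘ ι′) ≤ 1#
          sum≤ = by≤ (≤≈ (sums w v v≥0 (λ j p → ≤-reflexive (off j (proj₂ p)))) sum-v) (rearrange (w i) (sum (w ∘ ι)))
            where
            rearrange : ∀ a s → a + s + (1# - a) ≈ 1# + s
            rearrange a s = (solve 2 (λ a b → a :+ b :+ (:1 :- a) := :1 :+ b) refl _ _)

-- From a positive lower limit to inapproximability

module Badness (em : ExcludedMiddle 0ℓ) (reals : CompleteOrderedField) where

  open Analysis em reals hiding (zero; ∣_∣; ContinuousAt)
  open OrderedField em reals
  open Numbers em reals
  open Thinness em reals
  open Selections em reals
  open IntegerSolver commutativeRing

  opaque
    liminf-positive : ∀ (α : ℤ → ℝ) {L} → IsLiminf α L → [ 0# ] <± L → ∃ λ N → ∃ λ r → 0# < r × (∀ q → q ≢ + 0 → N ℕ.≤ ℤ.∣ q ∣ → r ≤ α q)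
    liminf-positive α {L} (_ , minimal) 0<L = by-contradiction λ none →
        <-irrefl (Strict.[<]-injective (Strict.<±-transˡ <-≤-trans 0<L (minimal [ 0# ] λ { m (N , inf) → below none m N (proj₁ inf) })))
      where
      module NonStrict = AddExtremaNonStrict _≤_
      module Strict = AddExtremaStrict _<_
      below : ¬ (∃ λ N → ∃ λ r → 0# < r × (∀ q → q ≢ + 0 → N ℕ.≤ ℤ.∣ q ∣ → r ≤ α q)) → ∀ m N →
        (∀ y → (∃ λ q → q ≢ + 0 × N ℕ.≤ ℤ.∣ q ∣ × y ≡ [ α q ]) → m ≤± y) → m ≤± [ 0# ]
      below none ⊥± N lower = NonStrict.⊥±≤ [ 0# ]
      below none [ y ] N lower with ≤⊎> y 0#
      ... | inj₁ p = NonStrict.[ p ]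
      ... | inj₂ p = ⊥-elim (none (N , y , p , λ q q≢0 N≤ → NonStrict.[≤]-injective (lower [ α q ] (q , q≢0 , N≤ , ≡.refl))))
      -- Tails are nonempty and consist of real values, so ⊤± is no lower bound.
      below none ⊤± N lower with lower [ α (+ suc N) ] (+ suc N , (λ ()) , ℕ.n≤1+n N , ≡.refl)
      ... | ()

  opaque
    max≤ : ∀ {n} (h : Vector ℝ n) {b} → 0# ≤ b → (∀ i → h i ≤ b) → max h ≤ b
    max≤ {zero}  h 0≤b h≤ = 0≤b
    max≤ {suc n} h 0≤b h≤ = ⊔≤ (h≤ zero) (max≤ (h ∘ suc) 0≤b (h≤ ∘ suc))

  opaque
    natural-≥ : ∀ {z q N} → q ≈ fromℤ z → fromℕ N ≤ q → 0# < q → z ≢ + 0 × N ℕ.≤ ℤ.∣ z ∣ × q ≈ fromℕ ℤ.∣ z ∣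
    natural-≥ {+ k}      {q} q≈ N≤ 0<q = (λ { ≡.refl → pos⇒≉0 0<q q≈ }) , fromℕ-reflects-≤ (≤≈ N≤ q≈) , q≈
    natural-≥ { -[1+ k ]} {q} q≈ N≤ 0<q = ⊥-elim (<⇒≱ 0<q (≈≤ q≈ (by≤ (fromℕ≥0 (suc k)) (cancel (fromℕ (suc k))))))
      where
      cancel : ∀ a → - a + a ≈ 0# + 0#
      cancel a = (solve 1 (λ a → :- a :+ a := :0 :+ :0) refl _)

  opaque
    -- Let r be an eventual lower bound of the sequence in `Bad` and 2^-m₀ < r. An approximation
    -- bounds every root by 2^-K, by `root≤` at the selected coordinates and by the convention 0 at
    -- the others; multiplied by q this is below r.
    bad⇒inapproximable : ∀ {n} {w θ x : Vector ℝ n} → (∀ i → 0# ≤ w i) → (s : Selection w) → Bad θ w x → let open Selection s in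
      ∃ λ N → ∃ λ m₀ → ¬ Approximable (w ∘ ι) (θ ∘ ι) N m₀ (x ∘ ι)
    bad⇒inapproximable {n} {w} {θ} {x} w≥0 s (L , liminf , 0<L) = from (liminf-positive α liminf 0<L)
      where
      open Selection s
      α : ℤ → ℝ
      α q = max (λ i → root (w i) ∣ fromℤ q * x i - θ i ∣ℤ) * fromℕ ℤ.∣ q ∣
      from : (∃ λ N → ∃ λ r → 0# < r × (∀ q → q ≢ + 0 → N ℕ.≤ ℤ.∣ q ∣ → r ≤ α q)) → ∃ λ N → ∃ λ m₀ → ¬ Approximable (w ∘ ι) (θ ∘ ι) N m₀ (x ∘ ι)
      from (N , r , 0<r , r≤) = N , proj₁ (∃h2< r 0<r) , refute
        where
        refute : ¬ Approximable (w ∘ ι) (θ ∘ ι) N (proj₁ (∃h2< r 0<r)) (x ∘ ι)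
        refute (q , P , K , j , (z , q≈z) , intP , N≤q , 0<q , qK≤ , Kw≤ , near) = <⇒≱ (proj₂ (∃h2< r 0<r)) (clash (natural-≥ {z} {q} {N} q≈ N≤q 0<q))
          where
          q≈ : q ≈ fromℤ z
          q≈ = trans q≈z (sym (fromℤ≈integer z))
          selected : ∀ k → root (w (ι k)) ∣ fromℤ z * x (ι k) - θ (ι k) ∣ℤ ≤ h2 K
          selected k = root≤ K (j k) (positive k) (∣∣ℤ≥0 _) (≤-trans (∣∣ℤ≤ _ (proj₁ (intP k)))
            (≈≤ (∣∣-cong (+-cong (+-congʳ (*-congʳ (sym q≈))) (-‿cong (trans (fromℤ≈integer (proj₁ (intP k))) (sym (proj₂ (intP k))))))) (near k))) (Kw≤ k)
          bounded : ∀ i → root (w i) ∣ fromℤ z * x i - θ i ∣ℤ ≤ h2 K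
          bounded i = split (lem (w i ≈ 0#))
            where
            split : (w i ≈ 0#) ⊎ ¬ (w i ≈ 0#) → root (w i) ∣ fromℤ z * x i - θ i ∣ℤ ≤ h2 K
            split (inj₁ e) = ≈≤ (root-zero _ e) (<⇒≤ (h2>0 K))
            split (inj₂ w≉0) = found (onto i (w≥0 i , λ e → w≉0 (sym e)))
              where
              found : (∃ λ k → ι k ≡ i) → root (w i) ∣ fromℤ z * x i - θ i ∣ℤ ≤ h2 K
              found (k , ≡.refl) = selected k
          clash : z ≢ + 0 × N ℕ.≤ ℤ.∣ z ∣ × q ≈ fromℕ ℤ.∣ z ∣ → r ≤ h2 (proj₁ (∃h2< r 0<r))
          clash (z≢0 , N≤z , q≈∣z∣) = ≤-trans (r≤ z z≢0 N≤z) (≤-trans (*-mono′ (max≤ _ (<⇒≤ (h2>0 K)) bounded))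
              (≤-trans (≤-trans (≤-reflexive (trans (*-congˡ (sym q≈∣z∣)) (*-comm _ _))) qK≤) (h2-anti (ℕ.n≤1+n (proj₁ (∃h2< r 0<r))))))
            where
            *-mono′ : ∀ {a b} → a ≤ b → a * fromℕ ℤ.∣ z ∣ ≤ b * fromℕ ℤ.∣ z ∣
            *-mono′ p = *-monoʳ _ (fromℕ≥0 ℤ.∣ z ∣) p

-- Bad points as a countable union of null sets

module Covering (em : ExcludedMiddle 0ℓ) (reals : CompleteOrderedField) where

  open Analysis em reals hiding (zero; ∣_∣; ContinuousAt)
  open OrderedField em reals
  open Numbers em reals
  open Calculus em reals
  open NullSets em reals
  open Goodness em reals
  open Thinness em reals
  open Charts em reals
  open ChartsNear em reals
  open Selections em reals
  open Badness em reals
  open IntegerSolver commutativeRing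

  opaque
    -- The chart occurs inside the set, since it is found only from a point of the cell. If the cell
    -- has a chart, any one of them settles all its points, and if not, the set is empty.
    critical-points-null : ∀ {m} (F : Fin (suc m) → ℝ → ℝ) u ℓ → Null (λ x → (∃ λ C → Chart F u ℓ C) × In u ℓ x × Der (F zero) x 0#)
    critical-points-null {m} F u ℓ = from (lem (∃ λ C → Chart F u ℓ C))
      where
      chart : ∀ {F u ℓ} (C : Curve (suc m)) → Chart F u ℓ C → Null (λ x → In u ℓ x × Der (F zero) x 0#)
      chart C (≡.refl , ≡.refl , ≡.refl , _) = Null-⊆ {λ x → In u₀ ℓ₀ x × Der (g 0 zero) x 0#} {λ x → In u₀ ℓ₀ x × g 1 zero x ≈ 0#}
          (λ { x (x∈ , d) → x∈ , der-unique (derivative x x∈ 0 (order>0 (nondegenerate (λ _ → 0#))) zero) d }) (critical-null C zero)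
        where
        open Curve C
        order>0 : ∀ {A : ℕ → Set} → (∃ λ o → suc o ℕ.≤ l × A o) → 0 ℕ.< l
        order>0 (o , p , _) = ℕ.≤-trans (s≤s z≤n) p
      from : (∃ λ C → Chart F u ℓ C) ⊎ ¬ (∃ λ C → Chart F u ℓ C) → Null (λ x → (∃ λ C → Chart F u ℓ C) × In u ℓ x × Der (F zero) x 0#)
      from (inj₁ (C , c)) = Null-⊆ {λ x → (∃ λ C → Chart F u ℓ C) × In u ℓ x × Der (F zero) x 0#} {λ x → In u ℓ x × Der (F zero) x 0#} (λ x p → proj₂ p) (chart C c)
      from (inj₂ absent) = Null-∅ {λ x → (∃ λ C → Chart F u ℓ C) × In u ℓ x × Der (F zero) x 0#} (λ x p → absent (proj₁ p))

  opaque
    inapproximable-points-null : ∀ {m} (F : Fin (suc m) → ℝ → ℝ) (W θ : Vector ℝ (suc m)) → (∀ k → 0# < W k) → (∀ k → W k ≤ W zero) → sum W ≤ 1# →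
      ∀ N m₀ u ℓ → Null (λ x → (∃ λ C → Chart F u ℓ C × Sloped u ℓ C) × In u ℓ x × ¬ Approximable W θ N m₀ (λ k → F k x))
    inapproximable-points-null {m} F W θ W>0 W≤ ΣW≤1 N m₀ u ℓ = from (lem (∃ λ C → Chart F u ℓ C × Sloped u ℓ C))
      where
      chart : ∀ {F u ℓ} (C : Curve (suc m)) → Chart F u ℓ C → Sloped u ℓ C → Null (λ x → In u ℓ x × ¬ Approximable W θ N m₀ (λ k → F k x))
      chart C (≡.refl , ≡.refl , ≡.refl , cont) (μ₁ , ς , 0<μ₁ , ς² , ∣ς∣≤1 , slope) =
        Thin.inapproximable-null C W θ W>0 W≤ ΣW≤1 {μ₁} {ς} 0<μ₁ ς² ∣ς∣≤1 slope cont N m₀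
      Exceptional : Pred ℝ 0ℓ
      Exceptional x = (∃ λ C → Chart F u ℓ C × Sloped u ℓ C) × In u ℓ x × ¬ Approximable W θ N m₀ (λ k → F k x)
      from : (∃ λ C → Chart F u ℓ C × Sloped u ℓ C) ⊎ ¬ (∃ λ C → Chart F u ℓ C × Sloped u ℓ C) → Null Exceptional
      from (inj₁ (C , c , s)) = Null-⊆ {Exceptional} {λ x → In u ℓ x × ¬ Approximable W θ N m₀ (λ k → F k x)} (λ x p → proj₂ p) (chart C c s)
      from (inj₂ absent) = Null-∅ {Exceptional} (λ x p → absent (proj₁ p))

  opaque
    -- Integers are written as differences of naturals, so that dyadic cells are indexed by naturals
    -- as `Null-⋃` expects.
    cell : ℕ → ℕ → ℕ → ℝ
    cell k a b = (fromℕ a - fromℕ b) * h2 k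
    in-cell : ∀ k x → ∃ λ a → ∃ λ b → In (cell k a b) (h2 k) x
    in-cell k x = from (floor (p2 k * x))
      where
      scale : p2 k * x * h2 k ≈ x
      scale = trans (rotate (p2 k) x (h2 k)) (trans (*-congʳ (p2-h2 k)) (*-identityˡ x))
        where
        rotate : ∀ a b c → a * b * c ≈ a * c * b
        rotate a b c = (solve 3 (λ a b c → a :* b :* c := a :* c :* b) refl _ _ _)
      between : ∀ {m a b} → m ≈ fromℕ a - fromℕ b → m ≤ p2 k * x → p2 k * x < m + 1# → ∃ λ a → ∃ λ b → In (cell k a b) (h2 k) x
      between {m} {a} {b} e p q = a , b , ≤≈ (*-monoʳ (h2 k) (<⇒≤ (h2>0 k)) (≈≤ (sym e) p)) scale ,
          ≈≤ (sym scale) (≤≈ (*-monoʳ (h2 k) (<⇒≤ (h2>0 k)) (≤≈ (<⇒≤ q) (+-congʳ e))) (trans (distribʳ _ _ _) (+-congˡ (*-identityˡ _))))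
      from : (∃ λ m → IsInt m × m ≤ p2 k * x × p2 k * x < m + 1#) → ∃ λ a → ∃ λ b → In (cell k a b) (h2 k) x
      from (m , (+ a , e) , p , q) = between {m} {a} {0} (trans e (trans (sym (fromℤ≈integer (+ a))) (positive (fromℕ a)))) p q
        where
        positive : ∀ t → t ≈ t - 0#
        positive t = (solve 1 (λ a → a := a :- :0) refl _)
      from (m , (-[1+ b ] , e) , p , q) = between {m} {0} {suc b} (trans e (trans (sym (fromℤ≈integer -[1+ b ])) (negative (fromℕ (suc b))))) p q
        where
        negative : ∀ t → - t ≈ 0# - t
        negative t = (solve 1 (λ a → :- a := :0 :- a) refl _)

  opaque
    Approximable-cong : ∀ {m} {W θ : Vector ℝ m} {N m₀} {x y : Vector ℝ m} → (∀ i → x i ≈ y i) → Approximable W θ N m₀ x → Approximable W θ N m₀ y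
    Approximable-cong x≈y (q , P , K , j , int , intP , N≤q , 0<q , small , KW≤ , near) = q , P , K , j , int , intP , N≤q , 0<q , small , KW≤ ,
      λ i → ≈≤ (∣∣-cong (+-congʳ (+-congʳ (*-congˡ (sym (x≈y i)))))) (near i)

  module _ {U : Pred ℝ 0ℓ} {n : ℕ} (f : Map U (suc n)) (w θ : Vector ℝ (suc n)) (weight : IsWeight w) (l : ℕ) where

    open Func f using (to)
    open Selection (selection w weight)

    F : Fin (suc m) → ℝ → ℝ
    F = coordinates f ι (basis-injective ι injective)

    Critical : ℕ → ℕ → ℕ → Pred ℝ 0ℓ
    Critical k a b x = (∃ λ C → Chart F (cell k a b) (h2 k) C) × In (cell k a b) (h2 k) x × Der (F zero) x 0#

    Exceptional : ℕ → ℕ → ℕ → ℕ → ℕ → Pred ℝ 0ℓ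
    Exceptional k a b N m₀ x = (∃ λ C → Chart F (cell k a b) (h2 k) C × Sloped (cell k a b) (h2 k) C) ×
      In (cell k a b) (h2 k) x × ¬ Approximable (w ∘ ι) (θ ∘ ι) N m₀ (λ i → F i x)

    Degenerate AnyCritical AnyExceptional : Pred ℝ 0ℓ
    Degenerate x = ∃ λ (x∈U : U x) → ¬ NondegenerateAt f l (x , x∈U)
    AnyCritical x = ∃ λ k → ∃ λ a → ∃ λ b → Critical k a b x
    AnyExceptional x = ∃ λ k → ∃ λ a → ∃ λ b → ∃ λ N → ∃ λ m₀ → Exceptional k a b N m₀ x

    opaque
      -- A nondegenerate point has charts on all sufficiently small cells around it, in particular
      -- on a dyadic one. There the selected first coordinate is steep or has derivative 0 at the
      -- point.
      bad-covered : ∀ x → (∃ λ (x∈U : U x) → ¬ (to (x , x∈U) ∉ Bad θ w)) → Degenerate x ⊎ (AnyCritical x ⊎ AnyExceptional x)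
      bad-covered x (x∈U , ¬¬bad) = from (lem (NondegenerateAt f l (x , x∈U)))
        where
        locate : ∀ k → (∃ λ a → ∃ λ b → In (cell k a b) (h2 k) x) →
          (∀ u → In u (h2 k) x → ∃ λ C → Chart F u (h2 k) C × (Sloped u (h2 k) C ⊎ Der (F zero) x 0#)) → AnyCritical x ⊎ AnyExceptional x
        locate k (a , b , x∈) chart = sort (chart (cell k a b) x∈)
          where
          inapproximable : (∃ λ N → ∃ λ m₀ → ¬ Approximable (w ∘ ι) (θ ∘ ι) N m₀ (to (x , x∈U) ∘ ι)) →
            (∃ λ C → Chart F (cell k a b) (h2 k) C × Sloped (cell k a b) (h2 k) C) → AnyExceptional x
          inapproximable (N , m₀ , ¬approx) sloped = k , a , b , N , m₀ , sloped , x∈ ,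
            λ approx → ¬approx (Approximable-cong {W = w ∘ ι} {θ = θ ∘ ι} {N = N} {m₀ = m₀} (λ i → extend-∈ f (ι i) x∈U x∈U refl) approx)
          sort : (∃ λ C → Chart F (cell k a b) (h2 k) C × (Sloped (cell k a b) (h2 k) C ⊎ Der (F zero) x 0#)) → AnyCritical x ⊎ AnyExceptional x
          sort (C , c , inj₁ s) = inj₂ (inapproximable (bad⇒inapproximable {w = w} {θ = θ} {x = to (x , x∈U)} (proj₁ weight) (selection w weight) (by-contradiction ¬¬bad)) (C , c , s))
          sort (C , c , inj₂ d) = inj₁ (k , a , b , (C , c) , x∈ , d)
        from : NondegenerateAt f l (x , x∈U) ⊎ ¬ NondegenerateAt f l (x , x∈U) → Degenerate x ⊎ (AnyCritical x ⊎ AnyExceptional x)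
        from (inj₂ degenerate) = inj₁ (x∈U , degenerate)
        from (inj₁ (δ , 0<δ , g , jet , order , independent)) = inj₂ (near (charts-near f ι (basis-injective ι injective) jet 0<δ order independent))
          where
          near : (∃ λ ρ → 0# < ρ × Local f ι (basis-injective ι injective) jet 0<δ order independent ρ) → AnyCritical x ⊎ AnyExceptional x
          near (ρ , 0<ρ , chart) = level (∃h2< ρ 0<ρ)
            where
            level : (∃ λ k → h2 k < ρ) → AnyCritical x ⊎ AnyExceptional x
            level (k , hk<ρ) = locate k (in-cell k x) λ u x∈ → chart u (h2 k) (h2>0 k) (h2≤1 k) hk<ρ x∈

      bad-null : Null Degenerate → Null (λ x → ∃ λ (x∈U : U x) → ¬ (to (x , x∈U) ∉ Bad θ w))
      bad-null null = Null-⊆ {λ x → ∃ λ (x∈U : U x) → ¬ (to (x , x∈U) ∉ Bad θ w)} {λ x → Degenerate x ⊎ (AnyCritical x ⊎ AnyExceptional x)} bad-covered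
        (Null-∪ {Degenerate} {λ x → AnyCritical x ⊎ AnyExceptional x} null (Null-∪ {AnyCritical} {AnyExceptional}
          (Null-⋃ {λ k x → ∃ λ a → ∃ λ b → Critical k a b x} λ k → Null-⋃ {λ a x → ∃ λ b → Critical k a b x} λ a → Null-⋃ {Critical k a} λ b →
            critical-points-null F (cell k a b) (h2 k))
          (Null-⋃ {λ k x → ∃ λ a → ∃ λ b → ∃ λ N → ∃ λ m₀ → Exceptional k a b N m₀ x} λ k → Null-⋃ {λ a x → ∃ λ b → ∃ λ N → ∃ λ m₀ → Exceptional k a b N m₀ x} λ a →
            Null-⋃ {λ b x → ∃ λ N → ∃ λ m₀ → Exceptional k a b N m₀ x} λ b → Null-⋃ {λ N x → ∃ λ m₀ → Exceptional k a b N m₀ x} λ N → Null-⋃ {Exceptional k a b N} λ m₀ →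
              inapproximable-points-null F (w ∘ ι) (θ ∘ ι) positive largest sum≤1 N m₀ (cell k a b) (h2 k))))

theorem2 : (em : ExcludedMiddle 0ℓ) (reals : CompleteOrderedField) →
  let open Analysis em reals in
  (n : ℕ) (w θ : Vector ℝ n) → IsWeight w →
  (a b : ℝ±) (f : Map (OpenInterval a b) n) → Nondegenerate f →
  AlmostEvery (OpenInterval a b) (λ x → Func.to f x ∉ Bad θ w)
-- There is no weight in dimension 0, where the empty sum would have to be 1.
theorem2 em reals zero    w θ (_ , 0≈1) a b f _          = ⊥-elim (CompleteOrderedField.0≉1 reals 0≈1)
theorem2 em reals (suc n) w θ weight    a b f (l , null) = Covering.bad-null em reals f w θ weight l null
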